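{- Let $q=2^r$. Let $N_1=|SO^+(2,q)|=q-1$, $N_2=|O^+(2,q)|=2(q-1)$, $N_3=|SO^+(4,q)|=q^2(q^2-1)^2$, and for $i=1,2,3$ let $\{C_{i,j}\}_{j=0}^{N_i}$ be the weight distributions of the binary codes $C(SO^+(2,q))$, $C(O^+(2,q))$, $C(SO^+(4,q))$ respectively. Then: (a) For $r\ge 3$ and $h=1,2,\ldots$, $$MK^h=\sum_{l=0}^{h-1}(-1)^{h+l+1}\binom{h}{l}(q-1)^{h-l}MK^l+q\sum_{j=0}^{\min\{N_1,h\}}(-1)^{h+j}C_{1,j}\sum_{t=j}^{h}t!\,S(h,t)\,2^{h-t}\binom{N_1-j}{N_1-t},$$ where $$C_{1,j}=\sum\binom{1}{\nu_0}\prod_{\beta\in\mathbb{F}_q^*,\ tr(\beta^{ -1})=0}\binom{2}{\nu_\beta}\quad(j=0,\ldots,N_1),$$ the sum being over all sets of nonnegative integers $\{\nu_0\}\cup\{\nu_\beta\}_{\beta\in\mathbb{F}_q^*,\,tr(\beta^{ -1})=0}$ with $\nu_0+\sum_{tr(\beta^{ -1})=0}\nu_\beta=j$ and $\sum_{tr(\beta^{ -1})=0}\nu_\beta\beta=0$ (in $\mathbb{F}_q$). (b) For $r\ge 3$ and $h=1,2,\ldots$, $$MK^h=\sum_{l=0}^{h-1}(-1)^{h+l+1}\binom{h}{l}(q-1)^{h-l}MK^l+q\sum_{j=0}^{\min\{N_2,h\}}(-1)^{h+j}C_{2,j}\sum_{t=j}^{h}t!\,S(h,t)\,2^{h-t}\binom{N_2-j}{N_2-t},$$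 where $$C_{2,j}=\sum\binom{q}{\nu_0}\prod_{\beta\in\mathbb{F}_q^*,\ tr(\beta^{ -1})=0}\binom{2}{\nu_\beta}\quad(j=0,\ldots,N_2),$$ the sum being over all sets of nonnegative integers $\{\nu_0\}\cup\{\nu_\beta\}_{\beta\in\mathbb{F}_q^*,\,tr(\beta^{ -1})=0}$ with $\nu_0+\sum_{tr(\beta^{ -1})=0}\nu_\beta=j$ and $\sum_{tr(\beta^{ -1})=0}\nu_\beta\beta=0$. (c) For $r\ge 2$ and $h=1,2,\ldots$, $$MK_2^h=\sum_{l=0}^{h-1}(-1)^{h+l+1}\binom{h}{l}(q^4-q^3-2q^2+1)^{h-l}MK_2^l+q^{1-2h}\sum_{j=0}^{\min\{N_3,h\}}(-1)^{h+j}C_{3,j}\sum_{t=j}^{h}t!\,S(h,t)\,2^{h-t}\binom{N_3-j}{N_3-t},$$ $$MK^{2h}=\sum_{l=0}^{h-1}(-1)^{h+l+1}\binom{h}{l}(q^4-q^3-2q^2+q+1)^{h-l}MK^{2l}+q^{1-2h}\sum_{j=0}^{\min\{N_3,h\}}(-1)^{h+j}C_{3,j}\sum_{t=j}^{h}t!\,S(h,t)\,2^{h-t}\binom{N_3-j}{N_3-t},$$ where $$C_{3,j}=\sum\binom{m_0}{\nu_0}\prod_{\substack{t\in\mathbb{Z},\ |t|<2\sqrt q\\ t\equiv -1\ (\mathrm{mod}\ 4)}}\ \prod_{\beta\in\mathbb{F}_q^*,\ K(\lambda;\beta^{ -1})=t}\binom{m_t}{\nu_\beta}\quad(j=0,\ldots,N_3),$$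 the sum being over all sets of nonnegative integers $\{\nu_\beta\}_{\beta\in\mathbb{F}_q}$ with $\sum_{\beta\in\mathbb{F}_q}\nu_\beta=j$ and $\sum_{\beta\in\mathbb{F}_q}\nu_\beta\beta=0$, and where $m_0=q^3(2q^2-q-2)$ and $m_t=q^2(q^3-q^2-2q+t)$.
   Context: $\mathbb{F}_q$ is the field with $q=2^r$ elements; $tr(x)=x+x^2+\cdots+x^{2^{r-1}}$ is the absolute trace $\mathbb{F}_q\to\mathbb{F}_2$ and $\lambda(x)=(-1)^{tr(x)}$ is the canonical additive character. For $a\in\mathbb{F}_q^*$: $K(\lambda;a)=\sum_{\alpha\in\mathbb{F}_q^*}\lambda(\alpha+a\alpha^{ -1})$ (Kloosterman sum) and $K_2(\lambda;a)=\sum_{\alpha_1,\alpha_2\in\mathbb{F}_q^*}\lambda(\alpha_1+\alpha_2+a\alpha_1^{ -1}\alpha_2^{ -1})$. For $h\ge 0$, $MK^h=\sum_{a\in\mathbb{F}_q^*}K(\lambda;a)^h$ and $MK_2^h=\sum_{a\in\mathbb{F}_q^*}K_2(\lambda;a)^h$ (so $MK^0=MK_2^0=q-1$). $S(h,t)=\frac{1}{t!}\sum_{j=0}^t(-1)^{t-j}\binom{t}{j}j^h$ is the Stirling number of the second kind; binomial coefficients $\binom{n}{k}$ are $0$ when $k<0$ or $k>n$. Orthogonal groups: on column vectors $x\in\mathbb{F}_q^{2n}$ let $\theta^+(x)=\sum_{i=1}^n x_ix_{n+i}$; $O^+(2n,q)$ is the group of $g\in GL(2n,q)$ with $\theta^+(gx)=\theta^+(x)$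 for all $x$; equivalently, writing $g=\begin{bmatrix}A&B\\C&D\end{bmatrix}$ with $n\times n$ blocks, ${}^tAC$ and ${}^tBD$ are alternating (symmetric with zero diagonal) and ${}^tAD+{}^tCB=1_n$. The map $\delta^+(g)=\mathrm{Tr}(B\,{}^tC)$ is a surjective homomorphism $O^+(2n,q)\to\mathbb{F}_2$ and $SO^+(2n,q)=\ker\delta^+$. Codes: for a finite group $G$ of square matrices over $\mathbb{F}_q$, with its elements listed as $g_1,\ldots,g_N$, the binary code $C(G)=\{u\in\mathbb{F}_2^N:\ \sum_{j=1}^N u_j\,\mathrm{Tr}(g_j)=0 \text{ in } \mathbb{F}_q\}$; its weight distribution is $\{C_j\}_{j=0}^N$ with $C_j$ the number of codewords of Hamming weight $j$. -}

module Defs where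

open import Data.Bool using (Bool; true; false; if_then_else_; _∧_; not)
open import Data.Nat as ℕ using (ℕ; zero; suc; _∸_; _≤ᵇ_; _<ᵇ_; _≡ᵇ_)
open import Data.Nat.Properties using (_!≢0; m^n≢0)
open import Data.Nat.Combinatorics using (_C_)
open import Data.Integer as ℤ using (ℤ; +_; -1ℤ; ∣_∣)
open import Data.Rational as ℚ using (ℚ)
open import Data.List using (List; []; _∷_; map; foldr; length; filterᵇ; concatMap; applyUpTo; upTo)
open import Data.Bool.ListAction using (all; any)
open import Data.List.Membership.Propositional using (_∈_)
open import Data.List.Relation.Unary.Unique.Propositional using (Unique)
open import Data.Vec using (Vec; []; _∷_; lookup)
open import Data.Fin using (Fin; zero; suc)
open import Data.Product using (_×_; _,_; proj₁; proj₂)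
open import Algebra.Structures using (IsCommutativeRing)
open import Relation.Binary.PropositionalEquality using (_≡_; _≢_)
open import Relation.Binary.Definitions using (DecidableEquality)
open import Relation.Nullary.Decidable using (⌊_⌋)

record FiniteField : Set₁ where
  field
    F        : Set
    _+F_     : F → F → F
    _*F_     : F → F → F
    -F_      : F → F
    0F 1F    : F
    isCommutativeRing : IsCommutativeRing _≡_ _+F_ _*F_ -F_ 0F 1F
    0F≢1F    : 0F ≢ 1F
    invF     : F → F
    invF-inv : ∀ x → x ≢ 0F → x *F invF x ≡ 1F
    _≟F_     : DecidableEquality F
    elements : List F
    complete : ∀ x → x ∈ elements
    unique   : Unique elements

sumℤ : List ℤ → ℤ
sumℤ = foldr ℤ._+_ (+ 0)

sumℚ : List ℚ → ℚ
sumℚ = foldr ℚ._+_ ℚ.0ℚ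

sumℕ : List ℕ → ℕ
sumℕ = foldr ℕ._+_ 0

prodℕ : List ℕ → ℕ
prodℕ = foldr ℕ._*_ 1

-- the list [a, a+1, ..., b]  (empty if b < a)
fromTo : ℕ → ℕ → List ℕ
fromTo a b = applyUpTo (a ℕ.+_) (suc b ∸ a)

Σℚ[_to_] : ℕ → ℕ → (ℕ → ℚ) → ℚ
Σℚ[ a to b ] f = sumℚ (map f (fromTo a b))

allVecs : {A : Set} → List A → (n : ℕ) → List (Vec A n)
allVecs xs zero    = [] ∷ []
allVecs xs (suc n) = concatMap (λ x → map (x ∷_) (allVecs xs n)) xs

sgn : ℕ → ℤ
sgn n = -1ℤ ℤ.^ n

ℤ→ℚ : ℤ → ℚ
ℤ→ℚ z = z ℚ./ 1

ℕ→ℚ : ℕ → ℚ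
ℕ→ℚ n = ℤ→ℚ (+ n)

-- binomial coefficient with integer arguments: 0 unless 0 ≤ k ≤ n
binomℤ : ℤ → ℤ → ℕ
binomℤ (+ n) (+ k) = n C k
binomℤ _ _ = 0

stirling2 : ℕ → ℕ → ℚ
stirling2 h t =
  ℚ._/_ (sumℤ (map (λ j → sgn (t ∸ j) ℤ.* (+ (t C j)) ℤ.* (+ (j ℕ.^ h))) (fromTo 0 t)))
        (t ℕ.!) {{t !≢0}}

innerSum : (N h j : ℕ) → ℚ
innerSum N h j = Σℚ[ j to h ] (λ t →
  ℕ→ℚ (t ℕ.!) ℚ.* stirling2 h t ℚ.* ℕ→ℚ (2 ℕ.^ (h ∸ t))
    ℚ.* ℕ→ℚ (binomℤ (+ N ℤ.- + j) (+ N ℤ.- + t)))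

codeSum : (N h : ℕ) → (ℕ → ℕ) → ℚ
codeSum N h Cw = Σℚ[ 0 to N ℕ.⊓ h ] (λ j →
  ℤ→ℚ (sgn (h ℕ.+ j)) ℚ.* ℕ→ℚ (Cw j) ℚ.* innerSum N h j)

recSum : (h : ℕ) → (c : ℤ) → (ℕ → ℤ) → ℚ
recSum h c M = sumℚ (map (λ l →
  ℤ→ℚ (sgn (h ℕ.+ l ℕ.+ 1) ℤ.* (+ (h C l)) ℤ.* (c ℤ.^ (h ∸ l)) ℤ.* M l)) (upTo h))

module Setup (FF : FiniteField) (r : ℕ) where
  open FiniteField FF

  q : ℕ
  q = 2 ℕ.^ r

  _==_ : F → F → Bool
  x == y = ⌊ x ≟F y ⌋

  powF : F → ℕ → F
  powF x zero    = 1F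
  powF x (suc n) = x *F powF x n

  sumF : List F → F
  sumF = foldr _+F_ 0F

  _·F_ : ℕ → F → F
  zero  ·F x = 0F
  suc n ·F x = x +F (n ·F x)

  tr : F → F
  tr x = sumF (map (λ i → powF x (2 ℕ.^ i)) (upTo r))

  -- canonical additive character λ(x) = (-1)^tr(x)  (tr(x) ∈ {0,1})
  λ' : F → ℤ
  λ' x = if tr x == 0F then + 1 else -1ℤ

  nonzero : List F
  nonzero = filterᵇ (λ x → not (x == 0F)) elements

  K : F → ℤ
  K a = sumℤ (map (λ α → λ' (α +F (a *F invF α))) nonzero)

  K2 : F → ℤ
  K2 a = sumℤ (concatMap (λ α₁ → map (λ α₂ →
           λ' ((α₁ +F α₂) +F ((a *F invF α₁) *F invF α₂))) nonzero) nonzero)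

  MK : ℕ → ℤ
  MK h = sumℤ (map (λ a → K a ℤ.^ h) nonzero)

  MK2 : ℕ → ℤ
  MK2 h = sumℤ (map (λ a → K2 a ℤ.^ h) nonzero)

  Mat : ℕ → Set
  Mat m = Vec (Vec F m) m

  entry : ∀ {m} → Mat m → Fin m → Fin m → F
  entry g i j = lookup (lookup g i) j

  finList : (m : ℕ) → List (Fin m)
  finList zero    = []
  finList (suc m) = zero ∷ map suc (finList m)

  ΣF[_] : ∀ {m} → (Fin m → F) → F
  ΣF[_] {m} f = sumF (map f (finList m))

  matVec : ∀ {m} → Mat m → Vec F m → Vec F m
  matVec {m} g x = Data.Vec.map (λ row → ΣF[ (λ j → lookup row j *F lookup x j) ]) g
    where import Data.Vec

  matMul : ∀ {m} → Mat m → Mat m → Mat m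
  matMul {m} g h = Data.Vec.tabulate (λ i → Data.Vec.tabulate (λ j →
                     ΣF[ (λ k → entry g i k *F entry h k j) ]))
    where import Data.Vec

  isId : ∀ {m} → Mat m → Bool
  isId {m} g = all (λ i → all (λ j →
                 entry g i j == (if ⌊ i Data.Fin.≟ j ⌋ then 1F else 0F)) (finList m)) (finList m)
    where import Data.Fin

  allMats : (m : ℕ) → List (Mat m)
  allMats m = allVecs (allVecs elements m) m

  invertible : ∀ {m} → Mat m → Bool
  invertible {m} g = any (λ h → isId (matMul h g)) (allMats m)

  trace : ∀ {m} → Mat m → F
  trace g = ΣF[ (λ i → entry g i i) ]

  θ⁺ : (n : ℕ) → Vec F (n ℕ.+ n) → F
  θ⁺ n x = ΣF[ (λ (i : Fin n) →
             lookup x (i Data.Fin.↑ˡ n) *F lookup x (n Data.Fin.↑ʳ i)) ]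
    where import Data.Fin

  isO⁺ : (n : ℕ) → Mat (n ℕ.+ n) → Bool
  isO⁺ n g = invertible g ∧
             all (λ x → θ⁺ n (matVec g x) == θ⁺ n x) (allVecs elements (n ℕ.+ n))

  -- δ⁺(g) = Tr(B ᵗC) where g = [[A,B],[C,D]] with n×n blocks
  δ⁺ : (n : ℕ) → Mat (n ℕ.+ n) → F
  δ⁺ n g = ΣF[ (λ (i : Fin n) → ΣF[ (λ (k : Fin n) →
             entry g (i Data.Fin.↑ˡ n) (n Data.Fin.↑ʳ k)      -- B i k
             *F entry g (n Data.Fin.↑ʳ i) (k Data.Fin.↑ˡ n)) ]) ]   -- C i k
    where import Data.Fin

  O⁺ : (n : ℕ) → List (Mat (n ℕ.+ n))
  O⁺ n = filterᵇ (isO⁺ n) (allMats (n ℕ.+ n))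

  SO⁺ : (n : ℕ) → List (Mat (n ℕ.+ n))
  SO⁺ n = filterᵇ (λ g → δ⁺ n g == 0F) (O⁺ n)

  weight : ∀ {N} → Vec Bool N → ℕ
  weight [] = 0
  weight (true ∷ u)  = suc (weight u)
  weight (false ∷ u) = weight u

  codeSyndrome : ∀ {m} → (G : List (Mat m)) → Vec Bool (length G) → F
  codeSyndrome [] [] = 0F
  codeSyndrome (g ∷ G) (b ∷ u) = (if b then trace g else 0F) +F codeSyndrome G u

  codewords : ∀ {m} → (G : List (Mat m)) → List (Vec Bool (length G))
  codewords G = filterᵇ (λ u → codeSyndrome G u == 0F) (allVecs (true ∷ false ∷ []) (length G))

  weightDist : ∀ {m} → List (Mat m) → ℕ → ℕ
  weightDist G j = length (filterᵇ (λ u → weight u ≡ᵇ j) (codewords G))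

  N₁ N₂ N₃ : ℕ
  N₁ = length (SO⁺ 1)
  N₂ = length (O⁺ 1)
  N₃ = length (SO⁺ 2)

  C₁ C₂ C₃ : ℕ → ℕ
  C₁ = weightDist (SO⁺ 1)
  C₂ = weightDist (O⁺ 1)
  C₃ = weightDist (SO⁺ 2)

  linComb : ∀ {k} → Vec ℕ k → Vec F k → F
  linComb [] [] = 0F
  linComb (ν ∷ νs) (β ∷ βs) = (ν ·F β) +F linComb νs βs

  sumVec : ∀ {k} → Vec ℕ k → ℕ
  sumVec [] = 0
  sumVec (ν ∷ νs) = ν ℕ.+ sumVec νs

  Bs : List F
  Bs = filterᵇ (λ β → tr (invF β) == 0F) nonzero

  BsV : Vec F (length Bs)
  BsV = Data.Vec.fromList Bs
    where import Data.Vec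

  -- families (ν₀ ; ν_β for β ∈ Bs) of naturals with ν₀ + Σ ν_β = j and Σ ν_β β = 0.
  -- (each entry is ≤ j, so enumerating entries in 0..j gives all of them)
  familiesAB : ℕ → List (ℕ × Vec ℕ (length Bs))
  familiesAB j = filterᵇ (λ p → (proj₁ p ℕ.+ sumVec (proj₂ p) ≡ᵇ j)
                                  ∧ (linComb (proj₂ p) BsV == 0F))
                   (concatMap (λ ν₀ → map (ν₀ ,_) (allVecs (fromTo 0 j) (length Bs))) (fromTo 0 j))

  formulaAB : ℕ → ℕ → ℕ
  formulaAB a j = sumℕ (map (λ p → (a C proj₁ p) ℕ.* prodℕ (Data.Vec.toList (Data.Vec.map (2 C_) (proj₂ p))))
                   (familiesAB j))
    where import Data.Vec

  formulaA formulaB : ℕ → ℕ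
  formulaA = formulaAB 1
  formulaB = formulaAB q

  m₀ : ℤ
  m₀ = + (q ℕ.^ 3) ℤ.* (+ (2 ℕ.* q ℕ.^ 2) ℤ.- + q ℤ.- + 2)

  m_ : ℤ → ℤ
  m_ t = + (q ℕ.^ 2) ℤ.* (+ (q ℕ.^ 3) ℤ.- + (q ℕ.^ 2) ℤ.- + (2 ℕ.* q) ℤ.+ t)

  -- integers t with |t| < 2√q (i.e. t² < 4q) and t ≡ -1 (mod 4)
  tRange : List ℤ
  tRange = filterᵇ (λ t → (∣ t ℤ.* t ∣ <ᵇ 4 ℕ.* q) ∧ (((t ℤ.+ + 1) ℤ.% (+ 4)) ≡ᵇ 0))
             (map (λ i → + i ℤ.- + (2 ℕ.* q)) (fromTo 0 (4 ℕ.* q)))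

  allF : Vec F (length elements)
  allF = Data.Vec.fromList elements
    where import Data.Vec

  familiesC : ℕ → List (Vec ℕ (length elements))
  familiesC j = filterᵇ (λ ν → (sumVec ν ≡ᵇ j) ∧ (linComb ν allF == 0F))
                  (allVecs (fromTo 0 j) (length elements))

  νat : Vec ℕ (length elements) → F → ℕ
  νat ν β = go ν allF
    where go : ∀ {k} → Vec ℕ k → Vec F k → ℕ
          go [] [] = 0
          go (n ∷ ns) (b ∷ bs) = if b == β then n else go ns bs

  summandC : Vec ℕ (length elements) → ℕ
  summandC ν = binomℤ m₀ (+ νat ν 0F) ℕ.*
    prodℕ (map (λ t → prodℕ (map (λ β → binomℤ (m_ t) (+ νat ν β))
                               (filterᵇ (λ β → ⌊ K (invF β) ℤ.≟ t ⌋) nonzero)))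
               tRange)

  formulaC : ℕ → ℕ
  formulaC j = sumℕ (map summandC (familiesC j))

  -- q^{1-2h} (h ≥ 1) as a rational

  qPowNeg : ℕ → ℚ
  qPowNeg h = ℚ._/_ (+ 1) (q ℕ.^ (2 ℕ.* h ∸ 1)) {{m^n≢0 q (2 ℕ.* h ∸ 1) {{m^n≢0 2 r}}}}

{-# OPTIONS --safe #-}
-- Write 2w(a) = N − Σ_g λ(a Tr g) for twice the weight of the word (tr(a Tr g))_g of the dual code.  Expanding w^h in
-- binomial coefficients (with coefficients t! S(h,t)) and summing over a by orthogonality of characters gives the Pless
-- power moment identity Σ_a (2w(a))^h = q Σ_j (−1)^j C_j Σ_t t! S(h,t) 2^(h−t) C(N−j,N−t).  For O⁺(2,q) the sum over g
-- is a Kloosterman sum because the traces are z + 1/z; for SO⁺(4,q) ≅ SL₂ × SL₂, acting on 2 × 2 matrices by X ↦ P X R,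
-- the trace is Tr P · Tr R, and the sum is q²(q³ + K₂(a)) with K₂ = K² − q (Carlitz).  The weights C_j depend only on
-- how often each trace occurs, which Artin–Schreier theory makes explicit.
--
-- The product over |t| < 2√q in C_{3,j} is complete only by the Weil bound K² < 4q.  Stepanov's method gives K² ≤ 31 q
-- when q is a square; along the tower of quadratic extensions K is replaced by 2q − K² and q by q², so a value K² > 4q
-- would make K²/q grow beyond any bound.  Equality K² = 4q is excluded by K ≡ −1 (mod 4).
module Submission where

-- The tower argument is the elementary side of a factorisation K = -(α + β) with αβ = q: a
-- quadratic extension replaces α and β by their squares, hence K by 2q - K². The first extension
-- already has even degree, so a bound for square q serves every r, and its constant only affects
-- how many extensions are taken. In Stepanov's method the auxiliary function comes from counting:
-- q^D coefficient vectors are sent to q^M vectors with M < D, and two with the same image differ by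
-- a function of controlled degree that vanishes on the whole set. Applied to trace 0 and to trace
-- 1, it bounds K from above and from below. Words of weight j in C(G) are choices of j group
-- elements whose traces add up to 0. Elements of equal trace are interchangeable, so only the
-- multiplicities of the traces matter, and each family ν contributes a product of binomial
-- coefficients. The moment identities are proved in the integers; the power q^(1-2h) enters by one
-- division at the end.

open import Defs
open import Algebra.Bundles using (CommutativeRing; RawRing)
import Algebra.Solver.Ring as RingSolver
open import Algebra.Solver.Ring.AlmostCommutativeRing using (AlmostCommutativeRing; _-Raw-AlmostCommutative⟶_; fromCommutativeSemiring)
open import Algebra.Structures using (IsCommutativeRing)
open import Data.Bool using (Bool; true; false; if_then_else_; T; not; _xor_; _∧_)
open import Data.Bool.ListAction using (all; any)
open import Data.Empty using (⊥; ⊥-elim)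
open import Data.Fin using (Fin)
import Data.Fin as Fin
open import Data.Fin.Properties using (pigeonhole; <⇒≢)
open import Data.Integer as ℤ using (ℤ; +_; -[1+_]; 0ℤ; 1ℤ)
import Data.Integer.DivMod as ℤD
import Data.Integer.Properties as ℤP
open import Data.Integer.Tactic.RingSolver using (solve-∀)
open import Data.List using (List; []; _∷_; _++_; map; foldr; length; lookup; filterᵇ; concatMap; cartesianProduct; replicate; upTo; applyUpTo)
import Data.List.Properties as ListP
open import Data.List.Membership.Propositional using (_∈_; find; lose)
open import Data.List.Membership.Propositional.Properties using (∈-lookup; ∈-map⁺; ∈-map⁻; ∈-filter⁺; ∈-filter⁻; ∈-concatMap⁺; ∈-++⁻; ∈-++⁺ˡ; ∈-++⁺ʳ; ∈-applyUpTo⁺; ∈-cartesianProduct⁺; ∈-cartesianProduct⁻)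
open import Data.List.Membership.Propositional.Properties.WithK using (unique∧set⇒bag)
open import Data.List.Relation.Binary.BagAndSetEquality using (∼bag⇒↭)
open import Data.List.Relation.Binary.Permutation.Propositional as Perm using (_↭_; prep; swap)
import Data.List.Relation.Binary.Permutation.Propositional.Properties as PermP
open import Data.List.Relation.Unary.All as All using ([]; _∷_)
open import Data.List.Relation.Unary.AllPairs using ([]; _∷_)
open import Data.List.Relation.Unary.Any using (any?; here; there; index)
open import Data.List.Relation.Unary.Any.Properties using (lookup-index)
open import Data.List.Relation.Unary.Unique.Propositional using (Unique)
import Data.List.Relation.Unary.Unique.Propositional.Properties as UniqueP
open import Data.Maybe using (Maybe; just; nothing)
open import Data.Nat using (_≤_; _^_; _*_)
open import Data.Nat as ℕ using (ℕ; zero; suc)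
open import Data.Nat.Combinatorics using (_C_; nCk≡nC[n∸k]; nCn≡1; nC1≡n; nCk+nC[k+1]≡[n+1]C[k+1]; k>n⇒nCk≡0)
open import Data.Nat.DivMod using (_/_; _%_; m%n<n; m≡m%n+[m/n]*n; m<n*o⇒m/o<n)
import Data.Nat.Properties as ℕP
open import Data.Nat.Tactic.RingSolver using () renaming (solve-∀ to solve-∀ᴺ)
open import Data.Product using (Σ; ∃; _×_; _,_; proj₁; proj₂)
open import Data.Product.Properties using (≡-dec)
open import Data.Rational as ℚ using (ℚ)
import Data.Rational.Properties as ℚP
import Data.Rational.Unnormalised as ℚᵘ
import Data.Rational.Unnormalised.Properties as ℚᵘP
open import Data.Sum using (_⊎_; inj₁; inj₂)
open import Data.Vec as Vec using (Vec; []; _∷_; fromList)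
open import Function using (_∘_; id; mk⇔; case_of_)
open import Level using (0ℓ)
open import Relation.Binary.Definitions using (DecidableEquality)
open import Relation.Binary.PropositionalEquality using (_≡_; _≢_; _≗_; refl; sym; trans; cong; cong₂; subst; subst₂; isEquivalence; module ≡-Reasoning)
open import Relation.Nullary using (yes; no; Dec; ¬_)
open import Relation.Nullary.Decidable using (⌊_⌋; T?; toWitness)

-- Integer-valued sums over lists

∑ : {A : Set} → List A → (A → ℤ) → ℤ
∑ xs f = sumℤ (map f xs)

𝟙 : Bool → ℤ
𝟙 true  = 1ℤ
𝟙 false = 0ℤ

module _ {A : Set} where

  ∑-cong : {f g : A → ℤ} (xs : List A) → f ≗ g → ∑ xs f ≡ ∑ xs g
  ∑-cong []       p = refl
  ∑-cong (x ∷ xs) p = cong₂ ℤ._+_ (p x) (∑-cong xs p)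

  ∑-cong-∈ : {f g : A → ℤ} (xs : List A) → (∀ x → x ∈ xs → f x ≡ g x) → ∑ xs f ≡ ∑ xs g
  ∑-cong-∈ []       p = refl
  ∑-cong-∈ (x ∷ xs) p = cong₂ ℤ._+_ (p x (here refl)) (∑-cong-∈ xs (λ y i → p y (there i)))

  ∑-+ : (xs : List A) (f g : A → ℤ) → ∑ xs (λ x → f x ℤ.+ g x) ≡ ∑ xs f ℤ.+ ∑ xs g
  ∑-+ []       f g = refl
  ∑-+ (x ∷ xs) f g = trans (cong (λ z → f x ℤ.+ g x ℤ.+ z) (∑-+ xs f g)) (lem (f x) (g x) _ _)
    where
    lem : ∀ a b c d → a ℤ.+ b ℤ.+ (c ℤ.+ d) ≡ a ℤ.+ c ℤ.+ (b ℤ.+ d)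
    lem = solve-∀

  ∑-*ˡ : (xs : List A) (c : ℤ) (f : A → ℤ) → ∑ xs (λ x → c ℤ.* f x) ≡ c ℤ.* ∑ xs f
  ∑-*ˡ []       c f = sym (ℤP.*-zeroʳ c)
  ∑-*ˡ (x ∷ xs) c f = trans (cong (λ z → c ℤ.* f x ℤ.+ z) (∑-*ˡ xs c f)) (sym (ℤP.*-distribˡ-+ c (f x) _))

  ∑-*ʳ : (xs : List A) (c : ℤ) (f : A → ℤ) → ∑ xs (λ x → f x ℤ.* c) ≡ ∑ xs f ℤ.* c
  ∑-*ʳ xs c f = trans (∑-cong xs (λ x → ℤP.*-comm (f x) c)) (trans (∑-*ˡ xs c f) (ℤP.*-comm c _))

  ∑-const : (xs : List A) (c : ℤ) → ∑ xs (λ _ → c) ≡ + length xs ℤ.* c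
  ∑-const []       c = refl
  ∑-const (x ∷ xs) c = trans (cong (λ z → c ℤ.+ z) (∑-const xs c)) (sym (ℤP.suc-* (+ length xs) c))

  ∑-0 : (xs : List A) → ∑ xs (λ _ → 0ℤ) ≡ 0ℤ
  ∑-0 xs = trans (∑-const xs 0ℤ) (ℤP.*-zeroʳ (+ length xs))

  ∑-1 : (xs : List A) → ∑ xs (λ _ → 1ℤ) ≡ + length xs
  ∑-1 xs = trans (∑-const xs 1ℤ) (ℤP.*-identityʳ _)

  ∑-0-∈ : {f : A → ℤ} (xs : List A) → (∀ x → x ∈ xs → f x ≡ 0ℤ) → ∑ xs f ≡ 0ℤ
  ∑-0-∈ xs p = trans (∑-cong-∈ xs p) (∑-0 xs)

  ∑-++ : (xs ys : List A) (f : A → ℤ) → ∑ (xs ++ ys) f ≡ ∑ xs f ℤ.+ ∑ ys f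
  ∑-++ []       ys f = sym (ℤP.+-identityˡ _)
  ∑-++ (x ∷ xs) ys f = trans (cong (λ z → f x ℤ.+ z) (∑-++ xs ys f)) (sym (ℤP.+-assoc (f x) _ _))

  ∑-filter : (p : A → Bool) (xs : List A) (f : A → ℤ) → ∑ (filterᵇ p xs) f ≡ ∑ xs (λ x → 𝟙 (p x) ℤ.* f x)
  ∑-filter p []       f = refl
  ∑-filter p (x ∷ xs) f with p x
  ... | true  = cong₂ ℤ._+_ (sym (ℤP.*-identityˡ (f x))) (∑-filter p xs f)
  ... | false = trans (∑-filter p xs f) (sym (ℤP.+-identityˡ _))

  length-filter : (p : A → Bool) (xs : List A) → + length (filterᵇ p xs) ≡ ∑ xs (λ x → 𝟙 (p x))
  length-filter p xs = trans (sym (∑-1 (filterᵇ p xs)))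
    (trans (∑-filter p xs (λ _ → 1ℤ)) (∑-cong xs (λ x → ℤP.*-identityʳ _)))

  ∑-↭ : {xs ys : List A} (f : A → ℤ) → xs ↭ ys → ∑ xs f ≡ ∑ ys f
  ∑-↭ f Perm.refl = refl
  ∑-↭ f (prep x p) = cong (λ z → f x ℤ.+ z) (∑-↭ f p)
  ∑-↭ f (swap x y p) = trans (cong (λ z → f x ℤ.+ (f y ℤ.+ z)) (∑-↭ f p)) (lem (f x) (f y) _)
    where
    lem : ∀ a b c → a ℤ.+ (b ℤ.+ c) ≡ b ℤ.+ (a ℤ.+ c)
    lem = solve-∀
  ∑-↭ f (Perm.trans p q) = trans (∑-↭ f p) (∑-↭ f q)

  unique-↭ : {xs ys : List A} → Unique xs → Unique ys → (∀ x → x ∈ xs → x ∈ ys) → (∀ x → x ∈ ys → x ∈ xs) → xs ↭ ys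
  unique-↭ u v f g = ∼bag⇒↭ (unique∧set⇒bag u v (mk⇔ (f _) (g _)))

  ∑-≥0 : {f : A → ℤ} (xs : List A) → (∀ x → x ∈ xs → 0ℤ ℤ.≤ f x) → 0ℤ ℤ.≤ ∑ xs f
  ∑-≥0 []       p = ℤP.≤-refl
  ∑-≥0 (x ∷ xs) p = ℤP.+-mono-≤ (p x (here refl)) (∑-≥0 xs (λ y i → p y (there i)))

  ∑-≤0⇒≡0 : {f : A → ℤ} (xs : List A) → (∀ x → x ∈ xs → 0ℤ ℤ.≤ f x) → ∑ xs f ℤ.≤ 0ℤ → ∀ x → x ∈ xs → f x ≡ 0ℤ
  ∑-≤0⇒≡0 {f} (x ∷ xs) p q y (here refl) = ℤP.≤-antisym
    (ℤP.≤-trans (subst (λ z → z ℤ.≤ f x ℤ.+ ∑ xs f) (ℤP.+-identityʳ (f x))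
      (ℤP.+-monoʳ-≤ (f x) (∑-≥0 xs (λ z i → p z (there i))))) q) (p x (here refl))
  ∑-≤0⇒≡0 {f} (x ∷ xs) p q y (there i) = ∑-≤0⇒≡0 xs (λ z j → p z (there j))
    (ℤP.≤-trans (subst (λ z → z ℤ.≤ f x ℤ.+ ∑ xs f) (ℤP.+-identityˡ (∑ xs f))
      (ℤP.+-monoˡ-≤ (∑ xs f) (p x (here refl)))) q) y i

  module _ (_≟_ : DecidableEquality A) where

    ∑-δ : (xs : List A) → Unique xs → ∀ {x} → x ∈ xs → (f : A → ℤ) → ∑ xs (λ y → 𝟙 ⌊ y ≟ x ⌋ ℤ.* f y) ≡ f x
    ∑-δ (z ∷ xs) (n ∷ u) {x} (here refl) f with z ≟ z
    ... | no ne = ⊥-elim (ne refl)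
    ... | yes _ = trans (cong₂ ℤ._+_ (ℤP.*-identityˡ (f x)) (∑-0-∈ xs step)) (ℤP.+-identityʳ _)
      where
      step : ∀ y → y ∈ xs → 𝟙 ⌊ y ≟ x ⌋ ℤ.* f y ≡ 0ℤ
      step y i with y ≟ x
      ... | yes refl = ⊥-elim (All.lookup n i refl)
      ... | no _ = refl
    ∑-δ (z ∷ xs) (n ∷ u) {x} (there i) f with z ≟ x
    ... | yes refl = ⊥-elim (All.lookup n i refl)
    ... | no _ = trans (ℤP.+-identityˡ _) (∑-δ xs u i f)

    ∑-δ-1 : (xs : List A) → Unique xs → ∀ {x} → x ∈ xs → ∑ xs (λ y → 𝟙 ⌊ y ≟ x ⌋) ≡ 1ℤ
    ∑-δ-1 xs u i = trans (∑-cong xs (λ y → sym (ℤP.*-identityʳ _))) (∑-δ xs u i (λ _ → 1ℤ))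

module _ {A B : Set} where

  ∑-map : (xs : List A) (φ : A → B) (f : B → ℤ) → ∑ (map φ xs) f ≡ ∑ xs (λ x → f (φ x))
  ∑-map []       φ f = refl
  ∑-map (x ∷ xs) φ f = cong (λ z → f (φ x) ℤ.+ z) (∑-map xs φ f)

  ∑-swap : (xs : List A) (ys : List B) (f : A → B → ℤ) →
           ∑ xs (λ x → ∑ ys (f x)) ≡ ∑ ys (λ y → ∑ xs (λ x → f x y))
  ∑-swap []       ys f = sym (∑-0 ys)
  ∑-swap (x ∷ xs) ys f = trans (cong (λ z → ∑ ys (f x) ℤ.+ z) (∑-swap xs ys f))
                               (sym (∑-+ ys (f x) (λ y → ∑ xs (λ x → f x y))))

  ∑-concatMap : (xs : List A) (g : A → List B) (f : B → ℤ) → ∑ (concatMap g xs) f ≡ ∑ xs (λ x → ∑ (g x) f)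
  ∑-concatMap []       g f = refl
  ∑-concatMap (x ∷ xs) g f = trans (∑-++ (g x) (concatMap g xs) f) (cong (λ z → ∑ (g x) f ℤ.+ z) (∑-concatMap xs g f))

  map-↭ : {xs : List A} {ys : List B} (φ : A → B) (ψ : B → A) → Unique xs → Unique ys →
          (∀ x → x ∈ xs → φ x ∈ ys) → (∀ y → y ∈ ys → ψ y ∈ xs) →
          (∀ x → x ∈ xs → ψ (φ x) ≡ x) → (∀ y → y ∈ ys → φ (ψ y) ≡ y) → map φ xs ↭ ys
  map-↭ {xs} {ys} φ ψ u v a b c d = unique-↭ (uniqueMap xs u c) v fwd bwd
    where
    uniqueMap : ∀ zs → Unique zs → (∀ x → x ∈ zs → ψ (φ x) ≡ x) → Unique (map φ zs)
    uniqueMap []       _       _ = []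
    uniqueMap (z ∷ zs) (n ∷ w) e = All.tabulate ne ∷ uniqueMap zs w (λ x i → e x (there i))
      where
      ne : ∀ {y} → y ∈ map φ zs → φ z ≢ y
      ne i eq with ∈-map⁻ φ i
      ... | x , j , refl = All.lookup n j (trans (sym (e z (here refl))) (trans (cong ψ eq) (e x (there j))))
    fwd : ∀ y → y ∈ map φ xs → y ∈ ys
    fwd y i with ∈-map⁻ φ i
    ... | x , j , refl = a x j
    bwd : ∀ y → y ∈ ys → y ∈ map φ xs
    bwd y i = subst (_∈ map φ xs) (d y i) (∈-map⁺ φ (b y i))

  ∑-bij : {xs : List A} {ys : List B} (φ : A → B) (ψ : B → A) → Unique xs → Unique ys →
          (∀ x → x ∈ xs → φ x ∈ ys) → (∀ y → y ∈ ys → ψ y ∈ xs) →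
          (∀ x → x ∈ xs → ψ (φ x) ≡ x) → (∀ y → y ∈ ys → φ (ψ y) ≡ y) →
          (f : B → ℤ) → ∑ xs (λ x → f (φ x)) ≡ ∑ ys f
  ∑-bij {xs} φ ψ u v a b c d f = trans (sym (∑-map xs φ f)) (∑-↭ f (map-↭ φ ψ u v a b c d))

module _ {A B : Set} where

  ∑-cartesianProduct : (xs : List A) (ys : List B) (f : A × B → ℤ) →
                       ∑ (cartesianProduct xs ys) f ≡ ∑ xs (λ x → ∑ ys (λ y → f (x , y)))
  ∑-cartesianProduct []       ys f = refl
  ∑-cartesianProduct (x ∷ xs) ys f = trans (∑-++ (map (x ,_) ys) _ f)
    (cong₂ ℤ._+_ (∑-map ys (x ,_) f) (∑-cartesianProduct xs ys f))

module _ {A : Set} where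

  ∑-allVecs-suc : (xs : List A) (n : ℕ) (f : Vec A (suc n) → ℤ) →
                  ∑ (allVecs xs (suc n)) f ≡ ∑ xs (λ x → ∑ (allVecs xs n) (λ v → f (x ∷ v)))
  ∑-allVecs-suc xs n f = trans (∑-concatMap xs _ f) (∑-cong xs (λ x → ∑-map (allVecs xs n) (x ∷_) f))

  allVecs-complete : (xs : List A) → (∀ x → x ∈ xs) → ∀ n (v : Vec A n) → v ∈ allVecs xs n
  allVecs-complete xs c zero    []      = here refl
  allVecs-complete xs c (suc n) (x ∷ v) =
    ∈-concatMap⁺ (λ x → map (x ∷_) (allVecs xs n)) (lose (c x) (∈-map⁺ (x ∷_) (allVecs-complete xs c n v)))

  allVecs≡cartesianProductWith : (xs ys : List A) (n : ℕ) →
    concatMap (λ x → map (x ∷_) (allVecs xs n)) ys ≡ Data.List.cartesianProductWith _∷_ ys (allVecs xs n)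
  allVecs≡cartesianProductWith xs []       n = refl
  allVecs≡cartesianProductWith xs (y ∷ ys) n = cong (map (y ∷_) (allVecs xs n) ++_) (allVecs≡cartesianProductWith xs ys n)

  allVecs-unique : (xs : List A) → Unique xs → ∀ n → Unique (allVecs xs n)
  allVecs-unique xs u zero    = [] ∷ []
  allVecs-unique xs u (suc n) = subst Unique (sym (allVecs≡cartesianProductWith xs xs n))
    (UniqueP.cartesianProductWith⁺ _∷_ (λ { refl → refl , refl }) u (allVecs-unique xs u n))

  length-allVecs : (xs : List A) → ∀ n → length (allVecs xs n) ≡ length xs ℕ.^ n
  length-allVecs xs zero    = refl
  length-allVecs xs (suc n) = trans (go xs) (cong (length xs ℕ.*_) (length-allVecs xs n))
    where
    go : ∀ ys → length (concatMap (λ x → map (x ∷_) (allVecs xs n)) ys) ≡ length ys ℕ.* length (allVecs xs n)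
    go []       = refl
    go (y ∷ ys) = trans (ListP.length-++ (map (y ∷_) (allVecs xs n)))
                        (cong₂ ℕ._+_ (ListP.length-map (y ∷_) (allVecs xs n)) (go ys))

⌊⌋-yes : {P : Set} (d : Dec P) → P → ⌊ d ⌋ ≡ true
⌊⌋-yes (yes _) _ = refl
⌊⌋-yes (no n)  p = ⊥-elim (n p)

⌊⌋-no : {P : Set} (d : Dec P) → ¬ P → ⌊ d ⌋ ≡ false
⌊⌋-no (yes p) n = ⊥-elim (n p)
⌊⌋-no (no _)  _ = refl

⌊⌋-⇔ : {P Q : Set} (d : Dec P) (e : Dec Q) → (P → Q) → (Q → P) → ⌊ d ⌋ ≡ ⌊ e ⌋
⌊⌋-⇔ (yes p) e f g = sym (⌊⌋-yes e (f p))
⌊⌋-⇔ (no n)  e f g = sym (⌊⌋-no e (n ∘ g))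

ℤ+-cancelˡ : ∀ a {b c} → a ℤ.+ b ≡ a ℤ.+ c → b ≡ c
ℤ+-cancelˡ a {b} {c} e = trans (lem a b) (trans (cong (ℤ._- a) e) (sym (lem a c)))
  where
  lem : ∀ a b → b ≡ a ℤ.+ b ℤ.- a
  lem = solve-∀

-- Takes the place of a kernel vector in Stepanov's method: two coefficient vectors with the same
-- image give the auxiliary function as their difference.
collision : {A B : Set} {xs : List A} {ys : List B} → Unique xs → (f : A → B) → (∀ x → f x ∈ ys) →
            length ys ℕ.< length xs → ∃ λ x → ∃ λ x′ → x ≢ x′ × f x ≡ f x′
collision {xs = xs} {ys} u f f∈ lt with pigeonhole lt (λ i → index (f∈ (lookup xs i)))
... | i , j , i<j , e = lookup xs i , lookup xs j , (λ eq → <⇒≢ i<j (lookup-injective u i j eq)) ,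
      trans (lookup-index (f∈ (lookup xs i))) (trans (cong (lookup ys) e) (sym (lookup-index (f∈ (lookup xs j)))))
  where
  lookup-injective : ∀ {A : Set} {xs : List A} → Unique xs → ∀ i j → lookup xs i ≡ lookup xs j → i ≡ j
  lookup-injective (n ∷ u) Fin.zero    Fin.zero    e = refl
  lookup-injective (n ∷ u) Fin.zero    (Fin.suc j) e = ⊥-elim (All.lookup n (∈-lookup j) e)
  lookup-injective (n ∷ u) (Fin.suc i) Fin.zero    e = ⊥-elim (All.lookup n (∈-lookup i) (sym e))
  lookup-injective (n ∷ u) (Fin.suc i) (Fin.suc j) e = cong Fin.suc (lookup-injective u i j e)

foldr-↭ : {A : Set} (_∙_ : A → A → A) (e : A) → (∀ a b c → a ∙ (b ∙ c) ≡ b ∙ (a ∙ c)) →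
          {xs ys : List A} → xs ↭ ys → foldr _∙_ e xs ≡ foldr _∙_ e ys
foldr-↭ _∙_ e lc Perm.refl        = refl
foldr-↭ _∙_ e lc (prep x p)       = cong (x ∙_) (foldr-↭ _∙_ e lc p)
foldr-↭ _∙_ e lc (swap x y p)     = trans (cong (λ z → x ∙ (y ∙ z)) (foldr-↭ _∙_ e lc p)) (lc x y _)
foldr-↭ _∙_ e lc (Perm.trans p q) = trans (foldr-↭ _∙_ e lc p) (foldr-↭ _∙_ e lc q)

-- The field with 2^r elements: characteristic and inverses

module FieldTheory (FF : FiniteField) (r : ℕ) (card : length (FiniteField.elements FF) ≡ 2 ℕ.^ r) where

  open FiniteField FF renaming (_+F_ to infixl 6 _⊕_; _*F_ to infixl 7 _⊗_)
  open Setup FF r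

  F-commutativeRing : CommutativeRing 0ℓ 0ℓ
  F-commutativeRing = record { isCommutativeRing = isCommutativeRing }

  open CommutativeRing F-commutativeRing using () renaming
    (+-comm to F+-comm; +-assoc to F+-assoc; *-comm to F*-comm; *-assoc to F*-assoc;
     *-identityˡ to F*-identityˡ; *-identityʳ to F*-identityʳ; +-identityˡ to F+-identityˡ; +-identityʳ to F+-identityʳ;
     zeroˡ to F*-zeroˡ; zeroʳ to F*-zeroʳ; distribˡ to F-distribˡ; distribʳ to F-distribʳ;
     -‿inverseʳ to F-inverseʳ; -‿inverseˡ to F-inverseˡ) public

  *-nonzero : ∀ {x y} → x ≢ 0F → x ⊗ y ≡ 0F → y ≡ 0F
  *-nonzero {x} {y} x≢0 e = begin
    y ≡⟨ F*-identityˡ y ⟨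
    1F ⊗ y ≡⟨ cong (_⊗ y) (invF-inv x x≢0) ⟨
    (x ⊗ invF x) ⊗ y ≡⟨ cong (_⊗ y) (F*-comm x (invF x)) ⟩
    (invF x ⊗ x) ⊗ y ≡⟨ F*-assoc _ _ _ ⟩
    invF x ⊗ (x ⊗ y) ≡⟨ cong (invF x ⊗_) e ⟩
    invF x ⊗ 0F ≡⟨ F*-zeroʳ _ ⟩
    0F ∎
    where open ≡-Reasoning

  *≢0 : ∀ {x y} → x ≢ 0F → y ≢ 0F → x ⊗ y ≢ 0F
  *≢0 a b e = b (*-nonzero a e)

  sumF-↭ : {xs ys : List F} → xs ↭ ys → sumF xs ≡ sumF ys
  sumF-↭ = foldr-↭ _⊕_ 0F (λ a b c → trans (sym (F+-assoc a b c)) (trans (cong (_⊕ c) (F+-comm a b)) (F+-assoc b a c)))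

  ·F-+ : ∀ m n x → (m ℕ.+ n) ·F x ≡ (m ·F x) ⊕ (n ·F x)
  ·F-+ zero    n x = sym (F+-identityˡ _)
  ·F-+ (suc m) n x = trans (cong (x ⊕_) (·F-+ m n x)) (sym (F+-assoc _ _ _))

  sumF-+1 : ∀ xs → sumF (map (_⊕ 1F) xs) ≡ sumF xs ⊕ (length xs ·F 1F)
  sumF-+1 []       = sym (F+-identityˡ _)
  sumF-+1 (x ∷ xs) = begin
    (x ⊕ 1F) ⊕ sumF (map (_⊕ 1F) xs) ≡⟨ cong ((x ⊕ 1F) ⊕_) (sumF-+1 xs) ⟩
    (x ⊕ 1F) ⊕ (sumF xs ⊕ (length xs ·F 1F)) ≡⟨ F+-assoc _ _ _ ⟩
    x ⊕ (1F ⊕ (sumF xs ⊕ (length xs ·F 1F))) ≡⟨ cong (x ⊕_) (sym (F+-assoc _ _ _)) ⟩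
    x ⊕ ((1F ⊕ sumF xs) ⊕ (length xs ·F 1F)) ≡⟨ cong (λ z → x ⊕ (z ⊕ (length xs ·F 1F))) (F+-comm _ _) ⟩
    x ⊕ ((sumF xs ⊕ 1F) ⊕ (length xs ·F 1F)) ≡⟨ cong (x ⊕_) (F+-assoc _ _ _) ⟩
    x ⊕ (sumF xs ⊕ (1F ⊕ (length xs ·F 1F))) ≡⟨ sym (F+-assoc _ _ _) ⟩
    (x ⊕ sumF xs) ⊕ (1F ⊕ (length xs ·F 1F)) ∎
    where open ≡-Reasoning

  cancel-+ˡ : ∀ a b → a ≡ a ⊕ b → b ≡ 0F
  cancel-+ˡ a b e = begin
    b ≡⟨ F+-identityˡ b ⟨
    0F ⊕ b ≡⟨ cong (_⊕ b) (F-inverseˡ a) ⟨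
    ((-F a) ⊕ a) ⊕ b ≡⟨ F+-assoc _ _ _ ⟩
    (-F a) ⊕ (a ⊕ b) ≡⟨ cong ((-F a) ⊕_) (sym e) ⟩
    (-F a) ⊕ a ≡⟨ F-inverseˡ a ⟩
    0F ∎
    where open ≡-Reasoning

  -- Translation by 1 permutes the field, so adding q · 1 to the sum of all elements does not change
  -- it.
  card·1 : (2 ℕ.^ r) ·F 1F ≡ 0F
  card·1 = subst (λ n → n ·F 1F ≡ 0F) card (cancel-+ˡ (sumF elements) _
    (trans (sym (sumF-↭ translate)) (sumF-+1 elements)))
    where
    cancelʳ : ∀ x a b → a ⊕ b ≡ 0F → (x ⊕ a) ⊕ b ≡ x
    cancelʳ x a b e = trans (F+-assoc x a b) (trans (cong (x ⊕_) e) (F+-identityʳ x))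
    translate : map (_⊕ 1F) elements ↭ elements
    translate = map-↭ (_⊕ 1F) (_⊕ (-F 1F)) unique unique (λ x _ → complete _) (λ x _ → complete _)
      (λ x _ → cancelʳ x 1F (-F 1F) (F-inverseʳ 1F)) (λ x _ → cancelʳ x (-F 1F) 1F (F-inverseˡ 1F))

  -- If 1 + 1 were nonzero it could be cancelled from 2^r · 1 = 0 one factor at a time, down to 1 =
  -- 0.
  char2 : 1F ⊕ 1F ≡ 0F
  char2 = go r card·1
    where
    double : ∀ n → (2 ℕ.* n) ·F 1F ≡ (1F ⊕ 1F) ⊗ (n ·F 1F)
    double n = begin
      (n ℕ.+ (n ℕ.+ 0)) ·F 1F ≡⟨ cong (λ k → (n ℕ.+ k) ·F 1F) (ℕP.+-identityʳ n) ⟩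
      (n ℕ.+ n) ·F 1F ≡⟨ ·F-+ n n 1F ⟩
      (n ·F 1F) ⊕ (n ·F 1F) ≡⟨ cong₂ _⊕_ (F*-identityˡ _) (F*-identityˡ _) ⟨
      (1F ⊗ (n ·F 1F)) ⊕ (1F ⊗ (n ·F 1F)) ≡⟨ F-distribʳ _ _ _ ⟨
      (1F ⊕ 1F) ⊗ (n ·F 1F) ∎
      where open ≡-Reasoning
    go : ∀ k → (2 ℕ.^ k) ·F 1F ≡ 0F → 1F ⊕ 1F ≡ 0F
    go zero    e = ⊥-elim (0F≢1F (trans (sym e) (F+-identityʳ 1F)))
    go (suc k) e with (1F ⊕ 1F) ≟F 0F
    ... | yes p = p
    ... | no  n = go k (*-nonzero n (trans (sym (double (2 ℕ.^ k))) e))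

  r≥1 : 1 ℕ.≤ r
  r≥1 = go r card·1
    where
    go : ∀ k → (2 ℕ.^ k) ·F 1F ≡ 0F → 1 ℕ.≤ k
    go zero    e = ⊥-elim (0F≢1F (trans (sym e) (F+-identityʳ 1F)))
    go (suc _) _ = ℕ.s≤s ℕ.z≤n

  -- Ring identities in characteristic 2 are decided by normalising polynomials with coefficients in 𝔽₂ = Bool.

  F-ring : AlmostCommutativeRing 0ℓ 0ℓ
  F-ring = fromCommutativeSemiring (CommutativeRing.commutativeSemiring F-commutativeRing)

  𝔽₂ : RawRing 0ℓ 0ℓ
  𝔽₂ = record { Carrier = Bool ; _≈_ = _≡_ ; _+_ = _xor_ ; _*_ = _∧_ ; -_ = id ; 0# = false ; 1# = true }

  𝔽₂→F : Bool → F
  𝔽₂→F true  = 1F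
  𝔽₂→F false = 0F

  𝔽₂-morphism : 𝔽₂ -Raw-AlmostCommutative⟶ F-ring
  𝔽₂-morphism = record
    { ⟦_⟧    = 𝔽₂→F
    ; +-homo = λ { true true → sym char2 ; true false → sym (F+-identityʳ _) ; false b → sym (F+-identityˡ _) }
    ; *-homo = λ { true b → sym (F*-identityˡ _) ; false b → sym (F*-zeroˡ _) }
    ; -‿homo = λ _ → refl
    ; 0-homo = refl
    ; 1-homo = refl
    }

  𝔽₂→F-≟ : ∀ a b → Maybe (𝔽₂→F a ≡ 𝔽₂→F b)
  𝔽₂→F-≟ true  true  = just refl
  𝔽₂→F-≟ false false = just refl
  𝔽₂→F-≟ _     _     = nothing

  module S₂ = RingSolver 𝔽₂ F-ring 𝔽₂-morphism 𝔽₂→F-≟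
  open S₂ using (_:+_; _:*_; _:=_; solve; con; Polynomial)

  :0 :1 : ∀ {n} → Polynomial n
  :0 = con false
  :1 = con true

  x+x : ∀ x → x ⊕ x ≡ 0F
  x+x = solve 1 (λ x → x :+ x := :0) refl

  +≡0⇒≡ : ∀ {x y} → x ⊕ y ≡ 0F → x ≡ y
  +≡0⇒≡ {x} {y} e = trans (solve 2 (λ x y → x := (x :+ y) :+ y) refl x y) (trans (cong (_⊕ y) e) (F+-identityˡ y))

  ≡⇒+≡0 : ∀ {x y} → x ≡ y → x ⊕ y ≡ 0F
  ≡⇒+≡0 {x} refl = x+x x

  -- Replacing a hypothesis l ≡ r by l + r ≡ 0 turns ideal membership into an identity.
  by₁ : ∀ {a b l r} c → l ≡ r → a ≡ b ⊕ (c ⊗ (l ⊕ r)) → a ≡ b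
  by₁ {a} {b} {l} c refl e = trans e (trans (cong (λ z → b ⊕ (c ⊗ z)) (x+x l)) (trans (cong (b ⊕_) (F*-zeroʳ c)) (F+-identityʳ b)))

  by₂ : ∀ {a b l r l′ r′} c c′ → l ≡ r → l′ ≡ r′ → a ≡ (b ⊕ (c ⊗ (l ⊕ r))) ⊕ (c′ ⊗ (l′ ⊕ r′)) → a ≡ b
  by₂ c c′ h h′ e = by₁ c h (by₁ c′ h′ e)

  inv-l : ∀ {x} → x ≢ 0F → invF x ⊗ x ≡ 1F
  inv-l {x} n = trans (F*-comm _ _) (invF-inv x n)

  inv≢0 : ∀ {x} → x ≢ 0F → invF x ≢ 0F
  inv≢0 {x} n e = 0F≢1F (trans (sym (F*-zeroʳ x)) (trans (cong (x ⊗_) (sym e)) (invF-inv x n)))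

  *-cancelˡ : ∀ {x y z} → x ≢ 0F → x ⊗ y ≡ x ⊗ z → y ≡ z
  *-cancelˡ {x} {y} {z} n e = +≡0⇒≡ (*-nonzero n (trans (F-distribˡ x y z) (≡⇒+≡0 e)))

  inv-unique : ∀ {x y} → x ⊗ y ≡ 1F → invF x ≡ y
  inv-unique {x} {y} e = *-cancelˡ n (trans (invF-inv x n) (sym e))
    where
    n : x ≢ 0F
    n refl = 0F≢1F (trans (sym (F*-zeroˡ y)) e)

  inv-inv : ∀ {x} → x ≢ 0F → invF (invF x) ≡ x
  inv-inv n = inv-unique (inv-l n)

  inv-* : ∀ {x y} → x ≢ 0F → y ≢ 0F → invF (x ⊗ y) ≡ invF x ⊗ invF y
  inv-* {x} {y} a b = inv-unique (by₂ (y ⊗ invF y) 1F (invF-inv x a) (invF-inv y b)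
    (solve 4 (λ x y z w → (x :* y) :* (z :* w) := (:1 :+ (y :* w) :* (x :* z :+ :1)) :+ :1 :* (y :* w :+ :1)) refl x y (invF x) (invF y)))

  sq-inj : ∀ {x y} → x ⊗ x ≡ y ⊗ y → x ≡ y
  sq-inj {x} {y} e with (x ⊕ y) ≟F 0F
  ... | yes p = +≡0⇒≡ p
  ... | no  n = +≡0⇒≡ (*-nonzero n (trans (solve 2 (λ x y → (x :+ y) :* (x :+ y) := x :* x :+ y :* y) refl x y) (≡⇒+≡0 e)))

  -- Powers and Fermat's little theorem

  powF-+ : ∀ x m n → powF x (m ℕ.+ n) ≡ powF x m ⊗ powF x n
  powF-+ x zero    n = sym (F*-identityˡ _)
  powF-+ x (suc m) n = trans (cong (x ⊗_) (powF-+ x m n)) (sym (F*-assoc _ _ _))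

  powF-* : ∀ x m n → powF x (m ℕ.* n) ≡ powF (powF x n) m
  powF-* x zero    n = refl
  powF-* x (suc m) n = trans (powF-+ x n (m ℕ.* n)) (cong (powF x n ⊗_) (powF-* x m n))

  powF-distrib-* : ∀ x y n → powF (x ⊗ y) n ≡ powF x n ⊗ powF y n
  powF-distrib-* x y zero    = sym (F*-identityˡ _)
  powF-distrib-* x y (suc n) = trans (cong ((x ⊗ y) ⊗_) (powF-distrib-* x y n))
    (solve 4 (λ x y a b → (x :* y) :* (a :* b) := (x :* a) :* (y :* b)) refl x y (powF x n) (powF y n))

  powF-1 : ∀ n → powF 1F n ≡ 1F
  powF-1 zero    = refl
  powF-1 (suc n) = trans (F*-identityˡ _) (powF-1 n)

  powF-≢0 : ∀ {x} n → x ≢ 0F → powF x n ≢ 0F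
  powF-≢0 zero    x≢0 e = 0F≢1F (sym e)
  powF-≢0 (suc n) x≢0   = *≢0 x≢0 (powF-≢0 n x≢0)

  ∈nonzero⁺ : ∀ {x} → x ≢ 0F → x ∈ nonzero
  ∈nonzero⁺ {x} n = ∈-filter⁺ _ (complete x) (subst (T ∘ not) (sym (⌊⌋-no (x ≟F 0F) n)) _)

  ∈nonzero⁻ : ∀ {x} → x ∈ nonzero → x ≢ 0F
  ∈nonzero⁻ {x} i e with x ≟F 0F | proj₂ (∈-filter⁻ (λ x → T? (not (x == 0F))) {xs = elements} i)
  ... | yes _ | ()
  ... | no n  | _ = n e

  nonzero-unique : Unique nonzero
  nonzero-unique = UniqueP.filter⁺ _ unique

  elements-↭ : elements ↭ 0F ∷ nonzero
  elements-↭ = unique-↭ unique (All.tabulate (λ i e → ∈nonzero⁻ i (sym e)) ∷ nonzero-unique) fwd (λ x _ → complete x)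
    where
    fwd : ∀ x → x ∈ elements → x ∈ 0F ∷ nonzero
    fwd x _ with x ≟F 0F
    ... | yes refl = here refl
    ... | no n     = there (∈nonzero⁺ n)

  suc-length-nonzero : suc (length nonzero) ≡ q
  suc-length-nonzero = trans (sym (PermP.↭-length elements-↭)) card

  prodF : List F → F
  prodF = foldr _⊗_ 1F

  prodF-≢0 : ∀ xs → (∀ x → x ∈ xs → x ≢ 0F) → prodF xs ≢ 0F
  prodF-≢0 []       p e = 0F≢1F (sym e)
  prodF-≢0 (x ∷ xs) p = *≢0 (p x (here refl)) (prodF-≢0 xs (λ y i → p y (there i)))

  prodF-scale : ∀ x xs → prodF (map (x ⊗_) xs) ≡ powF x (length xs) ⊗ prodF xs
  prodF-scale x []       = sym (F*-identityˡ _)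
  prodF-scale x (y ∷ xs) = trans (cong ((x ⊗ y) ⊗_) (prodF-scale x xs))
    (solve 4 (λ x y a b → (x :* y) :* (a :* b) := (x :* a) :* (y :* b)) refl x y (powF x (length xs)) (prodF xs))

  scale-↭ : ∀ {a} → a ≢ 0F → map (a ⊗_) nonzero ↭ nonzero
  scale-↭ {a} n = map-↭ (a ⊗_) (invF a ⊗_) nonzero-unique nonzero-unique
    (λ x i → ∈nonzero⁺ (*≢0 n (∈nonzero⁻ i))) (λ x i → ∈nonzero⁺ (*≢0 (inv≢0 n) (∈nonzero⁻ i)))
    (λ x _ → cancel (inv-l n) x) (λ x _ → cancel (invF-inv a n) x)
    where
    cancel : ∀ {a b} → a ⊗ b ≡ 1F → ∀ x → a ⊗ (b ⊗ x) ≡ x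
    cancel {a} {b} e x = trans (sym (F*-assoc a b x)) (trans (cong (_⊗ x) e) (F*-identityˡ x))

  -- Multiplication by x ≠ 0 permutes the nonzero elements, so their product P satisfies P = x^(q-1)
  -- P.
  fermat : ∀ x → powF x q ≡ x
  fermat x with x ≟F 0F
  ... | yes refl = trans (cong (powF 0F) (sym suc-length-nonzero)) (F*-zeroˡ _)
  ... | no n = trans (cong (powF x) (sym suc-length-nonzero)) (trans (cong (x ⊗_) pow1) (F*-identityʳ x))
    where
    P≢0 : prodF nonzero ≢ 0F
    P≢0 = prodF-≢0 nonzero (λ _ → ∈nonzero⁻)
    pow1 : powF x (length nonzero) ≡ 1F
    pow1 = *-cancelˡ P≢0 (trans (F*-comm _ _) (trans (sym (prodF-scale x nonzero))
      (trans (foldr-↭ _⊗_ 1F (λ a b c → solve 3 (λ a b c → a :* (b :* c) := b :* (a :* c)) refl a b c) (scale-↭ n)) (sym (F*-identityʳ _)))))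

  frob-suc : ∀ x n → powF x (2 ℕ.^ suc n) ≡ powF x (2 ℕ.^ n) ⊗ powF x (2 ℕ.^ n)
  frob-suc x n = trans (powF-* x 2 (2 ℕ.^ n)) (cong (powF x (2 ℕ.^ n) ⊗_) (F*-identityʳ _))

  frob-+ : ∀ n x y → powF (x ⊕ y) (2 ℕ.^ n) ≡ powF x (2 ℕ.^ n) ⊕ powF y (2 ℕ.^ n)
  frob-+ zero    x y = solve 2 (λ x y → (x :+ y) :* :1 := x :* :1 :+ y :* :1) refl x y
  frob-+ (suc n) x y = begin
    powF (x ⊕ y) (2 ℕ.^ suc n) ≡⟨ frob-suc (x ⊕ y) n ⟩
    powF (x ⊕ y) N ⊗ powF (x ⊕ y) N ≡⟨ cong (λ z → z ⊗ z) (frob-+ n x y) ⟩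
    (powF x N ⊕ powF y N) ⊗ (powF x N ⊕ powF y N)
      ≡⟨ solve 2 (λ x y → (x :+ y) :* (x :+ y) := x :* x :+ y :* y) refl (powF x N) (powF y N) ⟩
    powF x N ⊗ powF x N ⊕ powF y N ⊗ powF y N ≡⟨ cong₂ _⊕_ (frob-suc x n) (frob-suc y n) ⟨
    powF x (2 ℕ.^ suc n) ⊕ powF y (2 ℕ.^ suc n) ∎
    where
    open ≡-Reasoning
    N = 2 ℕ.^ n

  frob-inj : ∀ n {x y} → powF x (2 ℕ.^ n) ≡ powF y (2 ℕ.^ n) → x ≡ y
  frob-inj zero    {x} {y} e = trans (sym (F*-identityʳ x)) (trans e (F*-identityʳ y))
  frob-inj (suc n) {x} {y} e = frob-inj n (sq-inj (trans (sym (frob-suc x n)) (trans e (frob-suc y n))))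

  sqrtF : F → F
  sqrtF x = powF x (2 ℕ.^ (r ℕ.∸ 1))

  sqrtF-sq : ∀ x → sqrtF x ⊗ sqrtF x ≡ x
  sqrtF-sq x = trans (sym (frob-suc x (r ℕ.∸ 1))) (trans (cong (λ k → powF x (2 ℕ.^ k)) (ℕP.m+[n∸m]≡n r≥1)) (fermat x))

  -- Polynomial functions, given by coefficient vectors in increasing degree

  eval : ∀ {n} → Vec F n → F → F
  eval []       x = 0F
  eval (c ∷ cs) x = c ⊕ x ⊗ eval cs x

  evalMonic : ∀ {n} → Vec F n → F → F
  evalMonic []       x = 1F
  evalMonic (c ∷ cs) x = c ⊕ x ⊗ evalMonic cs x

  -- `IsPoly n` means degree below n, `IsMonic n` degree exactly n: the leading coefficient 1 is not
  -- stored.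
  IsPoly IsMonic : ℕ → (F → F) → Set
  IsPoly  n f = Σ (Vec F n) λ cs → ∀ x → f x ≡ eval cs x
  IsMonic n f = Σ (Vec F n) λ cs → ∀ x → f x ≡ evalMonic cs x

  IsPoly-≗ : ∀ {n f g} → (∀ x → f x ≡ g x) → IsPoly n g → IsPoly n f
  IsPoly-≗ e (cs , p) = cs , λ x → trans (e x) (p x)

  IsMonic-≗ : ∀ {n f g} → (∀ x → f x ≡ g x) → IsMonic n g → IsMonic n f
  IsMonic-≗ e (cs , p) = cs , λ x → trans (e x) (p x)

  poly-0 : ∀ n → IsPoly n (λ _ → 0F)
  poly-0 zero    = [] , λ _ → refl
  poly-0 (suc n) with poly-0 n
  ... | cs , p = 0F ∷ cs , λ x → trans (sym (trans (F+-identityˡ _) (F*-zeroʳ x))) (cong (λ z → 0F ⊕ x ⊗ z) (p x))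

  poly-X* : ∀ {n f} → IsPoly n f → IsPoly (suc n) (λ x → x ⊗ f x)
  poly-X* (cs , p) = 0F ∷ cs , λ x → trans (cong (x ⊗_) (p x)) (sym (F+-identityˡ _))

  monic-X* : ∀ {n f} → IsMonic n f → IsMonic (suc n) (λ x → x ⊗ f x)
  monic-X* (cs , p) = 0F ∷ cs , λ x → trans (cong (x ⊗_) (p x)) (sym (F+-identityˡ _))

  poly-X^* : ∀ k {n f} → IsPoly n f → IsPoly (k ℕ.+ n) (λ x → powF x k ⊗ f x)
  poly-X^* zero    p = IsPoly-≗ (λ x → F*-identityˡ _) p
  poly-X^* (suc k) p = IsPoly-≗ (λ x → F*-assoc _ _ _) (poly-X* (poly-X^* k p))

  monic-X^* : ∀ k {n f} → IsMonic n f → IsMonic (k ℕ.+ n) (λ x → powF x k ⊗ f x)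
  monic-X^* zero    p = IsMonic-≗ (λ x → F*-identityˡ _) p
  monic-X^* (suc k) p = IsMonic-≗ (λ x → F*-assoc _ _ _) (monic-X* (monic-X^* k p))

  monic-1 : IsMonic 0 (λ _ → 1F)
  monic-1 = [] , λ _ → refl

  monic-X^ : ∀ k → IsMonic k (λ x → powF x k)
  monic-X^ k = subst (λ n → IsMonic n (λ x → powF x k)) (ℕP.+-identityʳ k)
    (IsMonic-≗ (λ x → sym (F*-identityʳ _)) (monic-X^* k monic-1))

  poly-weaken : ∀ {m n f} → m ℕ.≤ n → IsPoly m f → IsPoly n f
  poly-weaken {n = n} ℕ.z≤n ([] , p) = IsPoly-≗ p (poly-0 n)
  poly-weaken {f = f} (ℕ.s≤s le) (c ∷ cs , p) with poly-weaken le (cs , λ x → refl {x = eval cs x})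
  ... | ds , e = c ∷ ds , λ x → trans (p x) (cong (λ z → c ⊕ x ⊗ z) (e x))

  monic⇒poly : ∀ {n f} → IsMonic n f → IsPoly (suc n) f
  monic⇒poly ([] , p) = 1F ∷ [] , λ x → trans (p x) (solve 2 (λ a x → a := a :+ x :* :0) refl 1F x)
  monic⇒poly (c ∷ cs , p) with monic⇒poly (cs , λ x → refl {x = evalMonic cs x})
  ... | ds , e = c ∷ ds , λ x → trans (p x) (cong (λ z → c ⊕ x ⊗ z) (e x))

  eval-+ : ∀ {n} (cs ds : Vec F n) x → eval cs x ⊕ eval ds x ≡ eval (Vec.zipWith _⊕_ cs ds) x
  eval-+ []       []       x = F+-identityˡ _
  eval-+ (c ∷ cs) (d ∷ ds) x = trans (solve 5 (λ c d x a b → (c :+ x :* a) :+ (d :+ x :* b) := (c :+ d) :+ x :* (a :+ b)) refl c d x _ _)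
    (cong (λ z → c ⊕ d ⊕ x ⊗ z) (eval-+ cs ds x))

  evalMonic-+ : ∀ {n} (cs ds : Vec F n) x → evalMonic cs x ⊕ eval ds x ≡ evalMonic (Vec.zipWith _⊕_ cs ds) x
  evalMonic-+ []       []       x = F+-identityʳ _
  evalMonic-+ (c ∷ cs) (d ∷ ds) x = trans (solve 5 (λ c d x a b → (c :+ x :* a) :+ (d :+ x :* b) := (c :+ d) :+ x :* (a :+ b)) refl c d x _ _)
    (cong (λ z → c ⊕ d ⊕ x ⊗ z) (evalMonic-+ cs ds x))

  eval-scale : ∀ {n} a (cs : Vec F n) x → a ⊗ eval cs x ≡ eval (Vec.map (a ⊗_) cs) x
  eval-scale a []       x = F*-zeroʳ a
  eval-scale a (c ∷ cs) x = trans (solve 4 (λ a c x e → a :* (c :+ x :* e) := a :* c :+ x :* (a :* e)) refl a c x _)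
    (cong (λ z → a ⊗ c ⊕ x ⊗ z) (eval-scale a cs x))

  poly-+ : ∀ {n f g} → IsPoly n f → IsPoly n g → IsPoly n (λ x → f x ⊕ g x)
  poly-+ (cs , p) (ds , e) = Vec.zipWith _⊕_ cs ds , λ x → trans (cong₂ _⊕_ (p x) (e x)) (eval-+ cs ds x)

  poly-scale : ∀ {n f} a → IsPoly n f → IsPoly n (λ x → a ⊗ f x)
  poly-scale a (cs , p) = Vec.map (a ⊗_) cs , λ x → trans (cong (a ⊗_) (p x)) (eval-scale a cs x)

  monic-+ : ∀ {n f g} → IsMonic n f → IsPoly n g → IsMonic n (λ x → f x ⊕ g x)
  monic-+ (cs , p) (ds , e) = Vec.zipWith _⊕_ cs ds , λ x → trans (cong₂ _⊕_ (p x) (e x)) (evalMonic-+ cs ds x)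

  -- Synthetic division: if M(x) = M(a) + (x + a) G(x), then x M(x) + a M(a) = (x + a)(M(x) + a
  -- G(x)), which gives the next quotient.
  factor : ∀ {n} (cs : Vec F (suc n)) a →
           Σ (F → F) λ g → IsMonic n g × (∀ x → evalMonic cs x ≡ evalMonic cs a ⊕ (x ⊕ a) ⊗ g x)
  factor (c ∷ []) a = (λ _ → 1F) , monic-1 ,
    λ x → solve 3 (λ c x a → c :+ x :* :1 := (c :+ a :* :1) :+ (x :+ a) :* :1) refl c x a
  factor (c ∷ cs@(_ ∷ _)) a with factor cs a
  ... | g , m , e = (λ x → evalMonic cs x ⊕ a ⊗ g x) ,
    monic-+ (cs , λ _ → refl) (poly-scale a (monic⇒poly m)) ,
    λ x → by₁ a (e x) (solve 6 (λ c x a M N G →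
      c :+ x :* M := ((c :+ a :* N) :+ (x :+ a) :* (M :+ a :* G)) :+ a :* (M :+ (N :+ (x :+ a) :* G)))
      refl c x a (evalMonic cs x) (evalMonic cs a) (g x))

  roots-bound : ∀ n {f} → IsMonic n f → ∀ xs → Unique xs → (∀ x → x ∈ xs → f x ≡ 0F) → length xs ℕ.≤ n
  roots-bound n       m         []       u       z = ℕ.z≤n
  roots-bound zero    ([] , p)  (a ∷ xs) u       z = ⊥-elim (0F≢1F (trans (sym (z a (here refl))) (p a)))
  roots-bound (suc n) {f} (cs , p) (a ∷ xs) (ne ∷ u) z with factor cs a
  ... | g , m , e = ℕ.s≤s (roots-bound n m xs u zero-g)
    where
    zero-g : ∀ x → x ∈ xs → g x ≡ 0F
    zero-g x i = *-nonzero {x = x ⊕ a} (λ w → All.lookup ne i (sym (+≡0⇒≡ w)))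
      (trans (sym (F+-identityˡ _)) (trans (cong (_⊕ (x ⊕ a) ⊗ g x) (sym (trans (sym (p a)) (z a (here refl)))))
        (trans (sym (e x)) (trans (sym (p x)) (z x (there i))))))

  -- Partial traces and the absolute trace

  partialTr : ℕ → F → F
  partialTr zero    x = 0F
  partialTr (suc n) x = partialTr n x ⊕ powF x (2 ℕ.^ n)

  sumF-∷ʳ : ∀ xs x → sumF (xs Data.List.∷ʳ x) ≡ sumF xs ⊕ x
  sumF-∷ʳ []       x = F+-comm _ _
  sumF-∷ʳ (y ∷ xs) x = trans (cong (y ⊕_) (sumF-∷ʳ xs x)) (sym (F+-assoc _ _ _))

  partialTr-sum : ∀ n x → sumF (map (λ i → powF x (2 ℕ.^ i)) (upTo n)) ≡ partialTr n x
  partialTr-sum zero    x = refl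
  partialTr-sum (suc n) x = begin
    sumF (map g (upTo (suc n))) ≡⟨ cong (sumF ∘ map g) (ListP.upTo-∷ʳ n) ⟨
    sumF (map g (upTo n Data.List.∷ʳ n)) ≡⟨ cong sumF (ListP.map-++ g (upTo n) (n ∷ [])) ⟩
    sumF (map g (upTo n) Data.List.∷ʳ g n) ≡⟨ sumF-∷ʳ (map g (upTo n)) (g n) ⟩
    sumF (map g (upTo n)) ⊕ g n ≡⟨ cong (_⊕ g n) (partialTr-sum n x) ⟩
    partialTr n x ⊕ g n ∎
    where
    open ≡-Reasoning
    g = λ i → powF x (2 ℕ.^ i)

  tr≡partialTr : ∀ x → tr x ≡ partialTr r x
  tr≡partialTr = partialTr-sum r

  partialTr-+ : ∀ n x y → partialTr n (x ⊕ y) ≡ partialTr n x ⊕ partialTr n y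
  partialTr-+ zero    x y = sym (F+-identityˡ _)
  partialTr-+ (suc n) x y = trans (cong₂ _⊕_ (partialTr-+ n x y) (frob-+ n x y))
    (solve 4 (λ a b c d → (a :+ b) :+ (c :+ d) := (a :+ c) :+ (b :+ d)) refl _ _ _ _)

  -- Squaring raises every exponent of the partial trace by one step, so the sum can also be
  -- extended at its lower end.
  partialTr-suc : ∀ n x → partialTr (suc n) x ≡ x ⊕ partialTr n x ⊗ partialTr n x
  partialTr-suc zero    x = solve 1 (λ x → :0 :+ x :* :1 := x :+ :0 :* :0) refl x
  partialTr-suc (suc n) x = begin
    partialTr (suc n) x ⊕ powF x (2 ℕ.^ suc n) ≡⟨ cong₂ _⊕_ (partialTr-suc n x) (frob-suc x n) ⟩
    x ⊕ A ⊗ A ⊕ B ⊗ B ≡⟨ solve 3 (λ x A B → (x :+ A :* A) :+ B :* B := x :+ (A :+ B) :* (A :+ B)) refl x A B ⟩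
    x ⊕ (A ⊕ B) ⊗ (A ⊕ B) ∎
    where
    open ≡-Reasoning
    A = partialTr n x
    B = powF x (2 ℕ.^ n)

  partialTr-monic : ∀ n → IsMonic (2 ℕ.^ n) (partialTr (suc n))
  partialTr-monic zero    = IsMonic-≗ (λ x → F+-identityˡ _) (monic-X^ 1)
  partialTr-monic (suc n) = IsMonic-≗ (λ x → F+-comm _ _) (monic-+ (monic-X^ (2 ℕ.^ suc n))
    (poly-weaken (ℕP.≤-trans (ℕP.+-monoˡ-≤ (2 ℕ.^ n) (ℕP.m^n>0 2 n)) (ℕP.≤-reflexive (cong (2 ℕ.^ n ℕ.+_) (sym (ℕP.+-identityʳ _))))) (monic⇒poly (partialTr-monic n))))

  tr-+ : ∀ x y → tr (x ⊕ y) ≡ tr x ⊕ tr y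
  tr-+ x y = trans (tr≡partialTr _) (trans (partialTr-+ r x y) (sym (cong₂ _⊕_ (tr≡partialTr x) (tr≡partialTr y))))

  -- The partial trace of length r + 1 is x + tr(x)² by one recursion and tr(x) + x^q = tr(x) + x by
  -- the other.
  tr-idem : ∀ x → tr x ⊗ tr x ≡ tr x
  tr-idem x rewrite tr≡partialTr x = +≡0⇒≡ (begin
    A ⊗ A ⊕ A ≡⟨ solve 2 (λ x A → A :* A :+ A := (x :+ A :* A) :+ (A :+ x)) refl x A ⟩
    x ⊕ A ⊗ A ⊕ (A ⊕ x) ≡⟨ cong₂ _⊕_ (sym (partialTr-suc r x)) (cong (A ⊕_) (sym (fermat x))) ⟩
    partialTr (suc r) x ⊕ partialTr (suc r) x ≡⟨ x+x _ ⟩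
    0F ∎)
    where
    open ≡-Reasoning
    A = partialTr r x

  tr-sq : ∀ x → tr (x ⊗ x) ≡ tr x
  tr-sq x = trans (trans (tr≡partialTr _) (trans (go r) (cong₂ _⊗_ (sym (tr≡partialTr x)) (sym (tr≡partialTr x))))) (tr-idem x)
    where
    go : ∀ n → partialTr n (x ⊗ x) ≡ partialTr n x ⊗ partialTr n x
    go zero    = sym (F*-zeroˡ _)
    go (suc n) = trans (cong₂ _⊕_ (go n) (powF-distrib-* x x (2 ℕ.^ n)))
      (solve 2 (λ A B → A :* A :+ B :* B := (A :+ B) :* (A :+ B)) refl (partialTr n x) (powF x (2 ℕ.^ n)))

  tr-01 : ∀ x → tr x ≡ 0F ⊎ tr x ≡ 1F
  tr-01 x with tr x ≟F 0F
  ... | yes p = inj₁ p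
  ... | no  n = inj₂ (*-cancelˡ n (trans (tr-idem x) (sym (F*-identityʳ _))))

  tr-℘ : ∀ z → tr (z ⊗ z ⊕ z) ≡ 0F
  tr-℘ z = trans (tr-+ _ _) (trans (cong (_⊕ tr z) (tr-sq z)) (x+x _))

  -- The canonical additive character

  λ-0 : ∀ {x} → tr x ≡ 0F → λ' x ≡ 1ℤ
  λ-0 {x} e rewrite ⌊⌋-yes (tr x ≟F 0F) e = refl

  λ-1 : ∀ {x} → tr x ≡ 1F → λ' x ≡ ℤ.-1ℤ
  λ-1 {x} e rewrite ⌊⌋-no (tr x ≟F 0F) (λ z → 0F≢1F (trans (sym z) e)) = refl

  λ-tr : ∀ {x y} → tr x ≡ tr y → λ' x ≡ λ' y
  λ-tr e rewrite e = refl

  λ-+ : ∀ x y → λ' (x ⊕ y) ≡ λ' x ℤ.* λ' y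
  λ-+ x y with tr-01 x | tr-01 y
  ... | inj₁ a | inj₁ b rewrite λ-0 a | λ-0 b = λ-0 (trans (tr-+ x y) (trans (cong₂ _⊕_ a b) (F+-identityˡ _)))
  ... | inj₁ a | inj₂ b rewrite λ-0 a | λ-1 b = λ-1 (trans (tr-+ x y) (trans (cong₂ _⊕_ a b) (F+-identityˡ _)))
  ... | inj₂ a | inj₁ b rewrite λ-1 a | λ-0 b = λ-1 (trans (tr-+ x y) (trans (cong₂ _⊕_ a b) (F+-identityʳ _)))
  ... | inj₂ a | inj₂ b rewrite λ-1 a | λ-1 b = λ-0 (trans (tr-+ x y) (trans (cong₂ _⊕_ a b) char2))

  λ-sq : ∀ x → λ' (x ⊗ x) ≡ λ' x
  λ-sq x = λ-tr (tr-sq x)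

  tr-0 : tr 0F ≡ 0F
  tr-0 = trans (sym (cong tr (x+x 0F))) (trans (tr-+ 0F 0F) (x+x _))

  λ-0F : λ' 0F ≡ 1ℤ
  λ-0F = λ-0 tr-0

  -- The fibres of ℘(z) = z² + z have two elements or none; as ker tr has at most q/2 elements, ℘ maps onto ker tr.

  ℘-fibre : F → ℤ
  ℘-fibre v = ∑ elements (λ z → 𝟙 ((z ⊗ z ⊕ z) == v))

  ==-sym : ∀ x y → (x == y) ≡ (y == x)
  ==-sym x y = ⌊⌋-⇔ (x ≟F y) (y ≟F x) sym sym

  ∑-==ˡ : ∀ x (f : F → ℤ) → ∑ elements (λ y → 𝟙 (x == y) ℤ.* f y) ≡ f x
  ∑-==ˡ x f = trans (∑-cong elements (λ y → cong (λ b → 𝟙 b ℤ.* f y) (==-sym x y))) (∑-δ _≟F_ elements unique (complete x) f)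

  ∑-==-1ˡ : ∀ x → ∑ elements (λ y → 𝟙 (x == y)) ≡ 1ℤ
  ∑-==-1ˡ x = trans (∑-cong elements (λ y → sym (ℤP.*-identityʳ _))) (∑-==ˡ x (λ _ → 1ℤ))

  ∑-==-1ʳ : ∀ x → ∑ elements (λ y → 𝟙 (y == x)) ≡ 1ℤ
  ∑-==-1ʳ x = ∑-δ-1 _≟F_ elements unique (complete x)

  two-roots : (P : F → Bool) (u v : F) → u ≢ v → P u ≡ true → P v ≡ true → (∀ z → z ≢ u → z ≢ v → P z ≡ false) →
              ∑ elements (λ z → 𝟙 (P z)) ≡ + 2
  two-roots P u v u≢v pu pv pz = trans (∑-cong elements step)
    (trans (∑-+ elements (λ z → 𝟙 (z == u)) (λ z → 𝟙 (z == v))) (cong₂ ℤ._+_ (∑-==-1ʳ u) (∑-==-1ʳ v)))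
    where
    step : ∀ z → 𝟙 (P z) ≡ 𝟙 (z == u) ℤ.+ 𝟙 (z == v)
    step z with z ≟F u | z ≟F v
    ... | yes refl | yes e = ⊥-elim (u≢v e)
    ... | yes refl | no _  = cong 𝟙 pu
    ... | no _ | yes refl  = cong 𝟙 pv
    ... | no a | no b      = cong 𝟙 (pz z a b)

  ℘-fibre-root : ∀ z v → z ⊗ z ⊕ z ≡ v → ℘-fibre v ≡ + 2
  ℘-fibre-root z v e = two-roots (λ y → (y ⊗ y ⊕ y) == v) z (z ⊕ 1F)
    (λ w → 0F≢1F (sym (cancel-+ˡ z 1F w)))
    (⌊⌋-yes (_ ≟F v) e)
    (⌊⌋-yes (_ ≟F v) (trans (solve 1 (λ z → (z :+ :1) :* (z :+ :1) :+ (z :+ :1) := z :* z :+ z) refl z) e))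
    (λ y a b → ⌊⌋-no (_ ≟F v) (λ w → b (+≡0⇒≡ (*-nonzero {x = y ⊕ z} (a ∘ +≡0⇒≡)
      (trans (solve 2 (λ y z → (y :+ z) :* (y :+ (z :+ :1)) := (y :* y :+ y) :+ (z :* z :+ z)) refl y z) (≡⇒+≡0 (trans w (sym e))))))))

  ℘-fibre-none : ∀ v → (∀ z → z ⊗ z ⊕ z ≢ v) → ℘-fibre v ≡ 0ℤ
  ℘-fibre-none v n = ∑-0-∈ elements (λ z _ → cong 𝟙 (⌊⌋-no (_ ≟F v) (n z)))

  ℘-root? : ∀ v → (∃ λ z → z ⊗ z ⊕ z ≡ v) ⊎ (∀ z → z ⊗ z ⊕ z ≢ v)
  ℘-root? v with any? (λ z → (z ⊗ z ⊕ z) ≟F v) elements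
  ... | yes p = inj₁ (proj₁ (find p) , proj₂ (proj₂ (find p)))
  ... | no n  = inj₂ (λ z e → n (lose (complete z) e))

  ∑-℘-fibre : ∑ elements ℘-fibre ≡ + q
  ∑-℘-fibre = trans (∑-swap elements elements _) (trans (∑-cong elements (λ z → ∑-==-1ˡ _)) (trans (∑-1 elements) (cong +_ card)))

  kerTr : List F
  kerTr = filterᵇ (λ v → tr v == 0F) elements

  ∈kerTr⁻ : ∀ {v} → v ∈ kerTr → tr v ≡ 0F
  ∈kerTr⁻ {v} i = toWitness′ (tr v ≟F 0F) (proj₂ (∈-filter⁻ (λ v → T? (tr v == 0F)) {xs = elements} i))
    where
    toWitness′ : {P : Set} (d : Dec P) → T ⌊ d ⌋ → P
    toWitness′ (yes p) _ = p

  -- The trace is a monic polynomial of degree 2^(r-1) = q/2.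
  kerTr-length : 2 ℕ.* length kerTr ℕ.≤ q
  kerTr-length = ℕP.≤-trans (ℕP.*-monoʳ-≤ 2 (roots-bound (2 ℕ.^ (r ℕ.∸ 1)) (partialTr-monic (r ℕ.∸ 1)) kerTr (UniqueP.filter⁺ _ unique) vanish))
      (ℕP.≤-reflexive (cong (2 ℕ.^_) eq))
    where
    eq : suc (r ℕ.∸ 1) ≡ r
    eq = ℕP.m+[n∸m]≡n r≥1
    vanish : ∀ v → v ∈ kerTr → partialTr (suc (r ℕ.∸ 1)) v ≡ 0F
    vanish v i = trans (cong (λ k → partialTr k v) eq) (trans (sym (tr≡partialTr v)) (∈kerTr⁻ i))

  ℘-fibre-tr1 : ∀ v → tr v ≢ 0F → ℘-fibre v ≡ 0ℤ
  ℘-fibre-tr1 v n = ℘-fibre-none v (λ { z refl → n (tr-℘ z) })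

  -- The deficiencies 2 - `℘-fibre v` are nonnegative on the kernel of the trace, and their sum is 2
  -- |ker tr| - q ≤ 0; hence each of them is 0.
  ℘-fibre-tr0 : ∀ v → tr v ≡ 0F → ℘-fibre v ≡ + 2
  ℘-fibre-tr0 v e = sym (ℤP.i-j≡0⇒i≡j (+ 2) (℘-fibre v) (∑-≤0⇒≡0 kerTr nonneg total v
      (∈-filter⁺ _ (complete v) (subst T (sym (⌊⌋-yes (tr v ≟F 0F) e)) _))))
    where
    nonneg : ∀ v → v ∈ kerTr → 0ℤ ℤ.≤ + 2 ℤ.- ℘-fibre v
    nonneg v _ with ℘-root? v
    ... | inj₁ (z , e) rewrite ℘-fibre-root z v e = ℤP.≤-refl
    ... | inj₂ n       rewrite ℘-fibre-none v n   = ℤ.+≤+ ℕ.z≤n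
    onKer : ∑ kerTr ℘-fibre ≡ + q
    onKer = trans (∑-filter _ elements ℘-fibre) (trans (∑-cong elements step) ∑-℘-fibre)
      where
      step : ∀ v → 𝟙 (tr v == 0F) ℤ.* ℘-fibre v ≡ ℘-fibre v
      step v with tr v ≟F 0F
      ... | yes _ = ℤP.*-identityˡ _
      ... | no n  = sym (℘-fibre-tr1 v n)
    total : ∑ kerTr (λ v → + 2 ℤ.- ℘-fibre v) ℤ.≤ 0ℤ
    total = ℤP.≤-trans (ℤP.≤-reflexive (trans (∑-+ kerTr (λ _ → + 2) (λ v → ℤ.- ℘-fibre v))
        (cong₂ ℤ._+_ (trans (∑-const kerTr (+ 2)) (trans (ℤP.*-comm (+ length kerTr) (+ 2)) (sym (ℤP.pos-* 2 (length kerTr)))))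
          (trans (∑-cong kerTr (λ v → sym (ℤP.-1*i≡-i _))) (trans (∑-*ˡ kerTr ℤ.-1ℤ ℘-fibre) (trans (ℤP.-1*i≡-i _) (cong ℤ.-_ onKer)))))))
      (ℤP.i≤j⇒i-j≤0 (ℤ.+≤+ kerTr-length))

  ℘-fibre-λ : ∀ v → ℘-fibre v ≡ 1ℤ ℤ.+ λ' v
  ℘-fibre-λ v with tr-01 v
  ... | inj₁ e rewrite λ-0 e = ℘-fibre-tr0 v e
  ... | inj₂ e rewrite λ-1 e = ℘-fibre-tr1 v (λ z → 0F≢1F (trans (sym z) e))

  -- The fibre sizes 1 + λ(v) of ℘ add up to q, and so do the summands 1.
  ∑λ : ∑ elements λ' ≡ 0ℤ
  ∑λ = ℤ+-cancelˡ (+ q) (trans (trans (sym (trans (∑-+ elements (λ _ → 1ℤ) λ') (cong (ℤ._+ ∑ elements λ') (trans (∑-1 elements) (cong +_ card)))))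
        (trans (∑-cong elements (λ v → sym (℘-fibre-λ v))) ∑-℘-fibre)) (sym (ℤP.+-identityʳ _)))

  -- Substitutions and orthogonality in sums over the field

  ∑-split : ∀ (f : F → ℤ) → ∑ elements f ≡ f 0F ℤ.+ ∑ nonzero f
  ∑-split f = ∑-↭ f elements-↭

  ∑λ-nonzero : ∑ nonzero λ' ≡ ℤ.-1ℤ
  ∑λ-nonzero = ℤ+-cancelˡ 1ℤ (trans (cong (ℤ._+ ∑ nonzero λ') (sym λ-0F)) (trans (sym (∑-split λ')) ∑λ))

  ∑-scale : ∀ {a} → a ≢ 0F → (f : F → ℤ) → ∑ nonzero (λ x → f (a ⊗ x)) ≡ ∑ nonzero f
  ∑-scale {a} n f = trans (sym (∑-map nonzero (a ⊗_) f)) (∑-↭ f (scale-↭ n))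

  ∑-inv : ∀ (f : F → ℤ) → ∑ nonzero (λ x → f (invF x)) ≡ ∑ nonzero f
  ∑-inv f = ∑-bij invF invF nonzero-unique nonzero-unique
    (λ x i → ∈nonzero⁺ (inv≢0 (∈nonzero⁻ i))) (λ x i → ∈nonzero⁺ (inv≢0 (∈nonzero⁻ i)))
    (λ x i → inv-inv (∈nonzero⁻ i)) (λ x i → inv-inv (∈nonzero⁻ i)) f

  ∑-sq : ∀ (f : F → ℤ) → ∑ nonzero (λ x → f (x ⊗ x)) ≡ ∑ nonzero f
  ∑-sq f = ∑-bij (λ x → x ⊗ x) sqrtF nonzero-unique nonzero-unique
    (λ x i → ∈nonzero⁺ (*≢0 (∈nonzero⁻ i) (∈nonzero⁻ i))) (λ x i → ∈nonzero⁺ (powF-≢0 (2 ℕ.^ (r ℕ.∸ 1)) (∈nonzero⁻ i)))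
    (λ x i → sq-inj (sqrtF-sq (x ⊗ x))) (λ x i → sqrtF-sq x) f

  ∑λ-nonzero-scale : ∀ {a} → a ≢ 0F → ∑ nonzero (λ x → λ' (a ⊗ x)) ≡ ℤ.-1ℤ
  ∑λ-nonzero-scale n = trans (∑-scale n λ') ∑λ-nonzero

  orthogonality : ∀ s → ∑ elements (λ a → λ' (a ⊗ s)) ≡ 𝟙 (s == 0F) ℤ.* + q
  orthogonality s with s ≟F 0F
  ... | yes refl = trans (∑-cong elements (λ a → trans (cong λ' (F*-zeroʳ a)) λ-0F)) (trans (∑-1 elements) (trans (cong +_ card) (sym (ℤP.*-identityˡ (+ q)))))
  ... | no n     = trans (∑-split _) (cong₂ ℤ._+_ (trans (cong λ' (F*-zeroˡ s)) λ-0F)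
                     (trans (∑-cong nonzero (λ a → cong λ' (F*-comm a s))) (∑λ-nonzero-scale n)))

  -- Sums sorted by values, and the fibres of z + 1/z

  ∑-pushforward : {A : Set} (xs : List A) (φ : A → F) (G : F → ℤ) →
                  ∑ xs (λ x → G (φ x)) ≡ ∑ elements (λ s → ∑ xs (λ x → 𝟙 (φ x == s)) ℤ.* G s)
  ∑-pushforward xs φ G = trans (∑-cong xs (λ x → sym (∑-==ˡ (φ x) G)))
    (trans (∑-swap xs elements _) (∑-cong elements (λ s → ∑-*ʳ xs (G s) _)))

  -- Replacing z by s z turns z + 1/z = s into z² + z = 1/s², an Artin-Schreier equation whose fibre
  -- has size 1 + λ(1/s²) = 1 + λ(1/s). The value z = 0, present in the fibre of ℘ but not here, is
  -- no solution as 1/s² ≠ 0.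
  recip-fibre : ∀ {s} → s ≢ 0F → ∑ nonzero (λ z → 𝟙 ((z ⊕ invF z) == s)) ≡ 1ℤ ℤ.+ λ' (invF s)
  recip-fibre {s} n = begin
    ∑ nonzero (λ z → 𝟙 ((z ⊕ invF z) == s)) ≡⟨ ∑-scale n (λ z → 𝟙 ((z ⊕ invF z) == s)) ⟨
    ∑ nonzero (λ z → 𝟙 ((s ⊗ z ⊕ invF (s ⊗ z)) == s)) ≡⟨ ∑-cong-∈ nonzero (λ z i → cong 𝟙 (⌊⌋-⇔ (_ ≟F _) (_ ≟F _) (to z (∈nonzero⁻ i)) (from z (∈nonzero⁻ i)))) ⟩
    ∑ nonzero (λ z → 𝟙 ((z ⊗ z ⊕ z) == v)) ≡⟨ ℤP.+-identityˡ _ ⟨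
    0ℤ ℤ.+ ∑ nonzero (λ z → 𝟙 ((z ⊗ z ⊕ z) == v)) ≡⟨ cong (ℤ._+ ∑ nonzero (λ z → 𝟙 ((z ⊗ z ⊕ z) == v))) (cong 𝟙 (sym (⌊⌋-no (_ ≟F _) zero-no))) ⟩
    𝟙 ((0F ⊗ 0F ⊕ 0F) == v) ℤ.+ ∑ nonzero (λ z → 𝟙 ((z ⊗ z ⊕ z) == v)) ≡⟨ ∑-split (λ z → 𝟙 ((z ⊗ z ⊕ z) == v)) ⟨
    ℘-fibre v ≡⟨ ℘-fibre-λ v ⟩
    1ℤ ℤ.+ λ' v ≡⟨ cong (λ k → 1ℤ ℤ.+ k) (λ-sq (invF s)) ⟩
    1ℤ ℤ.+ λ' (invF s) ∎
    where
    open ≡-Reasoning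
    s′ = invF s
    v = s′ ⊗ s′
    zero-no : 0F ⊗ 0F ⊕ 0F ≢ v
    zero-no e = *≢0 (inv≢0 n) (inv≢0 n) (trans (sym e) (trans (F+-identityʳ _) (F*-zeroˡ _)))
    to : ∀ z → z ≢ 0F → s ⊗ z ⊕ invF (s ⊗ z) ≡ s → z ⊗ z ⊕ z ≡ v
    to z m e = by₂ (s′ ⊗ s′) (z ⊗ s ⊗ s′ ⊗ z ⊕ z ⊗ z ⊕ z ⊗ s ⊗ s′ ⊕ z) eq (invF-inv s n)
      (solve 3 (λ s z i → z :* z :+ z := (i :* i :+ (i :* i) :* ((s :* z) :* (s :* z) :+ :1 :+ s :* (s :* z))) :+ (z :* s :* i :* z :+ z :* z :+ z :* s :* i :+ z) :* (s :* i :+ :1)) refl s z s′)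
      where
      eq : s ⊗ z ⊗ (s ⊗ z) ⊕ 1F ≡ s ⊗ (s ⊗ z)
      eq = by₂ (s ⊗ z) 1F e (invF-inv (s ⊗ z) (*≢0 n m))
        (solve 3 (λ s z w → s :* z :* (s :* z) :+ :1 := (s :* (s :* z) :+ (s :* z) :* (s :* z :+ w :+ s)) :+ :1 :* (s :* z :* w :+ :1)) refl s z (invF (s ⊗ z)))
    from : ∀ z → z ≢ 0F → z ⊗ z ⊕ z ≡ v → s ⊗ z ⊕ invF (s ⊗ z) ≡ s
    from z m e = *-cancelˡ (*≢0 n m) (by₂ 1F (s ⊗ s) (invF-inv (s ⊗ z) (*≢0 n m)) e
      (by₁ (s ⊗ s′ ⊕ 1F) (invF-inv s n)
      (solve 4 (λ s z w i → s :* z :* (s :* z :+ w) := s :* z :* s :+ :1 :* (s :* z :* w :+ :1) :+ s :* s :* (z :* z :+ z :+ i :* i) :+ (s :* i :+ :1) :* (s :* i :+ :1)) refl s z (invF (s ⊗ z)) s′)))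

  recip-fibre-0 : ∑ nonzero (λ z → 𝟙 ((z ⊕ invF z) == 0F)) ≡ 1ℤ
  recip-fibre-0 = trans (∑-cong-∈ nonzero (λ z i → cong 𝟙 (⌊⌋-⇔ (_ ≟F _) (z ≟F 1F) (to z (∈nonzero⁻ i)) (from z))))
      (∑-δ-1 _≟F_ nonzero nonzero-unique (∈nonzero⁺ (0F≢1F ∘ sym)))
    where
    to : ∀ z → z ≢ 0F → z ⊕ invF z ≡ 0F → z ≡ 1F
    to z n e = sq-inj (trans (cong (z ⊗_) (+≡0⇒≡ e)) (trans (invF-inv z n) (sym (F*-identityˡ _))))
    from : ∀ z → z ≡ 1F → z ⊕ invF z ≡ 0F
    from z refl = ≡⇒+≡0 (sym (inv-unique (F*-identityˡ 1F)))

  recip-pushforward : ∀ (G : F → ℤ) →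
    ∑ nonzero (λ z → G (z ⊕ invF z)) ≡ G 0F ℤ.+ ∑ nonzero (λ s → (1ℤ ℤ.+ λ' (invF s)) ℤ.* G s)
  recip-pushforward G = trans (∑-pushforward nonzero (λ z → z ⊕ invF z) G) (trans (∑-split _)
    (cong₂ ℤ._+_ (trans (cong (ℤ._* G 0F) recip-fibre-0) (ℤP.*-identityˡ _))
      (∑-cong-∈ nonzero (λ s i → cong (ℤ._* G s) (recip-fibre (∈nonzero⁻ i))))))

  -- Kloosterman sums and Carlitz's identity K₂ = K² − q

  length-nonzero : + length nonzero ≡ + q ℤ.- 1ℤ
  length-nonzero = ℤ+-cancelˡ 1ℤ (trans (cong +_ suc-length-nonzero) (lem (+ q)))
    where
    lem : ∀ x → x ≡ 1ℤ ℤ.+ (x ℤ.- 1ℤ)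
    lem = solve-∀

  K-0 : K 0F ≡ ℤ.-1ℤ
  K-0 = trans (∑-cong nonzero (λ α → cong λ' (trans (cong (α ⊕_) (F*-zeroˡ _)) (F+-identityʳ α)))) ∑λ-nonzero

  -- Squaring permutes the nonzero elements and preserves the trace.
  K-sq : ∀ a → K (a ⊗ a) ≡ K a
  K-sq a = trans (sym (∑-sq (λ α → λ' (α ⊕ a ⊗ a ⊗ invF α)))) (∑-cong-∈ nonzero step)
    where
    step : ∀ α → α ∈ nonzero → λ' (α ⊗ α ⊕ a ⊗ a ⊗ invF (α ⊗ α)) ≡ λ' (α ⊕ a ⊗ invF α)
    step α i = trans (cong (λ z → λ' (α ⊗ α ⊕ a ⊗ a ⊗ z)) (inv-* (∈nonzero⁻ i) (∈nonzero⁻ i)))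
      (trans (cong λ' (solve 3 (λ x a y → x :* x :+ a :* a :* (y :* y) := (x :+ a :* y) :* (x :+ a :* y)) refl α a (invF α))) (λ-sq _))

  K₂-∑ : ∀ a → K2 a ≡ ∑ nonzero (λ s → λ' s ℤ.* K (a ⊗ invF s))
  K₂-∑ a = trans (go nonzero) (∑-cong nonzero (λ s → trans (∑-cong nonzero (λ α →
      trans (cong λ' (F+-assoc _ _ _)) (λ-+ _ _))) (∑-*ˡ nonzero (λ' s) _)))
    where
    g : F → List ℤ
    g = λ α₁ → map (λ α₂ → λ' (α₁ ⊕ α₂ ⊕ a ⊗ invF α₁ ⊗ invF α₂)) nonzero
    sumℤ-++ : ∀ us vs → sumℤ (us ++ vs) ≡ sumℤ us ℤ.+ sumℤ vs
    sumℤ-++ []       vs = sym (ℤP.+-identityˡ _)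
    sumℤ-++ (u ∷ us) vs = trans (cong (λ z → u ℤ.+ z) (sumℤ-++ us vs)) (sym (ℤP.+-assoc u _ _))
    go : ∀ xs → sumℤ (concatMap g xs) ≡ ∑ xs (λ x → sumℤ (g x))
    go []       = refl
    go (x ∷ xs) = trans (sumℤ-++ (g x) (concatMap g xs)) (cong (λ z → sumℤ (g x) ℤ.+ z) (go xs))

  ∑K : ∑ nonzero K ≡ 1ℤ
  ∑K = trans (∑-swap nonzero nonzero (λ a α → λ' (α ⊕ a ⊗ invF α))) (trans (∑-cong-∈ nonzero step)
      (trans (∑-*ʳ nonzero ℤ.-1ℤ λ') (cong (ℤ._* ℤ.-1ℤ) ∑λ-nonzero)))
    where
    step : ∀ α → α ∈ nonzero → ∑ nonzero (λ a → λ' (α ⊕ a ⊗ invF α)) ≡ λ' α ℤ.* ℤ.-1ℤ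
    step α i = trans (∑-cong nonzero (λ a → trans (λ-+ _ _) (cong (λ z → λ' α ℤ.* λ' z) (F*-comm _ _))))
      (trans (∑-*ˡ nonzero (λ' α) _) (cong (λ' α ℤ.*_) (∑λ-nonzero-scale (inv≢0 (∈nonzero⁻ i)))))

  -- The second variable of the product is written as x z. For z ≠ 1, scaling x by 1 + z turns the
  -- inner sum into K(a(z + 1/z)), because (1 + z)(1 + 1/z) = z + 1/z in characteristic two.
  -- Weighting s = z + 1/z by 1 + λ(1/s) then gives K(0) = -1, the sum of all K(a s), which is 1,
  -- and K₂(a).
  carlitz : ∀ {a} → a ≢ 0F → K a ℤ.* K a ≡ + q ℤ.+ K2 a
  carlitz {a} a≢0 = begin
    K a ℤ.* K a ≡⟨ ∑-*ʳ nonzero (K a) f ⟨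
    ∑ nonzero (λ x → f x ℤ.* K a) ≡⟨ ∑-cong-∈ nonzero (λ x i → trans (cong (f x ℤ.*_) (sym (∑-scale (∈nonzero⁻ i) f))) (sym (∑-*ˡ nonzero (f x) _))) ⟩
    ∑ nonzero (λ x → ∑ nonzero (λ z → f x ℤ.* f (x ⊗ z))) ≡⟨ ∑-swap nonzero nonzero _ ⟩
    ∑ nonzero (λ z → ∑ nonzero (λ x → f x ℤ.* f (x ⊗ z))) ≡⟨ ∑-cong-∈ nonzero (λ z i → inner z (∈nonzero⁻ i)) ⟩
    ∑ nonzero (λ z → 𝟙 (z == 1F) ℤ.* + q ℤ.+ K (a ⊗ (z ⊕ invF z))) ≡⟨ ∑-+ nonzero _ _ ⟩
    ∑ nonzero (λ z → 𝟙 (z == 1F) ℤ.* + q) ℤ.+ ∑ nonzero (λ z → K (a ⊗ (z ⊕ invF z)))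
      ≡⟨ cong₂ ℤ._+_ (∑-δ _≟F_ nonzero nonzero-unique (∈nonzero⁺ (0F≢1F ∘ sym)) (λ _ → + q)) (recip-pushforward (λ s → K (a ⊗ s))) ⟩
    + q ℤ.+ (K (a ⊗ 0F) ℤ.+ ∑ nonzero (λ s → (1ℤ ℤ.+ λ' (invF s)) ℤ.* K (a ⊗ s)))
      ≡⟨ cong (λ k → + q ℤ.+ k) (cong₂ ℤ._+_ (trans (cong K (F*-zeroʳ a)) K-0) tail) ⟩
    + q ℤ.+ (ℤ.-1ℤ ℤ.+ (1ℤ ℤ.+ K2 a)) ≡⟨ lem (+ q) (K2 a) ⟩
    + q ℤ.+ K2 a ∎
    where
    open ≡-Reasoning
    f : F → ℤ
    f α = λ' (α ⊕ a ⊗ invF α)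
    lem : ∀ x y → x ℤ.+ (ℤ.-1ℤ ℤ.+ (1ℤ ℤ.+ y)) ≡ x ℤ.+ y
    lem = solve-∀
    tail : ∑ nonzero (λ s → (1ℤ ℤ.+ λ' (invF s)) ℤ.* K (a ⊗ s)) ≡ 1ℤ ℤ.+ K2 a
    tail = trans (∑-cong nonzero (λ s → dist (λ' (invF s)) (K (a ⊗ s)))) (trans (∑-+ nonzero _ _)
      (cong₂ ℤ._+_ (trans (∑-scale a≢0 K) ∑K)
        (trans (sym (∑-inv (λ s → λ' (invF s) ℤ.* K (a ⊗ s)))) (trans (∑-cong-∈ nonzero (λ s i → cong (λ z → λ' z ℤ.* K (a ⊗ invF s)) (inv-inv (∈nonzero⁻ i)))) (sym (K₂-∑ a))))))
      where
      dist : ∀ x y → (1ℤ ℤ.+ x) ℤ.* y ≡ y ℤ.+ x ℤ.* y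
      dist = solve-∀
    inner : ∀ z → z ≢ 0F → ∑ nonzero (λ x → f x ℤ.* f (x ⊗ z)) ≡ 𝟙 (z == 1F) ℤ.* + q ℤ.+ K (a ⊗ (z ⊕ invF z))
    inner z n with z ≟F 1F
    -- For z = 1 all q - 1 terms are 1; since K(0) = -1, this too has the form q + K(a(z + 1/z)).
    ... | yes refl = trans (∑-cong nonzero (λ x → trans (cong (λ y → f x ℤ.* f y) (F*-identityʳ x))
                       (trans (sym (λ-+ _ _)) (trans (cong λ' (x+x _)) λ-0F))))
                     (trans (∑-1 nonzero) (trans length-nonzero (cong₂ ℤ._+_ (sym (ℤP.*-identityˡ (+ q)))
                       (sym (trans (cong K (trans (cong (a ⊗_) (≡⇒+≡0 (sym (inv-unique (F*-identityˡ 1F))))) (F*-zeroʳ a))) K-0)))))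
    ... | no z≢1 = trans (trans (∑-cong-∈ nonzero step) (∑-scale w≢0 (λ t → λ' (t ⊕ a ⊗ (z ⊕ invF z) ⊗ invF t)))) (sym (ℤP.+-identityˡ _))
      where
      w = 1F ⊕ z
      w≢0 : w ≢ 0F
      w≢0 e = z≢1 (sym (+≡0⇒≡ e))
      step : ∀ x → x ∈ nonzero → f x ℤ.* f (x ⊗ z) ≡ λ' (w ⊗ x ⊕ a ⊗ (z ⊕ invF z) ⊗ invF (w ⊗ x))
      step x i = trans (sym (λ-+ _ _)) (cong λ' (trans (cong (λ y → x ⊕ a ⊗ invF x ⊕ (x ⊗ z ⊕ a ⊗ y)) (inv-* x≢0 n))
          (trans (by₂ (a ⊗ invF x ⊗ invF w) (a ⊗ invF x ⊗ (1F ⊕ invF z)) (invF-inv z n) (invF-inv w w≢0)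
            (solve 6 (λ x z a x′ z′ w′ → x :+ a :* x′ :+ (x :* z :+ a :* (x′ :* z′)) :=
               ((:1 :+ z) :* x :+ a :* (z :+ z′) :* (w′ :* x′)) :+ a :* x′ :* w′ :* (z :* z′ :+ :1) :+ a :* x′ :* (:1 :+ z′) :* ((:1 :+ z) :* w′ :+ :1)) refl x z a (invF x) (invF z) (invF w)))
           (cong (λ y → w ⊗ x ⊕ a ⊗ (z ⊕ invF z) ⊗ y) (sym (inv-* w≢0 x≢0))))))
        where
        x≢0 = ∈nonzero⁻ i

  -- If the trace were 0 everywhere, the vanishing character sum would be q. Such a c makes w² + w +
  -- c irreducible and so defines the quadratic extension.
  exists-tr1 : ∃ λ c → tr c ≡ 1F
  exists-tr1 with any? (λ c → tr c ≟F 1F) elements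
  ... | yes p = proj₁ (find p) , proj₂ (proj₂ (find p))
  ... | no n  = ⊥-elim (absurd (trans (sym ∑λ) (trans (∑-cong elements all0) (trans (∑-1 elements) (cong +_ (trans card (sym suc-length-nonzero)))))))
    where
    absurd : ∀ {n} → 0ℤ ≢ + suc n
    absurd ()
    all0 : ∀ c → λ' c ≡ 1ℤ
    all0 c with tr-01 c
    ... | inj₁ e = λ-0 e
    ... | inj₂ e = ⊥-elim (n (lose (complete c) e))

  -- Stepanov's method. With q = Q² and u = Σ_{i<m} (x + a/x)^(2^i), every x with tr (x + a/x) = ε satisfies u^Q = u + ε
  -- and x^(Q²) = x.  The functions x^(i + jQ) and u x^(i + jQ), multiplied by x^H (H = Q/2), are monic of pairwise
  -- distinct degrees H + d, while their Q-th powers have low degree on such x.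

  -- For n = k = r/2 this reads tr = u + u^Q, whence u^Q = u + ε where the trace is ε.
  partialTr-+ᵏ : ∀ n k x → partialTr (n ℕ.+ k) x ≡ partialTr k x ⊕ powF (partialTr n x) (2 ℕ.^ k)
  partialTr-+ᵏ zero    k x = sym (trans (cong (partialTr k x ⊕_) (powF-0 (2 ℕ.^ k) (ℕP.m^n>0 2 k))) (F+-identityʳ _))
    where
    powF-0 : ∀ n → 0 ℕ.< n → powF 0F n ≡ 0F
    powF-0 (suc n) _ = F*-zeroˡ _
  partialTr-+ᵏ (suc n) k x = trans (cong₂ _⊕_ (partialTr-+ᵏ n k x)
      (trans (cong (powF x) (trans (ℕP.^-distribˡ-+-* 2 n k) (ℕP.*-comm (2 ℕ.^ n) (2 ℕ.^ k)))) (powF-* x (2 ℕ.^ k) (2 ℕ.^ n))))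
    (trans (F+-assoc _ _ _) (cong (partialTr k x ⊕_) (sym (frob-+ k _ _))))

  -- The head of the vector is the coefficient of the highest index, so that an induction on the
  -- vector meets the leading term first.
  comb : ∀ {n} → Vec F n → (ℕ → F) → F
  comb []               g = 0F
  comb {suc n} (c ∷ cs) g = c ⊗ g n ⊕ comb cs g

  comb-scale : ∀ {n} a (cs : Vec F n) {g h : ℕ → F} → (∀ d → a ⊗ g d ≡ h d) → a ⊗ comb cs g ≡ comb cs h
  comb-scale a []               e = F*-zeroʳ a
  comb-scale {suc n} a (c ∷ cs) {g} e = trans (solve 4 (λ a c g b → a :* (c :* g :+ b) := c :* (a :* g) :+ a :* b) refl a c (g n) (comb cs g))
    (cong₂ _⊕_ (cong (c ⊗_) (e n)) (comb-scale a cs e))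

  comb-frob : ∀ {n} k (cs : Vec F n) (g : ℕ → F) →
              powF (comb cs g) (2 ℕ.^ k) ≡ comb (Vec.map (λ c → powF c (2 ℕ.^ k)) cs) (λ d → powF (g d) (2 ℕ.^ k))
  comb-frob k []       g = frob-inj-0
    where
    frob-inj-0 : powF 0F (2 ℕ.^ k) ≡ 0F
    frob-inj-0 = cancel-+ˡ _ _ (trans (sym (cong (λ z → powF z (2 ℕ.^ k)) (x+x 0F))) (frob-+ k 0F 0F))
  comb-frob k (c ∷ cs) g = trans (frob-+ k _ _) (cong₂ _⊕_ (powF-distrib-* c _ (2 ℕ.^ k)) (comb-frob k cs g))

  comb-poly : ∀ {n} M (cs : Vec F n) (g : ℕ → F → F) → (∀ d → d ℕ.< n → IsPoly M (g d)) → IsPoly M (λ x → comb cs (λ d → g d x))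
  comb-poly M []       g p = poly-0 M
  comb-poly M (c ∷ cs) g p = poly-+ (poly-scale c (p _ ℕP.≤-refl)) (comb-poly M cs g (λ d lt → p d (ℕP.m<n⇒m<1+n lt)))

  -- Distinct degrees make the functions independent: at the first place where the vectors differ,
  -- with entries c and d, the difference of the combinations divided by c + d is monic, and it
  -- vanishes on `xs`.
  comb-roots : ∀ {n} H (g : ℕ → F → F) → (∀ d → IsMonic (H ℕ.+ d) (g d)) → (cs ds : Vec F n) → cs ≢ ds →
               ∀ xs → Unique xs → (∀ x → x ∈ xs → comb cs (λ d → g d x) ≡ comb ds (λ d → g d x)) → length xs ℕ.≤ H ℕ.+ n
  comb-roots H g mon [] [] ne xs u e = ⊥-elim (ne refl)
  comb-roots {suc n} H g mon (c ∷ cs) (d ∷ ds) ne xs u e with c ≟F d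
  ... | yes refl = ℕP.≤-trans (comb-roots H g mon cs ds (ne ∘ cong (c ∷_)) xs u
            (λ x i → trans (cancel _ _) (trans (cong (c ⊗ g n x ⊕_) (e x i)) (sym (cancel _ _)))))
          (ℕP.+-monoʳ-≤ H (ℕP.n≤1+n n))
    where
    cancel : ∀ a b → b ≡ a ⊕ (a ⊕ b)
    cancel = solve 2 (λ a b → b := a :+ (a :+ b)) refl
  ... | no c≢d = ℕP.≤-trans (roots-bound (H ℕ.+ n) {f} monic-f xs u vanish) (ℕP.+-monoʳ-≤ H (ℕP.n≤1+n n))
    where
    b = invF (c ⊕ d)
    lower : F → F
    lower x = b ⊗ (comb cs (λ d → g d x) ⊕ comb ds (λ d → g d x))
    f : F → F
    f x = g n x ⊕ lower x
    polys : ∀ d → d ℕ.< n → IsPoly (H ℕ.+ n) (g d)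
    polys d lt = poly-weaken (ℕP.≤-trans (ℕP.≤-reflexive (sym (ℕP.+-suc H d))) (ℕP.+-monoʳ-≤ H lt)) (monic⇒poly (mon d))
    monic-f : IsMonic (H ℕ.+ n) f
    monic-f = monic-+ (mon n) (poly-scale b (poly-+ (comb-poly _ cs g polys) (comb-poly _ ds g polys)))
    vanish : ∀ x → x ∈ xs → f x ≡ 0F
    vanish x i = by₂ b (g n x) (e x i) (invF-inv (c ⊕ d) (c≢d ∘ +≡0⇒≡))
      (solve 6 (λ c d b G C D → G :+ b :* (C :+ D) := :0 :+ b :* ((c :* G :+ C) :+ (d :* G :+ D)) :+ G :* ((c :+ d) :* b :+ :1)) refl c d b (g n x) _ _)

  module Stepanov (k : ℕ) (r≡ : r ≡ suc k ℕ.+ suc k) (a : F) (ε : F) where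

    -- H = Q/2. D counts the triples of digits ι < H, ρ < 2, κ < H + 2 that index the functions `p`,
    -- and M bounds the number of coefficients of each `E d`. The range H + 2 of κ makes D = 2H² +
    -- 4H exceed M = 2H² + H + 2 even for H = 1.
    H Q D M : ℕ
    H = 2 ℕ.^ k
    Q = 2 ℕ.^ suc k
    D = (H ℕ.+ 2) ℕ.* 2 ℕ.* H
    M = H ℕ.* Q ℕ.+ (H ℕ.+ 2)

    instance
      H≢0 : ℕ.NonZero H
      H≢0 = ℕP.m^n≢0 2 k

    u : F → F
    u x = partialTr (suc k) (x ⊕ a ⊗ invF x)

    -- x^H · partialTr n (x + a/x), as a polynomial
    V : ℕ → F → F
    V zero    x = 0F
    V (suc n) x = powF x (H ℕ.+ 2 ℕ.^ n) ⊕ (powF a (2 ℕ.^ n) ⊗ powF x (H ℕ.∸ 2 ℕ.^ n) ⊕ V n x)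

    2^-< : ∀ n → suc (2 ℕ.^ n) ℕ.≤ 2 ℕ.^ suc n
    2^-< n = ℕP.≤-trans (ℕP.+-monoˡ-≤ (2 ℕ.^ n) (ℕP.m^n>0 2 n)) (ℕP.≤-reflexive (cong (2 ℕ.^ n ℕ.+_) (sym (ℕP.+-identityʳ _))))

    V-lower : ∀ n → IsPoly (H ℕ.+ 2 ℕ.^ n) (λ x → powF a (2 ℕ.^ n) ⊗ powF x (H ℕ.∸ 2 ℕ.^ n) ⊕ V n x)
    V-monic : ∀ n → IsMonic (H ℕ.+ 2 ℕ.^ n) (V (suc n))
    V-poly : ∀ n → IsPoly (H ℕ.+ 2 ℕ.^ n) (V n)
    V-lower n = poly-+ (poly-scale _ (poly-weaken (ℕP.≤-trans (ℕ.s≤s (ℕP.m∸n≤m H (2 ℕ.^ n)))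
      (ℕP.≤-trans (ℕP.≤-reflexive (ℕP.+-comm 1 H)) (ℕP.+-monoʳ-≤ H (ℕP.m^n>0 2 n)))) (monic⇒poly (monic-X^ (H ℕ.∸ 2 ℕ.^ n))))) (V-poly n)
    V-monic n = monic-+ (monic-X^ (H ℕ.+ 2 ℕ.^ n)) (V-lower n)
    V-poly zero    = poly-0 (H ℕ.+ 1)
    V-poly (suc n) = poly-weaken (ℕP.≤-trans (ℕP.≤-reflexive (sym (ℕP.+-suc H _))) (ℕP.+-monoʳ-≤ H (2^-< n))) (monic⇒poly (V-monic n))

    -- The terms of the partial trace up to 2^k have poles of order at most H = 2^k at 0, so x^H
    -- clears them. `V (suc n)` subtracts 2^n from H, which is exact for n ≤ k: hence the bound on
    -- n.
    V-value : ∀ {x} → x ≢ 0F → ∀ n → n ℕ.≤ suc k → V n x ≡ powF x H ⊗ partialTr n (x ⊕ a ⊗ invF x)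
    V-value {x} x≢0 zero    le = sym (F*-zeroʳ _)
    V-value {x} x≢0 (suc n) (ℕ.s≤s le) = begin
      powF x (H ℕ.+ N) ⊕ (powF a N ⊗ Y ⊕ V n x) ≡⟨ cong₂ (λ s t → s ⊕ (powF a N ⊗ Y ⊕ t)) (powF-+ x H N) (V-value x≢0 n (ℕP.m≤n⇒m≤1+n le)) ⟩
      powF x H ⊗ X ⊕ (powF a N ⊗ Y ⊕ powF x H ⊗ P) ≡⟨ cong (λ s → s ⊗ X ⊕ (powF a N ⊗ Y ⊕ s ⊗ P)) xH ⟩
      Y ⊗ X ⊗ X ⊕ (powF a N ⊗ Y ⊕ Y ⊗ X ⊗ P) ≡⟨ by₁ (Y ⊗ powF a N) xx′ (solve 5 (λ Y X A P X′ → Y :* X :* X :+ (A :* Y :+ Y :* X :* P) := Y :* X :* (P :+ (X :+ A :* X′)) :+ Y :* A :* (X :* X′ :+ :1)) refl Y X (powF a N) P X′) ⟩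
      Y ⊗ X ⊗ (P ⊕ (X ⊕ powF a N ⊗ X′)) ≡⟨ cong₂ (λ s t → s ⊗ (P ⊕ (X ⊕ t))) xH (powF-distrib-* a (invF x) N) ⟨
      powF x H ⊗ (P ⊕ (X ⊕ powF (a ⊗ invF x) N)) ≡⟨ cong (λ s → powF x H ⊗ (P ⊕ s)) (frob-+ n x (a ⊗ invF x)) ⟨
      powF x H ⊗ (P ⊕ powF (x ⊕ a ⊗ invF x) N) ∎
      where
      open ≡-Reasoning
      N = 2 ℕ.^ n
      X = powF x N
      X′ = powF (invF x) N
      Y = powF x (H ℕ.∸ N)
      P = partialTr n (x ⊕ a ⊗ invF x)
      xx′ : X ⊗ X′ ≡ 1F
      xx′ = trans (sym (powF-distrib-* x (invF x) N)) (trans (cong (λ z → powF z N) (invF-inv x x≢0)) (powF-1 N))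
      xH : powF x H ≡ Y ⊗ X
      xH = trans (cong (powF x) (sym (ℕP.m∸n+n≡m (ℕP.^-monoʳ-≤ 2 le)))) (powF-+ x (H ℕ.∸ N) N)

    -- The digit ρ chooses between the functions 1 and u. `W` is x^H times `w`, and `W′` is x^H
    -- times the Q-th power of `w`, rewritten by u^Q = u + ε.
    w W W′ : ℕ → F → F
    w zero    x = 1F
    w (suc _) x = u x
    W zero    x = powF x H
    W (suc _) x = V (suc k) x
    W′ zero    x = powF x H
    W′ (suc _) x = V (suc k) x ⊕ ε ⊗ powF x H

    -- The digits of d = ι + H(ρ + 2κ). The factor u adds H to the degree and x^Q adds 2H, so the
    -- d-th function times x^H has degree exactly H + d.
    ι κ ρ : ℕ → ℕ
    ι d = d % H
    ρ d = d / H % 2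
    κ d = d / H / 2

    -- `P d` represents x^H times `p d`, and `E d` represents x^H times the Q-th power of `p d` on
    -- `Sε`. Raising to the power Q turns x^(κQ) into x^κ and x^ι into x^(ιQ): the large exponent
    -- becomes small, and the growth of the other is limited by ι < H.
    p P E : ℕ → F → F
    p d x = powF x (ι d) ⊗ (powF x (κ d ℕ.* Q) ⊗ w (ρ d) x)
    P d x = powF x (ι d) ⊗ (powF x (κ d ℕ.* Q) ⊗ W (ρ d) x)
    E d x = powF x (ι d ℕ.* Q) ⊗ (powF x (κ d) ⊗ W′ (ρ d) x)

    W-monic : ∀ n → n ℕ.< 2 → IsMonic (H ℕ.+ n ℕ.* H) (W n)
    W-monic zero          _ = subst (λ n → IsMonic n (λ x → powF x H)) (sym (ℕP.+-identityʳ H)) (monic-X^ H)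
    W-monic (suc zero)    _ = subst (λ n → IsMonic (H ℕ.+ n) (V (suc k))) (sym (ℕP.+-identityʳ H)) (V-monic k)
    W-monic (suc (suc n)) (ℕ.s≤s (ℕ.s≤s ()))

    W′-poly : ∀ n → IsPoly (suc (H ℕ.+ H)) (W′ n)
    W′-poly zero    = poly-weaken (ℕ.s≤s (ℕP.m≤m+n H H)) (monic⇒poly (monic-X^ H))
    W′-poly (suc n) = poly-+ (monic⇒poly (V-monic k)) (poly-scale ε (poly-weaken (ℕ.s≤s (ℕP.m≤m+n H H)) (monic⇒poly (monic-X^ H))))

    P-monic : ∀ d → IsMonic (H ℕ.+ d) (P d)
    P-monic d = subst (λ n → IsMonic n (P d)) deg (monic-X^* (ι d) (monic-X^* (κ d ℕ.* Q) (W-monic (ρ d) (m%n<n (d / H) 2))))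
      where
      open ≡-Reasoning
      deg : ι d ℕ.+ (κ d ℕ.* Q ℕ.+ (H ℕ.+ ρ d ℕ.* H)) ≡ H ℕ.+ d
      deg = begin
        ι d ℕ.+ (κ d ℕ.* (2 ℕ.* H) ℕ.+ (H ℕ.+ ρ d ℕ.* H)) ≡⟨ lem (ι d) (κ d) (ρ d) H ⟩
        H ℕ.+ (ι d ℕ.+ (ρ d ℕ.+ κ d ℕ.* 2) ℕ.* H) ≡⟨ cong (λ n → H ℕ.+ (ι d ℕ.+ n ℕ.* H)) (m≡m%n+[m/n]*n (d / H) 2) ⟨
        H ℕ.+ (ι d ℕ.+ d / H ℕ.* H) ≡⟨ cong (H ℕ.+_) (m≡m%n+[m/n]*n d H) ⟨
        H ℕ.+ d ∎
        where
        lem : ∀ i j s h → i ℕ.+ (j ℕ.* (2 ℕ.* h) ℕ.+ (h ℕ.+ s ℕ.* h)) ≡ h ℕ.+ (i ℕ.+ (s ℕ.+ j ℕ.* 2) ℕ.* h)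
        lem = solve-∀ᴺ

    E-poly : ∀ d → d ℕ.< D → IsPoly M (E d)
    E-poly d lt = poly-weaken deg (poly-X^* (ι d ℕ.* Q) (poly-X^* (κ d) (W′-poly (ρ d))))
      where
      κ< : κ d ℕ.< H ℕ.+ 2
      κ< = m<n*o⇒m/o<n (m<n*o⇒m/o<n lt)
      open ℕP.≤-Reasoning
      deg : ι d ℕ.* Q ℕ.+ (κ d ℕ.+ suc (H ℕ.+ H)) ℕ.≤ M
      deg = begin
        ι d ℕ.* Q ℕ.+ (κ d ℕ.+ suc (H ℕ.+ H)) ≡⟨ lem (ι d) H (κ d) ⟩
        suc (ι d) ℕ.* Q ℕ.+ suc (κ d) ≤⟨ ℕP.+-mono-≤ (ℕP.*-monoˡ-≤ Q (m%n<n d H)) κ< ⟩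
        M ∎
        where
        lem : ∀ i h j → i ℕ.* (2 ℕ.* h) ℕ.+ (j ℕ.+ suc (h ℕ.+ h)) ≡ suc i ℕ.* (2 ℕ.* h) ℕ.+ suc j
        lem = solve-∀ᴺ

    M<D : M ℕ.< D
    M<D = begin-strict
      H ℕ.* (2 ℕ.* H) ℕ.+ (H ℕ.+ 2) ≤⟨ ℕP.+-monoʳ-≤ (H ℕ.* (2 ℕ.* H)) (ℕP.+-monoʳ-≤ H (ℕP.*-monoʳ-≤ 2 (ℕP.m^n>0 2 k))) ⟩
      H ℕ.* (2 ℕ.* H) ℕ.+ (H ℕ.+ 2 ℕ.* H) <⟨ ℕP.m<m+n _ (ℕP.m^n>0 2 k) ⟩
      H ℕ.* (2 ℕ.* H) ℕ.+ (H ℕ.+ 2 ℕ.* H) ℕ.+ H ≡⟨ lem H ⟩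
      (H ℕ.+ 2) ℕ.* 2 ℕ.* H ∎
      where
      open ℕP.≤-Reasoning
      lem : ∀ h → h ℕ.* (2 ℕ.* h) ℕ.+ (h ℕ.+ 2 ℕ.* h) ℕ.+ h ≡ (h ℕ.+ 2) ℕ.* 2 ℕ.* h
      lem = solve-∀ᴺ

    QQ : 2 ℕ.^ r ≡ Q ℕ.* Q
    QQ = trans (cong (2 ℕ.^_) r≡) (ℕP.^-distribˡ-+-* 2 (suc k) (suc k))

    frob-frob : ∀ x → powF (powF x Q) Q ≡ x
    frob-frob x = trans (sym (powF-* x Q Q)) (trans (cong (powF x) (sym QQ)) (fermat x))

    P-p : ∀ {x} → x ≢ 0F → ∀ d → powF x H ⊗ p d x ≡ P d x
    P-p {x} x≢0 d = trans (solve 4 (λ h s t w → h :* (s :* (t :* w)) := s :* (t :* (h :* w))) refl (powF x H) (powF x (ι d)) (powF x (κ d ℕ.* Q)) (w (ρ d) x))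
      (cong (λ z → powF x (ι d) ⊗ (powF x (κ d ℕ.* Q) ⊗ z)) (eq (ρ d)))
      where
      eq : ∀ n → powF x H ⊗ w n x ≡ W n x
      eq zero    = F*-identityʳ _
      eq (suc n) = sym (V-value x≢0 (suc k) ℕP.≤-refl)

    E-p : ∀ {x} → x ≢ 0F → powF (u x) Q ≡ u x ⊕ ε → ∀ d → powF x H ⊗ powF (p d x) Q ≡ E d x
    E-p {x} x≢0 h d = begin
      powF x H ⊗ powF (p d x) Q
        ≡⟨ cong (powF x H ⊗_) (trans (powF-distrib-* _ _ Q) (cong₂ _⊗_ (trans (sym (powF-* x Q (ι d))) (cong (powF x) (ℕP.*-comm Q (ι d))))
             (trans (powF-distrib-* _ _ Q) (cong (_⊗ powF (w (ρ d) x) Q) κ-eq)))) ⟩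
      powF x H ⊗ (powF x (ι d ℕ.* Q) ⊗ (powF x (κ d) ⊗ powF (w (ρ d) x) Q))
        ≡⟨ solve 4 (λ h s t w → h :* (s :* (t :* w)) := s :* (t :* (h :* w))) refl (powF x H) (powF x (ι d ℕ.* Q)) (powF x (κ d)) (powF (w (ρ d) x) Q) ⟩
      powF x (ι d ℕ.* Q) ⊗ (powF x (κ d) ⊗ (powF x H ⊗ powF (w (ρ d) x) Q))
        ≡⟨ cong (λ z → powF x (ι d ℕ.* Q) ⊗ (powF x (κ d) ⊗ z)) (eq (ρ d)) ⟩
      E d x ∎
      where
      open ≡-Reasoning
      κ-eq : powF (powF x (κ d ℕ.* Q)) Q ≡ powF x (κ d)
      κ-eq = begin
        powF (powF x (κ d ℕ.* Q)) Q ≡⟨ powF-* x Q (κ d ℕ.* Q) ⟨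
        powF x (Q ℕ.* (κ d ℕ.* Q)) ≡⟨ cong (powF x) (lem Q (κ d)) ⟩
        powF x (κ d ℕ.* (Q ℕ.* Q)) ≡⟨ powF-* x (κ d) (Q ℕ.* Q) ⟩
        powF (powF x (Q ℕ.* Q)) (κ d) ≡⟨ cong (λ z → powF z (κ d)) (trans (powF-* x Q Q) (frob-frob x)) ⟩
        powF x (κ d) ∎
        where
        lem : ∀ s t → s ℕ.* (t ℕ.* s) ≡ t ℕ.* (s ℕ.* s)
        lem = solve-∀ᴺ
      eq : ∀ n → powF x H ⊗ powF (w n x) Q ≡ W′ n x
      eq zero    = trans (cong (powF x H ⊗_) (powF-1 Q)) (F*-identityʳ _)
      eq (suc n) = trans (cong (powF x H ⊗_) h) (trans (solve 3 (λ h u e → h :* (u :+ e) := h :* u :+ e :* h) refl (powF x H) (u x) ε)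
        (cong (_⊕ ε ⊗ powF x H) (sym (V-value x≢0 (suc k) ℕP.≤-refl))))

    -- The coefficients of a polynomial that agrees on `Sε` with x^H times the Q-th power of the
    -- combination of the `p d`.
    Φ : Vec F D → Vec F M
    Φ cs = proj₁ (comb-poly M (Vec.map (λ c → powF c Q) cs) E E-poly)

    Φ-eval : ∀ cs x → comb (Vec.map (λ c → powF c Q) cs) (λ d → E d x) ≡ eval (Φ cs) x
    Φ-eval cs = proj₂ (comb-poly M (Vec.map (λ c → powF c Q) cs) E E-poly)

    Sε : List F
    Sε = filterᵇ (λ x → tr (x ⊕ a ⊗ invF x) == ε) nonzero

    u^Q : ∀ x → x ∈ Sε → powF (u x) Q ≡ u x ⊕ ε
    u^Q x i = begin
      powF (u x) Q ≡⟨ solve 2 (λ u v → v := u :+ (u :+ v)) refl (u x) (powF (u x) Q) ⟩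
      u x ⊕ (u x ⊕ powF (u x) Q) ≡⟨ cong (u x ⊕_) (partialTr-+ᵏ (suc k) (suc k) fx) ⟨
      u x ⊕ partialTr (suc k ℕ.+ suc k) fx ≡⟨ cong (λ n → u x ⊕ partialTr n fx) (sym r≡) ⟩
      u x ⊕ partialTr r fx ≡⟨ cong (u x ⊕_) (trans (sym (tr≡partialTr fx)) tr≡ε) ⟩
      u x ⊕ ε ∎
      where
      open ≡-Reasoning
      fx = x ⊕ a ⊗ invF x
      tr≡ε : tr fx ≡ ε
      tr≡ε = toWitness (proj₂ (∈-filter⁻ (λ x → T? (tr (x ⊕ a ⊗ invF x) == ε)) {xs = nonzero} i))

    Sε-≢0 : ∀ {x} → x ∈ Sε → x ≢ 0F
    Sε-≢0 i = ∈nonzero⁻ (proj₁ (∈-filter⁻ (λ x → T? (tr (x ⊕ a ⊗ invF x) == ε)) {xs = nonzero} i))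

    Φ-value : ∀ cs x → x ∈ Sε → powF x H ⊗ powF (comb cs (λ d → p d x)) Q ≡ eval (Φ cs) x
    Φ-value cs x i = trans (cong (powF x H ⊗_) (comb-frob (suc k) cs (λ d → p d x)))
      (trans (comb-scale (powF x H) (Vec.map (λ c → powF c Q) cs) (E-p (Sε-≢0 i) (u^Q x i))) (Φ-eval cs x))

    -- Equal images under `Φ` mean equal Q-th powers of the two combinations at each point of `Sε`,
    -- and the Frobenius map is injective.
    comb-agree : ∀ cs ds → Φ cs ≡ Φ ds → ∀ x → x ∈ Sε → comb cs (λ d → P d x) ≡ comb ds (λ d → P d x)
    comb-agree cs ds e x i = trans (sym (comb-scale (powF x H) cs (P-p (Sε-≢0 i))))
        (trans (cong (powF x H ⊗_) p-agree) (comb-scale (powF x H) ds (P-p (Sε-≢0 i))))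
      where
      p-agree : comb cs (λ d → p d x) ≡ comb ds (λ d → p d x)
      p-agree = frob-inj (suc k) (*-cancelˡ (powF-≢0 H (Sε-≢0 i))
        (trans (Φ-value cs x i) (trans (cong (λ v → eval v x) e) (sym (Φ-value ds x i)))))

    sizes : length (allVecs elements M) ℕ.< length (allVecs elements D)
    sizes = subst₂ ℕ._<_ (sym (size M)) (sym (size D)) (ℕP.^-monoʳ-< (2 ℕ.^ r) (ℕP.^-monoʳ-< 2 ℕP.≤-refl r≥1) M<D)
      where
      size : ∀ n → length (allVecs elements n) ≡ (2 ℕ.^ r) ℕ.^ n
      size n = trans (length-allVecs elements n) (cong (ℕ._^ n) card)

    Sε-bound : length Sε ℕ.≤ H ℕ.+ D
    Sε-bound = finish (collision (allVecs-unique elements unique D) Φ (λ cs → allVecs-complete elements complete M (Φ cs)) sizes)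
      where
      finish : (∃ λ cs → ∃ λ ds → cs ≢ ds × Φ cs ≡ Φ ds) → length Sε ℕ.≤ H ℕ.+ D
      finish (cs , ds , ne , e) = comb-roots H P P-monic cs ds ne Sε (UniqueP.filter⁺ _ nonzero-unique) (comb-agree cs ds e)

  -- From counts of trace values to the weak bound

  ∑λ-count : {A : Set} (xs : List A) (f : A → F) →
             + length xs ℤ.+ ∑ xs (λ x → λ' (f x)) ≡ + 2 ℤ.* + length (filterᵇ (λ x → tr (f x) == 0F) xs) ×
             + length xs ℤ.- ∑ xs (λ x → λ' (f x)) ≡ + 2 ℤ.* + length (filterᵇ (λ x → tr (f x) == 1F) xs)
  ∑λ-count xs f =
    trans (trans (cong (ℤ._+ ∑ xs (λ x → λ' (f x))) (sym (∑-1 xs))) (sym (∑-+ xs _ _)))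
      (trans (∑-cong xs plus) (trans (∑-*ˡ xs (+ 2) _) (cong (+ 2 ℤ.*_) (sym (length-filter _ xs))))) ,
    trans (trans (cong₂ ℤ._+_ (sym (∑-1 xs)) (trans (sym (ℤP.-1*i≡-i _)) (sym (∑-*ˡ xs ℤ.-1ℤ _)))) (sym (∑-+ xs _ _)))
      (trans (∑-cong xs minus) (trans (∑-*ˡ xs (+ 2) _) (cong (+ 2 ℤ.*_) (sym (length-filter _ xs)))))
    where
    plus : ∀ x → 1ℤ ℤ.+ λ' (f x) ≡ + 2 ℤ.* 𝟙 (tr (f x) == 0F)
    plus x with tr-01 (f x)
    ... | inj₁ e rewrite λ-0 e | ⌊⌋-yes (tr (f x) ≟F 0F) e = refl
    ... | inj₂ e rewrite λ-1 e | ⌊⌋-no (tr (f x) ≟F 0F) (λ z → 0F≢1F (trans (sym z) e)) = refl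
    minus : ∀ x → 1ℤ ℤ.+ ℤ.-1ℤ ℤ.* λ' (f x) ≡ + 2 ℤ.* 𝟙 (tr (f x) == 1F)
    minus x with tr-01 (f x)
    ... | inj₁ e rewrite λ-0 e | ⌊⌋-no (tr (f x) ≟F 1F) (λ z → 0F≢1F (trans (sym e) z)) = refl
    ... | inj₂ e rewrite λ-1 e | ⌊⌋-yes (tr (f x) ≟F 1F) e = refl

  -- Twice the size of `Sε` is q - 1 + K for ε = 0 and q - 1 - K for ε = 1. With q = 4H² and at most
  -- H + D = 2H² + 5H points this gives |K| ≤ 10H + 1 ≤ 11H, and 121 is rounded up to 124 = 4 · 31.
  K-weak-bound : ∀ k → r ≡ suc k ℕ.+ suc k → ∀ a → K a ℤ.* K a ℤ.≤ + 31 ℤ.* + q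
  K-weak-bound k r≡ a = begin
    K a ℤ.* K a ≤⟨ sq-≤ (K a) (+ 11 ℤ.* h) upper lower ⟩
    + 11 ℤ.* h ℤ.* (+ 11 ℤ.* h) ≡⟨ lem₁ h ⟩
    + 121 ℤ.* (h ℤ.* h) ≤⟨ ℤP.*-monoʳ-≤-nonNeg (h ℤ.* h) ⦃ ℤ.nonNegative hh≥0 ⦄ (ℤ.+≤+ (ℕP.m≤m+n 121 3)) ⟩
    + 124 ℤ.* (h ℤ.* h) ≡⟨ lem₂ h ⟩
    + 31 ℤ.* (+ 4 ℤ.* (h ℤ.* h)) ≡⟨ cong (+ 31 ℤ.*_) q≡ ⟨
    + 31 ℤ.* + q ∎
    where
    open ℤP.≤-Reasoning
    H = 2 ℕ.^ k
    D = (H ℕ.+ 2) ℕ.* 2 ℕ.* H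
    h = + H
    lem₁ : ∀ x → + 11 ℤ.* x ℤ.* (+ 11 ℤ.* x) ≡ + 121 ℤ.* (x ℤ.* x)
    lem₁ = solve-∀
    lem₂ : ∀ x → + 124 ℤ.* (x ℤ.* x) ≡ + 31 ℤ.* (+ 4 ℤ.* (x ℤ.* x))
    lem₂ = solve-∀
    hh≥0 : 0ℤ ℤ.≤ h ℤ.* h
    hh≥0 = subst (0ℤ ℤ.≤_) (ℤP.pos-* H H) (ℤ.+≤+ ℕ.z≤n)
    q≡ : + q ≡ + 4 ℤ.* (h ℤ.* h)
    q≡ = trans (cong +_ (trans (Stepanov.QQ k r≡ a 0F) (lem H)))
           (trans (ℤP.pos-* 4 (H ℕ.* H)) (cong (+ 4 ℤ.*_) (ℤP.pos-* H H)))
      where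
      lem : ∀ x → 2 ℕ.* x ℕ.* (2 ℕ.* x) ≡ 4 ℕ.* (x ℕ.* x)
      lem = solve-∀ᴺ
    HD≡ : + (H ℕ.+ D) ≡ h ℤ.+ (h ℤ.+ + 2) ℤ.* + 2 ℤ.* h
    HD≡ = cong (λ z → h ℤ.+ z) (trans (ℤP.pos-* ((H ℕ.+ 2) ℕ.* 2) H) (cong (ℤ._* h) (ℤP.pos-* (H ℕ.+ 2) 2)))
    half : ∀ κ s → + length nonzero ℤ.+ κ ≡ + 2 ℤ.* + s → s ℕ.≤ H ℕ.+ D → κ ℤ.≤ + 11 ℤ.* h
    half κ s e le = begin
      κ ≡⟨ lem κ (+ length nonzero) ⟩
      + length nonzero ℤ.+ κ ℤ.- + length nonzero ≡⟨ cong₂ ℤ._-_ e (trans length-nonzero (cong (ℤ._- 1ℤ) q≡)) ⟩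
      + 2 ℤ.* + s ℤ.- (+ 4 ℤ.* (h ℤ.* h) ℤ.- 1ℤ) ≤⟨ ℤP.+-monoˡ-≤ (ℤ.- (+ 4 ℤ.* (h ℤ.* h) ℤ.- 1ℤ)) (ℤP.*-monoˡ-≤-nonNeg (+ 2) (ℤ.+≤+ le)) ⟩
      + 2 ℤ.* + (H ℕ.+ D) ℤ.- (+ 4 ℤ.* (h ℤ.* h) ℤ.- 1ℤ) ≡⟨ cong (λ z → + 2 ℤ.* z ℤ.- (+ 4 ℤ.* (h ℤ.* h) ℤ.- 1ℤ)) HD≡ ⟩
      + 2 ℤ.* (h ℤ.+ (h ℤ.+ + 2) ℤ.* + 2 ℤ.* h) ℤ.- (+ 4 ℤ.* (h ℤ.* h) ℤ.- 1ℤ) ≡⟨ lem′ h ⟩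
      + 10 ℤ.* h ℤ.+ 1ℤ ≤⟨ ℤP.+-monoʳ-≤ (+ 10 ℤ.* h) (ℤ.+≤+ (ℕP.m^n>0 2 k)) ⟩
      + 10 ℤ.* h ℤ.+ h ≡⟨ lem″ h ⟩
      + 11 ℤ.* h ∎
      where
      lem : ∀ x y → x ≡ y ℤ.+ x ℤ.- y
      lem = solve-∀
      lem′ : ∀ x → + 2 ℤ.* (x ℤ.+ (x ℤ.+ + 2) ℤ.* + 2 ℤ.* x) ℤ.- (+ 4 ℤ.* (x ℤ.* x) ℤ.- 1ℤ) ≡ + 10 ℤ.* x ℤ.+ 1ℤ
      lem′ = solve-∀
      lem″ : ∀ x → + 10 ℤ.* x ℤ.+ x ≡ + 11 ℤ.* x
      lem″ = solve-∀
    upper : K a ℤ.≤ + 11 ℤ.* h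
    upper = half (K a) _ (proj₁ (∑λ-count nonzero (λ x → x ⊕ a ⊗ invF x))) (Stepanov.Sε-bound k r≡ a 0F)
    lower : ℤ.- K a ℤ.≤ + 11 ℤ.* h
    lower = half (ℤ.- K a) _ (proj₂ (∑λ-count nonzero (λ x → x ⊕ a ⊗ invF x))) (Stepanov.Sε-bound k r≡ a 1F)
    sq-≤ : ∀ x y → x ℤ.≤ y → ℤ.- x ℤ.≤ y → x ℤ.* x ℤ.≤ y ℤ.* y
    sq-≤ x y a b = ℤP.0≤i-j⇒j≤i (subst (0ℤ ℤ.≤_) (lem x y)
        (ℤP.*-monoʳ-≤-nonNeg (y ℤ.- ℤ.- x) ⦃ ℤ.nonNegative (ℤP.i≤j⇒0≤j-i b) ⦄ (ℤP.i≤j⇒0≤j-i a)))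
      where
      lem : ∀ x y → (y ℤ.- x) ℤ.* (y ℤ.- ℤ.- x) ≡ y ℤ.* y ℤ.- x ℤ.* x
      lem = solve-∀

-- The quadratic extension and its Kloosterman sums

module QuadraticExtension (FF : FiniteField) (r : ℕ) (card : length (FiniteField.elements FF) ≡ 2 ℕ.^ r)
  (c : FiniteField.F FF) (tr-c : Setup.tr FF r c ≡ FiniteField.1F FF) where

  open FiniteField FF renaming (_+F_ to infixl 6 _⊕_; _*F_ to infixl 7 _⊗_)
  open Setup FF r
  open FieldTheory FF r card
  open S₂ using (_:+_; _:*_; _:=_; solve; con; Polynomial)

  -- (x , y) stands for x + y w with w² = w + c.

  norm : F × F → F
  norm (x , y) = x ⊗ x ⊕ x ⊗ y ⊕ c ⊗ (y ⊗ y)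

  ℘+c≢0 : ∀ z → z ⊗ z ⊕ z ⊕ c ≢ 0F
  ℘+c≢0 z e = 0F≢1F (trans (sym (tr-℘ z)) (trans (cong tr (+≡0⇒≡ e)) tr-c))

  norm-scale : ∀ y z → norm (y ⊗ z , y) ≡ y ⊗ y ⊗ (z ⊗ z ⊕ z ⊕ c)
  norm-scale y z = solve 3 (λ y z c → y :* z :* (y :* z) :+ y :* z :* y :+ c :* (y :* y) := y :* y :* (z :* z :+ z :+ c)) refl y z c

  -- For y = 0 the norm is x². Otherwise dividing by y² leaves z² + z + c with z = x/y, whose trace
  -- is tr c = 1.
  norm≢0 : ∀ {x y} → (x , y) ≢ (0F , 0F) → norm (x , y) ≢ 0F
  norm≢0 {x} {y} n e with y ≟F 0F
  ... | yes refl = n (cong (_, 0F) (sq-inj (trans (solve 2 (λ x c → x :* x := x :* x :+ x :* :0 :+ c :* (:0 :* :0)) refl x c) (trans e (sym (F*-zeroˡ _))))))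
  ... | no y≢0 = *≢0 (*≢0 y≢0 y≢0) (℘+c≢0 (invF y ⊗ x)) (trans (sym (norm-scale y (invF y ⊗ x)))
        (trans (cong (λ z → norm (z , y)) (trans (sym (F*-assoc _ _ _)) (trans (cong (_⊗ x) (invF-inv y y≢0)) (F*-identityˡ x)))) e))

  _⊕₂_ _⊗₂_ : F × F → F × F → F × F
  (x , y) ⊕₂ (u , v) = x ⊕ u , y ⊕ v
  (x , y) ⊗₂ (u , v) = x ⊗ u ⊕ c ⊗ (y ⊗ v) , x ⊗ v ⊕ y ⊗ u ⊕ y ⊗ v

  -- Conjugate over norm: the conjugate of w is w + 1, so that of x + y w is (x + y) + y w.
  inv₂ : F × F → F × F
  inv₂ (x , y) = (x ⊕ y) ⊗ invF (norm (x , y)) , y ⊗ invF (norm (x , y))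

  neg₂ : F × F → F × F
  neg₂ (x , y) = -F x , -F y

  isCommutativeRing₂ : IsCommutativeRing _≡_ _⊕₂_ _⊗₂_ neg₂ (0F , 0F) (1F , 0F)
  isCommutativeRing₂ = record
    { isRing = record
      { +-isAbelianGroup = record
        { isGroup = record
          { isMonoid = record
            { isSemigroup = record
              { isMagma = record { isEquivalence = isEquivalence ; ∙-cong = cong₂ _⊕₂_ }
              ; assoc = λ { (x , y) (u , v) (s , t) → cong₂ _,_ (F+-assoc x u s) (F+-assoc y v t) } }
            ; identity = (λ { (x , y) → cong₂ _,_ (F+-identityˡ x) (F+-identityˡ y) })
                       , (λ { (x , y) → cong₂ _,_ (F+-identityʳ x) (F+-identityʳ y) }) }
          ; inverse = (λ { (x , y) → cong₂ _,_ (F-inverseˡ x) (F-inverseˡ y) })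
                    , (λ { (x , y) → cong₂ _,_ (F-inverseʳ x) (F-inverseʳ y) })
          ; ⁻¹-cong = cong neg₂ }
        ; comm = λ { (x , y) (u , v) → cong₂ _,_ (F+-comm x u) (F+-comm y v) } }
      ; *-cong = cong₂ _⊗₂_
      ; *-assoc = λ { (x , y) (u , v) (s , t) → cong₂ _,_
          (solve 7 (λ x y u v s t c → (x :* u :+ c :* (y :* v)) :* s :+ c :* ((x :* v :+ y :* u :+ y :* v) :* t) :=
                                      x :* (u :* s :+ c :* (v :* t)) :+ c :* (y :* (u :* t :+ v :* s :+ v :* t))) refl x y u v s t c)
          (solve 7 (λ x y u v s t c → (x :* u :+ c :* (y :* v)) :* t :+ (x :* v :+ y :* u :+ y :* v) :* s :+ (x :* v :+ y :* u :+ y :* v) :* t :=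
                                      x :* (u :* t :+ v :* s :+ v :* t) :+ y :* (u :* s :+ c :* (v :* t)) :+ y :* (u :* t :+ v :* s :+ v :* t)) refl x y u v s t c) }
      ; *-identity = (λ { (x , y) → cong₂ _,_ (solve 3 (λ x y c → :1 :* x :+ c :* (:0 :* y) := x) refl x y c)
                                              (solve 2 (λ x y → :1 :* y :+ :0 :* x :+ :0 :* y := y) refl x y) })
                   , (λ { (x , y) → cong₂ _,_ (solve 3 (λ x y c → x :* :1 :+ c :* (y :* :0) := x) refl x y c)
                                              (solve 2 (λ x y → x :* :0 :+ y :* :1 :+ y :* :0 := y) refl x y) })
      ; distrib = (λ { (x , y) (u , v) (s , t) → cong₂ _,_
            (solve 7 (λ x y u v s t c → x :* (u :+ s) :+ c :* (y :* (v :+ t)) := (x :* u :+ c :* (y :* v)) :+ (x :* s :+ c :* (y :* t))) refl x y u v s t c)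
            (solve 6 (λ x y u v s t → x :* (v :+ t) :+ y :* (u :+ s) :+ y :* (v :+ t) := (x :* v :+ y :* u :+ y :* v) :+ (x :* t :+ y :* s :+ y :* t)) refl x y u v s t) })
                , (λ { (x , y) (u , v) (s , t) → cong₂ _,_
            (solve 7 (λ x y u v s t c → (u :+ s) :* x :+ c :* ((v :+ t) :* y) := (u :* x :+ c :* (v :* y)) :+ (s :* x :+ c :* (t :* y))) refl x y u v s t c)
            (solve 6 (λ x y u v s t → (u :+ s) :* y :+ (v :+ t) :* x :+ (v :+ t) :* y := (u :* y :+ v :* x :+ v :* y) :+ (s :* y :+ t :* x :+ t :* y)) refl x y u v s t) }) }
    ; *-comm = λ { (x , y) (u , v) → cong₂ _,_
        (solve 5 (λ x y u v c → x :* u :+ c :* (y :* v) := u :* x :+ c :* (v :* y)) refl x y u v c)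
        (solve 4 (λ x y u v → x :* v :+ y :* u :+ y :* v := u :* y :+ v :* x :+ v :* y) refl x y u v) }
    }

  FF₂ : FiniteField
  FF₂ = record
    { F = F × F
    ; _+F_ = _⊕₂_
    ; _*F_ = _⊗₂_
    ; -F_ = neg₂
    ; 0F = 0F , 0F
    ; 1F = 1F , 0F
    ; isCommutativeRing = isCommutativeRing₂
    ; 0F≢1F = λ e → 0F≢1F (cong proj₁ e)
    ; invF = inv₂
    ; invF-inv = λ { (x , y) n → let i = invF (norm (x , y)) ; e = invF-inv (norm (x , y)) (norm≢0 n) in cong₂ _,_
        (trans (solve 4 (λ x y c i → x :* ((x :+ y) :* i) :+ c :* (y :* (y :* i)) := (x :* x :+ x :* y :+ c :* (y :* y)) :* i) refl x y c i) e)
        (solve 3 (λ x y i → x :* (y :* i) :+ y :* ((x :+ y) :* i) :+ y :* (y :* i) := :0) refl x y i) }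
    ; _≟F_ = ≡-dec _≟F_ _≟F_
    ; elements = cartesianProduct elements elements
    ; complete = λ { (x , y) → ∈-cartesianProduct⁺ (complete x) (complete y) }
    ; unique = UniqueP.cartesianProduct⁺ unique unique
    }

  card₂ : length (cartesianProduct elements elements) ≡ 2 ℕ.^ (r ℕ.+ r)
  card₂ = ℤP.+-injective (begin
    + length (cartesianProduct elements elements) ≡⟨ ∑-1 (cartesianProduct elements elements) ⟨
    ∑ (cartesianProduct elements elements) (λ _ → 1ℤ) ≡⟨ ∑-cartesianProduct elements elements (λ _ → 1ℤ) ⟩
    ∑ elements (λ _ → ∑ elements (λ _ → 1ℤ)) ≡⟨ ∑-cong elements (λ _ → ∑-1 elements) ⟩
    ∑ elements (λ _ → + length elements) ≡⟨ ∑-const elements _ ⟩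
    + length elements ℤ.* + length elements ≡⟨ cong₂ (λ m n → + m ℤ.* + n) card card ⟩
    + (2 ℕ.^ r) ℤ.* + (2 ℕ.^ r) ≡⟨ ℤP.pos-* (2 ℕ.^ r) (2 ℕ.^ r) ⟨
    + (2 ℕ.^ r ℕ.* 2 ℕ.^ r) ≡⟨ cong +_ (ℕP.^-distribˡ-+-* 2 r r) ⟨
    + (2 ℕ.^ (r ℕ.+ r)) ∎)
    where open ≡-Reasoning

  module S = Setup FF₂ (r ℕ.+ r)
  module E = FieldTheory FF₂ (r ℕ.+ r) card₂

  -- Iterating w² = w + c gives w^(2^n) = w + `partialTr n c`.
  frob₂ : ∀ n x y → S.powF (x , y) (2 ℕ.^ n) ≡ (powF x (2 ℕ.^ n) ⊕ powF y (2 ℕ.^ n) ⊗ partialTr n c , powF y (2 ℕ.^ n))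
  frob₂ zero    x y = cong₂ _,_ (solve 3 (λ x y c → x :* :1 :+ c :* (y :* :0) := x :* :1 :+ y :* :1 :* :0) refl x y c)
                                (solve 2 (λ x y → x :* :0 :+ y :* :1 :+ y :* :0 := y :* :1) refl x y)
  frob₂ (suc n) x y = trans (E.frob-suc (x , y) n) (trans (cong (λ z → z ⊗₂ z) (frob₂ n x y)) (cong₂ _,_
      (trans (solve 4 (λ X Y P c → (X :+ Y :* P) :* (X :+ Y :* P) :+ c :* (Y :* Y) := X :* X :+ Y :* Y :* (c :+ P :* P)) refl _ _ (partialTr n c) c)
        (cong₂ _⊕_ (sym (frob-suc x n)) (cong₂ _⊗_ (sym (frob-suc y n)) (sym (partialTr-suc n c)))))
      (trans (solve 2 (λ Z Y → Z :* Y :+ Y :* Z :+ Y :* Y := Y :* Y) refl _ _) (sym (frob-suc y n)))))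

  frob-+r : ∀ n x → powF x (2 ℕ.^ (n ℕ.+ r)) ≡ powF x (2 ℕ.^ n)
  frob-+r n x = trans (cong (powF x) (ℕP.^-distribˡ-+-* 2 n r))
      (trans (powF-* x (2 ℕ.^ n) (2 ℕ.^ r)) (cong (λ z → powF z (2 ℕ.^ n)) (fermat x)))

  partialTr-r+ : ∀ n x → partialTr (n ℕ.+ r) x ≡ partialTr n x ⊕ tr x
  partialTr-r+ zero    x = trans (sym (tr≡partialTr x)) (sym (F+-identityˡ _))
  partialTr-r+ (suc n) x = trans (cong₂ _⊕_ (partialTr-r+ n x) (frob-+r n x))
    (solve 3 (λ a b d → a :+ b :+ d := a :+ d :+ b) refl _ _ _)

  -- By w^q = w + tr c = w + 1 the traces from step r on complete those before it to traces of z + z^q = y.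
  partialTr₂-shift : ∀ n x y → E.partialTr (n ℕ.+ r) (x , y) ≡ E.partialTr n (x , y) ⊕₂ (E.partialTr r (x , y) ⊕₂ (partialTr n y , 0F))
  partialTr₂-shift zero    x y = sym (trans (E.F+-identityˡ _) (E.F+-identityʳ _))
  partialTr₂-shift (suc n) x y = begin
    E.partialTr (n ℕ.+ r) (x , y) ⊕₂ S.powF (x , y) (2 ℕ.^ (n ℕ.+ r))
      ≡⟨ cong₂ _⊕₂_ (partialTr₂-shift n x y) (trans (frob₂ (n ℕ.+ r) x y) (cong₂ _,_
           (cong₂ _⊕_ (frob-+r n x) (cong₂ _⊗_ (frob-+r n y) (trans (partialTr-r+ n c) (cong (partialTr n c ⊕_) tr-c)))) (frob-+r n y))) ⟩
    (A ⊕₂ (B ⊕₂ (partialTr n y , 0F))) ⊕₂ (X ⊕ Y ⊗ (P ⊕ 1F) , Y)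
      ≡⟨ cong₂ _,_ (solve 6 (λ a b t X Y P → (a :+ (b :+ t)) :+ (X :+ Y :* (P :+ :1)) := a :+ (X :+ Y :* P) :+ (b :+ (t :+ Y))) refl _ _ _ X Y P)
                   (solve 3 (λ a b Y → (a :+ (b :+ :0)) :+ Y := a :+ Y :+ (b :+ :0)) refl _ _ Y) ⟩
    (A ⊕₂ (X ⊕ Y ⊗ P , Y)) ⊕₂ (B ⊕₂ (partialTr (suc n) y , 0F))
      ≡⟨ cong (λ z → (A ⊕₂ z) ⊕₂ (B ⊕₂ (partialTr (suc n) y , 0F))) (frob₂ n x y) ⟨
    E.partialTr (suc n) (x , y) ⊕₂ (B ⊕₂ (partialTr (suc n) y , 0F)) ∎
    where
    open ≡-Reasoning
    A = E.partialTr n (x , y)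
    B = E.partialTr r (x , y)
    X = powF x (2 ℕ.^ n)
    Y = powF y (2 ℕ.^ n)
    P = partialTr n c

  -- Transitivity of the trace, the relative trace of x + y w being y: in `partialTr₂-shift` at n =
  -- r the two equal partial traces cancel.
  tr₂ : ∀ x y → S.tr (x , y) ≡ (tr y , 0F)
  tr₂ x y = trans (E.tr≡partialTr (x , y)) (trans (partialTr₂-shift r x y)
    (trans (sym (E.F+-assoc _ _ _)) (trans (cong (_⊕₂ (partialTr r y , 0F)) (E.x+x (E.partialTr r (x , y))))
      (trans (E.F+-identityˡ _) (cong (_, 0F) (sym (tr≡partialTr y)))))))

  λ₂ : ∀ x y → S.λ' (x , y) ≡ λ' y
  λ₂ x y with tr-01 y
  ... | inj₁ e = trans (E.λ-0 (trans (tr₂ x y) (cong (_, 0F) e))) (sym (λ-0 e))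
  ... | inj₂ e = trans (E.λ-1 (trans (tr₂ x y) (cong (_, 0F) e))) (sym (λ-1 e))

  ∑-shift : ∀ (f : F → ℤ) → ∑ elements (λ v → f (v ⊕ c)) ≡ ∑ elements f
  ∑-shift = ∑-bij (_⊕ c) (_⊕ c) unique unique (λ x _ → complete _) (λ x _ → complete _) (λ x _ → inv x) (λ x _ → inv x)
    where
    inv : ∀ x → x ⊕ c ⊕ c ≡ x
    inv x = solve 2 (λ x c → x :+ c :+ c := x) refl x c

  -- Since tr c = 1, the number 1 + λ(v + c) of z with z² + z + c = v equals 1 - λ(v).
  ∑-℘+c : ∀ (H : F → ℤ) → ∑ elements (λ z → H (z ⊗ z ⊕ z ⊕ c)) ≡ ∑ nonzero (λ v → (1ℤ ℤ.- λ' v) ℤ.* H v)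
  ∑-℘+c H = begin
    ∑ elements (λ z → H (z ⊗ z ⊕ z ⊕ c)) ≡⟨ ∑-pushforward elements (λ z → z ⊗ z ⊕ z) (λ s → H (s ⊕ c)) ⟩
    ∑ elements (λ s → ℘-fibre s ℤ.* H (s ⊕ c)) ≡⟨ ∑-cong elements (λ s → cong (ℤ._* H (s ⊕ c)) (trans (℘-fibre-λ s) (flip s))) ⟩
    ∑ elements (λ s → (1ℤ ℤ.- λ' (s ⊕ c)) ℤ.* H (s ⊕ c)) ≡⟨ ∑-shift (λ v → (1ℤ ℤ.- λ' v) ℤ.* H v) ⟩
    ∑ elements (λ v → (1ℤ ℤ.- λ' v) ℤ.* H v) ≡⟨ ∑-split _ ⟩
    (1ℤ ℤ.- λ' 0F) ℤ.* H 0F ℤ.+ ∑ nonzero (λ v → (1ℤ ℤ.- λ' v) ℤ.* H v) ≡⟨ cong (λ k → (1ℤ ℤ.- k) ℤ.* H 0F ℤ.+ ∑ nonzero (λ v → (1ℤ ℤ.- λ' v) ℤ.* H v)) λ-0F ⟩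
    0ℤ ℤ.+ ∑ nonzero (λ v → (1ℤ ℤ.- λ' v) ℤ.* H v) ≡⟨ ℤP.+-identityˡ _ ⟩
    ∑ nonzero (λ v → (1ℤ ℤ.- λ' v) ℤ.* H v) ∎
    where
    open ≡-Reasoning
    flip : ∀ s → 1ℤ ℤ.+ λ' s ≡ 1ℤ ℤ.- λ' (s ⊕ c)
    flip s = trans (lem (λ' s)) (cong (λ k → 1ℤ ℤ.- k) (trans (cong (λ' s ℤ.*_) (sym (λ-1 tr-c))) (sym (λ-+ s c))))
      where
      lem : ∀ x → 1ℤ ℤ.+ x ≡ 1ℤ ℤ.- x ℤ.* ℤ.-1ℤ
      lem = solve-∀

  -- The Hasse-Davenport relation in degree two, computed directly. By `λ₂` the summand sees only
  -- the second coordinate y + a y / N(x , y). The line y = 0 gives q, less 1 for the origin. For y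
  -- ≠ 0 put x = y z, so that N = y² v with v = z² + z + c, and v occurs with weight 1 - λ(v): the
  -- part 1 contributes 1 in all, the part -λ(v) contributes -K₂(a). The total q - K₂(a) is turned
  -- into 2q - K(a)² by `carlitz`.
  K-extension : ∀ {a} → a ≢ 0F → S.K (a , 0F) ≡ + 2 ℤ.* + q ℤ.- K a ℤ.* K a
  K-extension {a} a≢0 = begin
    S.K (a , 0F) ≡⟨ ∑-cong S.nonzero (λ { (x , y) → trans (λ₂ _ _) (cong (λ z → λ' (y ⊕ z))
                                                                (solve 3 (λ a u v → a :* v :+ :0 :* u :+ :0 :* v := a :* v) refl a _ _)) }) ⟩
    ∑ S.nonzero (λ { (x , y) → G x y }) ≡⟨ ℤ+-cancelˡ 1ℤ (trans (trans (cong (ℤ._+ ∑ S.nonzero (λ { (x , y) → G x y })) (sym (G0 0F))) (sym (E.∑-split _))) (lem₁ _)) ⟩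
    ∑ (cartesianProduct elements elements) (λ { (x , y) → G x y }) ℤ.- 1ℤ ≡⟨ cong (ℤ._- 1ℤ) (trans (∑-cartesianProduct elements elements _) (∑-swap elements elements G)) ⟩
    ∑ elements (λ y → ∑ elements (λ x → G x y)) ℤ.- 1ℤ ≡⟨ cong (ℤ._- 1ℤ) (∑-split _) ⟩
    ∑ elements (λ x → G x 0F) ℤ.+ ∑ nonzero (λ y → ∑ elements (λ x → G x y)) ℤ.- 1ℤ
      ≡⟨ cong₂ (λ s t → s ℤ.+ t ℤ.- 1ℤ) (trans (∑-cong elements G0) (trans (∑-1 elements) (cong +_ card))) outer ⟩
    + q ℤ.+ (1ℤ ℤ.- K2 a) ℤ.- 1ℤ ≡⟨ lem₂ (+ q) (K2 a) ⟩
    + 2 ℤ.* + q ℤ.- (+ q ℤ.+ K2 a) ≡⟨ cong (λ k → + 2 ℤ.* + q ℤ.- k) (carlitz a≢0) ⟨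
    + 2 ℤ.* + q ℤ.- K a ℤ.* K a ∎
    where
    open ≡-Reasoning
    G : F → F → ℤ
    G x y = λ' (y ⊕ a ⊗ (y ⊗ invF (norm (x , y))))
    lem₁ : ∀ s → s ≡ 1ℤ ℤ.+ (s ℤ.- 1ℤ)
    lem₁ = solve-∀
    lem₂ : ∀ s t → s ℤ.+ (1ℤ ℤ.- t) ℤ.- 1ℤ ≡ + 2 ℤ.* s ℤ.- (s ℤ.+ t)
    lem₂ = solve-∀
    G0 : ∀ x → G x 0F ≡ 1ℤ
    G0 x = trans (cong λ' (solve 2 (λ a n → :0 :+ a :* (:0 :* n) := :0) refl a _)) λ-0F
    H : F → F → ℤ
    H y v = λ' (y ⊕ a ⊗ invF y ⊗ invF v)
    G-scale : ∀ {y} → y ≢ 0F → ∀ z → G (y ⊗ z) y ≡ H y (z ⊗ z ⊕ z ⊕ c)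
    G-scale {y} n z = cong (λ k → λ' (y ⊕ k)) (begin
      a ⊗ (y ⊗ invF (norm (y ⊗ z , y))) ≡⟨ cong (λ k → a ⊗ (y ⊗ k)) (trans (cong invF (norm-scale y z)) (trans (inv-* (*≢0 n n) (℘+c≢0 z)) (cong (_⊗ invF v) (inv-* n n)))) ⟩
      a ⊗ (y ⊗ (y′ ⊗ y′ ⊗ invF v)) ≡⟨ by₁ (a ⊗ y′ ⊗ invF v) (invF-inv y n) (solve 4 (λ a y y′ v → a :* (y :* (y′ :* y′ :* v)) := a :* y′ :* v :+ a :* y′ :* v :* (y :* y′ :+ :1)) refl a y y′ (invF v)) ⟩
      a ⊗ y′ ⊗ invF v ∎)
      where
      y′ = invF y
      v = z ⊗ z ⊕ z ⊕ c
    inner : ∀ y → y ∈ nonzero → ∑ elements (λ x → G x y) ≡ λ' y ℤ.* ℤ.-1ℤ ℤ.+ ℤ.-1ℤ ℤ.* (λ' y ℤ.* K (a ⊗ invF y))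
    inner y i = begin
      ∑ elements (λ x → G x y) ≡⟨ ∑-split (λ x → G x y) ⟩
      G 0F y ℤ.+ ∑ nonzero (λ x → G x y) ≡⟨ cong₂ ℤ._+_ (cong (λ z → G z y) (sym (F*-zeroʳ y))) (sym (∑-scale n (λ x → G x y))) ⟩
      G (y ⊗ 0F) y ℤ.+ ∑ nonzero (λ z → G (y ⊗ z) y) ≡⟨ ∑-split (λ z → G (y ⊗ z) y) ⟨
      ∑ elements (λ z → G (y ⊗ z) y) ≡⟨ ∑-cong elements (G-scale n) ⟩
      ∑ elements (λ z → H y (z ⊗ z ⊕ z ⊕ c)) ≡⟨ ∑-℘+c (H y) ⟩
      ∑ nonzero (λ v → (1ℤ ℤ.- λ' v) ℤ.* H y v) ≡⟨ ∑-cong nonzero (λ v → trans (cong ((1ℤ ℤ.- λ' v) ℤ.*_) (λ-+ y _)) (trans (lem (λ' v) (λ' y) _)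
                                                              (cong (λ k → λ' y ℤ.* λ' (a ⊗ invF y ⊗ invF v) ℤ.+ ℤ.-1ℤ ℤ.* (λ' y ℤ.* k)) (sym (λ-+ v _))))) ⟩
      ∑ nonzero (λ v → λ' y ℤ.* λ' (a ⊗ invF y ⊗ invF v) ℤ.+ ℤ.-1ℤ ℤ.* (λ' y ℤ.* λ' (v ⊕ a ⊗ invF y ⊗ invF v)))
        ≡⟨ ∑-+ nonzero _ _ ⟩
      ∑ nonzero (λ v → λ' y ℤ.* λ' (a ⊗ invF y ⊗ invF v)) ℤ.+ ∑ nonzero (λ v → ℤ.-1ℤ ℤ.* (λ' y ℤ.* λ' (v ⊕ a ⊗ invF y ⊗ invF v)))
        ≡⟨ cong₂ ℤ._+_ (trans (∑-*ˡ nonzero (λ' y) _) (cong (λ' y ℤ.*_) (trans (∑-inv (λ v → λ' (a ⊗ invF y ⊗ v))) (∑λ-nonzero-scale (*≢0 a≢0 (inv≢0 n))))))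
             (trans (∑-*ˡ nonzero ℤ.-1ℤ _) (cong (ℤ.-1ℤ ℤ.*_) (∑-*ˡ nonzero (λ' y) _))) ⟩
      λ' y ℤ.* ℤ.-1ℤ ℤ.+ ℤ.-1ℤ ℤ.* (λ' y ℤ.* K (a ⊗ invF y)) ∎
      where
      n = ∈nonzero⁻ i
      lem : ∀ u s t → (1ℤ ℤ.- u) ℤ.* (s ℤ.* t) ≡ s ℤ.* t ℤ.+ ℤ.-1ℤ ℤ.* (s ℤ.* (u ℤ.* t))
      lem = solve-∀
    outer : ∑ nonzero (λ y → ∑ elements (λ x → G x y)) ≡ 1ℤ ℤ.- K2 a
    outer = trans (∑-cong-∈ nonzero inner) (trans (∑-+ nonzero _ _)
      (cong₂ ℤ._+_ (trans (∑-*ʳ nonzero ℤ.-1ℤ λ') (cong (ℤ._* ℤ.-1ℤ) ∑λ-nonzero))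
        (trans (∑-*ˡ nonzero ℤ.-1ℤ _) (trans (cong (ℤ.-1ℤ ℤ.*_) (sym (K₂-∑ a))) (ℤP.-1*i≡-i _)))))

-- In the tower of quadratic extensions, K² / q − 4 at least quadruples at every step once it is positive,
-- which contradicts the weak bound K² ≤ 31 q.

sq-mono-≤ : ∀ {x y} → 0ℤ ℤ.≤ x → x ℤ.≤ y → x ℤ.* x ℤ.≤ y ℤ.* y
sq-mono-≤ {x} {y} 0≤x x≤y = ℤP.≤-trans (ℤP.*-monoʳ-≤-nonNeg x ⦃ ℤ.nonNegative 0≤x ⦄ x≤y)
  (ℤP.*-monoˡ-≤-nonNeg y ⦃ ℤ.nonNegative (ℤP.≤-trans 0≤x x≤y) ⦄ x≤y)

-- If X/q ≥ 4 + e with e ≥ 0, then (X/q - 2)² ≥ (2 + e)² ≥ 4 + 4e. The excess e is carried as δ/q₀,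
-- with a denominator that stays fixed while q changes along the tower, so that only integers occur.
excess-step : ∀ (q₀ δ q : ℕ) (X : ℤ) → 0 ℕ.< q₀ →
  (+ 4 ℤ.* + q₀ ℤ.+ + δ) ℤ.* + q ℤ.≤ + q₀ ℤ.* X →
  (+ 4 ℤ.* + q₀ ℤ.+ + (4 ℕ.* δ)) ℤ.* + (q ℕ.* q) ℤ.≤ + q₀ ℤ.* ((+ 2 ℤ.* + q ℤ.- X) ℤ.* (+ 2 ℤ.* + q ℤ.- X))
excess-step (suc p) δ q X _ h = ℤP.*-cancelˡ-≤-pos _ _ (+ suc p) (begin
  + q₀ ℤ.* ((+ 4 ℤ.* + q₀ ℤ.+ + (4 ℕ.* δ)) ℤ.* + (q ℕ.* q)) ≡⟨ cong₂ (λ s t → + q₀ ℤ.* ((+ 4 ℤ.* + q₀ ℤ.+ s) ℤ.* t)) (ℤP.pos-* 4 δ) (ℤP.pos-* q q) ⟩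
  + q₀ ℤ.* ((+ 4 ℤ.* + q₀ ℤ.+ + 4 ℤ.* + δ) ℤ.* (+ q ℤ.* + q)) ≡⟨ lem₁ (+ q₀) (+ δ) (+ q) ⟩
  B ℤ.* B ℤ.- + δ ℤ.* + q ℤ.* (+ δ ℤ.* + q) ≤⟨ ℤP.i-j≤i (B ℤ.* B) _ ⦃ ℤ.nonNegative (subst (λ z → 0ℤ ℤ.≤ z ℤ.* z) (ℤP.pos-* δ q) (subst (0ℤ ℤ.≤_) (ℤP.pos-* (δ ℕ.* q) (δ ℕ.* q)) (ℤ.+≤+ ℕ.z≤n))) ⦄ ⟩
  B ℤ.* B ≤⟨ sq-mono-≤ B≥0 B≤A ⟩
  A ℤ.* A ≡⟨ lem₂ (+ q₀) (+ q) X ⟩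
  + q₀ ℤ.* (+ q₀ ℤ.* ((+ 2 ℤ.* + q ℤ.- X) ℤ.* (+ 2 ℤ.* + q ℤ.- X))) ∎)
  where
  open ℤP.≤-Reasoning
  q₀ = suc p
  A = + q₀ ℤ.* (X ℤ.- + 2 ℤ.* + q)
  B = (+ 2 ℤ.* + q₀ ℤ.+ + δ) ℤ.* + q
  lem₁ : ∀ p d q → p ℤ.* ((+ 4 ℤ.* p ℤ.+ + 4 ℤ.* d) ℤ.* (q ℤ.* q)) ≡
    (+ 2 ℤ.* p ℤ.+ d) ℤ.* q ℤ.* ((+ 2 ℤ.* p ℤ.+ d) ℤ.* q) ℤ.- d ℤ.* q ℤ.* (d ℤ.* q)
  lem₁ = solve-∀
  lem₂ : ∀ p q X → p ℤ.* (X ℤ.- + 2 ℤ.* q) ℤ.* (p ℤ.* (X ℤ.- + 2 ℤ.* q)) ≡ p ℤ.* (p ℤ.* ((+ 2 ℤ.* q ℤ.- X) ℤ.* (+ 2 ℤ.* q ℤ.- X)))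
  lem₂ = solve-∀
  B≥0 : 0ℤ ℤ.≤ B
  B≥0 = subst (0ℤ ℤ.≤_) (trans (ℤP.pos-* (2 ℕ.* q₀ ℕ.+ δ) q) (cong (λ z → (z ℤ.+ + δ) ℤ.* + q) (ℤP.pos-* 2 q₀))) (ℤ.+≤+ ℕ.z≤n)
  B≤A : B ℤ.≤ A
  B≤A = subst₂ ℤ._≤_ (lem₃ (+ q₀) (+ δ) (+ q)) (lem₄ (+ q₀) (+ q) X) (ℤP.+-monoˡ-≤ (ℤ.- (+ 2 ℤ.* + q₀ ℤ.* + q)) h)
    where
    lem₃ : ∀ p d q → (+ 4 ℤ.* p ℤ.+ d) ℤ.* q ℤ.+ ℤ.- (+ 2 ℤ.* p ℤ.* q) ≡ (+ 2 ℤ.* p ℤ.+ d) ℤ.* q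
    lem₃ = solve-∀
    lem₄ : ∀ p q X → p ℤ.* X ℤ.+ ℤ.- (+ 2 ℤ.* p ℤ.* q) ≡ p ℤ.* (X ℤ.- + 2 ℤ.* q)
    lem₄ = solve-∀

-- 27 = 31 - 4 is the excess of K²/q over 4 that `K-weak-bound` still permits.
excess-even : (FF : FiniteField) (r : ℕ) (card : length (FiniteField.elements FF) ≡ 2 ℕ.^ r) → ∀ k → r ≡ suc k ℕ.+ suc k →
  ∀ a (q₀ δ : ℕ) → 0 ℕ.< q₀ →
  let open Setup FF r in (+ 4 ℤ.* + q₀ ℤ.+ + δ) ℤ.* + q ℤ.≤ + q₀ ℤ.* (K a ℤ.* K a) → + δ ℤ.≤ + 27 ℤ.* + q₀
excess-even FF r card k r≡ a q₀ δ _ h = subst (ℤ._≤ + 27 ℤ.* + q₀) (lem₁ (+ q₀) (+ δ)) (subst (+ 4 ℤ.* + q₀ ℤ.+ + δ ℤ.- + 4 ℤ.* + q₀ ℤ.≤_) (lem₂ (+ q₀))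
    (ℤP.+-monoˡ-≤ (ℤ.- (+ 4 ℤ.* + q₀)) (ℤP.*-cancelʳ-≤-pos (+ 4 ℤ.* + q₀ ℤ.+ + δ) (+ 31 ℤ.* + q₀) (+ q) ⦃ ℤ.positive (ℤ.+<+ (ℕP.m^n>0 2 r)) ⦄ (ℤP.≤-trans h
      (subst (+ q₀ ℤ.* (K a ℤ.* K a) ℤ.≤_) (lem₃ (+ q₀) (+ q)) (ℤP.*-monoˡ-≤-nonNeg (+ q₀) (K-weak-bound k r≡ a)))))))
  where
  open Setup FF r
  open FieldTheory FF r card
  lem₁ : ∀ p d → + 4 ℤ.* p ℤ.+ d ℤ.- + 4 ℤ.* p ≡ d
  lem₁ = solve-∀
  lem₂ : ∀ p → + 31 ℤ.* p ℤ.- + 4 ℤ.* p ≡ + 27 ℤ.* p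
  lem₂ = solve-∀
  lem₃ : ∀ p q → p ℤ.* (+ 31 ℤ.* q) ≡ + 31 ℤ.* p ℤ.* q
  lem₃ = solve-∀

-- One extension is made before any bound is applied: it turns the degree r into r + r, as
-- `excess-even` requires, and δ into 4δ. With n further extensions the factor is 4^(n+1).
excess-bound : ∀ n (FF : FiniteField) (r : ℕ) (card : length (FiniteField.elements FF) ≡ 2 ℕ.^ r) →
  ∀ {a} → a ≢ FiniteField.0F FF → ∀ (q₀ δ : ℕ) → 0 ℕ.< q₀ →
  let open Setup FF r in (+ 4 ℤ.* + q₀ ℤ.+ + δ) ℤ.* + q ℤ.≤ + q₀ ℤ.* (K a ℤ.* K a) → + (4 ℕ.^ suc n ℕ.* δ) ℤ.≤ + 27 ℤ.* + q₀
excess-bound n FF r card {a} a≢0 q₀ δ q₀>0 h = go n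
  where
  open FieldTheory FF r card using (exists-tr1; r≥1)
  open QuadraticExtension FF r card (proj₁ exists-tr1) (proj₂ exists-tr1)
  open Setup FF r
  h₂ : (+ 4 ℤ.* + q₀ ℤ.+ + (4 ℕ.* δ)) ℤ.* + S.q ℤ.≤ + q₀ ℤ.* (S.K (a , FiniteField.0F FF) ℤ.* S.K (a , FiniteField.0F FF))
  h₂ = subst₂ ℤ._≤_ (cong (λ z → (+ 4 ℤ.* + q₀ ℤ.+ + (4 ℕ.* δ)) ℤ.* + z) (sym (ℕP.^-distribˡ-+-* 2 r r)))
         (cong (λ z → + q₀ ℤ.* (z ℤ.* z)) (sym (K-extension a≢0))) (excess-step q₀ δ q (K a ℤ.* K a) q₀>0 h)
  r+r≡ : r ℕ.+ r ≡ suc (r ℕ.∸ 1) ℕ.+ suc (r ℕ.∸ 1)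
  r+r≡ = cong₂ ℕ._+_ (sym (ℕP.m+[n∸m]≡n r≥1)) (sym (ℕP.m+[n∸m]≡n r≥1))
  go : ∀ n → + (4 ℕ.^ suc n ℕ.* δ) ℤ.≤ + 27 ℤ.* + q₀
  go zero    = excess-even FF₂ (r ℕ.+ r) card₂ (r ℕ.∸ 1) r+r≡ (a , FiniteField.0F FF) q₀ (4 ℕ.* δ) q₀>0 h₂
  go (suc n) = subst (λ z → + z ℤ.≤ + 27 ℤ.* + q₀) (lem (4 ℕ.^ suc n) δ)
    (excess-bound n FF₂ (r ℕ.+ r) card₂ (λ e → a≢0 (cong proj₁ e)) q₀ (4 ℕ.* δ) q₀>0 h₂)
    where
    lem : ∀ x d → x ℕ.* (4 ℕ.* d) ≡ 4 ℕ.* x ℕ.* d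
    lem = solve-∀ᴺ

-- Between integers K² > 4q is an excess of at least 1/q, so the climb starts with q₀ = q and δ = 1.
-- After r + 3 extensions the factor is 64 · 4^r, more than 27 q.
weil : (FF : FiniteField) (r : ℕ) (card : length (FiniteField.elements FF) ≡ 2 ℕ.^ r) →
  ∀ {a} → a ≢ FiniteField.0F FF → let open Setup FF r in K a ℤ.* K a ℤ.≤ + 4 ℤ.* + q
weil FF r card {a} a≢0 = ℤP.≮⇒≥ (λ lt → ℕP.<⇒≱ big (ℤP.drop‿+≤+ (subst₂ ℤ._≤_ refl (sym (ℤP.pos-* 27 q))
    (excess-bound (r ℕ.+ 2) FF r card a≢0 q 1 (ℕP.m^n>0 2 r) (excess lt)))))
  where
  open Setup FF r
  excess : + 4 ℤ.* + q ℤ.< K a ℤ.* K a → (+ 4 ℤ.* + q ℤ.+ 1ℤ) ℤ.* + q ℤ.≤ + q ℤ.* (K a ℤ.* K a)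
  excess lt = subst (ℤ._≤ + q ℤ.* (K a ℤ.* K a)) (lem (+ q)) (ℤP.*-monoˡ-≤-nonNeg (+ q) (ℤP.i<j⇒suc[i]≤j lt))
    where
    lem : ∀ x → x ℤ.* (1ℤ ℤ.+ + 4 ℤ.* x) ≡ (+ 4 ℤ.* x ℤ.+ 1ℤ) ℤ.* x
    lem = solve-∀
  big : 27 ℕ.* q ℕ.< 4 ℕ.^ suc (r ℕ.+ 2) ℕ.* 1
  big = begin-strict
    27 ℕ.* 2 ℕ.^ r <⟨ ℕP.*-monoˡ-< (2 ℕ.^ r) ⦃ ℕP.m^n≢0 2 r ⦄ (ℕP.m<m+n 27 {37} (ℕ.s≤s ℕ.z≤n)) ⟩
    64 ℕ.* 2 ℕ.^ r ≤⟨ ℕP.*-monoʳ-≤ 64 (ℕP.^-monoˡ-≤ r (ℕP.m≤m+n 2 2)) ⟩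
    64 ℕ.* 4 ℕ.^ r ≡⟨ lem (4 ℕ.^ r) ⟩
    4 ℕ.* (4 ℕ.^ r ℕ.* 4 ℕ.^ 2) ℕ.* 1 ≡⟨ cong (λ z → 4 ℕ.* z ℕ.* 1) (ℕP.^-distribˡ-+-* 4 r 2) ⟨
    4 ℕ.^ suc (r ℕ.+ 2) ℕ.* 1 ∎
    where
    open ℕP.≤-Reasoning
    lem : ∀ x → 64 ℕ.* x ≡ 4 ℕ.* (x ℕ.* 16) ℕ.* 1
    lem = solve-∀ᴺ

-- Sums over initial segments of ℕ

∑< : ℕ → (ℕ → ℤ) → ℤ
∑< zero    f = 0ℤ
∑< (suc n) f = f 0 ℤ.+ ∑< n (f ∘ suc)

∑-applyUpTo : ∀ {A : Set} (g : ℕ → A) n (f : A → ℤ) → ∑ (applyUpTo g n) f ≡ ∑< n (f ∘ g)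
∑-applyUpTo g zero    f = refl
∑-applyUpTo g (suc n) f = cong (λ z → f (g 0) ℤ.+ z) (∑-applyUpTo (g ∘ suc) n f)

∑-upTo : ∀ n (f : ℕ → ℤ) → ∑ (upTo n) f ≡ ∑< n f
∑-upTo = ∑-applyUpTo id

∑<-cong : ∀ n {f g : ℕ → ℤ} → (∀ i → i ℕ.< n → f i ≡ g i) → ∑< n f ≡ ∑< n g
∑<-cong zero    e = refl
∑<-cong (suc n) e = cong₂ ℤ._+_ (e 0 (ℕ.s≤s ℕ.z≤n)) (∑<-cong n (λ i lt → e (suc i) (ℕ.s≤s lt)))

∑<-0 : ∀ n {f : ℕ → ℤ} → (∀ i → i ℕ.< n → f i ≡ 0ℤ) → ∑< n f ≡ 0ℤ
∑<-0 zero    e = refl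
∑<-0 (suc n) e = cong₂ ℤ._+_ (e 0 (ℕ.s≤s ℕ.z≤n)) (∑<-0 n (λ i lt → e (suc i) (ℕ.s≤s lt)))

∑<-+ : ∀ n (f g : ℕ → ℤ) → ∑< n (λ i → f i ℤ.+ g i) ≡ ∑< n f ℤ.+ ∑< n g
∑<-+ zero    f g = refl
∑<-+ (suc n) f g = trans (cong (λ z → f 0 ℤ.+ g 0 ℤ.+ z) (∑<-+ n _ _)) (lem (f 0) (g 0) _ _)
  where
  lem : ∀ a b c d → a ℤ.+ b ℤ.+ (c ℤ.+ d) ≡ a ℤ.+ c ℤ.+ (b ℤ.+ d)
  lem = solve-∀

∑<-*ˡ : ∀ n c (f : ℕ → ℤ) → ∑< n (λ i → c ℤ.* f i) ≡ c ℤ.* ∑< n f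
∑<-*ˡ zero    c f = sym (ℤP.*-zeroʳ c)
∑<-*ˡ (suc n) c f = trans (cong (λ z → c ℤ.* f 0 ℤ.+ z) (∑<-*ˡ n c _)) (sym (ℤP.*-distribˡ-+ c (f 0) _))

∑<-split : ∀ m n (f : ℕ → ℤ) → ∑< (m ℕ.+ n) f ≡ ∑< m f ℤ.+ ∑< n (λ i → f (m ℕ.+ i))
∑<-split zero    n f = sym (ℤP.+-identityˡ _)
∑<-split (suc m) n f = trans (cong (λ z → f 0 ℤ.+ z) (∑<-split m n _)) (sym (ℤP.+-assoc (f 0) _ _))

∑<-last : ∀ n (f : ℕ → ℤ) → ∑< (suc n) f ≡ ∑< n f ℤ.+ f n
∑<-last n f = trans (cong (λ k → ∑< k f) (ℕP.+-comm 1 n)) (trans (∑<-split n 1 f)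
  (cong (λ z → ∑< n f ℤ.+ z) (trans (ℤP.+-identityʳ _) (cong f (ℕP.+-identityʳ n)))))

∑-fromTo : ∀ a b (f : ℕ → ℤ) → (∀ i → i ℕ.< a → f i ≡ 0ℤ) → ∑ (fromTo a b) f ≡ ∑< (suc b) f
∑-fromTo a b f z = trans (∑-applyUpTo (a ℕ.+_) (suc b ℕ.∸ a) f) (go (ℕP.≤-total a (suc b)))
  where
  go : a ℕ.≤ suc b ⊎ suc b ℕ.≤ a → ∑< (suc b ℕ.∸ a) (λ i → f (a ℕ.+ i)) ≡ ∑< (suc b) f
  go (inj₁ le) = sym (trans (cong (λ k → ∑< k f) (sym (ℕP.m+[n∸m]≡n le))) (trans (∑<-split a (suc b ℕ.∸ a) f)
    (trans (cong (ℤ._+ ∑< (suc b ℕ.∸ a) (λ i → f (a ℕ.+ i))) (∑<-0 a z)) (ℤP.+-identityˡ _))))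
  go (inj₂ ge) = trans (cong (λ k → ∑< k (λ i → f (a ℕ.+ i))) (ℕP.m≤n⇒m∸n≡0 ge))
    (sym (∑<-0 (suc b) (λ i lt → z i (ℕP.≤-trans lt ge))))

-- Binomial coefficients and Stirling numbers of the second kind

nC0≡1 : ∀ n → n C 0 ≡ 1
nC0≡1 n = trans (nCk≡nC[n∸k] {0} {n} ℕ.z≤n) (nCn≡1 n)

pascal : ∀ n k → + (suc n C suc k) ≡ + (n C k) ℤ.+ + (n C suc k)
pascal n k = cong +_ (sym (nCk+nC[k+1]≡[n+1]C[k+1] n k))

absorption : ∀ n k → + suc k ℤ.* + (suc n C suc k) ≡ + suc n ℤ.* + (n C k)
absorption zero    zero    = refl
absorption zero    (suc k) = trans (cong (λ z → + suc (suc k) ℤ.* + z) (k>n⇒nCk≡0 {1} {suc (suc k)} (ℕ.s≤s (ℕ.s≤s ℕ.z≤n))))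
  (trans (ℤP.*-zeroʳ (+ suc (suc k))) (sym (cong (λ z → 1ℤ ℤ.* + z) (k>n⇒nCk≡0 {0} {suc k} (ℕ.s≤s ℕ.z≤n)))))
absorption (suc n) zero    = trans (cong (λ z → 1ℤ ℤ.* + z) (nC1≡n (suc (suc n)))) (trans (ℤP.*-comm 1ℤ (+ suc (suc n)))
  (cong (λ z → + suc (suc n) ℤ.* + z) (sym (nC0≡1 (suc n)))))
absorption (suc n) (suc k) = begin
  + suc (suc k) ℤ.* + (suc (suc n) C suc (suc k)) ≡⟨ cong (+ suc (suc k) ℤ.*_) (pascal (suc n) (suc k)) ⟩
  + suc (suc k) ℤ.* (A ℤ.+ B) ≡⟨ lem₁ (+ suc k) A B ⟩
  + suc k ℤ.* A ℤ.+ A ℤ.+ + suc (suc k) ℤ.* B ≡⟨ cong₂ (λ x y → x ℤ.+ A ℤ.+ y) (absorption n k) (absorption n (suc k)) ⟩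
  + suc n ℤ.* + (n C k) ℤ.+ A ℤ.+ + suc n ℤ.* + (n C suc k) ≡⟨ lem₂ (+ suc n) (+ (n C k)) (+ (n C suc k)) A ⟩
  + suc n ℤ.* (+ (n C k) ℤ.+ + (n C suc k)) ℤ.+ A ≡⟨ cong (λ z → + suc n ℤ.* z ℤ.+ A) (pascal n k) ⟨
  + suc n ℤ.* A ℤ.+ A ≡⟨ lem₃ (+ suc n) A ⟩
  + suc (suc n) ℤ.* A ∎
  where
  open ≡-Reasoning
  A = + (suc n C suc k)
  B = + (suc n C suc (suc k))
  lem₁ : ∀ k a b → (1ℤ ℤ.+ k) ℤ.* (a ℤ.+ b) ≡ k ℤ.* a ℤ.+ a ℤ.+ (1ℤ ℤ.+ k) ℤ.* b
  lem₁ = solve-∀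
  lem₂ : ∀ n x y a → n ℤ.* x ℤ.+ a ℤ.+ n ℤ.* y ≡ n ℤ.* (x ℤ.+ y) ℤ.+ a
  lem₂ = solve-∀
  lem₃ : ∀ n a → n ℤ.* a ℤ.+ a ≡ (1ℤ ℤ.+ n) ℤ.* a
  lem₃ = solve-∀

-- The factor w is split as t + (w - t), and the second part is absorbed into C(w, t + 1).
w*wCt : ∀ w t → + w ℤ.* + (w C t) ≡ + t ℤ.* + (w C t) ℤ.+ + suc t ℤ.* + (w C suc t)
w*wCt w t = ℤ+-cancelˡ (+ (w C t)) (begin
  + (w C t) ℤ.+ + w ℤ.* + (w C t) ≡⟨ lem₁ (+ w) (+ (w C t)) ⟩
  + suc w ℤ.* + (w C t) ≡⟨ absorption w t ⟨
  + suc t ℤ.* + (suc w C suc t) ≡⟨ cong (+ suc t ℤ.*_) (pascal w t) ⟩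
  + suc t ℤ.* (+ (w C t) ℤ.+ + (w C suc t)) ≡⟨ lem₂ (+ t) (+ (w C t)) (+ (w C suc t)) ⟩
  + (w C t) ℤ.+ (+ t ℤ.* + (w C t) ℤ.+ + suc t ℤ.* + (w C suc t)) ∎)
  where
  open ≡-Reasoning
  lem₁ : ∀ w c → c ℤ.+ w ℤ.* c ≡ (1ℤ ℤ.+ w) ℤ.* c
  lem₁ = solve-∀
  lem₂ : ∀ t c d → (1ℤ ℤ.+ t) ℤ.* (c ℤ.+ d) ≡ c ℤ.+ (t ℤ.* c ℤ.+ (1ℤ ℤ.+ t) ℤ.* d)
  lem₂ = solve-∀

j*tCj : ∀ t j → + j ℤ.* + (suc t C j) ≡ + suc t ℤ.* (+ (suc t C j) ℤ.- + (t C j))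
j*tCj t zero    = sym (trans (cong (+ suc t ℤ.*_) (trans (cong₂ (λ x y → + x ℤ.- + y) (nC0≡1 (suc t)) (nC0≡1 t)) refl)) (ℤP.*-zeroʳ (+ suc t)))
j*tCj t (suc j) = trans (absorption t j) (cong (+ suc t ℤ.*_) (trans (lem (+ (t C j)) (+ (t C suc j))) (cong (ℤ._- + (t C suc j)) (sym (pascal t j)))))
  where
  lem : ∀ a b → a ≡ a ℤ.+ b ℤ.- b
  lem = solve-∀

binomial : ∀ h x y → (x ℤ.+ y) ℤ.^ h ≡ ∑< (suc h) (λ l → + (h C l) ℤ.* x ℤ.^ l ℤ.* y ℤ.^ (h ℕ.∸ l))
binomial zero    x y = refl
binomial (suc h) x y = sym (begin
  + (suc h C 0) ℤ.* 1ℤ ℤ.* y ℤ.^ suc h ℤ.+ ∑< (suc h) (λ l → + (suc h C suc l) ℤ.* x ℤ.^ suc l ℤ.* y ℤ.^ (h ℕ.∸ l))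
    ≡⟨ cong₂ (λ s t → + s ℤ.* 1ℤ ℤ.* y ℤ.^ suc h ℤ.+ t) (nC0≡1 (suc h)) (trans (∑<-cong (suc h) (λ l _ → step l)) (∑<-+ (suc h) (λ l → x ℤ.* f l) g)) ⟩
  1ℤ ℤ.* 1ℤ ℤ.* y ℤ.^ suc h ℤ.+ (∑< (suc h) (λ l → x ℤ.* f l) ℤ.+ ∑< (suc h) g)
    ≡⟨ lem (y ℤ.^ suc h) (∑< (suc h) (λ l → x ℤ.* f l)) (∑< (suc h) g) ⟩
  ∑< (suc h) (λ l → x ℤ.* f l) ℤ.+ (y ℤ.^ suc h ℤ.+ ∑< (suc h) g)
    ≡⟨ cong₂ ℤ._+_ (trans (∑<-*ˡ (suc h) x f) (cong (x ℤ.*_) (sym (binomial h x y)))) ys ⟩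
  x ℤ.* (x ℤ.+ y) ℤ.^ h ℤ.+ y ℤ.* (x ℤ.+ y) ℤ.^ h
    ≡⟨ ℤP.*-distribʳ-+ ((x ℤ.+ y) ℤ.^ h) x y ⟨
  (x ℤ.+ y) ℤ.^ suc h ∎)
  where
  open ≡-Reasoning
  f g : ℕ → ℤ
  f l = + (h C l) ℤ.* x ℤ.^ l ℤ.* y ℤ.^ (h ℕ.∸ l)
  g l = + (h C suc l) ℤ.* x ℤ.^ suc l ℤ.* y ℤ.^ (h ℕ.∸ l)
  lem : ∀ a b c → 1ℤ ℤ.* 1ℤ ℤ.* a ℤ.+ (b ℤ.+ c) ≡ b ℤ.+ (a ℤ.+ c)
  lem = solve-∀
  step : ∀ l → + (suc h C suc l) ℤ.* x ℤ.^ suc l ℤ.* y ℤ.^ (h ℕ.∸ l) ≡ x ℤ.* f l ℤ.+ g l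
  step l = trans (cong (λ z → z ℤ.* x ℤ.^ suc l ℤ.* y ℤ.^ (h ℕ.∸ l)) (pascal h l)) (lem′ (+ (h C l)) (+ (h C suc l)) x (x ℤ.^ l) (y ℤ.^ (h ℕ.∸ l)))
    where
    lem′ : ∀ a b x u v → (a ℤ.+ b) ℤ.* (x ℤ.* u) ℤ.* v ≡ x ℤ.* (a ℤ.* u ℤ.* v) ℤ.+ b ℤ.* (x ℤ.* u) ℤ.* v
    lem′ = solve-∀
  shift : ∀ l → l ℕ.< h → g l ≡ y ℤ.* f (suc l)
  shift l lt = trans (cong (λ k → + (h C suc l) ℤ.* x ℤ.^ suc l ℤ.* y ℤ.^ k) (ℕP.+-∸-assoc 1 lt)) (lem′ (+ (h C suc l) ℤ.* x ℤ.^ suc l) y (y ℤ.^ (h ℕ.∸ suc l)))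
    where
    lem′ : ∀ a y v → a ℤ.* (y ℤ.* v) ≡ y ℤ.* (a ℤ.* v)
    lem′ = solve-∀
  ys : y ℤ.^ suc h ℤ.+ ∑< (suc h) g ≡ y ℤ.* (x ℤ.+ y) ℤ.^ h
  ys = begin
    y ℤ.^ suc h ℤ.+ ∑< (suc h) g ≡⟨ cong (λ z → y ℤ.^ suc h ℤ.+ z) (trans (∑<-last h g) (trans (cong₂ ℤ._+_ (∑<-cong h shift)
                                                            (cong (λ z → + z ℤ.* x ℤ.^ suc h ℤ.* y ℤ.^ (h ℕ.∸ h)) (k>n⇒nCk≡0 {h} {suc h} ℕP.≤-refl))) (ℤP.+-identityʳ _))) ⟩
    y ℤ.^ suc h ℤ.+ ∑< h (λ l → y ℤ.* f (suc l)) ≡⟨ cong₂ ℤ._+_ (trans (lem″ y (y ℤ.^ h)) (cong (λ z → y ℤ.* (+ z ℤ.* 1ℤ ℤ.* y ℤ.^ h)) (sym (nC0≡1 h)))) (∑<-*ˡ h y (f ∘ suc)) ⟩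
    y ℤ.* f 0 ℤ.+ y ℤ.* ∑< h (f ∘ suc) ≡⟨ ℤP.*-distribˡ-+ y (f 0) _ ⟨
    y ℤ.* ∑< (suc h) f ≡⟨ cong (y ℤ.*_) (binomial h x y) ⟨
    y ℤ.* (x ℤ.+ y) ℤ.^ h ∎
    where
    lem″ : ∀ y a → y ℤ.* a ≡ y ℤ.* (1ℤ ℤ.* 1ℤ ℤ.* a)
    lem″ = solve-∀

-- t! S(h,t)
surj : ℕ → ℕ → ℤ
surj h t = sumℤ (map (λ j → sgn (t ℕ.∸ j) ℤ.* (+ (t C j)) ℤ.* (+ (j ℕ.^ h))) (fromTo 0 t))

surj-∑ : ∀ h t → surj h t ≡ ∑< (suc t) (λ j → sgn (t ℕ.∸ j) ℤ.* (+ (t C j)) ℤ.* (+ (j ℕ.^ h)))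
surj-∑ h t = ∑-fromTo 0 t (λ j → sgn (t ℕ.∸ j) ℤ.* (+ (t C j)) ℤ.* (+ (j ℕ.^ h))) (λ _ ())

-- The sum is the binomial expansion of (1 - 1)^(t+1).
surj-0-suc : ∀ t → surj 0 (suc t) ≡ 0ℤ
surj-0-suc t = trans (surj-∑ 0 (suc t)) (trans (∑<-cong (suc (suc t)) step) (sym (binomial (suc t) 1ℤ ℤ.-1ℤ)))
  where
  step : ∀ j → j ℕ.< suc (suc t) → sgn (suc t ℕ.∸ j) ℤ.* (+ (suc t C j)) ℤ.* 1ℤ ≡ + (suc t C j) ℤ.* 1ℤ ℤ.^ j ℤ.* ℤ.-1ℤ ℤ.^ (suc t ℕ.∸ j)
  step j _ = trans (lem (sgn (suc t ℕ.∸ j)) (+ (suc t C j))) (cong (λ z → + (suc t C j) ℤ.* z ℤ.* sgn (suc t ℕ.∸ j)) (sym (ℤP.^-zeroˡ j)))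
    where
    lem : ∀ s c → s ℤ.* c ℤ.* 1ℤ ≡ c ℤ.* 1ℤ ℤ.* s
    lem = solve-∀

-- The additional factor j is absorbed by j C(t+1, j) = (t+1)(C(t+1, j) - C(t, j)).
surj-suc : ∀ h t → surj (suc h) (suc t) ≡ + suc t ℤ.* (surj h (suc t) ℤ.+ surj h t)
surj-suc h t = begin
  surj (suc h) (suc t) ≡⟨ surj-∑ (suc h) (suc t) ⟩
  ∑< (suc (suc t)) (λ j → σ j ℤ.* + (suc t C j) ℤ.* + (j ℕ.^ suc h))
    ≡⟨ ∑<-cong (suc (suc t)) (λ j _ → step j) ⟩
  ∑< (suc (suc t)) (λ j → + suc t ℤ.* (σ j ℤ.* + (suc t C j) ℤ.* + (j ℕ.^ h) ℤ.+ g j))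
    ≡⟨ trans (∑<-*ˡ (suc (suc t)) (+ suc t) (λ j → f j ℤ.+ g j)) (cong (+ suc t ℤ.*_) (∑<-+ (suc (suc t)) f g)) ⟩
  + suc t ℤ.* (∑< (suc (suc t)) (λ j → σ j ℤ.* + (suc t C j) ℤ.* + (j ℕ.^ h)) ℤ.+ ∑< (suc (suc t)) g)
    ≡⟨ cong (+ suc t ℤ.*_) (cong₂ ℤ._+_ (sym (surj-∑ h (suc t))) tail) ⟩
  + suc t ℤ.* (surj h (suc t) ℤ.+ surj h t) ∎
  where
  open ≡-Reasoning
  σ f g : ℕ → ℤ
  σ j = sgn (suc t ℕ.∸ j)
  f j = σ j ℤ.* + (suc t C j) ℤ.* + (j ℕ.^ h)
  g j = ℤ.-1ℤ ℤ.* (σ j ℤ.* + (t C j) ℤ.* + (j ℕ.^ h))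
  step : ∀ j → σ j ℤ.* + (suc t C j) ℤ.* + (j ℕ.^ suc h) ≡ + suc t ℤ.* (σ j ℤ.* + (suc t C j) ℤ.* + (j ℕ.^ h) ℤ.+ g j)
  step j = trans (cong (λ z → σ j ℤ.* + (suc t C j) ℤ.* z) (ℤP.pos-* j (j ℕ.^ h))) (trans (lem₁ (σ j) (+ (suc t C j)) (+ j) (+ (j ℕ.^ h)))
    (trans (cong (λ z → σ j ℤ.* z ℤ.* + (j ℕ.^ h)) (j*tCj t j)) (lem₂ (σ j) (+ suc t) (+ (suc t C j)) (+ (t C j)) (+ (j ℕ.^ h)))))
    where
    lem₁ : ∀ s c j p → s ℤ.* c ℤ.* (j ℤ.* p) ≡ s ℤ.* (j ℤ.* c) ℤ.* p
    lem₁ = solve-∀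
    lem₂ : ∀ s t c d p → s ℤ.* (t ℤ.* (c ℤ.- d)) ℤ.* p ≡ t ℤ.* (s ℤ.* c ℤ.* p ℤ.+ ℤ.-1ℤ ℤ.* (s ℤ.* d ℤ.* p))
    lem₂ = solve-∀
  tail : ∑< (suc (suc t)) g ≡ surj h t
  tail = begin
    ∑< (suc (suc t)) g ≡⟨ ∑<-last (suc t) g ⟩
    ∑< (suc t) g ℤ.+ g (suc t) ≡⟨ cong₂ ℤ._+_ (∑<-cong (suc t) flip) (trans (cong (λ z → ℤ.-1ℤ ℤ.* (σ (suc t) ℤ.* + z ℤ.* + (suc t ℕ.^ h))) (k>n⇒nCk≡0 {t} {suc t} ℕP.≤-refl)) (lem (σ (suc t)) (+ (suc t ℕ.^ h)))) ⟩
    ∑< (suc t) (λ j → sgn (t ℕ.∸ j) ℤ.* + (t C j) ℤ.* + (j ℕ.^ h)) ℤ.+ 0ℤ ≡⟨ ℤP.+-identityʳ _ ⟩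
    ∑< (suc t) (λ j → sgn (t ℕ.∸ j) ℤ.* + (t C j) ℤ.* + (j ℕ.^ h)) ≡⟨ surj-∑ h t ⟨
    surj h t ∎
    where
    lem : ∀ s p → ℤ.-1ℤ ℤ.* (s ℤ.* 0ℤ ℤ.* p) ≡ 0ℤ
    lem = solve-∀
    flip : ∀ j → j ℕ.< suc t → g j ≡ sgn (t ℕ.∸ j) ℤ.* + (t C j) ℤ.* + (j ℕ.^ h)
    flip j (ℕ.s≤s le) = trans (cong (λ k → ℤ.-1ℤ ℤ.* (sgn k ℤ.* + (t C j) ℤ.* + (j ℕ.^ h))) (ℕP.+-∸-assoc 1 le)) (lem′ (sgn (t ℕ.∸ j)) (+ (t C j)) (+ (j ℕ.^ h)))
      where
      lem′ : ∀ s c p → ℤ.-1ℤ ℤ.* (ℤ.-1ℤ ℤ.* s ℤ.* c ℤ.* p) ≡ s ℤ.* c ℤ.* p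
      lem′ = solve-∀

surj-> : ∀ h t → h ℕ.< t → surj h t ≡ 0ℤ
surj-> zero    (suc t) _          = surj-0-suc t
surj-> (suc h) (suc t) (ℕ.s≤s lt) = trans (surj-suc h t)
  (trans (cong₂ (λ a b → + suc t ℤ.* (a ℤ.+ b)) (surj-> h (suc t) (ℕP.m<n⇒m<1+n lt)) (surj-> h t lt)) (ℤP.*-zeroʳ (+ suc t)))

-- Words of length h over w letters, sorted by the set of letters that occur: each t-set is hit by
-- t! S(h,t) words. In the induction on h, `w*wCt` supplies the same recurrence as `surj-suc`.
power-expansion : ∀ h w → (+ w) ℤ.^ h ≡ ∑< (suc h) (λ t → surj h t ℤ.* + (w C t))
power-expansion zero    w = sym (trans (ℤP.+-identityʳ _) (cong (λ z → 1ℤ ℤ.* + z) (nC0≡1 w)))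
power-expansion (suc h) w = begin
  + w ℤ.* (+ w) ℤ.^ h ≡⟨ cong (+ w ℤ.*_) (power-expansion h w) ⟩
  + w ℤ.* ∑< (suc h) (λ t → surj h t ℤ.* + (w C t)) ≡⟨ ∑<-*ˡ (suc h) (+ w) (λ t → surj h t ℤ.* + (w C t)) ⟨
  ∑< (suc h) (λ t → + w ℤ.* (surj h t ℤ.* + (w C t))) ≡⟨ trans (∑<-cong (suc h) (λ t _ → step t)) (∑<-+ (suc h) f g) ⟩
  ∑< (suc h) f ℤ.+ ∑< (suc h) (λ t → + suc t ℤ.* (surj h t ℤ.* + (w C suc t))) ≡⟨ cong (ℤ._+ ∑< (suc h) (λ t → + suc t ℤ.* (surj h t ℤ.* + (w C suc t)))) fs ⟩
  ∑< (suc h) (f ∘ suc) ℤ.+ ∑< (suc h) (λ t → + suc t ℤ.* (surj h t ℤ.* + (w C suc t))) ≡⟨ ∑<-+ (suc h) (f ∘ suc) g ⟨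
  ∑< (suc h) (λ t → f (suc t) ℤ.+ + suc t ℤ.* (surj h t ℤ.* + (w C suc t))) ≡⟨ ∑<-cong (suc h) (λ t _ → trans (lem (+ suc t) (surj h (suc t)) (surj h t) (+ (w C suc t))) (cong (ℤ._* + (w C suc t)) (sym (surj-suc h t)))) ⟩
  ∑< (suc h) (λ t → surj (suc h) (suc t) ℤ.* + (w C suc t)) ≡⟨ ℤP.+-identityˡ _ ⟨
  ∑< (suc (suc h)) (λ t → surj (suc h) t ℤ.* + (w C t)) ∎
  where
  open ≡-Reasoning
  f g : ℕ → ℤ
  f t = + t ℤ.* (surj h t ℤ.* + (w C t))
  g t = + suc t ℤ.* (surj h t ℤ.* + (w C suc t))
  lem : ∀ a b c d → a ℤ.* (b ℤ.* d) ℤ.+ a ℤ.* (c ℤ.* d) ≡ a ℤ.* (b ℤ.+ c) ℤ.* d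
  lem = solve-∀
  step : ∀ t → + w ℤ.* (surj h t ℤ.* + (w C t)) ≡ f t ℤ.+ + suc t ℤ.* (surj h t ℤ.* + (w C suc t))
  step t = trans (lem₁ (+ w) (surj h t) (+ (w C t))) (trans (cong (surj h t ℤ.*_) (w*wCt w t)) (lem₂ (surj h t) (+ t) (+ suc t) (+ (w C t)) (+ (w C suc t))))
    where
    lem₁ : ∀ w s c → w ℤ.* (s ℤ.* c) ≡ s ℤ.* (w ℤ.* c)
    lem₁ = solve-∀
    lem₂ : ∀ s t t′ c d → s ℤ.* (t ℤ.* c ℤ.+ t′ ℤ.* d) ≡ t ℤ.* (s ℤ.* c) ℤ.+ t′ ℤ.* (s ℤ.* d)
    lem₂ = solve-∀
  fs : ∑< (suc h) f ≡ ∑< (suc h) (f ∘ suc)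
  fs = trans (ℤP.+-identityˡ (∑< h (f ∘ suc))) (sym (trans (∑<-last h (f ∘ suc)) (trans (cong (λ z → ∑< h (f ∘ suc) ℤ.+ z)
    (trans (cong (λ z → + suc h ℤ.* (z ℤ.* + (w C suc h))) (surj-> h (suc h) ℕP.≤-refl)) (ℤP.*-zeroʳ (+ suc h)))) (ℤP.+-identityʳ (∑< h (f ∘ suc))))))

-- Shifted moments

sgn-+ : ∀ m n → sgn (m ℕ.+ n) ≡ sgn m ℤ.* sgn n
sgn-+ = ℤP.^-distribˡ-+-* ℤ.-1ℤ

sgn-sq : ∀ n → sgn n ℤ.* sgn n ≡ 1ℤ
sgn-sq zero    = refl
sgn-sq (suc n) = trans (lem (sgn n)) (sgn-sq n)
  where
  lem : ∀ s → ℤ.-1ℤ ℤ.* s ℤ.* (ℤ.-1ℤ ℤ.* s) ≡ s ℤ.* s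
  lem = solve-∀

^-distribʳ-* : ∀ n x y → (x ℤ.* y) ℤ.^ n ≡ x ℤ.^ n ℤ.* y ℤ.^ n
^-distribʳ-* zero    x y = refl
^-distribʳ-* (suc n) x y = trans (cong (λ z → x ℤ.* y ℤ.* z) (^-distribʳ-* n x y)) (lem x y (x ℤ.^ n) (y ℤ.^ n))
  where
  lem : ∀ x y a b → x ℤ.* y ℤ.* (a ℤ.* b) ≡ x ℤ.* a ℤ.* (y ℤ.* b)
  lem = solve-∀

sgn-^ : ∀ n x → (ℤ.- x) ℤ.^ n ≡ sgn n ℤ.* x ℤ.^ n
sgn-^ n x = trans (cong (ℤ._^ n) (sym (ℤP.-1*i≡-i x))) (^-distribʳ-* n ℤ.-1ℤ x)

-- The expansion of (X - c)^h solved for X^h; carrying the other terms across turns (-1)^(h-l) into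
-- (-1)^(h+l+1).
moment-shift : {A : Set} (xs : List A) (X : A → ℤ) (c : ℤ) (h : ℕ) →
  ∑ xs (λ a → X a ℤ.^ h) ≡
  ∑ (upTo h) (λ l → sgn (h ℕ.+ l ℕ.+ 1) ℤ.* (+ (h C l)) ℤ.* (c ℤ.^ (h ℕ.∸ l)) ℤ.* ∑ xs (λ a → X a ℤ.^ l))
    ℤ.+ ∑ xs (λ a → (X a ℤ.- c) ℤ.^ h)
moment-shift xs X c h = begin
  ∑ xs (λ a → X a ℤ.^ h)
    ≡⟨ ∑-cong xs (λ a → pointwise (X a)) ⟩
  ∑ xs (λ a → ∑ (upTo h) (λ l → coef l ℤ.* X a ℤ.^ l) ℤ.+ (X a ℤ.- c) ℤ.^ h)
    ≡⟨ trans (∑-+ xs _ _) (cong (ℤ._+ ∑ xs (λ a → (X a ℤ.- c) ℤ.^ h)) (trans (∑-swap xs (upTo h) _) (∑-cong (upTo h) (λ l → ∑-*ˡ xs (coef l) _)))) ⟩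
  ∑ (upTo h) (λ l → coef l ℤ.* ∑ xs (λ a → X a ℤ.^ l)) ℤ.+ ∑ xs (λ a → (X a ℤ.- c) ℤ.^ h) ∎
  where
  open ≡-Reasoning
  coef : ℕ → ℤ
  coef l = sgn (h ℕ.+ l ℕ.+ 1) ℤ.* (+ (h C l)) ℤ.* (c ℤ.^ (h ℕ.∸ l))
  pointwise : ∀ x → x ℤ.^ h ≡ ∑ (upTo h) (λ l → coef l ℤ.* x ℤ.^ l) ℤ.+ (x ℤ.- c) ℤ.^ h
  pointwise x = sym (begin
    ∑ (upTo h) (λ l → coef l ℤ.* x ℤ.^ l) ℤ.+ (x ℤ.- c) ℤ.^ h ≡⟨ cong₂ ℤ._+_ (∑-upTo h _) (trans (binomial h x (ℤ.- c)) (∑<-last h _)) ⟩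
    ∑< h (λ l → coef l ℤ.* x ℤ.^ l) ℤ.+ (∑< h b ℤ.+ b h) ≡⟨ ℤP.+-assoc (∑< h (λ l → coef l ℤ.* x ℤ.^ l)) _ _ ⟨
    ∑< h (λ l → coef l ℤ.* x ℤ.^ l) ℤ.+ ∑< h b ℤ.+ b h ≡⟨ cong₂ ℤ._+_ (trans (sym (∑<-+ h _ _)) (∑<-0 h cancel)) last ⟩
    0ℤ ℤ.+ x ℤ.^ h ≡⟨ ℤP.+-identityˡ _ ⟩
    x ℤ.^ h ∎)
    where
    b : ℕ → ℤ
    b l = + (h C l) ℤ.* x ℤ.^ l ℤ.* (ℤ.- c) ℤ.^ (h ℕ.∸ l)
    last : b h ≡ x ℤ.^ h
    last = trans (cong₂ (λ u v → + u ℤ.* x ℤ.^ h ℤ.* (ℤ.- c) ℤ.^ v) (nCn≡1 h) (ℕP.n∸n≡0 h)) (lem (x ℤ.^ h))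
      where
      lem : ∀ x → 1ℤ ℤ.* x ℤ.* 1ℤ ≡ x
      lem = solve-∀
    cancel : ∀ l → l ℕ.< h → coef l ℤ.* x ℤ.^ l ℤ.+ b l ≡ 0ℤ
    cancel l lt = trans (cong₂ (λ u v → u ℤ.* + (h C l) ℤ.* c ℤ.^ (h ℕ.∸ l) ℤ.* x ℤ.^ l ℤ.+ + (h C l) ℤ.* x ℤ.^ l ℤ.* v) sign (sgn-^ (h ℕ.∸ l) c))
        (lem (sgn (h ℕ.∸ l)) (+ (h C l)) (c ℤ.^ (h ℕ.∸ l)) (x ℤ.^ l))
      where
      lem : ∀ s b c x → ℤ.- s ℤ.* b ℤ.* c ℤ.* x ℤ.+ b ℤ.* x ℤ.* (s ℤ.* c) ≡ 0ℤ
      lem = solve-∀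
      sign : sgn (h ℕ.+ l ℕ.+ 1) ≡ ℤ.- sgn (h ℕ.∸ l)
      sign = begin
        sgn (h ℕ.+ l ℕ.+ 1) ≡⟨ cong (λ k → sgn (k ℕ.+ l ℕ.+ 1)) (ℕP.m∸n+n≡m (ℕP.<⇒≤ lt)) ⟨
        sgn (h ℕ.∸ l ℕ.+ l ℕ.+ l ℕ.+ 1) ≡⟨ trans (sgn-+ (h ℕ.∸ l ℕ.+ l ℕ.+ l) 1) (cong (ℤ._* ℤ.-1ℤ) (trans (sgn-+ (h ℕ.∸ l ℕ.+ l) l) (cong (ℤ._* sgn l) (sgn-+ (h ℕ.∸ l) l)))) ⟩
        sgn (h ℕ.∸ l) ℤ.* sgn l ℤ.* sgn l ℤ.* ℤ.-1ℤ ≡⟨ trans (cong (ℤ._* ℤ.-1ℤ) (trans (ℤP.*-assoc (sgn (h ℕ.∸ l)) _ _) (cong (sgn (h ℕ.∸ l) ℤ.*_) (sgn-sq l)))) (lem′ (sgn (h ℕ.∸ l))) ⟩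
        ℤ.- sgn (h ℕ.∸ l) ∎
        where
        lem′ : ∀ s → s ℤ.* 1ℤ ℤ.* ℤ.-1ℤ ≡ ℤ.- s
        lem′ = solve-∀

-- From ℤ to ℚ

ℤ→ℚᵘ : ∀ n d .{{_ : ℕ.NonZero d}} → ℚ.toℚᵘ (n ℚ./ d) ℚᵘ.≃ n ℚᵘ./ d
ℤ→ℚᵘ n (suc d) = ℚP.toℚᵘ-fromℚᵘ (ℚᵘ.mkℚᵘ n d)

ℤ→ℚ-+ : ∀ x y → ℤ→ℚ (x ℤ.+ y) ≡ ℤ→ℚ x ℚ.+ ℤ→ℚ y
ℤ→ℚ-+ x y = ℚP.toℚᵘ-injective (ℚᵘP.≃-trans (ℤ→ℚᵘ (x ℤ.+ y) 1) (ℚᵘP.≃-trans (ℚᵘ.*≡* (lem x y))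
  (ℚᵘP.≃-sym (ℚᵘP.≃-trans (ℚP.toℚᵘ-homo-+ (ℤ→ℚ x) (ℤ→ℚ y)) (ℚᵘP.+-cong (ℤ→ℚᵘ x 1) (ℤ→ℚᵘ y 1))))))
  where
  lem : ∀ x y → (x ℤ.+ y) ℤ.* 1ℤ ≡ (x ℤ.* 1ℤ ℤ.+ y ℤ.* 1ℤ) ℤ.* 1ℤ
  lem = solve-∀

ℤ→ℚ-* : ∀ x y → ℤ→ℚ (x ℤ.* y) ≡ ℤ→ℚ x ℚ.* ℤ→ℚ y
ℤ→ℚ-* x y = ℚP.toℚᵘ-injective (ℚᵘP.≃-trans (ℤ→ℚᵘ (x ℤ.* y) 1)
  (ℚᵘP.≃-sym (ℚᵘP.≃-trans (ℚP.toℚᵘ-homo-* (ℤ→ℚ x) (ℤ→ℚ y)) (ℚᵘP.*-cong (ℤ→ℚᵘ x 1) (ℤ→ℚᵘ y 1)))))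

ℤ→ℚ-/ : ∀ d .{{_ : ℕ.NonZero d}} x → ℕ→ℚ d ℚ.* (x ℚ./ d) ≡ ℤ→ℚ x
ℤ→ℚ-/ (suc d) x = ℚP.toℚᵘ-injective (ℚᵘP.≃-trans (ℚP.toℚᵘ-homo-* (ℕ→ℚ (suc d)) (x ℚ./ suc d))
  (ℚᵘP.≃-trans (ℚᵘP.*-cong (ℤ→ℚᵘ (+ suc d) 1) (ℤ→ℚᵘ x (suc d))) (ℚᵘP.≃-trans (ℚᵘ.*≡* eq) (ℚᵘP.≃-sym (ℤ→ℚᵘ x 1)))))
  where
  lem : ∀ d x → d ℤ.* x ℤ.* 1ℤ ≡ x ℤ.* d
  lem = solve-∀
  eq : + suc d ℤ.* x ℤ.* 1ℤ ≡ x ℤ.* (+ (suc d ℕ.+ 0))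
  eq = trans (lem (+ suc d) x) (cong (λ k → x ℤ.* + k) (sym (ℕP.+-identityʳ (suc d))))

sumℚ-ℤ : {A : Set} (xs : List A) {f : A → ℚ} {g : A → ℤ} → (∀ x → f x ≡ ℤ→ℚ (g x)) → sumℚ (map f xs) ≡ ℤ→ℚ (∑ xs g)
sumℚ-ℤ []       e = refl
sumℚ-ℤ (x ∷ xs) {g = g} e = trans (cong₂ ℚ._+_ (e x) (sumℚ-ℤ xs e)) (sym (ℤ→ℚ-+ (g x) (∑ xs g)))

innerSumℤ : (N h j : ℕ) → ℤ
innerSumℤ N h j = ∑ (fromTo j h) (λ t → surj h t ℤ.* + (2 ℕ.^ (h ℕ.∸ t)) ℤ.* + binomℤ (+ N ℤ.- + j) (+ N ℤ.- + t))

codeSumℤ : (N h : ℕ) → (ℕ → ℕ) → ℤ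
codeSumℤ N h Cw = ∑ (fromTo 0 (N ℕ.⊓ h)) (λ j → sgn (h ℕ.+ j) ℤ.* + Cw j ℤ.* innerSumℤ N h j)

codeSum-ℤ : ∀ N h Cw → codeSum N h Cw ≡ ℤ→ℚ (codeSumℤ N h Cw)
codeSum-ℤ N h Cw = sumℚ-ℤ (fromTo 0 (N ℕ.⊓ h)) {g = λ j → sgn (h ℕ.+ j) ℤ.* + Cw j ℤ.* innerSumℤ N h j} (λ j → trans (cong₂ (λ x y → x ℚ.* y) (sym (ℤ→ℚ-* (sgn (h ℕ.+ j)) (+ Cw j))) (inner j))
    (sym (ℤ→ℚ-* (sgn (h ℕ.+ j) ℤ.* + Cw j) (innerSumℤ N h j))))
  where
  inner : ∀ j → innerSum N h j ≡ ℤ→ℚ (innerSumℤ N h j)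
  inner j = sumℚ-ℤ (fromTo j h) (λ t → let b = + binomℤ (+ N ℤ.- + j) (+ N ℤ.- + t) in
    trans (cong (λ z → z ℚ.* ℕ→ℚ (2 ℕ.^ (h ℕ.∸ t)) ℚ.* ℤ→ℚ b) (ℤ→ℚ-/ (t ℕ.!) {{t ℕP.!≢0}} (surj h t)))
      (trans (cong (ℚ._* ℤ→ℚ b) (sym (ℤ→ℚ-* (surj h t) (+ (2 ℕ.^ (h ℕ.∸ t)))))) (sym (ℤ→ℚ-* (surj h t ℤ.* + (2 ℕ.^ (h ℕ.∸ t))) b))))

recSumℤ : (h : ℕ) → (c : ℤ) → (ℕ → ℤ) → ℤ
recSumℤ h c M = ∑ (upTo h) (λ l → sgn (h ℕ.+ l ℕ.+ 1) ℤ.* (+ (h C l)) ℤ.* (c ℤ.^ (h ℕ.∸ l)) ℤ.* M l)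

recSum-ℤ : ∀ h c M → recSum h c M ≡ ℤ→ℚ (recSumℤ h c M)
recSum-ℤ h c M = sumℚ-ℤ (upTo h) (λ _ → refl)

∑<-extend : ∀ {m n} (f : ℕ → ℤ) → m ℕ.≤ n → (∀ i → m ℕ.≤ i → i ℕ.< n → f i ≡ 0ℤ) → ∑< n f ≡ ∑< m f
∑<-extend {m} {n} f le z = trans (cong (λ k → ∑< k f) (sym (ℕP.m+[n∸m]≡n le))) (trans (∑<-split m (n ℕ.∸ m) f)
  (trans (cong (λ k → ∑< m f ℤ.+ k) (∑<-0 (n ℕ.∸ m) (λ i lt → z (m ℕ.+ i) (ℕP.m≤m+n m i)
    (subst (m ℕ.+ i ℕ.<_) (ℕP.m+[n∸m]≡n le) (ℕP.+-monoʳ-< m lt))))) (ℤP.+-identityʳ _)))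

∑-∑<-swap : {A : Set} (xs : List A) (n : ℕ) (f : A → ℕ → ℤ) → ∑ xs (λ x → ∑< n (f x)) ≡ ∑< n (λ i → ∑ xs (λ x → f x i))
∑-∑<-swap xs n f = trans (∑-cong xs (λ x → sym (∑-upTo n (f x)))) (trans (∑-swap xs (upTo n) f) (∑-upTo n (λ i → ∑ xs (λ x → f x i))))

∑<-swap : ∀ m n (f : ℕ → ℕ → ℤ) → ∑< m (λ i → ∑< n (f i)) ≡ ∑< n (λ j → ∑< m (λ i → f i j))
∑<-swap m n f = trans (sym (∑-upTo m (λ i → ∑< n (f i)))) (trans (∑-∑<-swap (upTo m) n f) (∑<-cong n (λ j _ → ∑-upTo m (λ i → f i j))))

∑<-δ : ∀ n (f : ℕ → ℤ) w → w ℕ.< n → ∑< n (λ j → 𝟙 (w ℕ.≡ᵇ j) ℤ.* f j) ≡ f w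
∑<-δ (suc n) f zero    _          = trans (cong₂ ℤ._+_ (ℤP.*-identityˡ (f 0)) (∑<-0 n (λ _ _ → refl))) (ℤP.+-identityʳ _)
∑<-δ (suc n) f (suc w) (ℕ.s≤s lt) = trans (ℤP.+-identityˡ _) (∑<-δ n (f ∘ suc) w lt)

-- The number of supersets of size t of the support of a binary word
supersets : ∀ {N} → Vec Bool N → ℕ → ℕ
supersets []          zero    = 1
supersets []          (suc t) = 0
supersets (true ∷ u)  zero    = 0
supersets (true ∷ u)  (suc t) = supersets u t
supersets (false ∷ u) zero    = supersets u zero
supersets (false ∷ u) (suc t) = supersets u (suc t) ℕ.+ supersets u t

binomℤ-≤ : ∀ {N w t} → w ℕ.≤ N → t ℕ.≤ N → binomℤ (+ N ℤ.- + w) (+ N ℤ.- + t) ≡ (N ℕ.∸ w) C (N ℕ.∸ t)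
binomℤ-≤ {N} {w} {t} a b = cong₂ binomℤ (trans (ℤP.m-n≡m⊖n N w) (ℤP.⊖-≥ a)) (trans (ℤP.m-n≡m⊖n N t) (ℤP.⊖-≥ b))

binomℤ-> : ∀ {N w t} → N ℕ.< t → binomℤ (+ N ℤ.- + w) (+ N ℤ.- + t) ≡ 0
binomℤ-> {N} {w} {t} lt rewrite ℤP.m-n≡m⊖n N t | ℤP.⊖-< lt | ℕP.+-∸-assoc 1 lt = neg (+ N ℤ.- + w)
  where
  neg : ∀ x {n} → binomℤ x -[1+ n ] ≡ 0
  neg (+ _)    = refl
  neg -[1+ _ ] = refl

binomℤ-< : ∀ {N w t} → w ℕ.≤ N → t ℕ.< w → binomℤ (+ N ℤ.- + w) (+ N ℤ.- + t) ≡ 0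
binomℤ-< {N} {w} {t} le lt = trans (binomℤ-≤ le (ℕP.≤-trans (ℕP.<⇒≤ lt) le)) (k>n⇒nCk≡0 (ℕP.∸-monoʳ-< lt le))

-- The power moment identity for the codes C(G)

module Codes (FF : FiniteField) (r : ℕ) (card : length (FiniteField.elements FF) ≡ 2 ℕ.^ r) where

  open FiniteField FF renaming (_+F_ to infixl 6 _⊕_; _*F_ to infixl 7 _⊗_)
  open Setup FF r
  open FieldTheory FF r card
  open S₂ using (_:+_; _:*_; _:=_; solve; con; Polynomial)

  weight-≤ : ∀ {N} (u : Vec Bool N) → weight u ℕ.≤ N
  weight-≤ []          = ℕ.z≤n
  weight-≤ (true ∷ u)  = ℕ.s≤s (weight-≤ u)
  weight-≤ (false ∷ u) = ℕP.m≤n⇒m≤1+n (weight-≤ u)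

  supersets-> : ∀ {N} (u : Vec Bool N) t → N ℕ.< t → supersets u t ≡ 0
  supersets-> []          (suc t) _          = refl
  supersets-> (true ∷ u)  (suc t) (ℕ.s≤s lt) = supersets-> u t lt
  supersets-> (false ∷ u) (suc t) (ℕ.s≤s lt) = cong₂ ℕ._+_ (supersets-> u (suc t) (ℕP.m<n⇒m<1+n lt)) (supersets-> u t lt)

  -- A superset of size t omits N - t of the N - w positions outside the support, w being the
  -- weight. Counting omissions instead of additions gives the binomial of the moment identity,
  -- which vanishes by itself when t < w.
  supersets-C : ∀ {N} (u : Vec Bool N) t → t ℕ.≤ N → supersets u t ≡ (N ℕ.∸ weight u) C (N ℕ.∸ t)
  supersets-C []                  zero    _          = refl
  supersets-C {suc N} (true ∷ u)  zero    _          = sym (k>n⇒nCk≡0 (ℕ.s≤s (ℕP.m∸n≤m N (weight u))))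
  supersets-C (true ∷ u)          (suc t) (ℕ.s≤s le) = supersets-C u t le
  supersets-C {suc N} (false ∷ u) zero    _          = trans (supersets-C u 0 ℕ.z≤n) (top N (weight u) (weight-≤ u))
    where
    top : ∀ N w → w ℕ.≤ N → (N ℕ.∸ w) C N ≡ (suc N ℕ.∸ w) C suc N
    top N zero    le = trans (nCn≡1 N) (sym (nCn≡1 (suc N)))
    top N (suc w) le = trans (k>n⇒nCk≡0 (ℕP.∸-monoʳ-< {N} {suc w} {0} (ℕ.s≤s ℕ.z≤n) le)) (sym (k>n⇒nCk≡0 (ℕ.s≤s (ℕP.m∸n≤m N w))))
  supersets-C {suc N} (false ∷ u) (suc t) (ℕ.s≤s le) with ℕP.m≤n⇒m<n∨m≡n le
  ... | inj₁ lt = trans (cong₂ ℕ._+_ (supersets-C u (suc t) lt) (supersets-C u t le)) (trans (cong (λ k → ((N ℕ.∸ weight u) C (N ℕ.∸ suc t)) ℕ.+ ((N ℕ.∸ weight u) C k)) (ℕP.+-∸-assoc 1 lt))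
        (trans (nCk+nC[k+1]≡[n+1]C[k+1] (N ℕ.∸ weight u) (N ℕ.∸ suc t)) (cong₂ _C_ (sym (ℕP.+-∸-assoc 1 (weight-≤ u))) (sym (ℕP.+-∸-assoc 1 lt)))))
  ... | inj₂ refl = trans (cong₂ ℕ._+_ (supersets-> u (suc N) ℕP.≤-refl) (supersets-C u N ℕP.≤-refl))
        (trans (cong ((N ℕ.∸ weight u) C_) (ℕP.n∸n≡0 N)) (trans (nC0≡1 (N ℕ.∸ weight u))
          (sym (trans (cong ((suc N ℕ.∸ weight u) C_) (ℕP.n∸n≡0 N)) (nC0≡1 (suc N ℕ.∸ weight u))))))

  supersets-binomℤ : ∀ {N} (u : Vec Bool N) t → supersets u t ≡ binomℤ (+ N ℤ.- + weight u) (+ N ℤ.- + t)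
  supersets-binomℤ {N} u t with t ℕP.≤? N
  ... | no t≰N  = trans (supersets-> u t (ℕP.≰⇒> t≰N)) (sym (binomℤ-> {w = weight u} (ℕP.≰⇒> t≰N)))
  ... | yes t≤N = trans (supersets-C u t t≤N) (sym (binomℤ-≤ (weight-≤ u) t≤N))

  words : (N : ℕ) → List (Vec Bool N)
  words = allVecs (true ∷ false ∷ [])

  ∑-words-suc : ∀ N (f : Vec Bool (suc N) → ℤ) → ∑ (words (suc N)) f ≡ ∑ (words N) (λ u → f (true ∷ u)) ℤ.+ ∑ (words N) (λ u → f (false ∷ u))
  ∑-words-suc N f = trans (∑-allVecs-suc (true ∷ false ∷ []) N f) (cong (λ z → ∑ (words N) (λ u → f (true ∷ u)) ℤ.+ z) (ℤP.+-identityʳ _))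

  module _ {m : ℕ} where

    -- Sorted by the supersets T of size t, the sum over words supported in T factors as the product
    -- of 1 - λ(a Tr g) over g in T: this is the elementary symmetric function of degree t in these
    -- numbers.
    charSum : List (Mat m) → F → ℕ → ℤ
    charSum G a t = ∑ (words (length G)) (λ u → sgn (weight u) ℤ.* λ' (a ⊗ codeSyndrome G u) ℤ.* + supersets u t)

    -- The weight w(a) of the dual word (tr(a Tr g))_g.
    bad : F → List (Mat m) → ℕ
    bad a G = length (filterᵇ (λ g → tr (a ⊗ trace g) == 1F) G)

    charSum-zero : ∀ g G a → charSum (g ∷ G) a 0 ≡ charSum G a 0
    charSum-zero g G a = trans (∑-words-suc (length G) (λ u → sgn (weight u) ℤ.* λ' (a ⊗ codeSyndrome (g ∷ G) u) ℤ.* + supersets u 0))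
      (trans (cong₂ ℤ._+_ (∑-0-∈ (words (length G)) (λ u _ → ℤP.*-zeroʳ (sgn (weight (true ∷ u)) ℤ.* λ' (a ⊗ codeSyndrome (g ∷ G) (true ∷ u)))))
        (∑-cong (words (length G)) (λ u → cong (λ z → sgn (weight u) ℤ.* λ' (a ⊗ z) ℤ.* + supersets u 0) (F+-identityˡ _)))) (ℤP.+-identityˡ _))

    charSum-suc : ∀ g G a t → charSum (g ∷ G) a (suc t) ≡ charSum G a (suc t) ℤ.+ (1ℤ ℤ.- λ' (a ⊗ trace g)) ℤ.* charSum G a t
    charSum-suc g G a t = begin
      charSum (g ∷ G) a (suc t)
        ≡⟨ ∑-words-suc (length G) (λ u → sgn (weight u) ℤ.* λ' (a ⊗ codeSyndrome (g ∷ G) u) ℤ.* + supersets u (suc t)) ⟩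
      ∑ W (λ u → sgn (suc (weight u)) ℤ.* λ' (a ⊗ (trace g ⊕ codeSyndrome G u)) ℤ.* + supersets u t)
        ℤ.+ ∑ W (λ u → sgn (weight u) ℤ.* λ' (a ⊗ (0F ⊕ codeSyndrome G u)) ℤ.* + (supersets u (suc t) ℕ.+ supersets u t))
        ≡⟨ cong₂ ℤ._+_ (trans (∑-cong W true-part) (∑-*ˡ W (ℤ.- τ) (X t))) (trans (∑-cong W false-part) (∑-+ W (X (suc t)) (X t))) ⟩
      ℤ.- τ ℤ.* charSum G a t ℤ.+ (charSum G a (suc t) ℤ.+ charSum G a t)
        ≡⟨ lem τ (charSum G a t) (charSum G a (suc t)) ⟩
      charSum G a (suc t) ℤ.+ (1ℤ ℤ.- τ) ℤ.* charSum G a t ∎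
      where
      open ≡-Reasoning
      W = words (length G)
      τ = λ' (a ⊗ trace g)
      X : ℕ → Vec Bool (length G) → ℤ
      X t u = sgn (weight u) ℤ.* λ' (a ⊗ codeSyndrome G u) ℤ.* + supersets u t
      lem : ∀ τ x y → ℤ.- τ ℤ.* x ℤ.+ (y ℤ.+ x) ≡ y ℤ.+ (1ℤ ℤ.- τ) ℤ.* x
      lem = solve-∀
      true-part : ∀ u → sgn (suc (weight u)) ℤ.* λ' (a ⊗ (trace g ⊕ codeSyndrome G u)) ℤ.* + supersets u t ≡ ℤ.- τ ℤ.* X t u
      true-part u = trans (cong (λ z → sgn (suc (weight u)) ℤ.* z ℤ.* + supersets u t) (trans (cong λ' (F-distribˡ a _ _)) (λ-+ _ _)))
        (lem′ (sgn (weight u)) τ (λ' (a ⊗ codeSyndrome G u)) (+ supersets u t))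
        where
        lem′ : ∀ s τ l c → ℤ.-1ℤ ℤ.* s ℤ.* (τ ℤ.* l) ℤ.* c ≡ ℤ.- τ ℤ.* (s ℤ.* l ℤ.* c)
        lem′ = solve-∀
      false-part : ∀ u → sgn (weight u) ℤ.* λ' (a ⊗ (0F ⊕ codeSyndrome G u)) ℤ.* + (supersets u (suc t) ℕ.+ supersets u t) ≡ X (suc t) u ℤ.+ X t u
      false-part u = trans (cong (λ z → sgn (weight u) ℤ.* λ' (a ⊗ z) ℤ.* + (supersets u (suc t) ℕ.+ supersets u t)) (F+-identityˡ _))
        (ℤP.*-distribˡ-+ (sgn (weight u) ℤ.* λ' (a ⊗ codeSyndrome G u)) (+ supersets u (suc t)) (+ supersets u t))

    -- A factor 1 - λ(a Tr g) is 2 for the elements counted by `bad` and 0 for the others, so only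
    -- t-sets of the former survive, each with value 2^t.
    charSum-C : ∀ G a t → charSum G a t ≡ + (2 ℕ.^ t) ℤ.* + (bad a G C t)
    charSum-C []      a zero    = cong (λ z → 1ℤ ℤ.* z ℤ.* 1ℤ ℤ.+ 0ℤ) (trans (cong λ' (F*-zeroʳ a)) λ-0F)
    charSum-C []      a (suc t) = trans (cong (ℤ._+ 0ℤ) (ℤP.*-zeroʳ (1ℤ ℤ.* λ' (a ⊗ 0F))))
      (sym (trans (cong (λ z → + (2 ℕ.^ suc t) ℤ.* + z) (k>n⇒nCk≡0 {0} {suc t} (ℕ.s≤s ℕ.z≤n))) (ℤP.*-zeroʳ (+ (2 ℕ.^ suc t)))))
    charSum-C (g ∷ G) a zero    = trans (charSum-zero g G a) (trans (charSum-C G a zero) (cong (λ z → 1ℤ ℤ.* + z) (trans (nC0≡1 (bad a G)) (sym (nC0≡1 (bad a (g ∷ G)))))))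
    charSum-C (g ∷ G) a (suc t) = trans (charSum-suc g G a t)
        (trans (cong₂ (λ x y → x ℤ.+ (1ℤ ℤ.- λ' (a ⊗ trace g)) ℤ.* y) (charSum-C G a (suc t)) (charSum-C G a t)) (go (tr-01 (a ⊗ trace g))))
      where
      w = bad a G
      P = 2 ℕ.^ t
      go : tr (a ⊗ trace g) ≡ 0F ⊎ tr (a ⊗ trace g) ≡ 1F →
           + (2 ℕ.* P) ℤ.* + (w C suc t) ℤ.+ (1ℤ ℤ.- λ' (a ⊗ trace g)) ℤ.* (+ P ℤ.* + (w C t)) ≡ + (2 ℕ.* P) ℤ.* + (bad a (g ∷ G) C suc t)
      go (inj₁ e) rewrite ⌊⌋-no (tr (a ⊗ trace g) ≟F 1F) (λ z → 0F≢1F (trans (sym e) z)) | λ-0 e = ℤP.+-identityʳ _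
      go (inj₂ e) rewrite ⌊⌋-yes (tr (a ⊗ trace g) ≟F 1F) e | λ-1 e = trans (cong (λ z → z ℤ.* + (w C suc t) ℤ.+ + 2 ℤ.* (+ P ℤ.* + (w C t))) (ℤP.pos-* 2 P))
        (trans (lem (+ P) (+ (w C suc t)) (+ (w C t))) (cong₂ ℤ._*_ (sym (ℤP.pos-* 2 P)) (sym (pascal w t))))
        where
        lem : ∀ p x y → + 2 ℤ.* p ℤ.* x ℤ.+ + 2 ℤ.* (p ℤ.* y) ≡ + 2 ℤ.* p ℤ.* (y ℤ.+ x)
        lem = solve-∀

    -- Orthogonality over a keeps exactly the words of syndrome 0, which are then sorted by weight.
    ∑-charSum : ∀ G t → let N = length G in
      ∑ elements (λ a → charSum G a t) ≡ + q ℤ.* ∑< (suc N) (λ j → sgn j ℤ.* + weightDist G j ℤ.* + binomℤ (+ N ℤ.- + j) (+ N ℤ.- + t))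
    ∑-charSum G t = begin
      ∑ elements (λ a → charSum G a t) ≡⟨ ∑-swap elements W _ ⟩
      ∑ W (λ u → ∑ elements (λ a → sgn (weight u) ℤ.* λ' (a ⊗ codeSyndrome G u) ℤ.* + supersets u t))
        ≡⟨ ∑-cong W (λ u → trans (∑-*ʳ elements (+ supersets u t) _) (trans (cong (ℤ._* + supersets u t) (trans (∑-*ˡ elements (sgn (weight u)) _)
             (cong (sgn (weight u) ℤ.*_) (orthogonality (codeSyndrome G u))))) (trans (lem (sgn (weight u)) (𝟙 (codeSyndrome G u == 0F)) (+ q) (+ supersets u t))
               (cong (λ z → + q ℤ.* (𝟙 (codeSyndrome G u == 0F) ℤ.* (sgn (weight u) ℤ.* + z))) (supersets-binomℤ u t))))) ⟩
      ∑ W (λ u → + q ℤ.* (𝟙 (codeSyndrome G u == 0F) ℤ.* e (weight u))) ≡⟨ ∑-*ˡ W (+ q) _ ⟩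
      + q ℤ.* ∑ W (λ u → 𝟙 (codeSyndrome G u == 0F) ℤ.* e (weight u)) ≡⟨ cong (+ q ℤ.*_) (sym (∑-filter _ W _)) ⟩
      + q ℤ.* ∑ (codewords G) (λ u → e (weight u))
        ≡⟨ cong (+ q ℤ.*_) (∑-cong (codewords G) (λ u → sym (∑<-δ (suc N) e (weight u) (ℕ.s≤s (weight-≤ u))))) ⟩
      + q ℤ.* ∑ (codewords G) (λ u → ∑< (suc N) (λ j → 𝟙 (weight u ℕ.≡ᵇ j) ℤ.* e j))
        ≡⟨ cong (+ q ℤ.*_) (trans (∑-∑<-swap (codewords G) (suc N) (λ u j → 𝟙 (weight u ℕ.≡ᵇ j) ℤ.* e j)) (∑<-cong (suc N) (λ j _ → regroup j))) ⟩
      + q ℤ.* ∑< (suc N) (λ j → sgn j ℤ.* + weightDist G j ℤ.* + binomℤ (+ N ℤ.- + j) (+ N ℤ.- + t)) ∎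
      where
      open ≡-Reasoning
      N = length G
      W = words N
      e : ℕ → ℤ
      e j = sgn j ℤ.* + binomℤ (+ N ℤ.- + j) (+ N ℤ.- + t)
      lem : ∀ s i q c → s ℤ.* (i ℤ.* q) ℤ.* c ≡ q ℤ.* (i ℤ.* (s ℤ.* c))
      lem = solve-∀
      regroup : ∀ j → ∑ (codewords G) (λ u → 𝟙 (weight u ℕ.≡ᵇ j) ℤ.* e j) ≡ sgn j ℤ.* + weightDist G j ℤ.* + binomℤ (+ N ℤ.- + j) (+ N ℤ.- + t)
      regroup j = trans (∑-*ʳ (codewords G) (e j) _) (trans (cong (ℤ._* e j) (sym (length-filter _ (codewords G)))) (lem′ (+ weightDist G j) (sgn j) (+ binomℤ (+ N ℤ.- + j) (+ N ℤ.- + t))))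
        where
        lem′ : ∀ w s b → w ℤ.* (s ℤ.* b) ≡ s ℤ.* w ℤ.* b
        lem′ = solve-∀

    -- In (2w)^h the power 2^h is split as 2^(h-t) 2^t, and 2^t C(w,t) is `charSum`; this is the
    -- source of the factor 2^(h-t).
    pless : ∀ G h → + q ℤ.* codeSumℤ (length G) h (weightDist G) ≡ sgn h ℤ.* ∑ elements (λ a → (+ 2 ℤ.* + bad a G) ℤ.^ h)
    pless G h = sym (begin
      sgn h ℤ.* ∑ elements (λ a → (+ 2 ℤ.* + bad a G) ℤ.^ h)
        ≡⟨ cong (sgn h ℤ.*_) (trans (∑-cong elements expand) (∑-∑<-swap elements (suc h) (λ a t → c t ℤ.* charSum G a t))) ⟩
      sgn h ℤ.* ∑< (suc h) (λ t → ∑ elements (λ a → c t ℤ.* charSum G a t))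
        ≡⟨ cong (sgn h ℤ.*_) (∑<-cong (suc h) (λ t _ → trans (∑-*ˡ elements (c t) _) (trans (cong (c t ℤ.*_) (∑-charSum G t)) (pull t)))) ⟩
      sgn h ℤ.* ∑< (suc h) (λ t → + q ℤ.* ∑< (suc N) (λ j → sgn j ℤ.* + Cw j ℤ.* (c t ℤ.* b j t)))
        ≡⟨ trans (cong (sgn h ℤ.*_) (∑<-*ˡ (suc h) (+ q) (λ t → ∑< (suc N) (λ j → sgn j ℤ.* + Cw j ℤ.* (c t ℤ.* b j t))))) (lem₁ (sgn h) (+ q) _) ⟩
      + q ℤ.* (sgn h ℤ.* ∑< (suc h) (λ t → ∑< (suc N) (λ j → sgn j ℤ.* + Cw j ℤ.* (c t ℤ.* b j t))))
        ≡⟨ cong (+ q ℤ.*_) (trans (cong (sgn h ℤ.*_) (∑<-swap (suc h) (suc N) (λ t j → sgn j ℤ.* + Cw j ℤ.* (c t ℤ.* b j t))))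
             (sym (∑<-*ˡ (suc N) (sgn h) (λ j → ∑< (suc h) (λ t → sgn j ℤ.* + Cw j ℤ.* (c t ℤ.* b j t)))))) ⟩
      + q ℤ.* ∑< (suc N) (λ j → sgn h ℤ.* ∑< (suc h) (λ t → sgn j ℤ.* + Cw j ℤ.* (c t ℤ.* b j t)))
        ≡⟨ cong (+ q ℤ.*_) (∑<-cong (suc N) (λ j lt → collect j (ℕP.≤-pred lt))) ⟩
      + q ℤ.* ∑< (suc N) term
        ≡⟨ cong (+ q ℤ.*_) (trans (∑<-extend term (ℕ.s≤s (ℕP.m⊓n≤m N h)) vanish) (sym (∑-fromTo 0 (N ℕ.⊓ h) term (λ _ ())))) ⟩
      + q ℤ.* codeSumℤ N h Cw ∎)
      where
      open ≡-Reasoning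
      N = length G
      Cw = weightDist G
      c : ℕ → ℤ
      c t = surj h t ℤ.* + (2 ℕ.^ (h ℕ.∸ t))
      b : ℕ → ℕ → ℤ
      b j t = + binomℤ (+ N ℤ.- + j) (+ N ℤ.- + t)
      term : ℕ → ℤ
      term j = sgn (h ℕ.+ j) ℤ.* + Cw j ℤ.* innerSumℤ N h j
      lem₁ : ∀ s q x → s ℤ.* (q ℤ.* x) ≡ q ℤ.* (s ℤ.* x)
      lem₁ = solve-∀
      expand : ∀ a → (+ 2 ℤ.* + bad a G) ℤ.^ h ≡ ∑< (suc h) (λ t → c t ℤ.* charSum G a t)
      expand a = trans (^-distribʳ-* h (+ 2) (+ bad a G)) (trans (cong₂ ℤ._*_ (sym (pos-^ h)) (power-expansion h (bad a G)))
          (trans (sym (∑<-*ˡ (suc h) (+ (2 ℕ.^ h)) (λ t → surj h t ℤ.* + (bad a G C t)))) (∑<-cong (suc h) step)))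
        where
        pos-^ : ∀ n → + (2 ℕ.^ n) ≡ (+ 2) ℤ.^ n
        pos-^ zero    = refl
        pos-^ (suc n) = trans (ℤP.pos-* 2 (2 ℕ.^ n)) (cong (+ 2 ℤ.*_) (pos-^ n))
        step : ∀ t → t ℕ.< suc h → + (2 ℕ.^ h) ℤ.* (surj h t ℤ.* + (bad a G C t)) ≡ c t ℤ.* charSum G a t
        step t (ℕ.s≤s le) = trans (cong (λ z → z ℤ.* (surj h t ℤ.* + (bad a G C t))) (trans (cong (λ k → + (2 ℕ.^ k)) (sym (ℕP.m∸n+n≡m le)))
            (trans (cong +_ (ℕP.^-distribˡ-+-* 2 (h ℕ.∸ t) t)) (ℤP.pos-* (2 ℕ.^ (h ℕ.∸ t)) (2 ℕ.^ t)))))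
          (trans (lem (+ (2 ℕ.^ (h ℕ.∸ t))) (+ (2 ℕ.^ t)) (surj h t) (+ (bad a G C t))) (cong (c t ℤ.*_) (sym (charSum-C G a t))))
          where
          lem : ∀ x y s w → x ℤ.* y ℤ.* (s ℤ.* w) ≡ s ℤ.* x ℤ.* (y ℤ.* w)
          lem = solve-∀
      pull : ∀ t → c t ℤ.* (+ q ℤ.* ∑< (suc N) (λ j → sgn j ℤ.* + Cw j ℤ.* b j t)) ≡ + q ℤ.* ∑< (suc N) (λ j → sgn j ℤ.* + Cw j ℤ.* (c t ℤ.* b j t))
      pull t = trans (lem₁ (c t) (+ q) _) (cong (+ q ℤ.*_) (trans (sym (∑<-*ˡ (suc N) (c t) (λ j → sgn j ℤ.* + Cw j ℤ.* b j t)))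
          (∑<-cong (suc N) (λ j _ → lem₁ (c t) (sgn j ℤ.* + Cw j) (b j t)))))
      collect : ∀ j → j ℕ.≤ N → sgn h ℤ.* ∑< (suc h) (λ t → sgn j ℤ.* + Cw j ℤ.* (c t ℤ.* b j t)) ≡ term j
      collect j le = trans (cong (sgn h ℤ.*_) (∑<-*ˡ (suc h) (sgn j ℤ.* + Cw j) (λ t → c t ℤ.* b j t)))
        (trans (lem (sgn h) (sgn j) (+ Cw j) _) (cong₂ (λ x y → x ℤ.* + Cw j ℤ.* y) (sym (sgn-+ h j))
          (sym (∑-fromTo j h (λ t → c t ℤ.* b j t) (λ t lt → trans (cong (λ z → c t ℤ.* + z) (binomℤ-< le lt)) (ℤP.*-zeroʳ (c t)))))))
        where
        lem : ∀ s s′ w x → s ℤ.* (s′ ℤ.* w ℤ.* x) ≡ s ℤ.* s′ ℤ.* w ℤ.* x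
        lem = solve-∀
      -- For min(N, h) < j ≤ N one has j > h, and the inner sum from j to h is empty.
      vanish : ∀ j → suc (N ℕ.⊓ h) ℕ.≤ j → j ℕ.< suc N → term j ≡ 0ℤ
      vanish j lo hi = trans (cong (λ k → sgn (h ℕ.+ j) ℤ.* + Cw j ℤ.* ∑ (applyUpTo (j ℕ.+_) k) (λ t → c t ℤ.* b j t)) (ℕP.m≤n⇒m∸n≡0 h<j)) (ℤP.*-zeroʳ (sgn (h ℕ.+ j) ℤ.* + Cw j))
        where
        h<j : suc h ℕ.≤ j
        h<j with ℕP.≤-total N h
        ... | inj₁ N≤h = ⊥-elim (ℕP.<⇒≱ (subst (ℕ._< j) (ℕP.m≤n⇒m⊓n≡m N≤h) lo) (ℕP.≤-pred hi))
        ... | inj₂ h≤N = subst (ℕ._< j) (ℕP.m≥n⇒m⊓n≡n h≤N) lo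

    traceSum : List (Mat m) → F → ℤ
    traceSum G a = ∑ G (λ g → λ' (a ⊗ trace g))

    -- The sign (-1)^h is absorbed by -2w(a) = `traceSum G a` - N. The term a = 0 is (N - N)^h,
    -- which vanishes because h ≥ 1.
    pless-nonzero : ∀ G h → 1 ℕ.≤ h → + q ℤ.* codeSumℤ (length G) h (weightDist G) ≡ ∑ nonzero (λ a → (traceSum G a ℤ.- + length G) ℤ.^ h)
    pless-nonzero G h@(suc h′) _ = trans (pless G h) (trans (sym (∑-*ˡ elements (sgn h) _)) (trans (∑-cong elements step)
        (trans (∑-split (λ a → (traceSum G a ℤ.- + length G) ℤ.^ h)) (trans (cong (ℤ._+ ∑ nonzero (λ a → (traceSum G a ℤ.- + length G) ℤ.^ h)) at-0) (ℤP.+-identityˡ _)))))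
      where
      step : ∀ a → sgn h ℤ.* (+ 2 ℤ.* + bad a G) ℤ.^ h ≡ (traceSum G a ℤ.- + length G) ℤ.^ h
      step a = trans (sym (sgn-^ h (+ 2 ℤ.* + bad a G))) (cong (ℤ._^ h) (trans (cong ℤ.-_ (sym (proj₂ (∑λ-count G (λ g → a ⊗ trace g))))) (lem (+ length G) (traceSum G a))))
        where
        lem : ∀ n s → ℤ.- (n ℤ.- s) ≡ s ℤ.- n
        lem = solve-∀
      at-0 : (traceSum G 0F ℤ.- + length G) ℤ.^ h ≡ 0ℤ
      at-0 = cong (λ z → z ℤ.* (traceSum G 0F ℤ.- + length G) ℤ.^ h′) (trans (cong (ℤ._- + length G) (trans (∑-cong G (λ g → trans (cong λ' (F*-zeroˡ (trace g))) λ-0F)) (∑-1 G)))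
        (ℤP.+-inverseʳ (+ length G)))

entryAt : {A : Set} → DecidableEquality A → A → ∀ {k} → Vec ℕ k → Vec A k → ℕ
entryAt _≟_ β []       []       = 0
entryAt _≟_ β (n ∷ ns) (b ∷ bs) = if ⌊ b ≟ β ⌋ then n else entryAt _≟_ β ns bs

-- The recursion equations determine the function; through them the local function inside `νat` is
-- identified.
entryAt-unique : {A : Set} (_≟_ : DecidableEquality A) (β : A) (f : ∀ k → Vec ℕ k → Vec A k → ℕ) →
  f 0 [] [] ≡ 0 → (∀ k n ns b bs → f (suc k) (n ∷ ns) (b ∷ bs) ≡ (if ⌊ b ≟ β ⌋ then n else f k ns bs)) →
  ∀ k ns bs → f k ns bs ≡ entryAt _≟_ β ns bs
entryAt-unique _≟_ β f z s zero    []       []       = z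
entryAt-unique _≟_ β f z s (suc k) (n ∷ ns) (b ∷ bs) =
  trans (s k n ns b bs) (cong (λ x → if ⌊ b ≟ β ⌋ then n else x) (entryAt-unique _≟_ β f z s k ns bs))

mutual

  -- The local function of νat, whose name is out of scope: the body is determined by its use in νat-entryAt, where
  -- abstracting over length es separates the vectors from the list of elements of the field.
  νat-go : (F : Set) (_+F_ _*F_ : F → F → F) (-F_ : F → F) (0F 1F : F)
    (isCR : IsCommutativeRing _≡_ _+F_ _*F_ -F_ 0F 1F) (0F≢1F : 0F ≢ 1F) (invF : F → F)
    (inv : ∀ x → x ≢ 0F → x *F invF x ≡ 1F) (_≟_ : DecidableEquality F) (e : F) (es : List F)
    (complete : ∀ x → x ∈ e ∷ es) (unique : Unique (e ∷ es)) (r : ℕ) (p : Vec ℕ (suc (length es))) (β : F) →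
    ∀ k → Vec ℕ k → Vec F k → ℕ
  νat-go F _+F_ _*F_ -F_ 0F 1F isCR 0F≢1F invF inv _≟_ e es complete unique r p β k ns bs = _

  νat-entryAt : (FF : FiniteField) (r : ℕ) (ν : Vec ℕ (length (FiniteField.elements FF))) (β : FiniteField.F FF) →
    Setup.νat FF r ν β ≡ entryAt (FiniteField._≟F_ FF) β ν (fromList (FiniteField.elements FF))
  νat-entryAt record { elements = [] } r [] β = refl
  νat-entryAt record { F = F ; _+F_ = _+F_ ; _*F_ = _*F_ ; -F_ = -F_ ; 0F = 0F ; 1F = 1F ; isCommutativeRing = isCR
    ; 0F≢1F = 0F≢1F ; invF = invF ; invF-inv = inv ; _≟F_ = _≟_ ; elements = e ∷ es ; complete = complete ; unique = unique } r (n ∷ ns) β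
    with e ≟ β
  ... | yes _ = refl
  ... | no _ with n Vec.∷ ns | fromList es
  ...   | p | bs with length es | Vec.head p
  ...     | k | _ = entryAt-unique _≟_ β (νat-go F _+F_ _*F_ -F_ 0F 1F isCR 0F≢1F invF inv _≟_ e es complete unique r p β)
                      refl (λ _ _ _ _ _ → refl) k ns bs

-- Finite products of natural numbers

prodℕ-↭ : {xs ys : List ℕ} → xs ↭ ys → prodℕ xs ≡ prodℕ ys
prodℕ-↭ = foldr-↭ ℕ._*_ 1 lem
  where
  lem : ∀ a b c → a ℕ.* (b ℕ.* c) ≡ b ℕ.* (a ℕ.* c)
  lem = solve-∀ᴺ

prodℕ-cong-∈ : {A : Set} {f g : A → ℕ} (xs : List A) → (∀ x → x ∈ xs → f x ≡ g x) → prodℕ (map f xs) ≡ prodℕ (map g xs)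
prodℕ-cong-∈ []       e = refl
prodℕ-cong-∈ (x ∷ xs) e = cong₂ ℕ._*_ (e x (here refl)) (prodℕ-cong-∈ xs (λ y i → e y (there i)))

-- The fibres of κ over `ts` partition `xs`, because `ts` contains every value of κ and has no
-- repetitions.
prodℕ-fibres : {A B : Set} (_≟_ : DecidableEquality B) (κ : A → B) (g : B → A → ℕ) (ts : List B) → Unique ts →
  (xs : List A) → (∀ x → x ∈ xs → κ x ∈ ts) →
  prodℕ (map (λ t → prodℕ (map (g t) (filterᵇ (λ x → ⌊ κ x ≟ t ⌋) xs))) ts) ≡ prodℕ (map (λ x → g (κ x) x) xs)
prodℕ-fibres _≟_ κ g ts u []       κ∈ = ones ts
  where
  ones : ∀ ts → prodℕ (map (λ _ → 1) ts) ≡ 1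
  ones []       = refl
  ones (t ∷ ts) = trans (ℕP.*-identityˡ _) (ones ts)
prodℕ-fibres {A} {B} _≟_ κ g ts u (x ∷ xs) κ∈ = trans (insert ts u (κ∈ x (here refl)))
    (cong (g (κ x) x ℕ.*_) (prodℕ-fibres _≟_ κ g ts u xs (λ y i → κ∈ y (there i))))
  where
  P P′ : B → ℕ
  P  t = prodℕ (map (g t) (filterᵇ (λ y → ⌊ κ y ≟ t ⌋) xs))
  P′ t = prodℕ (map (g t) (filterᵇ (λ y → ⌊ κ y ≟ t ⌋) (x ∷ xs)))
  P′-≡ : P′ (κ x) ≡ g (κ x) x ℕ.* P (κ x)
  P′-≡ rewrite ⌊⌋-yes (κ x ≟ κ x) refl = refl
  P′-≢ : ∀ t → κ x ≢ t → P′ t ≡ P t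
  P′-≢ t n rewrite ⌊⌋-no (κ x ≟ t) n = refl
  insert : ∀ ts → Unique ts → κ x ∈ ts → prodℕ (map P′ ts) ≡ g (κ x) x ℕ.* prodℕ (map P ts)
  insert (t ∷ ts) (n ∷ u) (here refl) = trans (cong₂ ℕ._*_ P′-≡ (prodℕ-cong-∈ ts (λ y i → P′-≢ y (All.lookup n i)))) (ℕP.*-assoc (g (κ x) x) (P (κ x)) _)
  insert (t ∷ ts) (n ∷ u) (there i)   = trans (cong₂ ℕ._*_ (P′-≢ t (λ e → All.lookup n i (sym e))) (insert ts u i)) (lem (P t) (g (κ x) x) _)
    where
    lem : ∀ a b c → a ℕ.* (b ℕ.* c) ≡ b ℕ.* (a ℕ.* c)
    lem = solve-∀ᴺ

+sumℕ : {A : Set} (xs : List A) (f : A → ℕ) → + sumℕ (map f xs) ≡ ∑ xs (λ x → + f x)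
+sumℕ []       f = refl
+sumℕ (x ∷ xs) f = cong (λ z → + f x ℤ.+ z) (+sumℕ xs f)

𝟙-∧ : ∀ a b → 𝟙 (a ∧ b) ≡ 𝟙 a ℤ.* 𝟙 b
𝟙-∧ true  b = sym (ℤP.*-identityˡ _)
𝟙-∧ false b = refl

≡ᵇ-∸ : ∀ {m n} k → m ℕ.≤ n → (m ℕ.+ k ℕ.≡ᵇ n) ≡ (k ℕ.≡ᵇ n ℕ.∸ m)
≡ᵇ-∸ k ℕ.z≤n      = refl
≡ᵇ-∸ k (ℕ.s≤s le) = ≡ᵇ-∸ k le

≡ᵇ-> : ∀ {m n} k → n ℕ.< m → (m ℕ.+ k ℕ.≡ᵇ n) ≡ false
≡ᵇ-> {suc m} {zero}  k _          = refl
≡ᵇ-> {suc m} {suc n} k (ℕ.s≤s lt) = ≡ᵇ-> {m} {n} k lt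

-- Weight distributions from the multiplicities of the traces

module WeightFormula (FF : FiniteField) (r : ℕ) (card : length (FiniteField.elements FF) ≡ 2 ℕ.^ r) where

  open FiniteField FF renaming (_+F_ to infixl 6 _⊕_; _*F_ to infixl 7 _⊗_)
  open Setup FF r
  open FieldTheory FF r card
  open Codes FF r card
  open S₂ using (_:+_; _:*_; _:=_; solve; con; Polynomial)

  -- The number of ways to choose j members of the list with sum s
  choices : List F → F → ℕ → ℤ
  choices []       s zero    = 𝟙 (0F == s)
  choices []       s (suc j) = 0ℤ
  choices (τ ∷ τs) s zero    = choices τs s zero
  choices (τ ∷ τs) s (suc j) = choices τs s (suc j) ℤ.+ choices τs (s ⊕ τ) j

  ==-shift : ∀ a b c → ((a ⊕ b) == c) ≡ (b == (c ⊕ a))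
  ==-shift a b c = ⌊⌋-⇔ ((a ⊕ b) ≟F c) (b ≟F (c ⊕ a))
    (λ e → trans (solve 2 (λ a b → b := a :+ b :+ a) refl a b) (cong (_⊕ a) e))
    (λ e → trans (cong (a ⊕_) e) (solve 2 (λ a c → a :+ (c :+ a) := c) refl a c))

  choices-words : ∀ {m} (G : List (Mat m)) s j →
    ∑ (words (length G)) (λ u → 𝟙 (codeSyndrome G u == s) ℤ.* 𝟙 (weight u ℕ.≡ᵇ j)) ≡ choices (map trace G) s j
  choices-words []      s zero    = trans (ℤP.+-identityʳ _) (ℤP.*-identityʳ _)
  choices-words []      s (suc j) = trans (ℤP.+-identityʳ _) (ℤP.*-zeroʳ (𝟙 (0F == s)))
  choices-words (g ∷ G) s j = trans (∑-words-suc (length G) (λ u → 𝟙 (codeSyndrome (g ∷ G) u == s) ℤ.* 𝟙 (weight u ℕ.≡ᵇ j))) (go j)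
    where
    W = words (length G)
    false-part : ∀ j → ∑ W (λ u → 𝟙 ((0F ⊕ codeSyndrome G u) == s) ℤ.* 𝟙 (weight u ℕ.≡ᵇ j)) ≡ choices (map trace G) s j
    false-part j = trans (∑-cong W (λ u → cong (λ z → 𝟙 (z == s) ℤ.* 𝟙 (weight u ℕ.≡ᵇ j)) (F+-identityˡ _))) (choices-words G s j)
    go : ∀ j → ∑ W (λ u → 𝟙 ((trace g ⊕ codeSyndrome G u) == s) ℤ.* 𝟙 (suc (weight u) ℕ.≡ᵇ j))
               ℤ.+ ∑ W (λ u → 𝟙 ((0F ⊕ codeSyndrome G u) == s) ℤ.* 𝟙 (weight u ℕ.≡ᵇ j)) ≡ choices (map trace (g ∷ G)) s j
    go zero    = trans (cong₂ ℤ._+_ (∑-0-∈ W (λ u _ → ℤP.*-zeroʳ (𝟙 ((trace g ⊕ codeSyndrome G u) == s)))) (false-part zero)) (ℤP.+-identityˡ _)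
    go (suc j) = trans (ℤP.+-comm (∑ W (λ u → 𝟙 ((trace g ⊕ codeSyndrome G u) == s) ℤ.* 𝟙 (weight u ℕ.≡ᵇ j))) _)
      (cong₂ ℤ._+_ (false-part (suc j)) (trans (∑-cong W (λ u → cong (λ b → 𝟙 b ℤ.* 𝟙 (weight u ℕ.≡ᵇ j)) (==-shift (trace g) _ s))) (choices-words G (s ⊕ trace g) j)))

  weightDist-choices : ∀ {m} (G : List (Mat m)) j → + weightDist G j ≡ choices (map trace G) 0F j
  weightDist-choices G j = trans (length-filter _ (codewords G)) (trans (∑-filter _ (words (length G)) _) (choices-words G 0F j))

  choices-↭ : ∀ {xs ys} → xs ↭ ys → ∀ s j → choices xs s j ≡ choices ys s j
  choices-↭ Perm.refl        s j       = refl
  choices-↭ (prep x p)       s zero    = choices-↭ p s zero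
  choices-↭ (prep x p)       s (suc j) = cong₂ ℤ._+_ (choices-↭ p s (suc j)) (choices-↭ p (s ⊕ x) j)
  choices-↭ (swap x y p)     s zero    = choices-↭ p s zero
  choices-↭ {xs = x ∷ y ∷ xs} {ys = _ ∷ _ ∷ ys} (swap x y p) s (suc zero) =
    trans (cong₂ ℤ._+_ (cong₂ ℤ._+_ (choices-↭ p s 1) (choices-↭ p (s ⊕ y) 0)) (choices-↭ p (s ⊕ x) 0)) (lem (choices ys s 1) (choices ys (s ⊕ y) 0) _)
    where
    lem : ∀ a b c → a ℤ.+ b ℤ.+ c ≡ a ℤ.+ c ℤ.+ b
    lem = solve-∀
  choices-↭ {xs = x ∷ y ∷ xs} {ys = _ ∷ _ ∷ ys} (swap x y p) s (suc (suc j)) =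
    trans (cong₂ ℤ._+_ (cong₂ ℤ._+_ (choices-↭ p s _) (choices-↭ p (s ⊕ y) _)) (cong₂ ℤ._+_ (choices-↭ p (s ⊕ x) _)
        (trans (choices-↭ p (s ⊕ x ⊕ y) j) (cong (λ z → choices ys z j) (solve 3 (λ s x y → s :+ x :+ y := s :+ y :+ x) refl s x y)))))
      (lem (choices ys s (suc (suc j))) (choices ys (s ⊕ y) (suc j)) _ _)
    where
    lem : ∀ a b c d → a ℤ.+ b ℤ.+ (c ℤ.+ d) ≡ a ℤ.+ c ℤ.+ (b ℤ.+ d)
    lem = solve-∀
  choices-↭ (Perm.trans p q) s j = trans (choices-↭ p s j) (choices-↭ q s j)

  -- Taking ν of the n equal members changes the required sum from s to s - νβ, written with `⊕` in
  -- characteristic two.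
  choices-replicate : ∀ n β τs s j → choices (replicate n β ++ τs) s j ≡ ∑< (suc j) (λ ν → + (n C ν) ℤ.* choices τs (s ⊕ (ν ·F β)) (j ℕ.∸ ν))
  choices-replicate zero    β τs s j = sym (trans (cong₂ ℤ._+_ (trans (ℤP.*-identityˡ _) (cong (λ z → choices τs z j) (F+-identityʳ s)))
    (∑<-0 j (λ ν _ → cong (λ z → + z ℤ.* choices τs (s ⊕ (suc ν ·F β)) (j ℕ.∸ suc ν)) (k>n⇒nCk≡0 {0} {suc ν} (ℕ.s≤s ℕ.z≤n))))) (ℤP.+-identityʳ _))
  choices-replicate (suc n) β τs s zero    = trans (choices-replicate n β τs s zero)
    (cong (λ z → + z ℤ.* choices τs (s ⊕ 0F) 0 ℤ.+ 0ℤ) (trans (nC0≡1 n) (sym (nC0≡1 (suc n)))))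
  choices-replicate (suc n) β τs s (suc j) = begin
    choices (replicate n β ++ τs) s (suc j) ℤ.+ choices (replicate n β ++ τs) (s ⊕ β) j
      ≡⟨ cong₂ ℤ._+_ (choices-replicate n β τs s (suc j)) (choices-replicate n β τs (s ⊕ β) j) ⟩
    f 0 ℤ.+ ∑< (suc j) (f ∘ suc) ℤ.+ ∑< (suc j) (λ ν → + (n C ν) ℤ.* choices τs (s ⊕ β ⊕ (ν ·F β)) (j ℕ.∸ ν))
      ≡⟨ ℤP.+-assoc (f 0) _ _ ⟩
    f 0 ℤ.+ (∑< (suc j) (f ∘ suc) ℤ.+ ∑< (suc j) (λ ν → + (n C ν) ℤ.* choices τs (s ⊕ β ⊕ (ν ·F β)) (j ℕ.∸ ν)))
      ≡⟨ cong₂ ℤ._+_ (cong (λ z → + z ℤ.* choices τs (s ⊕ 0F) (suc j)) (trans (nC0≡1 n) (sym (nC0≡1 (suc n)))))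
           (trans (sym (∑<-+ (suc j) (f ∘ suc) (λ ν → + (n C ν) ℤ.* choices τs (s ⊕ β ⊕ (ν ·F β)) (j ℕ.∸ ν)))) (∑<-cong (suc j) (λ ν _ → step ν))) ⟩
    ∑< (suc (suc j)) (λ ν → + (suc n C ν) ℤ.* choices τs (s ⊕ (ν ·F β)) (suc j ℕ.∸ ν)) ∎
    where
    open ≡-Reasoning
    f : ℕ → ℤ
    f ν = + (n C ν) ℤ.* choices τs (s ⊕ (ν ·F β)) (suc j ℕ.∸ ν)
    step : ∀ ν → f (suc ν) ℤ.+ + (n C ν) ℤ.* choices τs (s ⊕ β ⊕ (ν ·F β)) (j ℕ.∸ ν) ≡ + (suc n C suc ν) ℤ.* choices τs (s ⊕ (suc ν ·F β)) (j ℕ.∸ ν)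
    step ν = trans (cong (λ z → f (suc ν) ℤ.+ + (n C ν) ℤ.* choices τs z (j ℕ.∸ ν)) (F+-assoc s β _))
      (trans (lem (+ (n C suc ν)) (+ (n C ν)) _) (cong (ℤ._* choices τs (s ⊕ (suc ν ·F β)) (j ℕ.∸ ν)) (sym (pascal n ν))))
      where
      lem : ∀ a b c → a ℤ.* c ℤ.+ b ℤ.* c ≡ (b ℤ.+ a) ℤ.* c
      lem = solve-∀

  blocks : List F → (F → ℕ) → List F
  blocks []       n = []
  blocks (β ∷ bs) n = replicate (n β) β ++ blocks bs n

  binProd : (F → ℕ) → ∀ {k} → Vec F k → Vec ℕ k → ℕ
  binProd n []       []       = 1
  binProd n (β ∷ bs) (ν ∷ νs) = (n β C ν) ℕ.* binProd n bs νs

  -- The bound b on the entries stays fixed while j decreases along the list, because all entries of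
  -- a family range up to the original j. Entries above the current j contribute nothing.
  choices-blocks : ∀ b bs n s j → j ℕ.≤ b → choices (blocks bs n) s j ≡
    ∑ (allVecs (fromTo 0 b) (length bs)) (λ ν → 𝟙 (sumVec ν ℕ.≡ᵇ j) ℤ.* 𝟙 (linComb ν (Vec.fromList bs) == s) ℤ.* + binProd n (Vec.fromList bs) ν)
  choices-blocks b []       n s zero    le = sym (trans (ℤP.+-identityʳ _) (trans (ℤP.*-identityʳ _) (ℤP.*-identityˡ _)))
  choices-blocks b []       n s (suc j) le = refl
  choices-blocks b (β ∷ bs) n s j       le = begin
    choices (replicate (n β) β ++ blocks bs n) s j ≡⟨ choices-replicate (n β) β (blocks bs n) s j ⟩
    ∑< (suc j) (λ ν → + (n β C ν) ℤ.* choices (blocks bs n) (s ⊕ (ν ·F β)) (j ℕ.∸ ν))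
      ≡⟨ ∑<-cong (suc j) (λ ν lt → trans (cong (+ (n β C ν) ℤ.*_) (choices-blocks b bs n (s ⊕ (ν ·F β)) (j ℕ.∸ ν) (ℕP.≤-trans (ℕP.m∸n≤m j ν) le))) (inside ν (ℕP.≤-pred lt))) ⟩
    ∑< (suc j) g ≡⟨ ∑<-extend g (ℕ.s≤s le) outside ⟨
    ∑< (suc b) g ≡⟨ ∑-fromTo 0 b g (λ _ ()) ⟨
    ∑ (fromTo 0 b) g ≡⟨ ∑-allVecs-suc (fromTo 0 b) (length bs) _ ⟨
    ∑ (allVecs (fromTo 0 b) (suc (length bs))) h ∎
    where
    open ≡-Reasoning
    V = allVecs (fromTo 0 b) (length bs)
    βs = Vec.fromList bs
    h : Vec ℕ (suc (length bs)) → ℤ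
    h ν = 𝟙 (sumVec ν ℕ.≡ᵇ j) ℤ.* 𝟙 (linComb ν (β ∷ βs) == s) ℤ.* + binProd n (β ∷ βs) ν
    g : ℕ → ℤ
    g ν = ∑ V (λ νs → h (ν ∷ νs))
    outside : ∀ ν → suc j ℕ.≤ ν → ν ℕ.< suc b → g ν ≡ 0ℤ
    outside ν lo _ = ∑-0-∈ V (λ νs _ → cong (λ z → 𝟙 z ℤ.* 𝟙 (linComb (ν ∷ νs) (β ∷ βs) == s) ℤ.* + binProd n (β ∷ βs) (ν ∷ νs)) (≡ᵇ-> (sumVec νs) lo))
    inside : ∀ ν → ν ℕ.≤ j → + (n β C ν) ℤ.* ∑ V (λ νs → 𝟙 (sumVec νs ℕ.≡ᵇ j ℕ.∸ ν) ℤ.* 𝟙 (linComb νs βs == (s ⊕ (ν ·F β))) ℤ.* + binProd n βs νs) ≡ g ν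
    inside ν le = trans (sym (∑-*ˡ V (+ (n β C ν)) _)) (∑-cong V (λ νs → trans (lem (+ (n β C ν)) (𝟙 (sumVec νs ℕ.≡ᵇ j ℕ.∸ ν)) (𝟙 (linComb νs βs == (s ⊕ (ν ·F β)))) (+ binProd n βs νs))
      (cong₂ ℤ._*_ (cong₂ (λ x y → 𝟙 x ℤ.* 𝟙 y) (sym (≡ᵇ-∸ (sumVec νs) le)) (sym (==-shift (ν ·F β) (linComb νs βs) s))) (sym (ℤP.pos-* (n β C ν) (binProd n βs νs))))))
      where
      lem : ∀ c x y p → c ℤ.* (x ℤ.* y ℤ.* p) ≡ x ℤ.* y ℤ.* (c ℤ.* p)
      lem = solve-∀

  count : List F → F → ℕ
  count τs β = length (filterᵇ (λ τ → τ == β) τs)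

  +count : {A : Set} (xs : List A) (φ : A → F) (β : F) → + count (map φ xs) β ≡ ∑ xs (λ x → 𝟙 (φ x == β))
  +count xs φ β = trans (length-filter _ (map φ xs)) (∑-map xs φ _)

  blocks-cong : ∀ bs {n n′} → (∀ β → β ∈ bs → n β ≡ n′ β) → blocks bs n ≡ blocks bs n′
  blocks-cong []       e = refl
  blocks-cong (β ∷ bs) e = cong₂ (λ k l → replicate k β ++ l) (e β (here refl)) (blocks-cong bs (λ γ i → e γ (there i)))

  blocks-insert : ∀ bs {n n′ τ} → Unique bs → τ ∈ bs → n′ τ ≡ suc (n τ) → (∀ β → β ≢ τ → n′ β ≡ n β) → blocks bs n′ ↭ τ ∷ blocks bs n
  blocks-insert (τ ∷ bs) {n} {n′} (ne ∷ u) (here refl) e e′ = Perm.↭-reflexive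
    (trans (cong (λ k → replicate k τ ++ blocks bs n′) e) (cong (λ l → τ ∷ replicate (n τ) τ ++ l) (blocks-cong bs (λ β i → e′ β (λ w → All.lookup ne i (sym w))))))
  blocks-insert (β ∷ bs) {n} {n′} {τ} (ne ∷ u) (there i) e e′ = Perm.↭-trans
    (Perm.↭-reflexive (cong (λ k → replicate k β ++ blocks bs n′) (e′ β (All.lookup ne i))))
    (Perm.↭-trans (PermP.++⁺ˡ (replicate (n β) β) (blocks-insert bs u i e e′)) (PermP.shift τ (replicate (n β) β) (blocks bs n)))

  ↭-blocks : ∀ τs → τs ↭ blocks elements (count τs)
  ↭-blocks []       = Perm.↭-reflexive (sym (zeros elements))
    where
    zeros : ∀ bs → blocks bs (λ _ → 0) ≡ []
    zeros []       = refl
    zeros (β ∷ bs) = zeros bs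
  ↭-blocks (τ ∷ τs) = Perm.↭-trans (prep τ (↭-blocks τs)) (Perm.↭-sym (blocks-insert elements unique (complete τ) same other))
    where
    same : count (τ ∷ τs) τ ≡ suc (count τs τ)
    same rewrite ⌊⌋-yes (τ ≟F τ) refl = refl
    other : ∀ β → β ≢ τ → count (τ ∷ τs) β ≡ count τs β
    other β n rewrite ⌊⌋-no (τ ≟F β) (λ w → n (sym w)) = refl

  blocks-↭ : ∀ {bs cs} n → bs ↭ cs → blocks bs n ↭ blocks cs n
  blocks-↭ n Perm.refl        = Perm.↭-refl
  blocks-↭ n (prep β p)       = PermP.++⁺ˡ (replicate (n β) β) (blocks-↭ n p)
  blocks-↭ n (swap {ys = ys} β γ p) = Perm.↭-trans (PermP.++⁺ˡ (replicate (n β) β) (PermP.++⁺ˡ (replicate (n γ) γ) (blocks-↭ n p)))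
    (Perm.↭-trans (Perm.↭-sym (PermP.++-assoc (replicate (n β) β) (replicate (n γ) γ) (blocks ys n)))
      (Perm.↭-trans (PermP.++⁺ʳ (blocks ys n) (PermP.++-comm (replicate (n β) β) (replicate (n γ) γ))) (PermP.++-assoc (replicate (n γ) γ) (replicate (n β) β) (blocks ys n))))
  blocks-↭ n (Perm.trans p q) = Perm.↭-trans (blocks-↭ n p) (blocks-↭ n q)

  blocks-filter : ∀ (p : F → Bool) n bs → (∀ β → β ∈ bs → p β ≡ false → n β ≡ 0) → blocks (filterᵇ p bs) n ≡ blocks bs n
  blocks-filter p n []       z = refl
  blocks-filter p n (β ∷ bs) z with p β in eq
  ... | true  = cong (replicate (n β) β ++_) (blocks-filter p n bs (λ γ i → z γ (there i)))
  ... | false = trans (blocks-filter p n bs (λ γ i → z γ (there i))) (cong (λ k → replicate k β ++ blocks bs n) (sym (z β (here refl) eq)))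

  formulaAB-choices : ∀ a j → + formulaAB a j ≡ choices (replicate a 0F ++ blocks Bs (λ _ → 2)) 0F j
  formulaAB-choices a j = begin
    + formulaAB a j ≡⟨ +sumℕ (familiesAB j) _ ⟩
    ∑ (familiesAB j) (λ p → + ((a C proj₁ p) ℕ.* π (proj₂ p))) ≡⟨ ∑-filter _ (concatMap (λ ν₀ → map (ν₀ ,_) V) (fromTo 0 j)) _ ⟩
    ∑ (concatMap (λ ν₀ → map (ν₀ ,_) V) (fromTo 0 j)) h ≡⟨ trans (∑-concatMap (fromTo 0 j) (λ ν₀ → map (ν₀ ,_) V) h) (∑-cong (fromTo 0 j) (λ ν₀ → ∑-map V (ν₀ ,_) h)) ⟩
    ∑ (fromTo 0 j) (λ ν₀ → ∑ V (λ ν → h (ν₀ , ν))) ≡⟨ ∑-fromTo 0 j (λ ν₀ → ∑ V (λ ν → h (ν₀ , ν))) (λ _ ()) ⟩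
    ∑< (suc j) (λ ν₀ → ∑ V (λ ν → h (ν₀ , ν))) ≡⟨ ∑<-cong (suc j) (λ ν₀ lt → step ν₀ (ℕP.≤-pred lt)) ⟩
    ∑< (suc j) (λ ν₀ → + (a C ν₀) ℤ.* choices (blocks Bs (λ _ → 2)) (0F ⊕ (ν₀ ·F 0F)) (j ℕ.∸ ν₀)) ≡⟨ choices-replicate a 0F (blocks Bs (λ _ → 2)) 0F j ⟨
    choices (replicate a 0F ++ blocks Bs (λ _ → 2)) 0F j ∎
    where
    open ≡-Reasoning
    V = allVecs (fromTo 0 j) (length Bs)
    π : Vec ℕ (length Bs) → ℕ
    π ν = prodℕ (Vec.toList (Vec.map (2 C_) ν))
    h : ℕ × Vec ℕ (length Bs) → ℤ
    h p = 𝟙 ((proj₁ p ℕ.+ sumVec (proj₂ p) ℕ.≡ᵇ j) ∧ (linComb (proj₂ p) BsV == 0F)) ℤ.* + ((a C proj₁ p) ℕ.* π (proj₂ p))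
    π-binProd : ∀ bs (ν : Vec ℕ (length bs)) → prodℕ (Vec.toList (Vec.map (2 C_) ν)) ≡ binProd (λ _ → 2) (Vec.fromList bs) ν
    π-binProd []       []       = refl
    π-binProd (β ∷ bs) (ν ∷ νs) = cong ((2 C ν) ℕ.*_) (π-binProd bs νs)
    ·F-0 : ∀ n → n ·F 0F ≡ 0F
    ·F-0 zero    = refl
    ·F-0 (suc n) = trans (F+-identityˡ _) (·F-0 n)
    step : ∀ ν₀ → ν₀ ℕ.≤ j → ∑ V (λ ν → h (ν₀ , ν)) ≡ + (a C ν₀) ℤ.* choices (blocks Bs (λ _ → 2)) (0F ⊕ (ν₀ ·F 0F)) (j ℕ.∸ ν₀)
    step ν₀ le = trans (∑-cong V (λ ν → trans (cong₂ ℤ._*_ (trans (𝟙-∧ (ν₀ ℕ.+ sumVec ν ℕ.≡ᵇ j) (linComb ν BsV == 0F)) (cong (λ b → 𝟙 b ℤ.* 𝟙 (linComb ν BsV == 0F)) (≡ᵇ-∸ (sumVec ν) le)))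
          (trans (cong (λ z → + ((a C ν₀) ℕ.* z)) (π-binProd Bs ν)) (ℤP.pos-* (a C ν₀) (binProd (λ _ → 2) BsV ν)))) (lem (𝟙 (sumVec ν ℕ.≡ᵇ j ℕ.∸ ν₀) ℤ.* 𝟙 (linComb ν BsV == 0F)) (+ (a C ν₀)) _)))
        (trans (∑-*ˡ V (+ (a C ν₀)) _) (cong (+ (a C ν₀) ℤ.*_) (trans (sym (choices-blocks j Bs (λ _ → 2) 0F (j ℕ.∸ ν₀) (ℕP.m∸n≤m j ν₀)))
          (cong (λ z → choices (blocks Bs (λ _ → 2)) z (j ℕ.∸ ν₀)) (sym (trans (F+-identityˡ _) (·F-0 ν₀)))))))
      where
      lem : ∀ x c p → x ℤ.* (c ℤ.* p) ≡ c ℤ.* (x ℤ.* p)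
      lem = solve-∀

  weightDist-AB : ∀ {m} (G : List (Mat m)) a → count (map trace G) 0F ≡ a →
    (∀ β → β ≢ 0F → tr (invF β) ≡ 0F → count (map trace G) β ≡ 2) → (∀ β → β ≢ 0F → tr (invF β) ≢ 0F → count (map trace G) β ≡ 0) →
    ∀ j → weightDist G j ≡ formulaAB a j
  weightDist-AB G a e₀ e₂ e₁ j = ℤP.+-injective (trans (weightDist-choices G j) (trans (choices-↭ perm 0F j) (sym (formulaAB-choices a j))))
    where
    n = count (map trace G)
    perm : map trace G ↭ replicate a 0F ++ blocks Bs (λ _ → 2)
    perm = Perm.↭-trans (↭-blocks (map trace G)) (Perm.↭-trans (blocks-↭ n elements-↭) (Perm.↭-reflexive (cong₂ (λ k l → replicate k 0F ++ l) e₀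
      (trans (sym (blocks-filter (λ β → tr (invF β) == 0F) n nonzero outside)) (blocks-cong Bs inside)))))
      where
      outside : ∀ β → β ∈ nonzero → (tr (invF β) == 0F) ≡ false → n β ≡ 0
      outside β i e = e₁ β (∈nonzero⁻ i) (λ z → case trans (sym e) (⌊⌋-yes (tr (invF β) ≟F 0F) z) of λ ())
      inside : ∀ β → β ∈ Bs → n β ≡ 2
      inside β i with ∈-filter⁻ (λ β → T? (tr (invF β) == 0F)) {xs = nonzero} i
      ... | k , t = e₂ β (∈nonzero⁻ k) (toWitness t)

  binProd-entryAt : ∀ n xs → Unique xs → (ν : Vec ℕ (length xs)) →
    binProd n (Vec.fromList xs) ν ≡ prodℕ (map (λ β → n β C entryAt _≟F_ β ν (Vec.fromList xs)) xs)
  binProd-entryAt n []       _       []       = refl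
  binProd-entryAt n (x ∷ xs) (ne ∷ u) (c ∷ ν) = cong₂ ℕ._*_ head (trans (binProd-entryAt n xs u ν) (prodℕ-cong-∈ xs tail))
    where
    head : n x C c ≡ n x C entryAt _≟F_ x (c ∷ ν) (x ∷ Vec.fromList xs)
    head rewrite ⌊⌋-yes (x ≟F x) refl = refl
    tail : ∀ β → β ∈ xs → n β C entryAt _≟F_ β ν (Vec.fromList xs) ≡ n β C entryAt _≟F_ β (c ∷ ν) (x ∷ Vec.fromList xs)
    tail β i rewrite ⌊⌋-no (x ≟F β) (All.lookup ne i) = refl

  -- `summandC` groups its factors by the value of K(1/β); membership of all these values in
  -- `tRange` ensures that no β drops out of the product.
  weightDist-C : ∀ {m} (G : List (Mat m)) → + count (map trace G) 0F ≡ m₀ →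
    (∀ β → β ≢ 0F → + count (map trace G) β ≡ m_ (K (invF β))) → Unique tRange → (∀ β → β ≢ 0F → K (invF β) ∈ tRange) →
    ∀ j → weightDist G j ≡ formulaC j
  weightDist-C G e₀ e₁ u∈ K∈ j = ℤP.+-injective (trans (weightDist-choices G j) (trans (choices-↭ (↭-blocks (map trace G)) 0F j)
      (trans (choices-blocks j elements n 0F j ℕP.≤-refl) (trans (∑-cong V step) (sym (trans (+sumℕ (familiesC j) summandC) (∑-filter _ V _)))))))
    where
    n = count (map trace G)
    V = allVecs (fromTo 0 j) (length elements)
    summand : ∀ ν → binProd n allF ν ≡ summandC ν
    summand ν = begin
      binProd n allF ν ≡⟨ binProd-entryAt n elements unique ν ⟩
      prodℕ (map (λ β → n β C entryAt _≟F_ β ν allF) elements) ≡⟨ prodℕ-cong-∈ elements (λ β _ → cong (n β C_) (sym (νat-entryAt FF r ν β))) ⟩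
      prodℕ (map (λ β → n β C νat ν β) elements) ≡⟨ prodℕ-↭ (PermP.map⁺ (λ β → n β C νat ν β) elements-↭) ⟩
      (n 0F C νat ν 0F) ℕ.* prodℕ (map (λ β → n β C νat ν β) nonzero) ≡⟨ cong₂ ℕ._*_ (cong (λ z → binomℤ z (+ νat ν 0F)) e₀)
                                                                                     (prodℕ-cong-∈ nonzero (λ β i → cong (λ z → binomℤ z (+ νat ν β)) (e₁ β (∈nonzero⁻ i)))) ⟩
      binomℤ m₀ (+ νat ν 0F) ℕ.* prodℕ (map (λ β → binomℤ (m_ (K (invF β))) (+ νat ν β)) nonzero)
        ≡⟨ cong (binomℤ m₀ (+ νat ν 0F) ℕ.*_) (prodℕ-fibres ℤ._≟_ (λ β → K (invF β)) (λ t β → binomℤ (m_ t) (+ νat ν β)) tRange u∈ nonzero (λ β i → K∈ β (∈nonzero⁻ i))) ⟨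
      summandC ν ∎
      where open ≡-Reasoning
    step : ∀ ν → 𝟙 (sumVec ν ℕ.≡ᵇ j) ℤ.* 𝟙 (linComb ν allF == 0F) ℤ.* + binProd n allF ν ≡ 𝟙 ((sumVec ν ℕ.≡ᵇ j) ∧ (linComb ν allF == 0F)) ℤ.* + summandC ν
    step ν = cong₂ ℤ._*_ (sym (𝟙-∧ (sumVec ν ℕ.≡ᵇ j) (linComb ν allF == 0F))) (cong +_ (summand ν))

all-∈ : {A : Set} (p : A → Bool) (xs : List A) → all p xs ≡ true → ∀ {x} → x ∈ xs → p x ≡ true
all-∈ p (y ∷ ys) e i with p y in eq
all-∈ p (y ∷ ys) e (here refl) | true = eq
all-∈ p (y ∷ ys) e (there i)   | true = all-∈ p ys e i

all-true : {A : Set} (p : A → Bool) (xs : List A) → (∀ x → p x ≡ true) → all p xs ≡ true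
all-true p []       e = refl
all-true p (x ∷ xs) e rewrite e x = all-true p xs e

any-true : {A : Set} (p : A → Bool) {xs : List A} {x : A} → x ∈ xs → p x ≡ true → any p xs ≡ true
any-true p (here refl)        e rewrite e = refl
any-true p (there {y} i)      e with p y
... | true  = refl
... | false = any-true p i e

∈-filterᵇ⁺ : {A : Set} (p : A → Bool) {xs : List A} {x : A} → x ∈ xs → p x ≡ true → x ∈ filterᵇ p xs
∈-filterᵇ⁺ p i e = ∈-filter⁺ (T? ∘ p) i (subst T (sym e) _)

∈-filterᵇ⁻ : {A : Set} (p : A → Bool) {xs : List A} {x : A} → x ∈ filterᵇ p xs → x ∈ xs × p x ≡ true
∈-filterᵇ⁻ p {xs} {x} i = proj₁ (∈-filter⁻ (T? ∘ p) {xs = xs} i) , T-true (p x) (proj₂ (∈-filter⁻ (T? ∘ p) {xs = xs} i))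
  where
  T-true : ∀ b → T b → b ≡ true
  T-true true _ = refl

unique-map-∈ : {A B : Set} (f : A → B) (xs : List A) → Unique xs → (∀ x y → x ∈ xs → y ∈ xs → f x ≡ f y → x ≡ y) → Unique (map f xs)
unique-map-∈ f []       _       inj = []
unique-map-∈ f (x ∷ xs) (n ∷ u) inj = All.tabulate ne ∷ unique-map-∈ f xs u (λ y z i j → inj y z (there i) (there j))
  where
  ne : ∀ {b} → b ∈ map f xs → f x ≢ b
  ne i e with ∈-map⁻ f i
  ... | y , j , refl = All.lookup n j (inj x y (here refl) (there j) e)

⌊⌋-true : {P : Set} (d : Dec P) → ⌊ d ⌋ ≡ true → P
⌊⌋-true (yes p) _ = p

-- Symbolic counterparts of the operations on F⁴ = 2 × 2 matrices, used both over the field and over polynomials: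
-- the quadruple (x , y , z , w) is [[x,y],[z,w]], and F⁴ ∋ (x₁,x₂,x₃,x₄) is identified with [[x₁,x₂],[x₄,x₃]].
module Forms {A : Set} (_⊕_ _⊗_ : A → A → A) (0# : A) where

  private
    infixl 6 _+_
    infixl 7 _·_
    _+_ _·_ : A → A → A
    _+_ = _⊕_
    _·_ = _⊗_

  Quadᴬ : Set
  Quadᴬ = A × A × A × A

  on₈ : {X : Set} → (Quadᴬ → Quadᴬ → X) → A → A → A → A → A → A → A → A → X
  on₈ F a b c d e f g h = F (a , b , c , d) (e , f , g , h)

  on₁₂ : {X : Set} → (Quadᴬ → Quadᴬ → Quadᴬ → X) → A → A → A → A → A → A → A → A → A → A → A → A → X
  on₁₂ F a b c d e f g h x y z w = F (a , b , c , d) (e , f , g , h) (x , y , z , w)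

  on₁₆ : {X : Set} → (Quadᴬ → Quadᴬ → Quadᴬ → Quadᴬ → X) → A → A → A → A → A → A → A → A → A → A → A → A → A → A → A → A → X
  on₁₆ F a b c d e f g h i j k l m n o p = F (a , b , c , d) (e , f , g , h) (i , j , k , l) (m , n , o , p)

  det₂ tr₂ : Quadᴬ → A
  det₂ (x , y , z , w) = x · w + y · z
  tr₂  (x , y , z , w) = x + w

  polar : Quadᴬ → Quadᴬ → A
  polar (x , y , z , w) (x′ , y′ , z′ , w′) = x · w′ + w · x′ + y · z′ + z · y′

  -- The columns are the images of the basis vectors. The last two rows hold w before z, since the
  -- third coordinate is the lower right entry of the 2 × 2 matrix.
  columns : Quadᴬ → Quadᴬ → Quadᴬ → Quadᴬ → Vec (Vec A 4) 4
  columns (x₁ , y₁ , z₁ , w₁) (x₂ , y₂ , z₂ , w₂) (x₃ , y₃ , z₃ , w₃) (x₄ , y₄ , z₄ , w₄) =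
    (x₁ ∷ x₂ ∷ x₃ ∷ x₄ ∷ []) ∷ (y₁ ∷ y₂ ∷ y₃ ∷ y₄ ∷ []) ∷ (w₁ ∷ w₂ ∷ w₃ ∷ w₄ ∷ []) ∷ (z₁ ∷ z₂ ∷ z₃ ∷ z₄ ∷ []) ∷ []

  outer : A × A → A × A → Quadᴬ
  outer (p , p′) (s , s′) = p · s , p · s′ , p′ · s , p′ · s′

  -- The products pᵢ rⱼ of a column of P and a row of R
  p₁r₁ p₁r₂ p₂r₁ p₂r₂ : Quadᴬ → Quadᴬ → Quadᴬ
  p₁r₁ (a , b , c , d) (e , f , g , h) = outer (a , c) (e , f)
  p₁r₂ (a , b , c , d) (e , f , g , h) = outer (a , c) (g , h)
  p₂r₁ (a , b , c , d) (e , f , g , h) = outer (b , d) (e , f)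
  p₂r₂ (a , b , c , d) (e , f , g , h) = outer (b , d) (g , h)

  -- X ↦ P X R
  action : Quadᴬ → Quadᴬ → Vec (Vec A 4) 4
  action P R = columns (p₁r₁ P R) (p₁r₂ P R) (p₂r₂ P R) (p₂r₁ P R)

  adj : Quadᴬ → Quadᴬ
  adj (a , b , c , d) = d , b , c , a

  lin : A → A → Quadᴬ → Quadᴬ → Quadᴬ
  lin s t (x , y , z , w) (x′ , y′ , z′ , w′) = s · x + t · x′ , s · y + t · y′ , s · z + t · z′ , s · w + t · w′

  dot : ∀ {n} → Vec A n → Vec A n → A
  dot []       []       = 0#
  dot (x ∷ xs) (y ∷ ys) = x · y + dot xs ys

  apply : Vec (Vec A 4) 4 → Vec A 4 → Vec A 4
  apply m x = Vec.map (λ row → dot row x) m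

  at : Vec (Vec A 4) 4 → Fin 4 → Fin 4 → A
  at m i j = Vec.lookup (Vec.lookup m i) j

  product : Vec (Vec A 4) 4 → Vec (Vec A 4) 4 → Fin 4 → Fin 4 → A
  product m n i j = dot (Vec.lookup m i) (Vec.map (λ row → Vec.lookup row j) n)

  θ : Vec A 4 → A
  θ (x ∷ y ∷ z ∷ w ∷ []) = x · z + (y · w + 0#)

  δ : Vec (Vec A 4) 4 → A
  δ ((_ ∷ _ ∷ b₁ ∷ b₂ ∷ []) ∷ (_ ∷ _ ∷ b₃ ∷ b₄ ∷ []) ∷ (c₁ ∷ c₂ ∷ _ ∷ _ ∷ []) ∷ (c₃ ∷ c₄ ∷ _ ∷ _ ∷ []) ∷ []) =
    b₁ · c₁ + (b₂ · c₂ + 0#) + (b₃ · c₃ + (b₄ · c₄ + 0#) + 0#)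

  diagonal : Vec (Vec A 4) 4 → A
  diagonal ((a ∷ _) ∷ (_ ∷ b ∷ _) ∷ (_ ∷ _ ∷ c ∷ _) ∷ (_ ∷ _ ∷ _ ∷ d ∷ []) ∷ []) = a + (b + (c + (d + 0#)))

  -- The coordinates of V on p₁r₂ and p₂r₁
  coord₁₂ coord₂₁ : Quadᴬ → Quadᴬ → Quadᴬ → A
  coord₁₂ (a , b , c , d) (e , f , g , h) (x , y , z , w) = d · (x · f + y · e) + b · (z · f + w · e)
  coord₂₁ (a , b , c , d) (e , f , g , h) (x , y , z , w) = c · (x · h + y · g) + a · (z · h + w · g)

  minor : Fin 4 → Fin 4 → Fin 4 → Fin 4 → Fin 4 → Fin 4 → Fin 4 → Fin 4 → Vec (Vec A 4) 4 → A
  minor i j k l i′ j′ k′ l′ m = at m i j · at m k l + at m i′ j′ · at m k′ l′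

-- Explicit forms of SO⁺(2,q), O⁺(2,q) and SO⁺(4,q)

module Groups (FF : FiniteField) (r : ℕ) (card : length (FiniteField.elements FF) ≡ 2 ℕ.^ r) where

  open FiniteField FF renaming (_+F_ to infixl 6 _⊕_; _*F_ to infixl 7 _⊗_)
  open Setup FF r
  open FieldTheory FF r card
  open S₂ using (_:+_; _:*_; _:=_; solve; con; Polynomial)
  open Forms _⊕_ _⊗_ 0F
  module _ {n : ℕ} where
    open Forms {Polynomial n} _:+_ _:*_ :0 public using () renaming
      (det₂ to :det; tr₂ to :tr; polar to :polar; columns to :columns; p₁r₁ to :p₁r₁; p₁r₂ to :p₁r₂; p₂r₁ to :p₂r₁; p₂r₂ to :p₂r₂; action to :action; adj to :adj; lin to :lin;
       apply to :apply; product to :product; θ to :θ; δ to :δ; diagonal to :diagonal; coord₁₂ to :coord₁₂; coord₂₁ to :coord₂₁; minor to :minor;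
       on₈ to :on₈; on₁₂ to :on₁₂; on₁₆ to :on₁₆)

  allMats-complete : ∀ {n} (g : Mat n) → g ∈ allMats n
  allMats-complete {n} = allVecs-complete _ (allVecs-complete elements complete n) n

  O⁺-unique : ∀ n → Unique (O⁺ n)
  O⁺-unique n = UniqueP.filter⁺ _ (allVecs-unique _ (allVecs-unique elements unique (n ℕ.+ n)) (n ℕ.+ n))

  SO⁺-unique : ∀ n → Unique (SO⁺ n)
  SO⁺-unique n = UniqueP.filter⁺ _ (O⁺-unique n)

  isId-true : ∀ {n} (g : Mat n) → (∀ i j → entry g i j ≡ (if ⌊ i Fin.≟ j ⌋ then 1F else 0F)) → isId g ≡ true
  isId-true {n} g e = all-true _ (finList n) (λ i → all-true _ (finList n) (λ j → ⌊⌋-yes (_ ≟F _) (e i j)))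

  ∈O⁺⁺ : ∀ n {g} h → isId (matMul h g) ≡ true → (∀ x → θ⁺ n (matVec g x) ≡ θ⁺ n x) → g ∈ O⁺ n
  ∈O⁺⁺ n {g} h inv pres = ∈-filterᵇ⁺ (isO⁺ n) (allMats-complete g) (trans (cong₂ _∧_ (any-true _ (allMats-complete h) inv)
    (all-true _ (allVecs elements (n ℕ.+ n)) (λ x → ⌊⌋-yes (_ ≟F _) (pres x)))) refl)

  ∈O⁺⁻ : ∀ n {g} → g ∈ O⁺ n → ∀ x → θ⁺ n (matVec g x) ≡ θ⁺ n x
  ∈O⁺⁻ n {g} i x = ⌊⌋-true (_ ≟F _) (all-∈ (λ x → θ⁺ n (matVec g x) == θ⁺ n x) (allVecs elements (n ℕ.+ n))
      (second (invertible g) (proj₂ (∈-filterᵇ⁻ (isO⁺ n) {allMats (n ℕ.+ n)} i))) (allVecs-complete elements complete _ x))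
    where
    second : ∀ b {c} → b ∧ c ≡ true → c ≡ true
    second true e = e

  ∈SO⁺⁺ : ∀ n {g} → g ∈ O⁺ n → δ⁺ n g ≡ 0F → g ∈ SO⁺ n
  ∈SO⁺⁺ n {g} i e = ∈-filterᵇ⁺ _ i (⌊⌋-yes (δ⁺ n g ≟F 0F) e)

  ∈SO⁺⁻ : ∀ n {g} → g ∈ SO⁺ n → g ∈ O⁺ n × δ⁺ n g ≡ 0F
  ∈SO⁺⁻ n {g} i with ∈-filterᵇ⁻ (λ g → δ⁺ n g == 0F) {O⁺ n} i
  ... | j , e = j , ⌊⌋-true (δ⁺ n g ≟F 0F) e

  -- O⁺(2,q)

  diag anti : F → Mat 2
  diag a = (a ∷ 0F ∷ []) ∷ (0F ∷ invF a ∷ []) ∷ []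
  anti a = (0F ∷ a ∷ []) ∷ (invF a ∷ 0F ∷ []) ∷ []

  diag∈O⁺ : ∀ {a} → a ≢ 0F → diag a ∈ O⁺ 1
  diag∈O⁺ {a} n = ∈O⁺⁺ 1 ((invF a ∷ 0F ∷ []) ∷ (0F ∷ a ∷ []) ∷ []) (isId-true (matMul ((invF a ∷ 0F ∷ []) ∷ (0F ∷ a ∷ []) ∷ []) (diag a)) id-entries) pres
    where
    a′ = invF a
    id-entries : ∀ i j → entry (matMul ((a′ ∷ 0F ∷ []) ∷ (0F ∷ a ∷ []) ∷ []) (diag a)) i j ≡ (if ⌊ i Fin.≟ j ⌋ then 1F else 0F)
    id-entries Fin.zero           Fin.zero           = trans (solve 2 (λ x y → y :* x :+ (:0 :* :0 :+ :0) := x :* y) refl a a′) (invF-inv a n)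
    id-entries Fin.zero           (Fin.suc Fin.zero) = solve 2 (λ x y → y :* :0 :+ (:0 :* y :+ :0) := :0) refl a a′
    id-entries (Fin.suc Fin.zero) Fin.zero           = solve 2 (λ x y → :0 :* x :+ (x :* :0 :+ :0) := :0) refl a a′
    id-entries (Fin.suc Fin.zero) (Fin.suc Fin.zero) = trans (solve 2 (λ x y → :0 :* :0 :+ (x :* y :+ :0) := x :* y) refl a a′) (invF-inv a n)
    pres : ∀ x → θ⁺ 1 (matVec (diag a) x) ≡ θ⁺ 1 x
    pres (x ∷ y ∷ []) = by₁ (x ⊗ y) (invF-inv a n) (solve 4 (λ a b x y →
      (a :* x :+ (:0 :* y :+ :0)) :* (:0 :* x :+ (b :* y :+ :0)) :+ :0 := (x :* y :+ :0) :+ x :* y :* (a :* b :+ :1)) refl a a′ x y)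

  anti∈O⁺ : ∀ {a} → a ≢ 0F → anti a ∈ O⁺ 1
  anti∈O⁺ {a} n = ∈O⁺⁺ 1 (anti a) (isId-true (matMul (anti a) (anti a)) id-entries) pres
    where
    a′ = invF a
    id-entries : ∀ i j → entry (matMul (anti a) (anti a)) i j ≡ (if ⌊ i Fin.≟ j ⌋ then 1F else 0F)
    id-entries Fin.zero           Fin.zero           = trans (solve 2 (λ x y → :0 :* :0 :+ (x :* y :+ :0) := x :* y) refl a a′) (invF-inv a n)
    id-entries Fin.zero           (Fin.suc Fin.zero) = solve 2 (λ x y → :0 :* x :+ (x :* :0 :+ :0) := :0) refl a a′
    id-entries (Fin.suc Fin.zero) Fin.zero           = solve 2 (λ x y → y :* :0 :+ (:0 :* y :+ :0) := :0) refl a a′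
    id-entries (Fin.suc Fin.zero) (Fin.suc Fin.zero) = trans (solve 2 (λ x y → y :* x :+ (:0 :* :0 :+ :0) := x :* y) refl a a′) (invF-inv a n)
    pres : ∀ x → θ⁺ 1 (matVec (anti a) x) ≡ θ⁺ 1 x
    pres (x ∷ y ∷ []) = by₁ (x ⊗ y) (invF-inv a n) (solve 4 (λ a b x y →
      (:0 :* x :+ (a :* y :+ :0)) :* (b :* x :+ (:0 :* y :+ :0)) :+ :0 := (x :* y :+ :0) :+ x :* y :* (a :* b :+ :1)) refl a a′ x y)

  -- Testing the form on (1,0), (0,1) and (1,1) gives ac = 0, bd = 0 and ad + bc = 1, so either the
  -- diagonal or the antidiagonal vanishes.
  O⁺1-form : ∀ g → g ∈ O⁺ 1 → (∃ λ a → a ≢ 0F × g ≡ diag a) ⊎ (∃ λ a → a ≢ 0F × g ≡ anti a)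
  O⁺1-form ((a ∷ b ∷ []) ∷ (c ∷ d ∷ []) ∷ []) i with a ≟F 0F
  ... | yes refl = inj₂ (b , b≢0 , cong₂ (λ x y → (0F ∷ b ∷ []) ∷ (x ∷ y ∷ []) ∷ []) (sym (inv-unique bc)) (*-nonzero b≢0 bd))
    where
    pres = ∈O⁺⁻ 1 i
    bd : b ⊗ d ≡ 0F
    bd = trans (solve 3 (λ b c d → b :* d := (:0 :* :0 :+ (b :* :1 :+ :0)) :* (c :* :0 :+ (d :* :1 :+ :0)) :+ :0) refl b c d)
      (trans (pres (0F ∷ 1F ∷ [])) (solve 0 (:0 :* :1 :+ :0 := :0) refl))
    bc : b ⊗ c ≡ 1F
    bc = by₁ 1F bd (trans (solve 3 (λ b c d → b :* c := ((:0 :* :1 :+ (b :* :1 :+ :0)) :* (c :* :1 :+ (d :* :1 :+ :0)) :+ :0) :+ :1 :* (b :* d :+ :0)) refl b c d)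
      (cong (_⊕ 1F ⊗ (b ⊗ d ⊕ 0F)) (trans (pres (1F ∷ 1F ∷ [])) (solve 0 (:1 :* :1 :+ :0 := :1) refl))))
    b≢0 : b ≢ 0F
    b≢0 refl = 0F≢1F (trans (sym (F*-zeroˡ c)) bc)
  ... | no a≢0 = inj₁ (a , a≢0 , trans (cong₂ (λ x y → (a ∷ x ∷ []) ∷ (y ∷ d ∷ []) ∷ []) b≡0 c≡0) (cong (λ x → (a ∷ 0F ∷ []) ∷ (0F ∷ x ∷ []) ∷ []) (sym (inv-unique ad))))
    where
    pres = ∈O⁺⁻ 1 i
    ac : a ⊗ c ≡ 0F
    ac = trans (solve 4 (λ a b c d → a :* c := (a :* :1 :+ (b :* :0 :+ :0)) :* (c :* :1 :+ (d :* :0 :+ :0)) :+ :0) refl a b c d)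
      (trans (pres (1F ∷ 0F ∷ [])) (solve 0 (:1 :* :0 :+ :0 := :0) refl))
    c≡0 : c ≡ 0F
    c≡0 = *-nonzero a≢0 ac
    bd : b ⊗ d ≡ 0F
    bd = trans (solve 4 (λ a b c d → b :* d := (a :* :0 :+ (b :* :1 :+ :0)) :* (c :* :0 :+ (d :* :1 :+ :0)) :+ :0) refl a b c d)
      (trans (pres (0F ∷ 1F ∷ [])) (solve 0 (:0 :* :1 :+ :0 := :0) refl))
    ad : a ⊗ d ≡ 1F
    ad = by₂ (a ⊕ b) 1F c≡0 bd (trans (solve 4 (λ a b c d → a :* d := (((a :* :1 :+ (b :* :1 :+ :0)) :* (c :* :1 :+ (d :* :1 :+ :0)) :+ :0) :+ (a :+ b) :* (c :+ :0)) :+ :1 :* (b :* d :+ :0)) refl a b c d)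
      (cong (λ z → z ⊕ (a ⊕ b) ⊗ (c ⊕ 0F) ⊕ 1F ⊗ (b ⊗ d ⊕ 0F)) (trans (pres (1F ∷ 1F ∷ [])) (solve 0 (:1 :* :1 :+ :0 := :1) refl))))
    d≢0 : d ≢ 0F
    d≢0 refl = 0F≢1F (trans (sym (F*-zeroʳ a)) ad)
    b≡0 : b ≡ 0F
    b≡0 = *-nonzero d≢0 (trans (F*-comm d b) bd)

  δ-diag : ∀ a → δ⁺ 1 (diag a) ≡ 0F
  δ-diag a = solve 0 (:0 :* :0 :+ :0 :+ :0 := :0) refl

  δ-anti : ∀ {a} → a ≢ 0F → δ⁺ 1 (anti a) ≢ 0F
  δ-anti {a} n e = 0F≢1F (trans (sym e) (trans (solve 2 (λ x y → x :* y :+ :0 :+ :0 := x :* y) refl a (invF a)) (invF-inv a n)))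

  diag-unique : Unique (map diag nonzero)
  diag-unique = UniqueP.map⁺ (cong (λ g → entry g Fin.zero Fin.zero)) nonzero-unique

  SO⁺1-↭ : SO⁺ 1 ↭ map diag nonzero
  SO⁺1-↭ = unique-↭ (SO⁺-unique 1) diag-unique fwd bwd
    where
    fwd : ∀ g → g ∈ SO⁺ 1 → g ∈ map diag nonzero
    fwd g i with ∈SO⁺⁻ 1 i
    ... | j , δ≡0 with O⁺1-form g j
    ...   | inj₁ (a , n , refl) = ∈-map⁺ diag (∈nonzero⁺ n)
    ...   | inj₂ (a , n , refl) = ⊥-elim (δ-anti n δ≡0)
    bwd : ∀ g → g ∈ map diag nonzero → g ∈ SO⁺ 1
    bwd g i with ∈-map⁻ diag i
    ... | a , j , refl = ∈SO⁺⁺ 1 (diag∈O⁺ (∈nonzero⁻ j)) (δ-diag a)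

  O⁺1-↭ : O⁺ 1 ↭ map diag nonzero ++ map anti nonzero
  O⁺1-↭ = unique-↭ (O⁺-unique 1) (UniqueP.++⁺ diag-unique (UniqueP.map⁺ (cong (λ g → entry g Fin.zero (Fin.suc Fin.zero))) nonzero-unique) disjoint) fwd bwd
    where
    disjoint : ∀ {g} → g ∈ map diag nonzero × g ∈ map anti nonzero → ⊥
    disjoint (i , j) with ∈-map⁻ diag i | ∈-map⁻ anti j
    ... | a , k , refl | b , l , e = ∈nonzero⁻ k (cong (λ g → entry g Fin.zero Fin.zero) e)
    fwd : ∀ g → g ∈ O⁺ 1 → g ∈ map diag nonzero ++ map anti nonzero
    fwd g i with O⁺1-form g i
    ... | inj₁ (a , n , refl) = ∈-++⁺ˡ (∈-map⁺ diag (∈nonzero⁺ n))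
    ... | inj₂ (a , n , refl) = ∈-++⁺ʳ (map diag nonzero) (∈-map⁺ anti (∈nonzero⁺ n))
    bwd : ∀ g → g ∈ map diag nonzero ++ map anti nonzero → g ∈ O⁺ 1
    bwd g i with ∈-++⁻ (map diag nonzero) i
    ... | inj₁ j with ∈-map⁻ diag j
    ...   | a , k , refl = diag∈O⁺ (∈nonzero⁻ k)
    bwd g i | inj₂ j with ∈-map⁻ anti j
    ...   | a , k , refl = anti∈O⁺ (∈nonzero⁻ k)

  ∑-SO⁺1 : ∀ (f : F → ℤ) → ∑ (SO⁺ 1) (λ g → f (trace g)) ≡ ∑ nonzero (λ z → f (z ⊕ invF z))
  ∑-SO⁺1 f = trans (∑-↭ _ SO⁺1-↭) (trans (∑-map nonzero diag _) (∑-cong nonzero (λ z → cong (λ t → f (z ⊕ t)) (F+-identityʳ (invF z)))))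

  ∑-O⁺1 : ∀ (f : F → ℤ) → ∑ (O⁺ 1) (λ g → f (trace g)) ≡ ∑ nonzero (λ z → f (z ⊕ invF z)) ℤ.+ + length nonzero ℤ.* f 0F
  ∑-O⁺1 f = trans (∑-↭ _ O⁺1-↭) (trans (∑-++ (map diag nonzero) (map anti nonzero) _) (cong₂ ℤ._+_
    (trans (∑-map nonzero diag _) (∑-cong nonzero (λ z → cong (λ t → f (z ⊕ t)) (F+-identityʳ (invF z)))))
    (trans (∑-map nonzero anti _) (trans (∑-cong nonzero (λ z → cong f (solve 0 (:0 :+ (:0 :+ :0) := :0) refl))) (∑-const nonzero (f 0F))))))

  -- SO⁺(4,q) is SL₂ × SL₂ acting by X ↦ P X R, since θ⁺ is the determinant.

  Quad : Set
  Quad = F × F × F × F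

  quads SL : List Quad
  quads = cartesianProduct elements (cartesianProduct elements (cartesianProduct elements elements))
  SL    = filterᵇ (λ P → det₂ P == 1F) quads

  SL-unique : Unique SL
  SL-unique = UniqueP.filter⁺ _ (UniqueP.cartesianProduct⁺ unique (UniqueP.cartesianProduct⁺ unique (UniqueP.cartesianProduct⁺ unique unique)))

  ∈SL⁺ : ∀ {P} → det₂ P ≡ 1F → P ∈ SL
  ∈SL⁺ {P@(a , b , c , d)} e = ∈-filterᵇ⁺ _ (∈-cartesianProduct⁺ (complete a) (∈-cartesianProduct⁺ (complete b) (∈-cartesianProduct⁺ (complete c) (complete d))))
    (⌊⌋-yes (det₂ P ≟F 1F) e)

  ∈SL⁻ : ∀ {P} → P ∈ SL → det₂ P ≡ 1F
  ∈SL⁻ {P} i = ⌊⌋-true (det₂ P ≟F 1F) (proj₂ (∈-filterᵇ⁻ (λ P → det₂ P == 1F) {quads} i))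

  act : Quad × Quad → Mat 4
  act (P , R) = action P R

  det-scale : ∀ {x y p s} → p ≡ 1F → s ≡ 1F → x ≡ p ⊗ s ⊗ y → x ≡ y
  det-scale {y = y} refl refl e = trans e (solve 1 (λ y → :1 :* :1 :* y := y) refl y)

  act-preserves : ∀ P R → det₂ P ≡ 1F → det₂ R ≡ 1F → ∀ x → θ⁺ 2 (matVec (act (P , R)) x) ≡ θ⁺ 2 x
  act-preserves (a , b , c , d) (e , f , g , h) p s (x ∷ y ∷ z ∷ t ∷ []) = det-scale p s (solve 12 (λ a b c d e f g h x y z t →
    :θ (:apply (:action (a , b , c , d) (e , f , g , h)) (x ∷ y ∷ z ∷ t ∷ [])) := :det (a , b , c , d) :* :det (e , f , g , h) :* :θ (x ∷ y ∷ z ∷ t ∷ []))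
    refl a b c d e f g h x y z t)

  pattern 0₄ = Fin.zero
  pattern 1₄ = Fin.suc Fin.zero
  pattern 2₄ = Fin.suc (Fin.suc Fin.zero)
  pattern 3₄ = Fin.suc (Fin.suc (Fin.suc Fin.zero))

  act-inverse : ∀ P R → det₂ P ≡ 1F → det₂ R ≡ 1F → ∀ i j → entry (matMul (act (adj P , adj R)) (act (P , R))) i j ≡ (if ⌊ i Fin.≟ j ⌋ then 1F else 0F)
  act-inverse (a , b , c , d) (e , f , g , h) p s = entries
    where
    poly : ∀ {n} → Fin 4 → Fin 4 → (P R : Polynomial n × Polynomial n × Polynomial n × Polynomial n) → Polynomial n
    poly i j P R = :product (:action (:adj P) (:adj R)) (:action P R) i j
    entries : ∀ i j → entry (matMul (act (adj (a , b , c , d) , adj (e , f , g , h))) (act ((a , b , c , d) , (e , f , g , h)))) i j ≡ (if ⌊ i Fin.≟ j ⌋ then 1F else 0F)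
    entries 0₄ 0₄ = det-scale p s (solve 8 (:on₈ λ P R → poly 0₄ 0₄ P R := :det P :* :det R :* :1) refl a b c d e f g h)
    entries 0₄ 1₄ = solve 8 (:on₈ λ P R → poly 0₄ 1₄ P R := :0) refl a b c d e f g h
    entries 0₄ 2₄ = solve 8 (:on₈ λ P R → poly 0₄ 2₄ P R := :0) refl a b c d e f g h
    entries 0₄ 3₄ = solve 8 (:on₈ λ P R → poly 0₄ 3₄ P R := :0) refl a b c d e f g h
    entries 1₄ 0₄ = solve 8 (:on₈ λ P R → poly 1₄ 0₄ P R := :0) refl a b c d e f g h
    entries 1₄ 1₄ = det-scale p s (solve 8 (:on₈ λ P R → poly 1₄ 1₄ P R := :det P :* :det R :* :1) refl a b c d e f g h)
    entries 1₄ 2₄ = solve 8 (:on₈ λ P R → poly 1₄ 2₄ P R := :0) refl a b c d e f g h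
    entries 1₄ 3₄ = solve 8 (:on₈ λ P R → poly 1₄ 3₄ P R := :0) refl a b c d e f g h
    entries 2₄ 0₄ = solve 8 (:on₈ λ P R → poly 2₄ 0₄ P R := :0) refl a b c d e f g h
    entries 2₄ 1₄ = solve 8 (:on₈ λ P R → poly 2₄ 1₄ P R := :0) refl a b c d e f g h
    entries 2₄ 2₄ = det-scale p s (solve 8 (:on₈ λ P R → poly 2₄ 2₄ P R := :det P :* :det R :* :1) refl a b c d e f g h)
    entries 2₄ 3₄ = solve 8 (:on₈ λ P R → poly 2₄ 3₄ P R := :0) refl a b c d e f g h
    entries 3₄ 0₄ = solve 8 (:on₈ λ P R → poly 3₄ 0₄ P R := :0) refl a b c d e f g h
    entries 3₄ 1₄ = solve 8 (:on₈ λ P R → poly 3₄ 1₄ P R := :0) refl a b c d e f g h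
    entries 3₄ 2₄ = solve 8 (:on₈ λ P R → poly 3₄ 2₄ P R := :0) refl a b c d e f g h
    entries 3₄ 3₄ = det-scale p s (solve 8 (:on₈ λ P R → poly 3₄ 3₄ P R := :det P :* :det R :* :1) refl a b c d e f g h)

  act-δ : ∀ P R → δ⁺ 2 (act (P , R)) ≡ 0F
  act-δ (a , b , c , d) (e , f , g , h) = solve 8 (:on₈ λ P R → :δ (:action P R) := :0) refl a b c d e f g h

  act∈SO⁺ : ∀ P R → det₂ P ≡ 1F → det₂ R ≡ 1F → act (P , R) ∈ SO⁺ 2
  act∈SO⁺ P R p s = ∈SO⁺⁺ 2 (∈O⁺⁺ 2 (act (adj P , adj R))
    (isId-true (matMul (act (adj P , adj R)) (act (P , R))) (act-inverse P R p s)) (act-preserves P R p s)) (act-δ P R)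

  act-trace : ∀ P R → trace (act (P , R)) ≡ tr₂ P ⊗ tr₂ R
  act-trace (a , b , c , d) (e , f , g , h) =
    solve 8 (:on₈ λ P R → :diagonal (:action P R) := :tr P :* :tr R) refl a b c d e f g h

  -- Up to the other determinant, the squares of the entries of P and R are 2 × 2 minors of act (P , R).
  act-injective : ∀ P R P′ R′ → det₂ P ≡ 1F → det₂ R ≡ 1F → det₂ P′ ≡ 1F → det₂ R′ ≡ 1F → act (P , R) ≡ act (P′ , R′) → (P , R) ≡ (P′ , R′)
  act-injective (a , b , c , d) (e , f , g , h) (a′ , b′ , c′ , d′) (e′ , f′ , g′ , h′) p s p′ s′ eq =
    cong₂ _,_ (cong₂ _,_ eq-a (cong₂ _,_ eq-b (cong₂ _,_ eq-c eq-d))) (cong₂ _,_ eq-e (cong₂ _,_ eq-f (cong₂ _,_ eq-g eq-h)))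
    where
    unscale : ∀ {x y δ} → δ ≡ 1F → δ ⊗ x ⊗ x ≡ y → x ⊗ x ≡ y
    unscale {x} refl e = trans (solve 1 (λ x → x :* x := :1 :* x :* x) refl x) e
    sq-a : ∀ a b c d e f g h → det₂ (e , f , g , h) ⊗ a ⊗ a ≡ minor 0₄ 0₄ 1₄ 1₄ 1₄ 0₄ 0₄ 1₄ (action (a , b , c , d) (e , f , g , h))
    sq-a = solve 8 (:on₈ λ { P@(a , b , c , d) R → :det R :* a :* a := :minor 0₄ 0₄ 1₄ 1₄ 1₄ 0₄ 0₄ 1₄ (:action P R) }) refl
    eq-a : a ≡ a′
    eq-a = sq-inj (trans (unscale s (sq-a a b c d e f g h)) (trans (cong (minor 0₄ 0₄ 1₄ 1₄ 1₄ 0₄ 0₄ 1₄) eq) (sym (unscale s′ (sq-a a′ b′ c′ d′ e′ f′ g′ h′)))))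
    sq-b : ∀ a b c d e f g h → det₂ (e , f , g , h) ⊗ b ⊗ b ≡ minor 0₄ 3₄ 1₄ 2₄ 1₄ 3₄ 0₄ 2₄ (action (a , b , c , d) (e , f , g , h))
    sq-b = solve 8 (:on₈ λ { P@(a , b , c , d) R → :det R :* b :* b := :minor 0₄ 3₄ 1₄ 2₄ 1₄ 3₄ 0₄ 2₄ (:action P R) }) refl
    eq-b : b ≡ b′
    eq-b = sq-inj (trans (unscale s (sq-b a b c d e f g h)) (trans (cong (minor 0₄ 3₄ 1₄ 2₄ 1₄ 3₄ 0₄ 2₄) eq) (sym (unscale s′ (sq-b a′ b′ c′ d′ e′ f′ g′ h′)))))
    sq-c : ∀ a b c d e f g h → det₂ (e , f , g , h) ⊗ c ⊗ c ≡ minor 3₄ 0₄ 2₄ 1₄ 2₄ 0₄ 3₄ 1₄ (action (a , b , c , d) (e , f , g , h))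
    sq-c = solve 8 (:on₈ λ { P@(a , b , c , d) R → :det R :* c :* c := :minor 3₄ 0₄ 2₄ 1₄ 2₄ 0₄ 3₄ 1₄ (:action P R) }) refl
    eq-c : c ≡ c′
    eq-c = sq-inj (trans (unscale s (sq-c a b c d e f g h)) (trans (cong (minor 3₄ 0₄ 2₄ 1₄ 2₄ 0₄ 3₄ 1₄) eq) (sym (unscale s′ (sq-c a′ b′ c′ d′ e′ f′ g′ h′)))))
    sq-d : ∀ a b c d e f g h → det₂ (e , f , g , h) ⊗ d ⊗ d ≡ minor 3₄ 3₄ 2₄ 2₄ 2₄ 3₄ 3₄ 2₄ (action (a , b , c , d) (e , f , g , h))
    sq-d = solve 8 (:on₈ λ { P@(a , b , c , d) R → :det R :* d :* d := :minor 3₄ 3₄ 2₄ 2₄ 2₄ 3₄ 3₄ 2₄ (:action P R) }) refl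
    eq-d : d ≡ d′
    eq-d = sq-inj (trans (unscale s (sq-d a b c d e f g h)) (trans (cong (minor 3₄ 3₄ 2₄ 2₄ 2₄ 3₄ 3₄ 2₄) eq) (sym (unscale s′ (sq-d a′ b′ c′ d′ e′ f′ g′ h′)))))
    sq-e : ∀ a b c d e f g h → det₂ (a , b , c , d) ⊗ e ⊗ e ≡ minor 0₄ 0₄ 3₄ 3₄ 0₄ 3₄ 3₄ 0₄ (action (a , b , c , d) (e , f , g , h))
    sq-e = solve 8 (:on₈ λ { P R@(e , f , g , h) → :det P :* e :* e := :minor 0₄ 0₄ 3₄ 3₄ 0₄ 3₄ 3₄ 0₄ (:action P R) }) refl
    eq-e : e ≡ e′
    eq-e = sq-inj (trans (unscale p (sq-e a b c d e f g h)) (trans (cong (minor 0₄ 0₄ 3₄ 3₄ 0₄ 3₄ 3₄ 0₄) eq) (sym (unscale p′ (sq-e a′ b′ c′ d′ e′ f′ g′ h′)))))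
    sq-f : ∀ a b c d e f g h → det₂ (a , b , c , d) ⊗ f ⊗ f ≡ minor 1₄ 0₄ 2₄ 3₄ 1₄ 3₄ 2₄ 0₄ (action (a , b , c , d) (e , f , g , h))
    sq-f = solve 8 (:on₈ λ { P R@(e , f , g , h) → :det P :* f :* f := :minor 1₄ 0₄ 2₄ 3₄ 1₄ 3₄ 2₄ 0₄ (:action P R) }) refl
    eq-f : f ≡ f′
    eq-f = sq-inj (trans (unscale p (sq-f a b c d e f g h)) (trans (cong (minor 1₄ 0₄ 2₄ 3₄ 1₄ 3₄ 2₄ 0₄) eq) (sym (unscale p′ (sq-f a′ b′ c′ d′ e′ f′ g′ h′)))))
    sq-g : ∀ a b c d e f g h → det₂ (a , b , c , d) ⊗ g ⊗ g ≡ minor 0₄ 1₄ 3₄ 2₄ 0₄ 2₄ 3₄ 1₄ (action (a , b , c , d) (e , f , g , h))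
    sq-g = solve 8 (:on₈ λ { P R@(e , f , g , h) → :det P :* g :* g := :minor 0₄ 1₄ 3₄ 2₄ 0₄ 2₄ 3₄ 1₄ (:action P R) }) refl
    eq-g : g ≡ g′
    eq-g = sq-inj (trans (unscale p (sq-g a b c d e f g h)) (trans (cong (minor 0₄ 1₄ 3₄ 2₄ 0₄ 2₄ 3₄ 1₄) eq) (sym (unscale p′ (sq-g a′ b′ c′ d′ e′ f′ g′ h′)))))
    sq-h : ∀ a b c d e f g h → det₂ (a , b , c , d) ⊗ h ⊗ h ≡ minor 1₄ 1₄ 2₄ 2₄ 1₄ 2₄ 2₄ 1₄ (action (a , b , c , d) (e , f , g , h))
    sq-h = solve 8 (:on₈ λ { P R@(e , f , g , h) → :det P :* h :* h := :minor 1₄ 1₄ 2₄ 2₄ 1₄ 2₄ 2₄ 1₄ (:action P R) }) refl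
    eq-h : h ≡ h′
    eq-h = sq-inj (trans (unscale p (sq-h a b c d e f g h)) (trans (cong (minor 1₄ 1₄ 2₄ 2₄ 1₄ 2₄ 2₄ 1₄) eq) (sym (unscale p′ (sq-h a′ b′ c′ d′ e′ f′ g′ h′)))))

  -- A nonzero entry of the first row serves as pivot; if there is none, the matrix is the column
  -- (0, 1) times its second row.
  rank-one : ∀ V → det₂ V ≡ 0F → ∃ λ p → ∃ λ s → V ≡ outer p s
  rank-one (x , y , z , w) δ with x ≟F 0F
  ... | no x≢0 = (1F , invF x ⊗ z) , (x , y) , cong₂ _,_ (sym (F*-identityˡ x)) (cong₂ _,_ (sym (F*-identityˡ y)) (cong₂ _,_
        (by₁ z (invF-inv x x≢0) (solve 3 (λ x i z → z := i :* z :* x :+ z :* (x :* i :+ :1)) refl x (invF x) z))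
        (by₂ (invF x) w δ (invF-inv x x≢0) (solve 5 (λ x y z w i → w := (i :* z :* y :+ i :* (x :* w :+ y :* z :+ :0)) :+ w :* (x :* i :+ :1)) refl x y z w (invF x)))))
  ... | yes refl with y ≟F 0F
  ...   | no y≢0 = (1F , invF y ⊗ w) , (0F , y) , cong₂ _,_ (sym (F*-zeroʳ 1F)) (cong₂ _,_ (sym (F*-identityˡ y)) (cong₂ _,_
          (trans (*-nonzero y≢0 (trans (solve 3 (λ y z w → y :* z := :0 :* w :+ y :* z) refl y z w) δ)) (sym (F*-zeroʳ _)))
          (by₁ w (invF-inv y y≢0) (solve 3 (λ y i w → w := i :* w :* y :+ w :* (y :* i :+ :1)) refl y (invF y) w))))
  ...   | yes refl = (0F , 1F) , (z , w) , cong₂ _,_ (sym (F*-zeroˡ z)) (cong₂ _,_ (sym (F*-zeroˡ w)) (cong₂ _,_ (sym (F*-identityˡ z)) (sym (F*-identityˡ w))))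

  Frame : Quad → Quad → Set
  Frame V V′ = ∃ λ P → ∃ λ R → det₂ P ≡ 1F × det₂ R ≡ 1F × V ≡ p₁r₁ P R × V′ ≡ p₂r₂ P R

  -- For rank one matrices the polar form of p r and p′ r′ is det(p, p′) det(r, r′). As this is 1
  -- here, the factor D = det(p, p′) can be moved from the second column of P to the second row of
  -- R, which keeps p₂r₂ and makes both determinants 1.
  frame : ∀ V V′ → det₂ V ≡ 0F → det₂ V′ ≡ 0F → polar V V′ ≡ 1F → Frame V V′
  frame V V′ δ δ′ β with rank-one V δ | rank-one V′ δ′
  ... | (a , c) , (e , f) , refl | (b , d) , (g , h) , refl =
    (a , b ⊗ D′ , c , d ⊗ D′) , (e , f , D ⊗ g , D ⊗ h) ,
    trans (solve 5 (λ a b c d D′ → :det (a , b :* D′ , c , d :* D′) := :det (a , b , c , d) :* D′) refl a b c d D′) DD′ ,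
    trans (solve 5 (λ D e f g h → :det (e , f , D :* g , D :* h) := D :* :det (e , f , g , h)) refl D e f g h) Dβ ,
    refl , cong₂ _,_ (keep b g) (cong₂ _,_ (keep b h) (cong₂ _,_ (keep d g) (keep d h)))
    where
    D = det₂ (a , b , c , d)
    D′ = invF D
    Dβ : D ⊗ det₂ (e , f , g , h) ≡ 1F
    Dβ = trans (solve 8 (:on₈ λ P R → :det P :* :det R := :polar (:p₁r₁ P R) (:p₂r₂ P R))
      refl a b c d e f g h) β
    DD′ : D ⊗ D′ ≡ 1F
    DD′ = invF-inv D (λ z → 0F≢1F (trans (sym (F*-zeroˡ _)) (trans (cong (_⊗ det₂ (e , f , g , h)) (sym z)) Dβ)))
    keep : ∀ u v → u ⊗ v ≡ u ⊗ D′ ⊗ (D ⊗ v)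
    keep u v = by₁ (u ⊗ v) DD′ (solve 4 (λ u v D D′ → u :* v := u :* D′ :* (D :* v) :+ u :* v :* (D :* D′ :+ :1)) refl u v D D′)

  Complement : Quad → Quad → Quad → Set
  Complement P R V = ∃ λ s → ∃ λ t → s ⊗ t ≡ 0F × V ≡ lin s t (p₁r₂ P R) (p₂r₁ P R)

  -- The orthogonal complement of p₁r₁ and p₂r₂ is spanned by p₁r₂ and p₂r₁, and s p₁r₂ + t p₂r₁ has
  -- determinant s t. The coordinates s and t are the off-diagonal entries of adj(P) V adj(R), whose
  -- diagonal entries are the two polar values.
  complement : ∀ P R V → det₂ P ≡ 1F → det₂ R ≡ 1F → det₂ V ≡ 0F → polar (p₁r₁ P R) V ≡ 0F → polar (p₂r₂ P R) V ≡ 0F → Complement P R V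
  complement P@(a , b , c , d) R@(e , f , g , h) V@(x , y , z , w) p s δ β₁ β₃ = coord₁₂ P R V , coord₂₁ P R V ,
    trans (solve 12 (:on₁₂ λ P R V → :coord₁₂ P R V :* :coord₂₁ P R V :=
        :det P :* :det R :* :det V :+
        :polar (:p₂r₂ P R) V :* :polar (:p₁r₁ P R) V) refl a b c d e f g h x y z w)
      (trans (cong₂ _⊕_ (trans (cong (det₂ P ⊗ det₂ R ⊗_) δ) (F*-zeroʳ _)) (trans (cong (_⊗ polar (p₁r₁ P R) V) β₃) (F*-zeroˡ _))) (x+x 0F)) ,
    cong₂ _,_ (part x-eq) (cong₂ _,_ (part y-eq) (cong₂ _,_ (part z-eq) (part w-eq)))
    where
    part : ∀ {v u k l} → v ≡ (u ⊕ k ⊗ (polar (p₁r₁ P R) V ⊕ 0F)) ⊕ l ⊗ (polar (p₂r₂ P R) V ⊕ 0F) → v ≡ u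
    part {k = k} {l} = by₂ k l β₁ β₃
    x-eq : x ≡ (coord₁₂ P R V ⊗ (a ⊗ g) ⊕ coord₂₁ P R V ⊗ (b ⊗ e) ⊕ b ⊗ g ⊗ (polar (p₁r₁ P R) V ⊕ 0F)) ⊕ a ⊗ e ⊗ (polar (p₂r₂ P R) V ⊕ 0F)
    x-eq = sym (det-scale p s (solve 12 (:on₁₂ λ { P@(a , b , c , d) R@(e , f , g , h) V@(x , y , z , w) → (:coord₁₂ P R V :* (a :* g) :+ :coord₂₁ P R V :* (b :* e) :+ b :* g :* (:polar (:p₁r₁ P R) V :+ :0)) :+ a :* e :* (:polar (:p₂r₂ P R) V :+ :0) :=
      :det P :* :det R :* x }) refl a b c d e f g h x y z w))
    y-eq : y ≡ (coord₁₂ P R V ⊗ (a ⊗ h) ⊕ coord₂₁ P R V ⊗ (b ⊗ f) ⊕ b ⊗ h ⊗ (polar (p₁r₁ P R) V ⊕ 0F)) ⊕ a ⊗ f ⊗ (polar (p₂r₂ P R) V ⊕ 0F)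
    y-eq = sym (det-scale p s (solve 12 (:on₁₂ λ { P@(a , b , c , d) R@(e , f , g , h) V@(x , y , z , w) → (:coord₁₂ P R V :* (a :* h) :+ :coord₂₁ P R V :* (b :* f) :+ b :* h :* (:polar (:p₁r₁ P R) V :+ :0)) :+ a :* f :* (:polar (:p₂r₂ P R) V :+ :0) :=
      :det P :* :det R :* y }) refl a b c d e f g h x y z w))
    z-eq : z ≡ (coord₁₂ P R V ⊗ (c ⊗ g) ⊕ coord₂₁ P R V ⊗ (d ⊗ e) ⊕ d ⊗ g ⊗ (polar (p₁r₁ P R) V ⊕ 0F)) ⊕ c ⊗ e ⊗ (polar (p₂r₂ P R) V ⊕ 0F)
    z-eq = sym (det-scale p s (solve 12 (:on₁₂ λ { P@(a , b , c , d) R@(e , f , g , h) V@(x , y , z , w) → (:coord₁₂ P R V :* (c :* g) :+ :coord₂₁ P R V :* (d :* e) :+ d :* g :* (:polar (:p₁r₁ P R) V :+ :0)) :+ c :* e :* (:polar (:p₂r₂ P R) V :+ :0) :=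
      :det P :* :det R :* z }) refl a b c d e f g h x y z w))
    w-eq : w ≡ (coord₁₂ P R V ⊗ (c ⊗ h) ⊕ coord₂₁ P R V ⊗ (d ⊗ f) ⊕ d ⊗ h ⊗ (polar (p₁r₁ P R) V ⊕ 0F)) ⊕ c ⊗ f ⊗ (polar (p₂r₂ P R) V ⊕ 0F)
    w-eq = sym (det-scale p s (solve 12 (:on₁₂ λ { P@(a , b , c , d) R@(e , f , g , h) V@(x , y , z , w) → (:coord₁₂ P R V :* (c :* h) :+ :coord₂₁ P R V :* (d :* f) :+ d :* h :* (:polar (:p₁r₁ P R) V :+ :0)) :+ c :* f :* (:polar (:p₂r₂ P R) V :+ :0) :=
      :det P :* :det R :* w }) refl a b c d e f g h x y z w))

  IsAct : Mat 4 → Set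
  IsAct m = ∃ λ P → ∃ λ R → det₂ P ≡ 1F × det₂ R ≡ 1F × m ≡ act (P , R)

  framed : Quad → Quad → (σ τ σ′ τ′ : F) → Mat 4
  framed P R σ τ σ′ τ′ = columns (p₁r₁ P R) (lin σ τ (p₁r₂ P R) (p₂r₁ P R)) (p₂r₂ P R) (lin σ′ τ′ (p₁r₂ P R) (p₂r₁ P R))

  -- For σ τ′ = 1 and τ σ′ = 0 the value is bc + bc = 0; for σ τ′ = 0 and τ σ′ = 1 it is bc + ad =
  -- det P. So δ⁺ separates the two kinds of isometry.
  framed-δ : ∀ a b c d R σ τ σ′ τ′ → det₂ R ≡ 1F → δ⁺ 2 (framed (a , b , c , d) R σ τ σ′ τ′) ≡ b ⊗ c ⊕ b ⊗ c ⊗ (σ ⊗ τ′) ⊕ a ⊗ d ⊗ (τ ⊗ σ′)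
  framed-δ a b c d (e , f , g , h) σ τ σ′ τ′ s = det-scale refl s (solve 12 (:on₁₂ λ { P@(a , b , c , d) R (σ , τ , σ′ , τ′) →
    :δ (:columns (:p₁r₁ P R) (:lin σ τ (:p₁r₂ P R) (:p₂r₁ P R))
                 (:p₂r₂ P R) (:lin σ′ τ′ (:p₁r₂ P R) (:p₂r₁ P R))) :=
    :1 :* :det R :* (b :* c :+ b :* c :* (σ :* τ′) :+ a :* d :* (τ :* σ′)) }) refl a b c d e f g h σ τ σ′ τ′)

  framed-polar : ∀ P R σ τ σ′ τ′ → det₂ P ≡ 1F → det₂ R ≡ 1F →
    polar (lin σ τ (p₁r₂ P R) (p₂r₁ P R)) (lin σ′ τ′ (p₁r₂ P R) (p₂r₁ P R)) ≡ σ ⊗ τ′ ⊕ τ ⊗ σ′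
  framed-polar (a , b , c , d) (e , f , g , h) σ τ σ′ τ′ p s = det-scale p s (solve 12 (:on₁₂ λ { P R (σ , τ , σ′ , τ′) →
    :polar (:lin σ τ (:p₁r₂ P R) (:p₂r₁ P R)) (:lin σ′ τ′ (:p₁r₂ P R) (:p₂r₁ P R)) :=
    :det P :* :det R :* (σ :* τ′ :+ τ :* σ′) }) refl a b c d e f g h σ τ σ′ τ′)

  -- The scale σ is distributed over the two frames as its square root.
  framed-act : ∀ P R σ τ σ′ τ′ → det₂ P ≡ 1F → det₂ R ≡ 1F → τ ≡ 0F → σ′ ≡ 0F → σ ⊗ τ′ ≡ 1F → IsAct (framed P R σ τ σ′ τ′)
  framed-act (a , b , c , d) (e , f , g , h) σ τ σ′ τ′ p s τ≡0 σ′≡0 στ′≡1 = (k ⊗ a , k′ ⊗ b , k ⊗ c , k′ ⊗ d) , (k′ ⊗ e , k′ ⊗ f , k ⊗ g , k ⊗ h) ,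
      trans (solve 6 (λ a b c d k k′ → :det (k :* a , k′ :* b , k :* c , k′ :* d) := (k :* k′) :* :det (a , b , c , d)) refl a b c d k k′) (trans (cong₂ _⊗_ kk′ p) (F*-identityˡ 1F)) ,
      trans (solve 6 (λ e f g h k k′ → :det (k′ :* e , k′ :* f , k :* g , k :* h) := (k :* k′) :* :det (e , f , g , h)) refl e f g h k k′) (trans (cong₂ _⊗_ kk′ s) (F*-identityˡ 1F)) ,
      cong₂ _∷_ (row a b e g) (cong₂ _∷_ (row a b f h) (cong₂ _∷_ (row c d f h) (cong₂ _∷_ (row c d e g) refl)))
    where
    σ≢0 : σ ≢ 0F
    σ≢0 e = 0F≢1F (trans (sym (F*-zeroˡ τ′)) (trans (cong (_⊗ τ′) (sym e)) στ′≡1))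
    k = sqrtF σ
    k′ = invF k
    kk : k ⊗ k ≡ σ
    kk = sqrtF-sq σ
    kk′ : k ⊗ k′ ≡ 1F
    kk′ = invF-inv k (λ e → σ≢0 (trans (sym kk) (trans (cong (_⊗ k) e) (F*-zeroˡ k))))
    k′k′ : k′ ⊗ k′ ≡ τ′
    k′k′ = *-cancelˡ σ≢0 (trans (by₂ (k′ ⊗ k′) (k ⊗ k′ ⊕ 1F) (sym kk) kk′
      (solve 3 (λ σ k k′ → σ :* (k′ :* k′) := :1 :+ k′ :* k′ :* (σ :+ k :* k) :+ (k :* k′ :+ :1) :* (k :* k′ :+ :1)) refl σ k k′)) (sym στ′≡1))
    row : ∀ a b e g →
      (a ⊗ e ∷ σ ⊗ (a ⊗ g) ⊕ τ ⊗ (b ⊗ e) ∷ b ⊗ g ∷ σ′ ⊗ (a ⊗ g) ⊕ τ′ ⊗ (b ⊗ e) ∷ []) ≡ (k ⊗ a ⊗ (k′ ⊗ e) ∷ k ⊗ a ⊗ (k ⊗ g) ∷ k′ ⊗ b ⊗ (k ⊗ g) ∷ k′ ⊗ b ⊗ (k′ ⊗ e) ∷ [])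
    row a b e g = cong₂ _∷_ (by₁ (a ⊗ e) kk′ (solve 4 (λ a e k k′ → a :* e := k :* a :* (k′ :* e) :+ a :* e :* (k :* k′ :+ :1)) refl a e k k′))
      (cong₂ _∷_ (by₂ (a ⊗ g) (b ⊗ e) kk τ≡0 (solve 7 (λ a b e g k σ τ → σ :* (a :* g) :+ τ :* (b :* e) := k :* a :* (k :* g) :+ a :* g :* (k :* k :+ σ) :+ b :* e :* (τ :+ :0)) refl a b e g k σ τ))
      (cong₂ _∷_ (by₁ (b ⊗ g) kk′ (solve 4 (λ b g k k′ → b :* g := k′ :* b :* (k :* g) :+ b :* g :* (k :* k′ :+ :1)) refl b g k k′))
      (cong₂ _∷_ (by₂ (b ⊗ e) (a ⊗ g) k′k′ σ′≡0 (solve 7 (λ a b e g k′ σ′ τ′ → σ′ :* (a :* g) :+ τ′ :* (b :* e) := k′ :* b :* (k′ :* e) :+ b :* e :* (k′ :* k′ :+ τ′) :+ a :* g :* (σ′ :+ :0)) refl a b e g k′ σ′ τ′)) refl)))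

  -- The isometries exchanging the two rulings have δ⁺ = 1.
  framed-cases : ∀ a b c d R σ τ σ′ τ′ → det₂ (a , b , c , d) ≡ 1F → det₂ R ≡ 1F → σ ⊗ τ ≡ 0F → σ′ ⊗ τ′ ≡ 0F → σ ⊗ τ′ ⊕ τ ⊗ σ′ ≡ 1F →
    b ⊗ c ⊕ b ⊗ c ⊗ (σ ⊗ τ′) ⊕ a ⊗ d ⊗ (τ ⊗ σ′) ≡ 0F → IsAct (framed (a , b , c , d) R σ τ σ′ τ′)
  framed-cases a b c d R σ τ σ′ τ′ p s στ στ′ pairing δ≡0 with τ ≟F 0F
  ... | no τ≢0 = ⊥-elim (0F≢1F (trans (sym δ≡0) (begin
      b ⊗ c ⊕ b ⊗ c ⊗ (σ ⊗ τ′) ⊕ a ⊗ d ⊗ (τ ⊗ σ′) ≡⟨ cong₂ (λ u v → b ⊗ c ⊕ b ⊗ c ⊗ u ⊕ a ⊗ d ⊗ v) (trans (cong (_⊗ τ′) σ≡0) (F*-zeroˡ τ′)) τσ′ ⟩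
      b ⊗ c ⊕ b ⊗ c ⊗ 0F ⊕ a ⊗ d ⊗ 1F ≡⟨ solve 4 (λ a b c d → b :* c :+ b :* c :* :0 :+ a :* d :* :1 := a :* d :+ b :* c) refl a b c d ⟩
      a ⊗ d ⊕ b ⊗ c ≡⟨ p ⟩
      1F ∎)))
    where
    open ≡-Reasoning
    σ≡0 : σ ≡ 0F
    σ≡0 = *-nonzero τ≢0 (trans (F*-comm τ σ) στ)
    τσ′ : τ ⊗ σ′ ≡ 1F
    τσ′ = by₁ τ′ σ≡0 (trans (solve 4 (λ σ τ σ′ τ′ → τ :* σ′ := (σ :* τ′ :+ τ :* σ′) :+ τ′ :* (σ :+ :0)) refl σ τ σ′ τ′) (cong (_⊕ τ′ ⊗ (σ ⊕ 0F)) pairing))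
  ... | yes τ≡0 = framed-act (a , b , c , d) R σ τ σ′ τ′ p s τ≡0 (*-nonzero τ′≢0 (trans (F*-comm τ′ σ′) στ′)) στ′≡1
    where
    στ′≡1 : σ ⊗ τ′ ≡ 1F
    στ′≡1 = by₁ σ′ τ≡0 (trans (solve 4 (λ σ τ σ′ τ′ → σ :* τ′ := (σ :* τ′ :+ τ :* σ′) :+ σ′ :* (τ :+ :0)) refl σ τ σ′ τ′) (cong (_⊕ σ′ ⊗ (τ ⊕ 0F)) pairing))
    τ′≢0 : τ′ ≢ 0F
    τ′≢0 e = 0F≢1F (trans (sym (F*-zeroʳ σ)) (trans (cong (σ ⊗_) (sym e)) στ′≡1))

  complement-cases : ∀ P R V₂ V₄ → det₂ P ≡ 1F → det₂ R ≡ 1F → Complement P R V₂ → Complement P R V₄ → polar V₂ V₄ ≡ 1F →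
    δ⁺ 2 (columns (p₁r₁ P R) V₂ (p₂r₂ P R) V₄) ≡ 0F → IsAct (columns (p₁r₁ P R) V₂ (p₂r₂ P R) V₄)
  complement-cases P@(a , b , c , d) R _ _ p s (σ , τ , στ , refl) (σ′ , τ′ , στ′ , refl) β₂₄ δ≡0 =
    framed-cases a b c d R σ τ σ′ τ′ p s στ στ′ (trans (sym (framed-polar P R σ τ σ′ τ′ p s)) β₂₄) (trans (sym (framed-δ a b c d R σ τ σ′ τ′ s)) δ≡0)

  isometry-form : ∀ V₁ V₂ V₃ V₄ → Frame V₁ V₃ → det₂ V₂ ≡ 0F → det₂ V₄ ≡ 0F → polar V₂ V₄ ≡ 1F →
    polar V₁ V₂ ≡ 0F → polar V₁ V₄ ≡ 0F → polar V₃ V₂ ≡ 0F → polar V₃ V₄ ≡ 0F → δ⁺ 2 (columns V₁ V₂ V₃ V₄) ≡ 0F → IsAct (columns V₁ V₂ V₃ V₄)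
  isometry-form _ V₂ _ V₄ (P , R , p , s , refl , refl) θ₂ θ₄ β₂₄ β₁₂ β₁₄ β₃₂ β₃₄ δ≡0 =
    complement-cases P R V₂ V₄ p s (complement P R V₂ p s θ₂ β₁₂ β₃₂) (complement P R V₄ p s θ₄ β₁₄ β₃₄) β₂₄ δ≡0

  -- The columns form two mutually orthogonal hyperbolic pairs, (V₁, V₃) and (V₂, V₄). Evaluating
  -- the form at the basis vectors gives the determinants, and at sums of two of them the polar
  -- values.
  SO⁺2-form : ∀ m → m ∈ SO⁺ 2 → IsAct m
  SO⁺2-form ((x₁ ∷ x₂ ∷ x₃ ∷ x₄ ∷ []) ∷ (y₁ ∷ y₂ ∷ y₃ ∷ y₄ ∷ []) ∷ (w₁ ∷ w₂ ∷ w₃ ∷ w₄ ∷ []) ∷ (z₁ ∷ z₂ ∷ z₃ ∷ z₄ ∷ []) ∷ []) i =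
    isometry-form V₁ V₂ V₃ V₄ (frame V₁ V₃ θ₁ θ₃ β₁₃) θ₂ θ₄ β₂₄ β₁₂ β₁₄ β₃₂ β₃₄ (proj₂ (∈SO⁺⁻ 2 i))
    where
    V₁ = (x₁ , y₁ , z₁ , w₁)
    V₂ = (x₂ , y₂ , z₂ , w₂)
    V₃ = (x₃ , y₃ , z₃ , w₃)
    V₄ = (x₄ , y₄ , z₄ , w₄)
    pres = ∈O⁺⁻ 2 (proj₁ (∈SO⁺⁻ 2 i))
    image : ∀ {n} → (V₁ V₂ V₃ V₄ : Polynomial n × Polynomial n × Polynomial n × Polynomial n) → Vec (Polynomial n) 4 → Polynomial n
    image V₁ V₂ V₃ V₄ x = :θ (:apply (:columns V₁ V₂ V₃ V₄) x)
    θ₁ : det₂ V₁ ≡ 0F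
    θ₁ = trans (solve 16 (:on₁₆ λ V₁ V₂ V₃ V₄ → :det V₁ := image V₁ V₂ V₃ V₄ (:1 ∷ :0 ∷ :0 ∷ :0 ∷ [])) refl x₁ y₁ z₁ w₁ x₂ y₂ z₂ w₂ x₃ y₃ z₃ w₃ x₄ y₄ z₄ w₄)
      (trans (pres (1F ∷ 0F ∷ 0F ∷ 0F ∷ [])) (solve 0 (:θ (:1 ∷ :0 ∷ :0 ∷ :0 ∷ []) := :0) refl))
    θ₂ : det₂ V₂ ≡ 0F
    θ₂ = trans (solve 16 (:on₁₆ λ V₁ V₂ V₃ V₄ → :det V₂ := image V₁ V₂ V₃ V₄ (:0 ∷ :1 ∷ :0 ∷ :0 ∷ [])) refl x₁ y₁ z₁ w₁ x₂ y₂ z₂ w₂ x₃ y₃ z₃ w₃ x₄ y₄ z₄ w₄)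
      (trans (pres (0F ∷ 1F ∷ 0F ∷ 0F ∷ [])) (solve 0 (:θ (:0 ∷ :1 ∷ :0 ∷ :0 ∷ []) := :0) refl))
    θ₃ : det₂ V₃ ≡ 0F
    θ₃ = trans (solve 16 (:on₁₆ λ V₁ V₂ V₃ V₄ → :det V₃ := image V₁ V₂ V₃ V₄ (:0 ∷ :0 ∷ :1 ∷ :0 ∷ [])) refl x₁ y₁ z₁ w₁ x₂ y₂ z₂ w₂ x₃ y₃ z₃ w₃ x₄ y₄ z₄ w₄)
      (trans (pres (0F ∷ 0F ∷ 1F ∷ 0F ∷ [])) (solve 0 (:θ (:0 ∷ :0 ∷ :1 ∷ :0 ∷ []) := :0) refl))
    θ₄ : det₂ V₄ ≡ 0F
    θ₄ = trans (solve 16 (:on₁₆ λ V₁ V₂ V₃ V₄ → :det V₄ := image V₁ V₂ V₃ V₄ (:0 ∷ :0 ∷ :0 ∷ :1 ∷ [])) refl x₁ y₁ z₁ w₁ x₂ y₂ z₂ w₂ x₃ y₃ z₃ w₃ x₄ y₄ z₄ w₄)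
      (trans (pres (0F ∷ 0F ∷ 0F ∷ 1F ∷ [])) (solve 0 (:θ (:0 ∷ :0 ∷ :0 ∷ :1 ∷ []) := :0) refl))
    β₁₃ : polar V₁ V₃ ≡ 1F
    β₁₃ = trans (solve 16 (:on₁₆ λ V₁ V₂ V₃ V₄ → :polar V₁ V₃ := image V₁ V₂ V₃ V₄ (:1 ∷ :0 ∷ :1 ∷ :0 ∷ []) :+ (:det V₁ :+ :det V₃)) refl x₁ y₁ z₁ w₁ x₂ y₂ z₂ w₂ x₃ y₃ z₃ w₃ x₄ y₄ z₄ w₄)
      (trans (cong₂ _⊕_ (pres (1F ∷ 0F ∷ 1F ∷ 0F ∷ [])) (cong₂ _⊕_ θ₁ θ₃)) (solve 0 (:θ (:1 ∷ :0 ∷ :1 ∷ :0 ∷ []) :+ (:0 :+ :0) := :1) refl))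
    β₂₄ : polar V₂ V₄ ≡ 1F
    β₂₄ = trans (solve 16 (:on₁₆ λ V₁ V₂ V₃ V₄ → :polar V₂ V₄ := image V₁ V₂ V₃ V₄ (:0 ∷ :1 ∷ :0 ∷ :1 ∷ []) :+ (:det V₂ :+ :det V₄)) refl x₁ y₁ z₁ w₁ x₂ y₂ z₂ w₂ x₃ y₃ z₃ w₃ x₄ y₄ z₄ w₄)
      (trans (cong₂ _⊕_ (pres (0F ∷ 1F ∷ 0F ∷ 1F ∷ [])) (cong₂ _⊕_ θ₂ θ₄)) (solve 0 (:θ (:0 ∷ :1 ∷ :0 ∷ :1 ∷ []) :+ (:0 :+ :0) := :1) refl))
    β₁₂ : polar V₁ V₂ ≡ 0F
    β₁₂ = trans (solve 16 (:on₁₆ λ V₁ V₂ V₃ V₄ → :polar V₁ V₂ := image V₁ V₂ V₃ V₄ (:1 ∷ :1 ∷ :0 ∷ :0 ∷ []) :+ (:det V₁ :+ :det V₂)) refl x₁ y₁ z₁ w₁ x₂ y₂ z₂ w₂ x₃ y₃ z₃ w₃ x₄ y₄ z₄ w₄)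
      (trans (cong₂ _⊕_ (pres (1F ∷ 1F ∷ 0F ∷ 0F ∷ [])) (cong₂ _⊕_ θ₁ θ₂)) (solve 0 (:θ (:1 ∷ :1 ∷ :0 ∷ :0 ∷ []) :+ (:0 :+ :0) := :0) refl))
    β₁₄ : polar V₁ V₄ ≡ 0F
    β₁₄ = trans (solve 16 (:on₁₆ λ V₁ V₂ V₃ V₄ → :polar V₁ V₄ := image V₁ V₂ V₃ V₄ (:1 ∷ :0 ∷ :0 ∷ :1 ∷ []) :+ (:det V₁ :+ :det V₄)) refl x₁ y₁ z₁ w₁ x₂ y₂ z₂ w₂ x₃ y₃ z₃ w₃ x₄ y₄ z₄ w₄)
      (trans (cong₂ _⊕_ (pres (1F ∷ 0F ∷ 0F ∷ 1F ∷ [])) (cong₂ _⊕_ θ₁ θ₄)) (solve 0 (:θ (:1 ∷ :0 ∷ :0 ∷ :1 ∷ []) :+ (:0 :+ :0) := :0) refl))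
    β₃₂ : polar V₃ V₂ ≡ 0F
    β₃₂ = trans (solve 16 (:on₁₆ λ V₁ V₂ V₃ V₄ → :polar V₃ V₂ := image V₁ V₂ V₃ V₄ (:0 ∷ :1 ∷ :1 ∷ :0 ∷ []) :+ (:det V₃ :+ :det V₂)) refl x₁ y₁ z₁ w₁ x₂ y₂ z₂ w₂ x₃ y₃ z₃ w₃ x₄ y₄ z₄ w₄)
      (trans (cong₂ _⊕_ (pres (0F ∷ 1F ∷ 1F ∷ 0F ∷ [])) (cong₂ _⊕_ θ₃ θ₂)) (solve 0 (:θ (:0 ∷ :1 ∷ :1 ∷ :0 ∷ []) :+ (:0 :+ :0) := :0) refl))
    β₃₄ : polar V₃ V₄ ≡ 0F
    β₃₄ = trans (solve 16 (:on₁₆ λ V₁ V₂ V₃ V₄ → :polar V₃ V₄ := image V₁ V₂ V₃ V₄ (:0 ∷ :0 ∷ :1 ∷ :1 ∷ []) :+ (:det V₃ :+ :det V₄)) refl x₁ y₁ z₁ w₁ x₂ y₂ z₂ w₂ x₃ y₃ z₃ w₃ x₄ y₄ z₄ w₄)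
      (trans (cong₂ _⊕_ (pres (0F ∷ 0F ∷ 1F ∷ 1F ∷ [])) (cong₂ _⊕_ θ₃ θ₄)) (solve 0 (:θ (:0 ∷ :0 ∷ :1 ∷ :1 ∷ []) :+ (:0 :+ :0) := :0) refl))

  SO⁺2-↭ : SO⁺ 2 ↭ map act (cartesianProduct SL SL)
  SO⁺2-↭ = unique-↭ (SO⁺-unique 2) (unique-map-∈ act (cartesianProduct SL SL) (UniqueP.cartesianProduct⁺ SL-unique SL-unique) inj) fwd bwd
    where
    inj : ∀ x y → x ∈ cartesianProduct SL SL → y ∈ cartesianProduct SL SL → act x ≡ act y → x ≡ y
    inj (P , S) (P′ , S′) i j with ∈-cartesianProduct⁻ SL SL i | ∈-cartesianProduct⁻ SL SL j
    ... | k , l | k′ , l′ = act-injective P S P′ S′ (∈SL⁻ {P} k) (∈SL⁻ {S} l) (∈SL⁻ {P′} k′) (∈SL⁻ {S′} l′)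
    fwd : ∀ m → m ∈ SO⁺ 2 → m ∈ map act (cartesianProduct SL SL)
    fwd m i with SO⁺2-form m i
    ... | P , S , p , s , refl = ∈-map⁺ act (∈-cartesianProduct⁺ (∈SL⁺ {P} p) (∈SL⁺ {S} s))
    bwd : ∀ m → m ∈ map act (cartesianProduct SL SL) → m ∈ SO⁺ 2
    bwd m i with ∈-map⁻ act i
    ... | (P , S) , j , refl with ∈-cartesianProduct⁻ SL SL j
    ...   | k , l = act∈SO⁺ P S (∈SL⁻ {P} k) (∈SL⁻ {S} l)

  ∑-SO⁺2 : ∀ (f : F → ℤ) → ∑ (SO⁺ 2) (λ g → f (trace g)) ≡ ∑ SL (λ P → ∑ SL (λ S → f (tr₂ P ⊗ tr₂ S)))
  ∑-SO⁺2 f = trans (∑-↭ _ SO⁺2-↭) (trans (∑-map (cartesianProduct SL SL) act _) (trans (∑-cartesianProduct SL SL _)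
    (∑-cong SL (λ P → ∑-cong SL (λ S → cong f (act-trace P S))))))

-- Even powers and divisibility by 4

^2*≡ : ∀ (x : ℤ) l → x ℤ.^ (2 ℕ.* l) ≡ (x ℤ.* x) ℤ.^ l
^2*≡ x l = trans (sym (ℤP.^-*-assoc x 2 l)) (cong (λ z → (x ℤ.* z) ℤ.^ l) (ℤP.*-identityʳ x))

4∤1 : ∀ z → 1ℤ ≢ + 4 ℤ.* z
4∤1 z e = absurd ℤ.∣ z ∣ (trans (cong ℤ.∣_∣ e) (ℤP.abs-* (+ 4) z))
  where
  absurd : ∀ n → 1 ≢ 4 ℕ.* n
  absurd zero    ()
  absurd (suc n) e = ℕP.<⇒≢ (ℕP.≤-trans (ℕ.s≤s (ℕ.s≤s ℕ.z≤n)) (ℕP.*-monoʳ-≤ 4 (ℕ.s≤s (ℕ.z≤n {n})))) e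

[4*z]%4≡0 : ∀ z → (+ 4 ℤ.* z) ℤ.% (+ 4) ≡ 0
[4*z]%4≡0 z = small ((+ 4 ℤ.* z) ℤ.% (+ 4)) ℤ.∣ z ℤ.- y ∣ (ℤD.n%d<d (+ 4 ℤ.* z) (+ 4))
    (trans (cong ℤ.∣_∣ (trans (lem₁ (+ ((+ 4 ℤ.* z) ℤ.% (+ 4))) y) (trans (cong (ℤ._- y ℤ.* + 4) (sym (ℤD.a≡a%n+[a/n]*n (+ 4 ℤ.* z) (+ 4)))) (lem₂ z y)))) (ℤP.abs-* (+ 4) (z ℤ.- y)))
  where
  y = (+ 4 ℤ.* z) ℤ./ (+ 4)
  lem₁ : ∀ r y → r ≡ r ℤ.+ y ℤ.* + 4 ℤ.- y ℤ.* + 4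
  lem₁ = solve-∀
  lem₂ : ∀ z y → + 4 ℤ.* z ℤ.- y ℤ.* + 4 ≡ + 4 ℤ.* (z ℤ.- y)
  lem₂ = solve-∀
  small : ∀ r n → r ℕ.< 4 → r ≡ 4 ℕ.* n → r ≡ 0
  small r zero    _  e = e
  small r (suc n) lt e = ⊥-elim (ℕP.<⇒≱ lt (subst (4 ℕ.≤_) (sym e) (ℕP.m≤m*n 4 (suc n))))

-- Character sums over the groups and the resulting identities

module Assembly (FF : FiniteField) (r : ℕ) (card : length (FiniteField.elements FF) ≡ 2 ℕ.^ r) where

  open FiniteField FF renaming (_+F_ to infixl 6 _⊕_; _*F_ to infixl 7 _⊗_)
  open Setup FF r
  open FieldTheory FF r card
  open Codes FF r card
  open WeightFormula FF r card
  open Groups FF r card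
  open Forms _⊕_ _⊗_ 0F using (det₂; tr₂)
  open S₂ using (_:+_; _:*_; _:=_; solve; con; Polynomial)

  Q : ℤ
  Q = + q

  q^2 : + (q ℕ.^ 2) ≡ Q ℤ.* Q
  q^2 = trans (cong (λ z → + (q ℕ.* z)) (ℕP.*-identityʳ q)) (ℤP.pos-* q q)

  q^3 : + (q ℕ.^ 3) ≡ Q ℤ.* (Q ℤ.* Q)
  q^3 = trans (ℤP.pos-* q (q ℕ.^ 2)) (cong (Q ℤ.*_) q^2)

  q^4 : + (q ℕ.^ 4) ≡ Q ℤ.* (Q ℤ.* (Q ℤ.* Q))
  q^4 = trans (ℤP.pos-* q (q ℕ.^ 3)) (cong (Q ℤ.*_) q^3)

  -- O⁺(2,q) and SO⁺(2,q)

  -- The substitution α = a z turns the sum into K(a²), which equals K(a).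
  K-recip : ∀ {a} → a ≢ 0F → ∑ nonzero (λ z → λ' (a ⊗ (z ⊕ invF z))) ≡ K a
  K-recip {a} n = trans (∑-cong-∈ nonzero step) (trans (∑-scale n (λ α → λ' (α ⊕ a ⊗ a ⊗ invF α))) (K-sq a))
    where
    step : ∀ z → z ∈ nonzero → λ' (a ⊗ (z ⊕ invF z)) ≡ λ' (a ⊗ z ⊕ a ⊗ a ⊗ invF (a ⊗ z))
    step z i = cong λ' (trans (by₁ (a ⊗ invF z) (invF-inv a n)
      (solve 4 (λ a z z′ a′ → a :* (z :+ z′) := (a :* z :+ a :* a :* (a′ :* z′)) :+ a :* z′ :* (a :* a′ :+ :1)) refl a z (invF z) (invF a)))
      (cong (λ w → a ⊗ z ⊕ a ⊗ a ⊗ w) (sym (inv-* n (∈nonzero⁻ i)))))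

  moments-AB : ∀ {m} (G : List (Mat m)) → (∀ {a} → a ≢ 0F → traceSum G a ℤ.- + length G ≡ K a ℤ.- (Q ℤ.- + 1)) →
    ∀ h → 1 ℕ.≤ h → ℤ→ℚ (MK h) ≡ recSum h (Q ℤ.- + 1) MK ℚ.+ ℕ→ℚ q ℚ.* codeSum (length G) h (weightDist G)
  moments-AB G e h h≥1 = begin
    ℤ→ℚ (MK h) ≡⟨ cong ℤ→ℚ (moment-shift nonzero K (Q ℤ.- + 1) h) ⟩
    ℤ→ℚ (recSumℤ h (Q ℤ.- + 1) MK ℤ.+ ∑ nonzero (λ a → (K a ℤ.- (Q ℤ.- + 1)) ℤ.^ h))
      ≡⟨ cong (λ z → ℤ→ℚ (recSumℤ h (Q ℤ.- + 1) MK ℤ.+ z)) (trans (∑-cong-∈ nonzero (λ a i → cong (ℤ._^ h) (sym (e (∈nonzero⁻ i))))) (sym (pless-nonzero G h h≥1))) ⟩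
    ℤ→ℚ (recSumℤ h (Q ℤ.- + 1) MK ℤ.+ Q ℤ.* codeSumℤ (length G) h (weightDist G))
      ≡⟨ trans (ℤ→ℚ-+ (recSumℤ h (Q ℤ.- + 1) MK) (Q ℤ.* codeSumℤ (length G) h (weightDist G)))
           (cong₂ ℚ._+_ (sym (recSum-ℤ h (Q ℤ.- + 1) MK)) (trans (ℤ→ℚ-* Q (codeSumℤ (length G) h (weightDist G))) (cong (ℕ→ℚ q ℚ.*_) (sym (codeSum-ℤ (length G) h (weightDist G)))))) ⟩
    recSum h (Q ℤ.- + 1) MK ℚ.+ ℕ→ℚ q ℚ.* codeSum (length G) h (weightDist G) ∎
    where open ≡-Reasoning

  length-SO⁺1 : + length (SO⁺ 1) ≡ Q ℤ.- + 1
  length-SO⁺1 = trans (sym (∑-1 (SO⁺ 1))) (trans (∑-SO⁺1 (λ _ → 1ℤ)) (trans (∑-1 nonzero) length-nonzero))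

  length-O⁺1 : + length (O⁺ 1) ≡ Q ℤ.- + 1 ℤ.+ (Q ℤ.- + 1)
  length-O⁺1 = trans (sym (∑-1 (O⁺ 1))) (trans (∑-O⁺1 (λ _ → 1ℤ)) (cong₂ ℤ._+_ (trans (∑-1 nonzero) length-nonzero) (trans (ℤP.*-identityʳ _) length-nonzero)))

  traceSum-SO⁺1 : ∀ {a} → a ≢ 0F → traceSum (SO⁺ 1) a ℤ.- + length (SO⁺ 1) ≡ K a ℤ.- (Q ℤ.- + 1)
  traceSum-SO⁺1 {a} n = cong₂ ℤ._-_ (trans (∑-SO⁺1 (λ t → λ' (a ⊗ t))) (K-recip n)) length-SO⁺1

  -- The q - 1 antidiagonal elements have trace 0 and add q - 1 both to the character sum and to the
  -- order, so the difference is the same as for SO⁺(2,q).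
  traceSum-O⁺1 : ∀ {a} → a ≢ 0F → traceSum (O⁺ 1) a ℤ.- + length (O⁺ 1) ≡ K a ℤ.- (Q ℤ.- + 1)
  traceSum-O⁺1 {a} n = trans (cong₂ ℤ._-_ (trans (∑-O⁺1 (λ t → λ' (a ⊗ t))) (cong₂ ℤ._+_ (K-recip n) (cong₂ ℤ._*_ length-nonzero (trans (cong λ' (F*-zeroʳ a)) λ-0F)))) length-O⁺1)
    (lem (K a) (Q ℤ.- + 1))
    where
    lem : ∀ k c → k ℤ.+ c ℤ.* 1ℤ ℤ.- (c ℤ.+ c) ≡ k ℤ.- c
    lem = solve-∀

  recip-count-2 : ∀ {β} → β ≢ 0F → tr (invF β) ≡ 0F → ∑ nonzero (λ z → 𝟙 ((z ⊕ invF z) == β)) ≡ + 2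
  recip-count-2 n t = trans (recip-fibre n) (cong (λ z → 1ℤ ℤ.+ z) (λ-0 t))

  recip-count-0 : ∀ {β} → β ≢ 0F → tr (invF β) ≢ 0F → ∑ nonzero (λ z → 𝟙 ((z ⊕ invF z) == β)) ≡ 0ℤ
  recip-count-0 {β} n t with tr-01 (invF β)
  ... | inj₁ e = ⊥-elim (t e)
  ... | inj₂ e = trans (recip-fibre n) (cong (λ z → 1ℤ ℤ.+ z) (λ-1 e))

  count-SO⁺1 : ∀ β → + count (map trace (SO⁺ 1)) β ≡ ∑ nonzero (λ z → 𝟙 ((z ⊕ invF z) == β))
  count-SO⁺1 β = trans (+count (SO⁺ 1) trace β) (∑-SO⁺1 (λ t → 𝟙 (t == β)))

  count-O⁺1 : ∀ β → + count (map trace (O⁺ 1)) β ≡ ∑ nonzero (λ z → 𝟙 ((z ⊕ invF z) == β)) ℤ.+ (Q ℤ.- + 1) ℤ.* 𝟙 (0F == β)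
  count-O⁺1 β = trans (+count (O⁺ 1) trace β) (trans (∑-O⁺1 (λ t → 𝟙 (t == β))) (cong (λ z → ∑ nonzero (λ z → 𝟙 ((z ⊕ invF z) == β)) ℤ.+ z ℤ.* 𝟙 (0F == β)) length-nonzero))

  C₁-formula : ∀ j → C₁ j ≡ formulaA j
  C₁-formula = weightDist-AB (SO⁺ 1) 1 (ℤP.+-injective (trans (count-SO⁺1 0F) recip-fibre-0))
    (λ β n t → ℤP.+-injective (trans (count-SO⁺1 β) (recip-count-2 n t))) (λ β n t → ℤP.+-injective (trans (count-SO⁺1 β) (recip-count-0 n t)))

  C₂-formula : ∀ j → C₂ j ≡ formulaB j
  C₂-formula = weightDist-AB (O⁺ 1) q (ℤP.+-injective (trans (count-O⁺1 0F) (trans (cong₂ (λ x b → x ℤ.+ (Q ℤ.- + 1) ℤ.* 𝟙 b) recip-fibre-0 (⌊⌋-yes (0F ≟F 0F) refl)) (lem Q))))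
      (λ β n t → ℤP.+-injective (trans (count-O⁺1 β) (trans (cong₂ ℤ._+_ (recip-count-2 n t) (none n)) refl)))
      (λ β n t → ℤP.+-injective (trans (count-O⁺1 β) (trans (cong₂ ℤ._+_ (recip-count-0 n t) (none n)) refl)))
    where
    lem : ∀ x → 1ℤ ℤ.+ (x ℤ.- + 1) ℤ.* 1ℤ ≡ x
    lem = solve-∀
    none : ∀ {β} → β ≢ 0F → (Q ℤ.- + 1) ℤ.* 𝟙 (0F == β) ≡ 0ℤ
    none {β} n = trans (cong (λ b → (Q ℤ.- + 1) ℤ.* 𝟙 b) (⌊⌋-no (0F ≟F β) (λ e → n (sym e)))) (ℤP.*-zeroʳ (Q ℤ.- + 1))

  -- Traces in SL₂ and SO⁺(4,q)

  slTr : F → ℤ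
  slTr s = ∑ SL (λ P → 𝟙 (tr₂ P == s))

  solutions : F → ℤ
  solutions s = ∑ nonzero (λ z → 𝟙 ((z ⊕ invF z) == s))

  -- Each b ≠ 0 determines c, while b = 0 leaves c free if u = 1 and allows none otherwise.
  hyperbola : ∀ u → ∑ elements (λ b → ∑ elements (λ c → 𝟙 ((u ⊕ b ⊗ c) == 1F))) ≡ (Q ℤ.- + 1) ℤ.+ Q ℤ.* 𝟙 (u == 1F)
  hyperbola u = trans (∑-split _) (trans (cong₂ ℤ._+_ at-0 (trans (∑-cong-∈ nonzero away) (trans (∑-1 nonzero) length-nonzero))) (ℤP.+-comm (Q ℤ.* 𝟙 (u == 1F)) (Q ℤ.- + 1)))
    where
    at-0 : ∑ elements (λ c → 𝟙 ((u ⊕ 0F ⊗ c) == 1F)) ≡ Q ℤ.* 𝟙 (u == 1F)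
    at-0 = trans (∑-cong elements (λ c → cong (λ z → 𝟙 (z == 1F)) (trans (cong (u ⊕_) (F*-zeroˡ c)) (F+-identityʳ u)))) (trans (∑-const elements _) (cong (λ n → + n ℤ.* 𝟙 (u == 1F)) card))
    away : ∀ b → b ∈ nonzero → ∑ elements (λ c → 𝟙 ((u ⊕ b ⊗ c) == 1F)) ≡ 1ℤ
    away b i = trans (∑-cong elements (λ c → cong 𝟙 (⌊⌋-⇔ (_ ≟F 1F) (_ ≟F c) (to c) (from c)))) (∑-==-1ˡ (invF b ⊗ (1F ⊕ u)))
      where
      b≢0 = ∈nonzero⁻ i
      to : ∀ c → u ⊕ b ⊗ c ≡ 1F → invF b ⊗ (1F ⊕ u) ≡ c
      to c e = by₂ (invF b) c e (invF-inv b b≢0) (solve 4 (λ u b c b′ → b′ :* (:1 :+ u) := c :+ b′ :* (u :+ b :* c :+ :1) :+ c :* (b :* b′ :+ :1)) refl u b c (invF b))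
      from : ∀ c → invF b ⊗ (1F ⊕ u) ≡ c → u ⊕ b ⊗ c ≡ 1F
      from _ refl = by₁ (1F ⊕ u) (invF-inv b b≢0) (solve 3 (λ u b b′ → u :+ b :* (b′ :* (:1 :+ u)) := :1 :+ (:1 :+ u) :* (b :* b′ :+ :1)) refl u b (invF b))

  -- The trace fixes d = s + a, and bc = 1 + a(s + a) is counted by `hyperbola`. Its exceptional
  -- case a(s + a) = 1 means a + 1/a = s.
  slTr-value : ∀ s → slTr s ≡ Q ℤ.* (Q ℤ.- + 1) ℤ.+ Q ℤ.* solutions s
  slTr-value s = begin
    slTr s ≡⟨ ∑-filter _ quads _ ⟩
    ∑ quads (λ P → 𝟙 (det₂ P == 1F) ℤ.* 𝟙 (tr₂ P == s)) ≡⟨ ∑-quads (λ P → 𝟙 (det₂ P == 1F) ℤ.* 𝟙 (tr₂ P == s)) ⟩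
    ∑ elements (λ a → ∑ elements (λ b → ∑ elements (λ c → ∑ elements (λ d → 𝟙 ((a ⊗ d ⊕ b ⊗ c) == 1F) ℤ.* 𝟙 ((a ⊕ d) == s)))))
      ≡⟨ ∑-cong elements (λ a → ∑-cong elements (λ b → ∑-cong elements (λ c → trans (∑-cong elements (λ d → trans (ℤP.*-comm (𝟙 ((a ⊗ d ⊕ b ⊗ c) == 1F)) _)
           (cong (λ x → 𝟙 x ℤ.* 𝟙 ((a ⊗ d ⊕ b ⊗ c) == 1F)) (trans (==-shift a d s) (==-sym d (s ⊕ a)))))) (∑-==ˡ (s ⊕ a) (λ d → 𝟙 ((a ⊗ d ⊕ b ⊗ c) == 1F)))))) ⟩
    ∑ elements (λ a → ∑ elements (λ b → ∑ elements (λ c → 𝟙 ((a ⊗ (s ⊕ a) ⊕ b ⊗ c) == 1F)))) ≡⟨ ∑-cong elements (λ a → hyperbola (a ⊗ (s ⊕ a))) ⟩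
    ∑ elements (λ a → (Q ℤ.- + 1) ℤ.+ Q ℤ.* 𝟙 ((a ⊗ (s ⊕ a)) == 1F)) ≡⟨ ∑-+ elements _ _ ⟩
    ∑ elements (λ _ → Q ℤ.- + 1) ℤ.+ ∑ elements (λ a → Q ℤ.* 𝟙 ((a ⊗ (s ⊕ a)) == 1F))
      ≡⟨ cong₂ ℤ._+_ (trans (∑-const elements _) (cong (λ n → + n ℤ.* (Q ℤ.- + 1)) card)) (trans (∑-*ˡ elements Q _) (cong (Q ℤ.*_) roots)) ⟩
    Q ℤ.* (Q ℤ.- + 1) ℤ.+ Q ℤ.* solutions s ∎
    where
    open ≡-Reasoning
    ∑-quads : ∀ (f : Quad → ℤ) → ∑ quads f ≡ ∑ elements (λ a → ∑ elements (λ b → ∑ elements (λ c → ∑ elements (λ d → f (a , b , c , d)))))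
    ∑-quads f = trans (∑-cartesianProduct elements (cartesianProduct elements (cartesianProduct elements elements)) f) (∑-cong elements (λ a →
      trans (∑-cartesianProduct elements (cartesianProduct elements elements) (λ t → f (a , t))) (∑-cong elements (λ b → ∑-cartesianProduct elements elements (λ t → f (a , b , t))))))
    roots : ∑ elements (λ a → 𝟙 ((a ⊗ (s ⊕ a)) == 1F)) ≡ solutions s
    roots = trans (∑-split _) (trans (cong₂ ℤ._+_ (cong 𝟙 (⌊⌋-no ((0F ⊗ (s ⊕ 0F)) ≟F 1F) (λ e → 0F≢1F (trans (sym (F*-zeroˡ _)) e))))
      (∑-cong-∈ nonzero (λ a i → cong 𝟙 (⌊⌋-⇔ (_ ≟F 1F) (_ ≟F s) (to a) (from a (∈nonzero⁻ i)))))) (ℤP.+-identityˡ _))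
      where
      to : ∀ a → a ⊗ (s ⊕ a) ≡ 1F → a ⊕ invF a ≡ s
      to a e = trans (cong (a ⊕_) (inv-unique e)) (solve 2 (λ a s → a :+ (s :+ a) := s) refl a s)
      from : ∀ a → a ≢ 0F → a ⊕ invF a ≡ s → a ⊗ (s ⊕ a) ≡ 1F
      from a n refl = trans (solve 2 (λ a a′ → a :* (a :+ a′ :+ a) := a :* a′) refl a (invF a)) (invF-inv a n)

  slTr-0 : slTr 0F ≡ Q ℤ.* Q
  slTr-0 = trans (slTr-value 0F) (trans (cong (λ z → Q ℤ.* (Q ℤ.- + 1) ℤ.+ Q ℤ.* z) recip-fibre-0) (lem Q))
    where
    lem : ∀ x → x ℤ.* (x ℤ.- + 1) ℤ.+ x ℤ.* 1ℤ ≡ x ℤ.* x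
    lem = solve-∀

  slTr-≢0 : ∀ {s} → s ≢ 0F → slTr s ≡ Q ℤ.* Q ℤ.+ Q ℤ.* λ' (invF s)
  slTr-≢0 {s} n = trans (slTr-value s) (trans (cong (λ z → Q ℤ.* (Q ℤ.- + 1) ℤ.+ Q ℤ.* z) (recip-fibre n)) (lem Q (λ' (invF s))))
    where
    lem : ∀ x l → x ℤ.* (x ℤ.- + 1) ℤ.+ x ℤ.* (1ℤ ℤ.+ l) ≡ x ℤ.* x ℤ.+ x ℤ.* l
    lem = solve-∀

  ∑λ-inv : ∑ nonzero (λ s → λ' (invF s)) ≡ ℤ.-1ℤ
  ∑λ-inv = trans (∑-inv λ') ∑λ-nonzero

  ∑slTr-nonzero : ∑ nonzero slTr ≡ Q ℤ.* Q ℤ.* (Q ℤ.- + 1) ℤ.- Q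
  ∑slTr-nonzero = trans (∑-cong-∈ nonzero (λ s i → slTr-≢0 (∈nonzero⁻ i))) (trans (∑-+ nonzero _ _) (trans (cong₂ ℤ._+_
    (trans (∑-const nonzero (Q ℤ.* Q)) (cong (ℤ._* (Q ℤ.* Q)) length-nonzero)) (trans (∑-*ˡ nonzero Q _) (cong (Q ℤ.*_) ∑λ-inv))) (lem Q)))
    where
    lem : ∀ x → (x ℤ.- + 1) ℤ.* (x ℤ.* x) ℤ.+ x ℤ.* ℤ.-1ℤ ≡ x ℤ.* x ℤ.* (x ℤ.- + 1) ℤ.- x
    lem = solve-∀

  ∑slTr : ∑ elements slTr ≡ Q ℤ.* Q ℤ.* Q ℤ.- Q
  ∑slTr = trans (∑-split slTr) (trans (cong₂ ℤ._+_ slTr-0 ∑slTr-nonzero) (lem Q))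
    where
    lem : ∀ x → x ℤ.* x ℤ.+ (x ℤ.* x ℤ.* (x ℤ.- + 1) ℤ.- x) ≡ x ℤ.* x ℤ.* x ℤ.- x
    lem = solve-∀

  ∑-SO⁺2-slTr : ∀ (f : F → ℤ) → ∑ (SO⁺ 2) (λ g → f (trace g)) ≡ ∑ elements (λ s → slTr s ℤ.* ∑ elements (λ t → slTr t ℤ.* f (s ⊗ t)))
  ∑-SO⁺2-slTr f = trans (∑-SO⁺2 f) (trans (∑-pushforward SL tr₂ (λ s → ∑ SL (λ S → f (s ⊗ tr₂ S))))
    (∑-cong elements (λ s → cong (slTr s ℤ.*_) (∑-pushforward SL tr₂ (λ t → f (s ⊗ t))))))

  length-SO⁺2 : + length (SO⁺ 2) ≡ (Q ℤ.* Q ℤ.* Q ℤ.- Q) ℤ.* (Q ℤ.* Q ℤ.* Q ℤ.- Q)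
  length-SO⁺2 = trans (sym (∑-1 (SO⁺ 2))) (trans (∑-SO⁺2-slTr (λ _ → 1ℤ)) (trans (∑-cong elements (λ s → cong (slTr s ℤ.*_)
    (trans (∑-cong elements (λ t → ℤP.*-identityʳ (slTr t))) ∑slTr))) (trans (∑-*ʳ elements (Q ℤ.* Q ℤ.* Q ℤ.- Q) slTr) (cong (ℤ._* (Q ℤ.* Q ℤ.* Q ℤ.- Q)) ∑slTr))))

  traceCount : F → ℤ
  traceCount β = ∑ (SO⁺ 2) (λ g → 𝟙 (trace g == β))

  fibre-mul : ∀ {s} → s ≢ 0F → ∀ β → ∑ elements (λ t → slTr t ℤ.* 𝟙 ((s ⊗ t) == β)) ≡ slTr (invF s ⊗ β)
  fibre-mul {s} n β = trans (∑-cong elements (λ t → trans (ℤP.*-comm (slTr t) _) (cong (λ b → 𝟙 b ℤ.* slTr t) (⌊⌋-⇔ (_ ≟F β) (_ ≟F t) (to t) (from t))))) (∑-==ˡ (invF s ⊗ β) slTr)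
    where
    to : ∀ t → s ⊗ t ≡ β → invF s ⊗ β ≡ t
    to t refl = by₁ t (invF-inv s n) (solve 3 (λ s s′ t → s′ :* (s :* t) := t :+ t :* (s :* s′ :+ :1)) refl s (invF s) t)
    from : ∀ t → invF s ⊗ β ≡ t → s ⊗ t ≡ β
    from _ refl = by₁ β (invF-inv s n) (solve 3 (λ s s′ b → s :* (s′ :* b) := b :+ b :* (s :* s′ :+ :1)) refl s (invF s) β)

  traceCount-0 : traceCount 0F ≡ m₀
  traceCount-0 = begin
    traceCount 0F ≡⟨ ∑-SO⁺2-slTr (λ t → 𝟙 (t == 0F)) ⟩
    ∑ elements (λ s → slTr s ℤ.* ∑ elements (λ t → slTr t ℤ.* 𝟙 ((s ⊗ t) == 0F))) ≡⟨ ∑-split _ ⟩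
    slTr 0F ℤ.* ∑ elements (λ t → slTr t ℤ.* 𝟙 ((0F ⊗ t) == 0F)) ℤ.+ ∑ nonzero (λ s → slTr s ℤ.* ∑ elements (λ t → slTr t ℤ.* 𝟙 ((s ⊗ t) == 0F)))
      ≡⟨ cong₂ ℤ._+_ (cong₂ ℤ._*_ slTr-0 (trans (∑-cong elements (λ t → trans (cong (λ b → slTr t ℤ.* 𝟙 b) (⌊⌋-yes (_ ≟F 0F) (F*-zeroˡ t))) (ℤP.*-identityʳ _))) ∑slTr))
           (trans (∑-cong-∈ nonzero (λ s i → cong (slTr s ℤ.*_) (trans (fibre-mul (∈nonzero⁻ i) 0F) (trans (cong slTr (F*-zeroʳ (invF s))) slTr-0))))
             (trans (∑-*ʳ nonzero (Q ℤ.* Q) slTr) (cong (ℤ._* (Q ℤ.* Q)) ∑slTr-nonzero))) ⟩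
    Q ℤ.* Q ℤ.* (Q ℤ.* Q ℤ.* Q ℤ.- Q) ℤ.+ (Q ℤ.* Q ℤ.* (Q ℤ.- + 1) ℤ.- Q) ℤ.* (Q ℤ.* Q) ≡⟨ lem Q ⟩
    Q ℤ.* (Q ℤ.* Q) ℤ.* (+ 2 ℤ.* (Q ℤ.* Q) ℤ.- Q ℤ.- + 2)
      ≡⟨ cong₂ (λ x y → x ℤ.* (y ℤ.- Q ℤ.- + 2)) (sym q^3) (sym (trans (ℤP.pos-* 2 (q ℕ.^ 2)) (cong (+ 2 ℤ.*_) q^2))) ⟩
    m₀ ∎
    where
    open ≡-Reasoning
    lem : ∀ x → x ℤ.* x ℤ.* (x ℤ.* x ℤ.* x ℤ.- x) ℤ.+ (x ℤ.* x ℤ.* (x ℤ.- + 1) ℤ.- x) ℤ.* (x ℤ.* x) ≡ x ℤ.* (x ℤ.* x) ℤ.* (+ 2 ℤ.* (x ℤ.* x) ℤ.- x ℤ.- + 2)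
    lem = solve-∀

  m-value : ∀ t → m_ t ≡ Q ℤ.* Q ℤ.* (Q ℤ.* (Q ℤ.* Q) ℤ.- Q ℤ.* Q ℤ.- + 2 ℤ.* Q ℤ.+ t)
  m-value t = trans (cong₂ (λ x y → x ℤ.* (y ℤ.- x ℤ.- + (2 ℕ.* q) ℤ.+ t)) q^2 q^3) (cong (λ z → Q ℤ.* Q ℤ.* (Q ℤ.* (Q ℤ.* Q) ℤ.- Q ℤ.* Q ℤ.- z ℤ.+ t)) (ℤP.pos-* 2 q))

  -- For β ≠ 0 the trace s of P is nonzero and that of R is β/s. In the product (q² + q λ(1/s))(q² +
  -- q λ(s/β)) the last term λ(1/s + s/β) sums to K(1/β), the other characters to -1.
  traceCount-≢0 : ∀ {β} → β ≢ 0F → traceCount β ≡ m_ (K (invF β))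
  traceCount-≢0 {β} n = begin
    traceCount β ≡⟨ ∑-SO⁺2-slTr (λ t → 𝟙 (t == β)) ⟩
    ∑ elements (λ s → slTr s ℤ.* ∑ elements (λ t → slTr t ℤ.* 𝟙 ((s ⊗ t) == β))) ≡⟨ ∑-split _ ⟩
    slTr 0F ℤ.* ∑ elements (λ t → slTr t ℤ.* 𝟙 ((0F ⊗ t) == β)) ℤ.+ ∑ nonzero (λ s → slTr s ℤ.* ∑ elements (λ t → slTr t ℤ.* 𝟙 ((s ⊗ t) == β)))
      ≡⟨ cong₂ ℤ._+_ (trans (cong (slTr 0F ℤ.*_) (∑-0-∈ elements (λ t _ → trans (cong (λ b → slTr t ℤ.* 𝟙 b) (⌊⌋-no (_ ≟F β) (λ e → n (trans (sym e) (F*-zeroˡ t))))) (ℤP.*-zeroʳ (slTr t))))) (ℤP.*-zeroʳ (slTr 0F)))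
           (∑-cong-∈ nonzero (λ s i → term s (∈nonzero⁻ i))) ⟩
    0ℤ ℤ.+ ∑ nonzero (λ s → Q ℤ.* Q ℤ.* (Q ℤ.* Q) ℤ.+ Q ℤ.* Q ℤ.* (Q ℤ.* λ' (invF s) ℤ.+ (Q ℤ.* λ' (β′ ⊗ s) ℤ.+ λ' (invF s ⊕ β′ ⊗ s))))
      ≡⟨ trans (ℤP.+-identityˡ _) (trans (∑-+ nonzero _ _) (cong₂ ℤ._+_ (trans (∑-const nonzero _) (cong (ℤ._* (Q ℤ.* Q ℤ.* (Q ℤ.* Q))) length-nonzero))
           (trans (∑-*ˡ nonzero (Q ℤ.* Q) _) (cong (Q ℤ.* Q ℤ.*_) (trans (∑-+ nonzero _ _) (cong₂ ℤ._+_ (trans (∑-*ˡ nonzero Q _) (cong (Q ℤ.*_) ∑λ-inv))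
             (trans (∑-+ nonzero _ _) (cong₂ ℤ._+_ (trans (∑-*ˡ nonzero Q _) (cong (Q ℤ.*_) (∑λ-nonzero-scale (inv≢0 n)))) kloosterman)))))))) ⟩
    (Q ℤ.- + 1) ℤ.* (Q ℤ.* Q ℤ.* (Q ℤ.* Q)) ℤ.+ Q ℤ.* Q ℤ.* (Q ℤ.* ℤ.-1ℤ ℤ.+ (Q ℤ.* ℤ.-1ℤ ℤ.+ K β′)) ≡⟨ lem Q (K β′) ⟩
    Q ℤ.* Q ℤ.* (Q ℤ.* (Q ℤ.* Q) ℤ.- Q ℤ.* Q ℤ.- + 2 ℤ.* Q ℤ.+ K β′) ≡⟨ m-value (K β′) ⟨
    m_ (K β′) ∎
    where
    open ≡-Reasoning
    β′ = invF β
    lem : ∀ x k → (x ℤ.- + 1) ℤ.* (x ℤ.* x ℤ.* (x ℤ.* x)) ℤ.+ x ℤ.* x ℤ.* (x ℤ.* ℤ.-1ℤ ℤ.+ (x ℤ.* ℤ.-1ℤ ℤ.+ k)) ≡ x ℤ.* x ℤ.* (x ℤ.* (x ℤ.* x) ℤ.- x ℤ.* x ℤ.- + 2 ℤ.* x ℤ.+ k)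
    lem = solve-∀
    kloosterman : ∑ nonzero (λ s → λ' (invF s ⊕ β′ ⊗ s)) ≡ K β′
    kloosterman = trans (sym (∑-inv (λ s → λ' (invF s ⊕ β′ ⊗ s)))) (∑-cong-∈ nonzero (λ α i → cong (λ z → λ' (z ⊕ β′ ⊗ invF α)) (inv-inv (∈nonzero⁻ i))))
    term : ∀ s → s ≢ 0F → slTr s ℤ.* ∑ elements (λ t → slTr t ℤ.* 𝟙 ((s ⊗ t) == β)) ≡
           Q ℤ.* Q ℤ.* (Q ℤ.* Q) ℤ.+ Q ℤ.* Q ℤ.* (Q ℤ.* λ' (invF s) ℤ.+ (Q ℤ.* λ' (β′ ⊗ s) ℤ.+ λ' (invF s ⊕ β′ ⊗ s)))
    term s m≢0 = trans (cong₂ ℤ._*_ (slTr-≢0 m≢0) (trans (fibre-mul m≢0 β) (trans (slTr-≢0 (*≢0 (inv≢0 m≢0) n)) (cong (λ z → Q ℤ.* Q ℤ.+ Q ℤ.* λ' z) inv-eq))))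
      (trans (lem′ Q (λ' (invF s)) (λ' (β′ ⊗ s))) (cong (λ z → Q ℤ.* Q ℤ.* (Q ℤ.* Q) ℤ.+ Q ℤ.* Q ℤ.* (Q ℤ.* λ' (invF s) ℤ.+ (Q ℤ.* λ' (β′ ⊗ s) ℤ.+ z))) (sym (λ-+ (invF s) (β′ ⊗ s)))))
      where
      inv-eq : invF (invF s ⊗ β) ≡ β′ ⊗ s
      inv-eq = trans (inv-* (inv≢0 m≢0) n) (trans (cong (_⊗ β′) (inv-inv m≢0)) (F*-comm s β′))
      lem′ : ∀ x u v → (x ℤ.* x ℤ.+ x ℤ.* u) ℤ.* (x ℤ.* x ℤ.+ x ℤ.* v) ≡ x ℤ.* x ℤ.* (x ℤ.* x) ℤ.+ x ℤ.* x ℤ.* (x ℤ.* u ℤ.+ (x ℤ.* v ℤ.+ u ℤ.* v))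
      lem′ = solve-∀

  -- The traces β ≠ 0 have multiplicity q²(D + K(1/β)). Against λ(aβ) the constant D sums to -D, and
  -- m₀ - q² D = q⁵; the Kloosterman part becomes q² K₂(a) under β = s/a.
  traceSum-SO⁺2 : ∀ {a} → a ≢ 0F → traceSum (SO⁺ 2) a ≡ Q ℤ.* Q ℤ.* (Q ℤ.* (Q ℤ.* Q) ℤ.+ K2 a)
  traceSum-SO⁺2 {a} a≢0 = begin
    traceSum (SO⁺ 2) a ≡⟨ ∑-pushforward (SO⁺ 2) trace (λ t → λ' (a ⊗ t)) ⟩
    ∑ elements (λ β → traceCount β ℤ.* λ' (a ⊗ β)) ≡⟨ ∑-split _ ⟩
    traceCount 0F ℤ.* λ' (a ⊗ 0F) ℤ.+ ∑ nonzero (λ β → traceCount β ℤ.* λ' (a ⊗ β))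
      ≡⟨ cong₂ ℤ._+_ (cong₂ ℤ._*_ m₀-value (trans (cong λ' (F*-zeroʳ a)) λ-0F)) (trans (∑-cong-∈ nonzero (λ β i → trans (cong (ℤ._* λ' (a ⊗ β)) (trans (traceCount-≢0 (∈nonzero⁻ i)) (m-value (K (invF β)))))
           (lem₁ (Q ℤ.* Q) D (K (invF β)) (λ' (a ⊗ β))))) (trans (∑-*ˡ nonzero (Q ℤ.* Q) _) (cong (Q ℤ.* Q ℤ.*_) (trans (∑-+ nonzero _ _)
             (cong₂ ℤ._+_ (trans (∑-*ˡ nonzero D _) (cong (D ℤ.*_) (∑λ-nonzero-scale a≢0))) K₂-eq))))) ⟩
    Q ℤ.* (Q ℤ.* Q) ℤ.* (+ 2 ℤ.* (Q ℤ.* Q) ℤ.- Q ℤ.- + 2) ℤ.* 1ℤ ℤ.+ Q ℤ.* Q ℤ.* (D ℤ.* ℤ.-1ℤ ℤ.+ K2 a) ≡⟨ lem₂ Q (K2 a) ⟩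
    Q ℤ.* Q ℤ.* (Q ℤ.* (Q ℤ.* Q) ℤ.+ K2 a) ∎
    where
    open ≡-Reasoning
    D = Q ℤ.* (Q ℤ.* Q) ℤ.- Q ℤ.* Q ℤ.- + 2 ℤ.* Q
    m₀-value : traceCount 0F ≡ Q ℤ.* (Q ℤ.* Q) ℤ.* (+ 2 ℤ.* (Q ℤ.* Q) ℤ.- Q ℤ.- + 2)
    m₀-value = trans traceCount-0 (cong₂ (λ x y → x ℤ.* (y ℤ.- Q ℤ.- + 2)) q^3 (trans (ℤP.pos-* 2 (q ℕ.^ 2)) (cong (+ 2 ℤ.*_) q^2)))
    lem₁ : ∀ y d k l → y ℤ.* (d ℤ.+ k) ℤ.* l ≡ y ℤ.* (d ℤ.* l ℤ.+ l ℤ.* k)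
    lem₁ = solve-∀
    lem₂ : ∀ x k → x ℤ.* (x ℤ.* x) ℤ.* (+ 2 ℤ.* (x ℤ.* x) ℤ.- x ℤ.- + 2) ℤ.* 1ℤ ℤ.+ x ℤ.* x ℤ.* ((x ℤ.* (x ℤ.* x) ℤ.- x ℤ.* x ℤ.- + 2 ℤ.* x) ℤ.* ℤ.-1ℤ ℤ.+ k) ≡ x ℤ.* x ℤ.* (x ℤ.* (x ℤ.* x) ℤ.+ k)
    lem₂ = solve-∀
    K₂-eq : ∑ nonzero (λ β → λ' (a ⊗ β) ℤ.* K (invF β)) ≡ K2 a
    K₂-eq = trans (sym (∑-scale (inv≢0 a≢0) (λ β → λ' (a ⊗ β) ℤ.* K (invF β)))) (trans (∑-cong-∈ nonzero (λ s i → cong₂ (λ x y → λ' x ℤ.* K y)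
        (by₁ s (invF-inv a a≢0) (solve 3 (λ a a′ s → a :* (a′ :* s) := s :+ s :* (a :* a′ :+ :1)) refl a (invF a) s))
        (trans (inv-* (inv≢0 a≢0) (∈nonzero⁻ i)) (cong (_⊗ invF s) (inv-inv a≢0))))) (sym (K₂-∑ a)))

  -- Applied with X = K₂ and with X = K². The factor q² contributes q^(2h) to the h-th power; one q
  -- cancels against that of the moment identity, and d = q^(2h-1) is left to divide by.
  moments-C : (X : F → ℤ) (c : ℤ) → (∀ {a} → a ≢ 0F → traceSum (SO⁺ 2) a ℤ.- + N₃ ≡ Q ℤ.* Q ℤ.* (X a ℤ.- c)) → ∀ h → 1 ℕ.≤ h →
    ℤ→ℚ (∑ nonzero (λ a → X a ℤ.^ h)) ≡ recSum h c (λ l → ∑ nonzero (λ a → X a ℤ.^ l)) ℚ.+ qPowNeg h ℚ.* codeSum N₃ h C₃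
  moments-C X c e h@(suc h′) h≥1 = begin
    ℤ→ℚ (∑ nonzero (λ a → X a ℤ.^ h)) ≡⟨ cong ℤ→ℚ (moment-shift nonzero X c h) ⟩
    ℤ→ℚ (recSumℤ h c M ℤ.+ S) ≡⟨ trans (ℤ→ℚ-+ (recSumℤ h c M) S) (cong₂ ℚ._+_ (sym (recSum-ℤ h c M)) S≡) ⟩
    recSum h c M ℚ.+ qPowNeg h ℚ.* codeSum N₃ h C₃ ∎
    where
    open ≡-Reasoning
    M : ℕ → ℤ
    M l = ∑ nonzero (λ a → X a ℤ.^ l)
    S = ∑ nonzero (λ a → (X a ℤ.- c) ℤ.^ h)
    CS = codeSumℤ N₃ h C₃
    d = q ℕ.^ (2 ℕ.* h ℕ.∸ 1)
    instance
      d≢0 : ℕ.NonZero d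
      d≢0 = ℕP.m^n≢0 q (2 ℕ.* h ℕ.∸ 1) {{ℕP.m^n≢0 2 r}}
      Q≢0 : ℤ.NonZero Q
      Q≢0 = ℕP.m^n≢0 2 r
    pos-^ : ∀ n → + (q ℕ.^ n) ≡ Q ℤ.^ n
    pos-^ zero    = refl
    pos-^ (suc n) = trans (ℤP.pos-* q (q ℕ.^ n)) (cong (Q ℤ.*_) (pos-^ n))
    power : (Q ℤ.* Q) ℤ.^ h ≡ Q ℤ.* + d
    power = trans (sym (^2*≡ Q h)) (trans (sym (pos-^ (2 ℕ.* h))) (ℤP.pos-* q d))
    CS≡ : CS ≡ + d ℤ.* S
    CS≡ = ℤP.*-cancelˡ-≡ Q CS (+ d ℤ.* S) (begin
      Q ℤ.* CS ≡⟨ pless-nonzero (SO⁺ 2) h h≥1 ⟩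
      ∑ nonzero (λ a → (traceSum (SO⁺ 2) a ℤ.- + N₃) ℤ.^ h) ≡⟨ ∑-cong-∈ nonzero (λ a i → trans (cong (ℤ._^ h) (e (∈nonzero⁻ i))) (^-distribʳ-* h (Q ℤ.* Q) (X a ℤ.- c))) ⟩
      ∑ nonzero (λ a → (Q ℤ.* Q) ℤ.^ h ℤ.* (X a ℤ.- c) ℤ.^ h) ≡⟨ ∑-*ˡ nonzero ((Q ℤ.* Q) ℤ.^ h) _ ⟩
      (Q ℤ.* Q) ℤ.^ h ℤ.* S ≡⟨ trans (cong (ℤ._* S) power) (ℤP.*-assoc Q (+ d) S) ⟩
      Q ℤ.* (+ d ℤ.* S) ∎)
    S≡ : ℤ→ℚ S ≡ qPowNeg h ℚ.* codeSum N₃ h C₃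
    S≡ = sym (begin
      qPowNeg h ℚ.* codeSum N₃ h C₃ ≡⟨ cong (qPowNeg h ℚ.*_) (trans (codeSum-ℤ N₃ h C₃) (trans (cong ℤ→ℚ CS≡) (ℤ→ℚ-* (+ d) S))) ⟩
      qPowNeg h ℚ.* (ℕ→ℚ d ℚ.* ℤ→ℚ S) ≡⟨ ℚP.*-assoc (qPowNeg h) (ℕ→ℚ d) (ℤ→ℚ S) ⟨
      qPowNeg h ℚ.* ℕ→ℚ d ℚ.* ℤ→ℚ S ≡⟨ cong (ℚ._* ℤ→ℚ S) (trans (ℚP.*-comm (qPowNeg h) (ℕ→ℚ d)) (ℤ→ℚ-/ d (+ 1))) ⟩
      ℚ.1ℚ ℚ.* ℤ→ℚ S ≡⟨ ℚP.*-identityˡ (ℤ→ℚ S) ⟩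
      ℤ→ℚ S ∎)

  -- c₂ = (q² - 1)² - q³, where (q² - 1)² is N₃/q² and q³ comes from the trace sum; c₃ = c₂ + q
  -- because K² = K₂ + q.
  c₂ c₃ : ℤ
  c₂ = + (q ℕ.^ 4) ℤ.- + (q ℕ.^ 3) ℤ.- + (2 ℕ.* q ℕ.^ 2) ℤ.+ + 1
  c₃ = + (q ℕ.^ 4) ℤ.- + (q ℕ.^ 3) ℤ.- + (2 ℕ.* q ℕ.^ 2) ℤ.+ + q ℤ.+ + 1

  c-value : + (q ℕ.^ 4) ℤ.- + (q ℕ.^ 3) ℤ.- + (2 ℕ.* q ℕ.^ 2) ≡ Q ℤ.* (Q ℤ.* (Q ℤ.* Q)) ℤ.- Q ℤ.* (Q ℤ.* Q) ℤ.- + 2 ℤ.* (Q ℤ.* Q)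
  c-value = cong₂ ℤ._-_ (cong₂ ℤ._-_ q^4 q^3) (trans (ℤP.pos-* 2 (q ℕ.^ 2)) (cong (+ 2 ℤ.*_) q^2))

  excess-K₂ : ∀ {a} → a ≢ 0F → traceSum (SO⁺ 2) a ℤ.- + N₃ ≡ Q ℤ.* Q ℤ.* (K2 a ℤ.- c₂)
  excess-K₂ {a} n = trans (cong₂ ℤ._-_ (traceSum-SO⁺2 n) length-SO⁺2) (trans (lem Q (K2 a)) (cong (λ z → Q ℤ.* Q ℤ.* (K2 a ℤ.- (z ℤ.+ + 1))) (sym c-value)))
    where
    lem : ∀ x k → x ℤ.* x ℤ.* (x ℤ.* (x ℤ.* x) ℤ.+ k) ℤ.- (x ℤ.* x ℤ.* x ℤ.- x) ℤ.* (x ℤ.* x ℤ.* x ℤ.- x) ≡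
      x ℤ.* x ℤ.* (k ℤ.- (x ℤ.* (x ℤ.* (x ℤ.* x)) ℤ.- x ℤ.* (x ℤ.* x) ℤ.- + 2 ℤ.* (x ℤ.* x) ℤ.+ + 1))
    lem = solve-∀

  excess-K² : ∀ {a} → a ≢ 0F → traceSum (SO⁺ 2) a ℤ.- + N₃ ≡ Q ℤ.* Q ℤ.* (K a ℤ.* K a ℤ.- c₃)
  excess-K² {a} n = trans (excess-K₂ n) (cong (Q ℤ.* Q ℤ.*_) (trans (lem Q (K2 a) (+ (q ℕ.^ 4) ℤ.- + (q ℕ.^ 3) ℤ.- + (2 ℕ.* q ℕ.^ 2))) (cong (ℤ._- c₃) (sym (carlitz n)))))
    where
    lem : ∀ x k c → k ℤ.- (c ℤ.+ + 1) ≡ x ℤ.+ k ℤ.- (c ℤ.+ x ℤ.+ + 1)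
    lem = solve-∀

  recSum-cong : ∀ h c {M M′ : ℕ → ℤ} → (∀ l → M l ≡ M′ l) → recSum h c M ≡ recSum h c M′
  recSum-cong h c {M} {M′} e = trans (recSum-ℤ h c M) (trans (cong ℤ→ℚ (∑-cong (upTo h) (λ l → cong (λ z → sgn (h ℕ.+ l ℕ.+ 1) ℤ.* (+ (h C l)) ℤ.* (c ℤ.^ (h ℕ.∸ l)) ℤ.* z) (e l)))) (sym (recSum-ℤ h c M′)))

  moments-K² : ∀ h → 1 ℕ.≤ h → ℤ→ℚ (MK (2 ℕ.* h)) ≡ recSum h c₃ (λ l → MK (2 ℕ.* l)) ℚ.+ qPowNeg h ℚ.* codeSum N₃ h C₃
  moments-K² h h≥1 = trans (cong ℤ→ℚ (squares h)) (trans (moments-C (λ a → K a ℤ.* K a) c₃ excess-K² h h≥1)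
      (cong (ℚ._+ qPowNeg h ℚ.* codeSum N₃ h C₃) (recSum-cong h c₃ (λ l → sym (squares l)))))
    where
    squares : ∀ l → MK (2 ℕ.* l) ≡ ∑ nonzero (λ a → (K a ℤ.* K a) ℤ.^ l)
    squares l = ∑-cong nonzero (λ a → ^2*≡ (K a) l)

  -- The range of Kloosterman sums

  -- q - 1 - K is the sum of 1 - λ(a(z + 1/z)). Sorted by s = z + 1/z it has the terms (1 +
  -- λ(1/s))(1 - λ(a s)), each of them 0 or 4, and 0 at s = 0. Since r ≥ 2, also 4 divides q, and K
  -- + 1 = q - (q - 1 - K).
  K-mod-4 : 2 ℕ.≤ r → ∀ {a} → a ≢ 0F → ∃ λ z → K a ℤ.+ + 1 ≡ + 4 ℤ.* z
  K-mod-4 r≥2 {a} n = + (2 ℕ.^ (r ℕ.∸ 2)) ℤ.- M , trans (lem₁ (K a) Q) (trans (cong₂ ℤ._-_ q≡ (trans (trans (lem₂ Q (K a)) (cong (ℤ._- K a) (sym length-nonzero))) 4M)) (lem₃ (+ (2 ℕ.^ (r ℕ.∸ 2))) M))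
    where
    G : F → ℤ
    G s = 1ℤ ℤ.- λ' (a ⊗ s)
    M = ∑ nonzero (λ s → 𝟙 (tr (invF s) == 0F) ℤ.* 𝟙 (tr (a ⊗ s) == 1F))
    lem₁ : ∀ k q → k ℤ.+ + 1 ≡ q ℤ.- (q ℤ.- + 1 ℤ.- k)
    lem₁ = solve-∀
    lem₂ : ∀ q k → q ℤ.- + 1 ℤ.- k ≡ q ℤ.- 1ℤ ℤ.- k
    lem₂ = solve-∀
    lem₃ : ∀ x m → + 4 ℤ.* x ℤ.- + 4 ℤ.* m ≡ + 4 ℤ.* (x ℤ.- m)
    lem₃ = solve-∀
    q≡ : Q ≡ + 4 ℤ.* + (2 ℕ.^ (r ℕ.∸ 2))
    q≡ = trans (cong (λ k → + (2 ℕ.^ k)) (sym (ℕP.m+[n∸m]≡n r≥2))) (trans (cong +_ (ℕP.^-distribˡ-+-* 2 2 (r ℕ.∸ 2))) (ℤP.pos-* 4 (2 ℕ.^ (r ℕ.∸ 2))))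
    term : ∀ s → (1ℤ ℤ.+ λ' (invF s)) ℤ.* G s ≡ + 4 ℤ.* (𝟙 (tr (invF s) == 0F) ℤ.* 𝟙 (tr (a ⊗ s) == 1F))
    term s with tr-01 (invF s) | tr-01 (a ⊗ s)
    ... | inj₁ u | inj₁ v rewrite λ-0 u | λ-0 v | ⌊⌋-yes (tr (invF s) ≟F 0F) u | ⌊⌋-no (tr (a ⊗ s) ≟F 1F) (λ w → 0F≢1F (trans (sym v) w)) = refl
    ... | inj₁ u | inj₂ v rewrite λ-0 u | λ-1 v | ⌊⌋-yes (tr (invF s) ≟F 0F) u | ⌊⌋-yes (tr (a ⊗ s) ≟F 1F) v = refl
    ... | inj₂ u | v rewrite λ-1 u | ⌊⌋-no (tr (invF s) ≟F 0F) (λ w → 0F≢1F (trans (sym w) u)) = refl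
    4M : + length nonzero ℤ.- K a ≡ + 4 ℤ.* M
    4M = begin
      + length nonzero ℤ.- K a ≡⟨ cong₂ ℤ._+_ (sym (∑-1 nonzero)) (trans (cong ℤ.-_ (sym (K-recip n))) (trans (sym (ℤP.-1*i≡-i _)) (sym (∑-*ˡ nonzero ℤ.-1ℤ _)))) ⟩
      ∑ nonzero (λ _ → 1ℤ) ℤ.+ ∑ nonzero (λ z → ℤ.-1ℤ ℤ.* λ' (a ⊗ (z ⊕ invF z))) ≡⟨ trans (sym (∑-+ nonzero _ _)) (∑-cong nonzero (λ z → cong (λ k → 1ℤ ℤ.+ k) (ℤP.-1*i≡-i (λ' (a ⊗ (z ⊕ invF z)))))) ⟩
      ∑ nonzero (λ z → G (z ⊕ invF z)) ≡⟨ recip-pushforward G ⟩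
      G 0F ℤ.+ ∑ nonzero (λ s → (1ℤ ℤ.+ λ' (invF s)) ℤ.* G s) ≡⟨ cong₂ ℤ._+_ (cong (λ k → 1ℤ ℤ.- k) (trans (cong λ' (F*-zeroʳ a)) λ-0F)) (trans (∑-cong nonzero term) (∑-*ˡ nonzero (+ 4) _)) ⟩
      0ℤ ℤ.+ + 4 ℤ.* M ≡⟨ ℤP.+-identityˡ _ ⟩
      + 4 ℤ.* M ∎
      where open ≡-Reasoning

  K²<4q : 2 ℕ.≤ r → ∀ {a} → a ≢ 0F → ℤ.∣ K a ℤ.* K a ∣ ℕ.< 4 ℕ.* q
  K²<4q r≥2 {a} n = ℤP.drop‿+<+ (subst₂ ℤ._<_ (sym ∣K²∣) (sym (ℤP.pos-* 4 q)) (ℤP.≤∧≢⇒< (weil FF r card n) K²≢4q))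
    where
    ∣K²∣ : + ℤ.∣ K a ℤ.* K a ∣ ≡ K a ℤ.* K a
    ∣K²∣ = ℤP.0≤i⇒+∣i∣≡i (subst (0ℤ ℤ.≤_) (sq-abs (K a)) (ℤ.+≤+ ℕ.z≤n))
      where
      sq-abs : ∀ x → + (ℤ.∣ x ∣ ℕ.* ℤ.∣ x ∣) ≡ x ℤ.* x
      sq-abs (+ n)    = ℤP.pos-* n n
      sq-abs -[1+ n ] = refl
    K²≢4q : K a ℤ.* K a ≢ + 4 ℤ.* Q
    K²≢4q e = odd (proj₁ (K-mod-4 r≥2 n)) (proj₂ (K-mod-4 r≥2 n))
      where
      -- 1 = K² - (K - 1)(K + 1): if K² = 4q, the right side is divisible by 4, as K + 1 is.
      lem₁ : ∀ k → 1ℤ ≡ k ℤ.* k ℤ.- (k ℤ.+ + 1 ℤ.- + 2) ℤ.* (k ℤ.+ + 1)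
      lem₁ = solve-∀
      lem₂ : ∀ q z → + 4 ℤ.* q ℤ.- (+ 4 ℤ.* z ℤ.- + 2) ℤ.* (+ 4 ℤ.* z) ≡ + 4 ℤ.* (q ℤ.- (+ 4 ℤ.* z ℤ.- + 2) ℤ.* z)
      lem₂ = solve-∀
      odd : ∀ z → K a ℤ.+ + 1 ≡ + 4 ℤ.* z → ⊥
      odd z w = 4∤1 (Q ℤ.- (+ 4 ℤ.* z ℤ.- + 2) ℤ.* z) (trans (lem₁ (K a)) (trans (cong₂ (λ u v → u ℤ.- (v ℤ.- + 2) ℤ.* v) e w) (lem₂ Q z)))

  shiftℤ : ℕ → ℤ
  shiftℤ i = + i ℤ.- + (2 ℕ.* q)

  tRange-unique : Unique tRange
  tRange-unique = UniqueP.filter⁺ (λ t → T? ((ℤ.∣ t ℤ.* t ∣ ℕ.<ᵇ 4 ℕ.* q) ∧ (((t ℤ.+ + 1) ℤ.% (+ 4)) ℕ.≡ᵇ 0))) (UniqueP.map⁺ inj (UniqueP.applyUpTo⁺₁ (0 ℕ.+_) (suc (4 ℕ.* q)) (λ i<j _ → ℕP.<⇒≢ i<j)))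
    where
    inj : ∀ {i j} → shiftℤ i ≡ shiftℤ j → i ≡ j
    inj {i} {j} e = ℤP.+-injective (trans (lem (+ i) (+ (2 ℕ.* q))) (trans (cong (ℤ._+ + (2 ℕ.* q)) e) (sym (lem (+ j) (+ (2 ℕ.* q))))))
      where
      lem : ∀ x y → x ≡ x ℤ.- y ℤ.+ y
      lem = solve-∀

  K∈tRange : 2 ℕ.≤ r → ∀ {a} → a ≢ 0F → K a ∈ tRange
  K∈tRange r≥2 {a} n = ∈-filterᵇ⁺ (λ t → (ℤ.∣ t ℤ.* t ∣ ℕ.<ᵇ 4 ℕ.* q) ∧ (((t ℤ.+ + 1) ℤ.% (+ 4)) ℕ.≡ᵇ 0)) member
      (cong₂ _∧_ (T⇒true (ℕP.<⇒<ᵇ (K²<4q r≥2 n))) (trans (cong (λ z → (z ℤ.% (+ 4)) ℕ.≡ᵇ 0) (proj₂ (K-mod-4 r≥2 n))) (cong (ℕ._≡ᵇ 0) ([4*z]%4≡0 (proj₁ (K-mod-4 r≥2 n))))))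
    where
    T⇒true : ∀ {b} → T b → b ≡ true
    T⇒true {true} _ = refl
    S₀ = filterᵇ (λ x → tr (x ⊕ a ⊗ invF x) == 0F) nonzero
    -- The list position of K is K + 2q. From K = 2 |S₀| - (q - 1) this is 2 |S₀| + q + 1, visibly a
    -- natural number.
    i = 2 ℕ.* length S₀ ℕ.+ suc q
    i-value : shiftℤ i ≡ K a
    i-value = begin
      + (2 ℕ.* length S₀) ℤ.+ (+ 1 ℤ.+ Q) ℤ.- + (2 ℕ.* q) ≡⟨ cong₂ (λ x y → x ℤ.+ (+ 1 ℤ.+ Q) ℤ.- y) (trans (ℤP.pos-* 2 (length S₀)) (sym (proj₁ (∑λ-count nonzero (λ x → x ⊕ a ⊗ invF x))))) (ℤP.pos-* 2 q) ⟩
      + length nonzero ℤ.+ K a ℤ.+ (+ 1 ℤ.+ Q) ℤ.- + 2 ℤ.* Q ≡⟨ cong (λ z → z ℤ.+ K a ℤ.+ (+ 1 ℤ.+ Q) ℤ.- + 2 ℤ.* Q) length-nonzero ⟩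
      Q ℤ.- 1ℤ ℤ.+ K a ℤ.+ (+ 1 ℤ.+ Q) ℤ.- + 2 ℤ.* Q ≡⟨ lem Q (K a) ⟩
      K a ∎
      where
      open ≡-Reasoning
      lem : ∀ q k → q ℤ.- 1ℤ ℤ.+ k ℤ.+ (+ 1 ℤ.+ q) ℤ.- + 2 ℤ.* q ≡ k
      lem = solve-∀
    i≤ : i ℕ.≤ 4 ℕ.* q
    i≤ = begin
      2 ℕ.* length S₀ ℕ.+ suc q ≤⟨ ℕP.+-monoˡ-≤ (suc q) (ℕP.*-monoʳ-≤ 2 (ListP.length-filter _ nonzero)) ⟩
      2 ℕ.* length nonzero ℕ.+ suc q ≤⟨ ℕP.+-mono-≤ (ℕP.*-monoʳ-≤ 2 (ℕP.≤-trans (ℕP.n≤1+n _) (ℕP.≤-reflexive suc-length-nonzero))) (ℕP.+-monoˡ-≤ q (ℕP.m^n>0 2 r)) ⟩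
      2 ℕ.* q ℕ.+ (q ℕ.+ q) ≡⟨ lem q ⟩
      4 ℕ.* q ∎
      where
      open ℕP.≤-Reasoning
      lem : ∀ x → 2 ℕ.* x ℕ.+ (x ℕ.+ x) ≡ 4 ℕ.* x
      lem = solve-∀ᴺ
    member : K a ∈ map shiftℤ (fromTo 0 (4 ℕ.* q))
    member = subst (_∈ map shiftℤ (fromTo 0 (4 ℕ.* q))) i-value (∈-map⁺ shiftℤ (∈-applyUpTo⁺ (0 ℕ.+_) (ℕ.s≤s i≤)))

  C₃-formula : 2 ℕ.≤ r → ∀ j → C₃ j ≡ formulaC j
  C₃-formula r≥2 = weightDist-C (SO⁺ 2) (trans (+count (SO⁺ 2) trace 0F) traceCount-0)
    (λ β n → trans (+count (SO⁺ 2) trace β) (traceCount-≢0 n)) tRange-unique (λ β n → K∈tRange r≥2 (inv≢0 n))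

theorem1 : (FF : FiniteField) (r : ℕ) → length (FiniteField.elements FF) ≡ 2 ^ r →
    let open Setup FF r in
    -- (a)
    (3 ≤ r →
      ((h : ℕ) → 1 ≤ h →
        ℤ→ℚ (MK h) ≡ recSum h (+ q ℤ.- + 1) MK ℚ.+ ℕ→ℚ q ℚ.* codeSum N₁ h C₁)
      × ((j : ℕ) → j ≤ N₁ → C₁ j ≡ formulaA j))
    -- (b)
    × (3 ≤ r →
      ((h : ℕ) → 1 ≤ h →
        ℤ→ℚ (MK h) ≡ recSum h (+ q ℤ.- + 1) MK ℚ.+ ℕ→ℚ q ℚ.* codeSum N₂ h C₂)
      × ((j : ℕ) → j ≤ N₂ → C₂ j ≡ formulaB j))
    -- (c)
    × (2 ≤ r →
      ((h : ℕ) → 1 ≤ h →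
        (ℤ→ℚ (MK2 h)
          ≡ recSum h (+ (q ^ 4) ℤ.- + (q ^ 3) ℤ.- + (2 * q ^ 2) ℤ.+ + 1) MK2
              ℚ.+ qPowNeg h ℚ.* codeSum N₃ h C₃)
        × (ℤ→ℚ (MK (2 * h))
          ≡ recSum h (+ (q ^ 4) ℤ.- + (q ^ 3) ℤ.- + (2 * q ^ 2) ℤ.+ + q ℤ.+ + 1) (λ l → MK (2 * l))
              ℚ.+ qPowNeg h ℚ.* codeSum N₃ h C₃))
      × ((j : ℕ) → j ≤ N₃ → C₃ j ≡ formulaC j))
theorem1 FF r card =
    (λ _ → moments-AB (SO⁺ 1) traceSum-SO⁺1 , λ j _ → C₁-formula j)
  , (λ _ → moments-AB (O⁺ 1) traceSum-O⁺1 , λ j _ → C₂-formula j)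
  , (λ r≥2 → (λ h h≥1 → moments-C K2 c₂ excess-K₂ h h≥1 , moments-K² h h≥1) , λ j _ → C₃-formula r≥2 j)
  where
  open Setup FF r
  open Assembly FF r card
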